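{- Every T-valid scene has a trajectory.
   Context: A list assignment $L$ gives each vertex $v$ a set $L(v)$ of colors; an $L$-coloring is a proper coloring with $\varphi(v)\in L(v)$. A sequence of recolorings $(v_1,c_1),\ldots,(v_m,c_m)$ successively changes the color of $v_i$ to $c_i$; it is proper if all intermediate colorings are proper colorings of the graph, once-only if each vertex is recolored at most once; for an induced subgraph $H$, it is $H$-late if all recolorings of vertices outside $V(H)$ precede all recolorings of vertices of $H$. An $(L_1,L_2)$-trajectory in a graph $G$ starting with $\varphi_0$ is a triple $(\varphi_0,\varphi_1,\varphi_2)$ where $\varphi_0$ is a proper coloring of $G$ and, for $i\in\{1,2\}$, $\varphi_i$ is an $L_i$-coloring obtained from $\varphi_{i-1}$ by a proper once-only sequence of recolorings. For an induced subgraph $H$ of $G$, an $(L_1,L_2)$-trajectory $\vec{\delta}$ in $H$ lifts to an $(L_1,L_2)$-trajectory $\vec{\varphi}$ in $G$ if $\delta_i=\varphi_i\restriction V(H)$ for $i=0,1,2$ and for $i\in\{1,2\}$ there is a proper once-only $H$-late sequence of recolorings of $G$ transforming $\varphi_{i-1}$ into $\varphi_i$. A scene $S=(G,H,L_1,L_2,\varphi_0,\vec{\delta})$ consists of a plane graph $G$, an induced subgraph $H$ of $G$ whose vertices are consecutive in the boundary of the outer face of $G$ (possibly $H$ empty), list assignments $L_1,L_2$ for $G$, a proper coloring $\varphi_0$ of $G$, and an $(L_1,L_2)$-trajectory $\vec{\delta}$ in $H$ starting with $\varphi_0\restriction V(H)$. The scene has a trajectory if $\vec{\delta}$ lifts to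 an $(L_1,L_2)$-trajectory in $G$ starting with $\varphi_0$. A vertex is internal if it is not incident with the outer face. The scene is T-valid if $G$ is triangle-free, $|V(H)|\le 5$, and: (Ta) for each $v\in V(G)$, $|L_1(v)\setminus L_2(v)|\le 1$ and $|L_1(v)|,|L_2(v)|\ge 5$; (Tb) every internal $v$ satisfies $|L_1(v)|\ge 7$ and $|L_2(v)|\ge 6$, and moreover, if $H$ is a path with at least four vertices, then at least $|V(H)|-3$ ends $x$ of $H$ have the property that all neighbors $v\in V(G)\setminus V(H)$ of $x$ satisfy $|L_1(v)|\ge 7$ and $|L_2(v)|\ge 6$; (Tc) if $H$ is a path with five vertices, then each vertex of $V(G)\setminus V(H)$ has at most one neighbor in $H$. -}

module Defs where

open import Data.Nat using (ℕ; zero; suc; _+_; _*_; _∸_; _≤_; _<_)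
import Data.Nat as Nat
open import Data.Fin using (Fin; toℕ; fromℕ) renaming (zero to fz; suc to fs)
import Data.Fin as Fin
open import Data.Bool using (Bool; true; false; _∧_; _∨_; not; if_then_else_)
open import Data.Product using (Σ; ∃; ∃-syntax; _×_; _,_; proj₁; proj₂)
open import Data.Sum using (_⊎_)
open import Data.Unit using (⊤)
open import Data.Empty using (⊥)
open import Data.List using (List; []; _∷_; length; map; _++_; deduplicate)
open import Data.List.Membership.Propositional using (_∈_; _∉_)
open import Data.List.Relation.Unary.Unique.Propositional using (Unique)
open import Data.List.Relation.Unary.All using (All)
open import Relation.Binary.PropositionalEquality using (_≡_; _≢_)
open import Relation.Nullary using (¬_)
open import Relation.Nullary.Decidable using (⌊_⌋)
open import Function using (_∘_)
open import Function.Bundles using (_⇔_)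
open import Function.Definitions using (Injective)

iter : {A : Set} → (A → A) → ℕ → A → A
iter f zero x = x
iter f (suc i) x = f (iter f i x)

countB : ∀ {n} → (Fin n → Bool) → ℕ
countB {zero} p = 0
countB {suc n} p = (if p fz then 1 else 0) + countB (p ∘ fs)

anyF : ∀ {n} → (Fin n → Bool) → Bool
anyF {zero} p = false
anyF {suc n} p = p fz ∨ anyF (p ∘ fs)

allF : ∀ {n} → (Fin n → Bool) → Bool
allF {zero} p = true
allF {suc n} p = p fz ∧ allF (p ∘ fs)

eqF : ∀ {n} → Fin n → Fin n → Bool
eqF a b = ⌊ a Fin.≟ b ⌋

leF : ∀ {n} → Fin n → Fin n → Bool
leF a b = ⌊ toℕ a Nat.≤? toℕ b ⌋

-- Combinatorial maps (rotation systems).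
-- Vertices are Fin n, darts (half-edges) are Fin k.  vert d is the tail
-- vertex of dart d, α d is the reverse dart, σ rotates the darts around
-- their common tail vertex (the clockwise order of the embedding).

record Map : Set where
  field
    n    : ℕ
    k    : ℕ
    vert : Fin k → Fin n
    α    : Fin k → Fin k
    σ    : Fin k → Fin k

module MapDefs (M : Map) where
  open Map M

  -- face permutation: its orbits are the facial walks
  φ : Fin k → Fin k
  φ d = σ (α d)

  Adj : Fin n → Fin n → Set
  Adj u v = ∃[ d ] (vert d ≡ u × vert (α d) ≡ v)

  adjB : Fin n → Fin n → Bool
  adjB u v = anyF (λ d → eqF (vert d) u ∧ eqF (vert (α d)) v)

  reachB : ℕ → Fin n → Fin n → Bool
  reachB zero u v = eqF u v
  reachB (suc t) u v = reachB t u v ∨ anyF (λ x → reachB t u x ∧ adjB x v)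

  SameComp : Fin n → Fin n → Set
  SameComp u v = reachB n u v ≡ true

  compRepB : Fin n → Bool
  compRepB v = allF (λ u → not (reachB n u v) ∨ leF v u)

  numComp : ℕ
  numComp = countB compRepB

  isolatedB : Fin n → Bool
  isolatedB v = not (anyF (λ d → eqF (vert d) v))

  orbitB : Fin k → Fin k → Bool
  orbitB d e = anyF (λ (i : Fin k) → eqF (iter φ (toℕ i) d) e)

  faceRepB : Fin k → Bool
  faceRepB d = allF (λ e → not (orbitB d e) ∨ leF d e)

  -- number of faces of the map (facial walks of components with edges)
  numFaces : ℕ
  numFaces = countB faceRepB

-- Plane graphs: a simple graph with a genus-0 rotation system on every
-- component, together with the data of which facial walks form the
-- boundary of the outer face.

record PlaneGraph : Set where
  field
    rot : Map
  open Map rot public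
  open MapDefs rot public
  field
    α-invol  : ∀ d → α (α d) ≡ d
    α-nofix  : ∀ d → α d ≢ d
    σ-inj    : Injective _≡_ _≡_ σ
    σ-vert   : ∀ d → vert (σ d) ≡ vert d
    σ-trans  : ∀ d e → vert d ≡ vert e → ∃[ i ] iter σ i d ≡ e
    noLoop   : ∀ d → vert (α d) ≢ vert d
    noMulti  : ∀ d e → vert d ≡ vert e → vert (α d) ≡ vert (α e) → d ≡ e
    -- Euler's formula on every component (genus 0):
    -- sum over components of (V - E + F) = 2·#components, where an
    -- isolated vertex counts as having one face.  (Each summand is ≤ 2.)
    euler    : 2 * (n + numFaces + countB isolatedB) ≡ 4 * numComp + k
    -- outer face data: the darts on the outer face boundary, and the
    -- isolated vertices lying in the outer face
    outerD   : Fin k → Bool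
    outerIso : Fin n → Bool
    outerD-closed : ∀ d → outerD d ≡ true → outerD (φ d) ≡ true
    outerIso-iso  : ∀ v → outerIso v ≡ true → isolatedB v ≡ true
    outer-one : ∀ d e → outerD d ≡ true → outerD e ≡ true →
                SameComp (vert d) (vert e) → orbitB d e ≡ true
    -- components not touching the outer face must lie inside a bounded
    -- face of a component that touches the outer face
    nesting :
      (∀ v → (∃[ d ] (outerD d ≡ true × SameComp (vert d) v)) ⊎ outerIso v ≡ true)
      ⊎ (∃[ d ] ∃[ e ] (outerD d ≡ true × SameComp (vert d) (vert e) × orbitB d e ≡ false))

  OuterVertex : Fin n → Set
  OuterVertex v = (∃[ d ] (outerD d ≡ true × vert d ≡ v)) ⊎ outerIso v ≡ true

  Internal : Fin n → Set
  Internal v = ¬ OuterVertex v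

  TriangleFree : Set
  TriangleFree = ∀ u v w → Adj u v → Adj v w → Adj u w → ⊥

  ConsecutiveOnOuter : (Fin n → Bool) → Set
  ConsecutiveOnOuter hv =
    (∀ v → hv v ≡ false)
    ⊎ (∃[ d ] ∃[ ℓ ] (outerD d ≡ true ×
         (∀ v → (hv v ≡ true) ⇔ (∃[ i ] (i < ℓ × vert (iter φ i d) ≡ v)))))
    ⊎ (∃[ v ] (outerIso v ≡ true × (∀ u → (hv u ≡ true) ⇔ (u ≡ v))))

-- Colourings, list assignments, recolouring sequences.
-- A vertex subset (the induced subgraph H, or all of G) is given by a
-- Boolean predicate P; colourings of G[P] are functions on all vertices
-- of which only the values on P matter.

module Colouring (G : PlaneGraph) where
  open PlaneGraph G

  Colouring : Set
  Colouring = Fin n → ℕ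

  ListAssignment : Set
  ListAssignment = Fin n → List ℕ

  ∣_∣ : List ℕ → ℕ
  ∣ xs ∣ = length (deduplicate Nat._≟_ xs)

  allV : Fin n → Bool
  allV _ = true

  ProperOn : (Fin n → Bool) → Colouring → Set
  ProperOn P c = ∀ u v → P u ≡ true → P v ≡ true → Adj u v → c u ≢ c v

  LColOn : (Fin n → Bool) → ListAssignment → Colouring → Set
  LColOn P L c = ProperOn P c × (∀ v → P v ≡ true → c v ∈ L v)

  AgreeOn : (Fin n → Bool) → Colouring → Colouring → Set
  AgreeOn P c c' = ∀ v → P v ≡ true → c v ≡ c' v

  Recolouring : Set
  Recolouring = List (Fin n × ℕ)

  update : Colouring → Fin n → ℕ → Colouring
  update c v a u = if eqF u v then a else c u

  run : Colouring → Recolouring → Colouring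
  run c [] = c
  run c ((v , a) ∷ s) = run (update c v a) s

  ProperSeqOn : (Fin n → Bool) → Colouring → Recolouring → Set
  ProperSeqOn P c [] = ProperOn P c
  ProperSeqOn P c ((v , a) ∷ s) = ProperOn P c × ProperSeqOn P (update c v a) s

  OnceOnly : Recolouring → Set
  OnceOnly s = Unique (map proj₁ s)

  Within : (Fin n → Bool) → Recolouring → Set
  Within P s = All (λ r → P (proj₁ r) ≡ true) s

  Late : (Fin n → Bool) → Recolouring → Set
  Late hv s = ∃[ s₁ ] ∃[ s₂ ] (s ≡ s₁ ++ s₂ ×
                All (λ r → hv (proj₁ r) ≡ false) s₁ ×
                All (λ r → hv (proj₁ r) ≡ true) s₂)

  StepOn : (Fin n → Bool) → Colouring → Colouring → Set
  StepOn P c c' = ∃[ s ] (Within P s × ProperSeqOn P c s × OnceOnly s ×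
                          AgreeOn P (run c s) c')

  TrajectoryIn : (Fin n → Bool) → ListAssignment → ListAssignment →
                 Colouring → Colouring → Colouring → Set
  TrajectoryIn hv L₁ L₂ δ₀ δ₁ δ₂ =
    ProperOn hv δ₀ × LColOn hv L₁ δ₁ × LColOn hv L₂ δ₂ ×
    StepOn hv δ₀ δ₁ × StepOn hv δ₁ δ₂

  LateStep : (Fin n → Bool) → Colouring → Colouring → Set
  LateStep hv c c' = ∃[ s ] (ProperSeqOn allV c s × OnceOnly s × Late hv s ×
                             (∀ v → run c s v ≡ c' v))

  -- the trajectory δ in H lifts to an (L₁,L₂)-trajectory in G starting with φ₀
  -- (δ₀ = φ₀ restricted to H is a hypothesis of the scene)
  Lifts : (Fin n → Bool) → ListAssignment → ListAssignment →
          Colouring → Colouring → Colouring → Colouring → Set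
  Lifts hv L₁ L₂ φ₀ δ₀ δ₁ δ₂ =
    ∃[ φ₁ ] ∃[ φ₂ ] (LColOn allV L₁ φ₁ × LColOn allV L₂ φ₂ ×
      AgreeOn hv δ₀ φ₀ × AgreeOn hv δ₁ φ₁ × AgreeOn hv δ₂ φ₂ ×
      LateStep hv φ₀ φ₁ × LateStep hv φ₁ φ₂)

  IsPathOf : (Fin n → Bool) → (m : ℕ) → (Fin (suc m) → Fin n) → Set
  IsPathOf hv m p =
    Injective _≡_ _≡_ p ×
    (∀ v → (hv v ≡ true) ⇔ (∃[ i ] p i ≡ v)) ×
    (∀ i j → Adj (p i) (p j) ⇔ (toℕ i ≡ suc (toℕ j) ⊎ toℕ j ≡ suc (toℕ i)))

  Big : Fin n → ListAssignment → ListAssignment → Set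
  Big v L₁ L₂ = 7 ≤ ∣ L₁ v ∣ × 6 ≤ ∣ L₂ v ∣

  GoodEnd : (Fin n → Bool) → ListAssignment → ListAssignment → Fin n → Set
  GoodEnd hv L₁ L₂ x = ∀ v → hv v ≡ false → Adj x v → Big v L₁ L₂

  AtLeastEnds : ℕ → Set → Set → Set
  AtLeastEnds zero A B = ⊤
  AtLeastEnds (suc zero) A B = A ⊎ B
  AtLeastEnds (suc (suc zero)) A B = A × B
  AtLeastEnds (suc (suc (suc _))) A B = ⊥

  record TValid (hv : Fin n → Bool) (L₁ L₂ : ListAssignment) : Set where
    field
      triangleFree : TriangleFree
      smallH       : countB hv ≤ 5
      Ta-diff  : ∀ v a b → a ∈ L₁ v → a ∉ L₂ v → b ∈ L₁ v → b ∉ L₂ v → a ≡ b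
      Ta-size₁ : ∀ v → 5 ≤ ∣ L₁ v ∣
      Ta-size₂ : ∀ v → 5 ≤ ∣ L₂ v ∣
      Tb-internal : ∀ v → Internal v → Big v L₁ L₂
      Tb-ends : ∀ m p → IsPathOf hv m p →
                AtLeastEnds (suc m ∸ 3) (GoodEnd hv L₁ L₂ (p Fin.zero))
                                         (GoodEnd hv L₁ L₂ (p (fromℕ m)))
      Tc : ∀ p → IsPathOf hv 4 p → ∀ v → hv v ≡ false → ∀ x y →
           hv x ≡ true → hv y ≡ true → Adj v x → Adj v y → x ≡ y

  record Scene : Set where
    field
      hv      : Fin n → Bool
      H-outer : ConsecutiveOnOuter hv
      L₁ L₂   : ListAssignment
      φ₀      : Colouring
      φ₀-proper : ProperOn allV φ₀
      δ₀ δ₁ δ₂ : Colouring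
      δ₀-restr : AgreeOn hv δ₀ φ₀
      δ-traj  : TrajectoryIn hv L₁ L₂ δ₀ δ₁ δ₂

  HasTrajectory : Scene → Set
  HasTrajectory S = Lifts hv L₁ L₂ φ₀ δ₀ δ₁ δ₂
    where open Scene S

  TValidScene : Scene → Set
  TValidScene S = TValid (Scene.hv S) (Scene.L₁ S) (Scene.L₂ S)

-- The new colours of the vertices outside H are chosen greedily in an order p and the vertices are
-- recoloured in an order t, so that the new colour of v has to avoid the new colours of the
-- neighbours preceding v in p and the old colours of the neighbours following v in t.  The vertices
-- of a set S receive a colour which suits both lists and rest during the second step.
--
-- Let κ(v) = 4 + [v has large lists] - 2 |N(v) ∩ H| and ρ(X) = Σ_{v ∈ X} (κ(v) - 1 - deg_X(v)).
-- Suitable p, t and S exist if ρ(X) ≥ -1 for all nonempty sets X outside H: a proper subset with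
-- ρ ≤ 0 can be treated separately, and if there is none, discharging yields a vertex or an edge
-- whose removal preserves the hypothesis.
--
-- Since all faces have length at least 4, Euler's formula for the subgraph induced by H ∪ X, refined
-- by counting the darts of the outer face, yields ρ(X) ≥ -1, except for one shape of H, for which
-- only ρ(X) ≥ -2 holds.  In this case either a proper subset of X has ρ ≤ -1, cut off by a chord or
-- consisting of one vertex, or X contains a vertex of capacity 2 which can be treated first.
module Submission where

open import Defs
open import Data.Nat as ℕ using (ℕ; zero; suc)
import Data.Nat.Properties as ℕₚ
open import Data.Integer using (ℤ; +_; 0ℤ; 1ℤ; -1ℤ; _+_; _-_; _*_; -_; _≤_; _<_; +≤+; -≤+; -≤-; _≤?_)
import Data.Integer.Properties as ℤₚ
open import Data.Integer.Tactic.RingSolver using (solve-∀)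
import Algebra.Properties.CommutativeMonoid.Sum ℤₚ.+-0-commutativeMonoid as Std
open import Data.Fin using (Fin) renaming (zero to fz; suc to fs)
import Data.Fin as Fin
import Data.Fin.Properties as Finₚ
import Data.Fin.Permutation as Perm
open import Data.Fin.Subset.Properties using (anySubset?)
import Data.Vec as Vec
import Data.Vec.Properties as Vecₚ
open import Data.Bool using (Bool; true; false; _∧_; _∨_; not; if_then_else_)
import Data.Bool as 𝔹
import Data.Bool.Properties as 𝔹ₚ
open import Data.Product using (∃; _×_; _,_; proj₁; proj₂)
open import Data.Sum using (_⊎_; inj₁; inj₂)
import Data.Sum as Sum
open import Data.Empty using (⊥-elim; ⊥)
open import Data.List using (List; []; _∷_; length; map; _++_; _ʳ++_; deduplicate; filter; allFin; tabulate; lookup; applyUpTo)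
import Data.List.Properties as Listₚ
open import Data.List.Membership.Propositional using (_∈_; _∉_; find; lose)
open import Data.List.Membership.Propositional.Properties
  using (∈-++⁺ˡ; ∈-++⁺ʳ; ∈-++⁻; ∈-map⁺; ∈-map⁻; ∈-allFin; ∈-filter⁺; ∈-filter⁻; ∈-lookup; ∈-deduplicate⁻; ∈-applyUpTo⁻; ∈-applyUpTo⁺)
import Data.List.Membership.DecPropositional as DecMem
open import Data.List.Relation.Unary.Any using (here; there; index; any?)
import Data.List.Relation.Unary.Any.Properties as Anyₚ
open import Data.List.Relation.Unary.All using (All; []; _∷_)
import Data.List.Relation.Unary.All as All
import Data.List.Relation.Unary.All.Properties as Allₚ
open import Data.List.Relation.Unary.AllPairs using (AllPairs; []; _∷_)
open import Data.List.Relation.Unary.Unique.Propositional using (Unique)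
import Data.List.Relation.Unary.Unique.Propositional.Properties as Uniqueₚ
import Data.List.Relation.Unary.Unique.DecPropositional.Properties as DecUniqueₚ
import Data.List.Relation.Unary.Linked.Properties as Linkedₚ
open import Data.List.Relation.Binary.Permutation.Propositional using (↭⇒↭ₛ; ↭-sym)
open import Data.List.Relation.Binary.Permutation.Propositional.Properties using (∈-resp-↭)
import Data.List.Relation.Binary.Permutation.Setoid.Properties as PermSₚ
import Data.List.Sort
open import Axiom.UniquenessOfIdentityProofs using (module Decidable⇒UIP)
open import Function using (_∘_)
open import Function.Bundles using (Equivalence; mk⇔)
open import Function.Definitions using (Injective)
open import Relation.Binary.Definitions using (Tri; tri<; tri≈; tri>)
import Relation.Binary.Construct.On as On
open import Relation.Binary.PropositionalEquality
open import Relation.Nullary using (¬_; Dec; yes; no)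
open import Relation.Nullary.Decidable using (⌊_⌋; _×-dec_; _⊎-dec_; ¬?; decidable-stable)

-- An edge between two recoloured vertices costs two units in each step: one end avoids the new
-- colour of the other, one end avoids the old colour of the other, and the orders only decide who
-- pays. With b = [large lists] the lists leave 4 + 2b and 4 + b exclusions in the two steps, and a
-- neighbour in `H` uses up two of them. Hence κ is the budget of the second step, and large lists
-- give one more unit in the first; this surplus is what lets a neighbour rest. If all lists are
-- large and `H` is empty, ρ(X) is 4 |X| minus twice the number of edges, which Euler's formula
-- bounds for triangle-free plane graphs. A vertex with small lists misses one unit, but it lies on
-- the outer face and one of its darts there repays it. The same currency pays for `H`: the darts of
-- its boundary walk and those next to it count, and the conditions on paths supply the ones still
-- missing. The exceptional `H` has five vertices and a boundary walk of length five; it is not a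
-- path, so these conditions do not apply and one dart may be missing.

-- Linear arithmetic: each hypothesis a ≤ b contributes the non-negative quantity b - a.

lin₁ : ∀ {a b c d} j → a ≤ b → d - c ≡ (b - a) + + j → c ≤ d
lin₁ j h eq = ℤₚ.0≤i-j⇒j≤i (subst (0ℤ ≤_) (sym eq)
  (ℤₚ.+-mono-≤ (ℤₚ.i≤j⇒0≤j-i h) (+≤+ ℕ.z≤n)))

lin₂ : ∀ {a b a′ b′ c d} j → a ≤ b → a′ ≤ b′ → d - c ≡ (b - a) + (b′ - a′) + + j → c ≤ d
lin₂ j h h′ eq = ℤₚ.0≤i-j⇒j≤i (subst (0ℤ ≤_) (sym eq)
  (ℤₚ.+-mono-≤ (ℤₚ.+-mono-≤ (ℤₚ.i≤j⇒0≤j-i h) (ℤₚ.i≤j⇒0≤j-i h′)) (+≤+ ℕ.z≤n)))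

lin₃ : ∀ {a b a′ b′ a″ b″ c d} j → a ≤ b → a′ ≤ b′ → a″ ≤ b″ →
       d - c ≡ (b - a) + (b′ - a′) + (b″ - a″) + + j → c ≤ d
lin₃ j h h′ h″ eq = ℤₚ.0≤i-j⇒j≤i (subst (0ℤ ≤_) (sym eq)
  (ℤₚ.+-mono-≤ (ℤₚ.+-mono-≤ (ℤₚ.+-mono-≤ (ℤₚ.i≤j⇒0≤j-i h) (ℤₚ.i≤j⇒0≤j-i h′))
    (ℤₚ.i≤j⇒0≤j-i h″)) (+≤+ ℕ.z≤n)))

-- Finite integer sums and Boolean vertex sets.

ι : Bool → ℤ
ι b = if b then 1ℤ else 0ℤ

on : Bool → ℤ → ℤ
on b x = if b then x else 0ℤ

0≤ι : ∀ b → 0ℤ ≤ ι b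
0≤ι true  = +≤+ ℕ.z≤n
0≤ι false = ℤₚ.≤-refl

⌊≟⌋-suc : ∀ {n} (i j : Fin n) → ⌊ fs i Fin.≟ fs j ⌋ ≡ ⌊ i Fin.≟ j ⌋
⌊≟⌋-suc i j with i Fin.≟ j
... | yes _ = refl
... | no  _ = refl

opaque
  sum : ∀ {n} → (Fin n → ℤ) → ℤ
  sum {zero}  f = 0ℤ
  sum {suc n} f = f fz + sum (f ∘ fs)

  sum-[] : ∀ (f : Fin 0 → ℤ) → sum f ≡ 0ℤ
  sum-[] f = refl

  sum-∷ : ∀ {n} (f : Fin (suc n) → ℤ) → sum f ≡ f fz + sum (f ∘ fs)
  sum-∷ f = refl

  sum≡std : ∀ {n} (f : Fin n → ℤ) → sum f ≡ Std.sum f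
  sum≡std {zero}  f = refl
  sum≡std {suc n} f = cong (λ x → f fz + x) (sum≡std (f ∘ fs))

  sum-cong-≗ : ∀ {n} {f g : Fin n → ℤ} → (∀ i → f i ≡ g i) → sum f ≡ sum g
  sum-cong-≗ {zero}  h = refl
  sum-cong-≗ {suc n} h = cong₂ _+_ (h fz) (sum-cong-≗ (h ∘ fs))

  ∑-distrib-+ : ∀ {n} (f g : Fin n → ℤ) → sum (λ i → f i + g i) ≡ sum f + sum g
  ∑-distrib-+ f g = begin
    sum (λ i → f i + g i)     ≡⟨ sum≡std (λ i → f i + g i) ⟩
    Std.sum (λ i → f i + g i) ≡⟨ Std.∑-distrib-+ f g ⟩
    Std.sum f + Std.sum g     ≡⟨ cong₂ _+_ (sum≡std f) (sum≡std g) ⟨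
    sum f + sum g             ∎
    where open ≡-Reasoning

  sum-mono : ∀ {n} {f g : Fin n → ℤ} → (∀ i → f i ≤ g i) → sum f ≤ sum g
  sum-mono {zero}  h = ℤₚ.≤-refl
  sum-mono {suc n} h = ℤₚ.+-mono-≤ (h fz) (sum-mono (h ∘ fs))

  sum-zero : ∀ {n} {f : Fin n → ℤ} → (∀ i → f i ≡ 0ℤ) → sum f ≡ 0ℤ
  sum-zero {zero}  h = refl
  sum-zero {suc n} h = cong₂ _+_ (h fz) (sum-zero (h ∘ fs))

  sum-neg : ∀ {n} (f : Fin n → ℤ) → sum (λ i → - f i) ≡ - sum f
  sum-neg {zero}  f = refl
  sum-neg {suc n} f = trans (cong (λ x → - f fz + x) (sum-neg (f ∘ fs))) (sym (ℤₚ.neg-distrib-+ (f fz) _))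

  sum-scale : ∀ {n} c (f : Fin n → ℤ) → sum (λ i → c * f i) ≡ c * sum f
  sum-scale {zero}  c f = sym (ℤₚ.*-zeroʳ c)
  sum-scale {suc n} c f = trans (cong (λ x → c * f fz + x) (sum-scale c (f ∘ fs))) (sym (ℤₚ.*-distribˡ-+ c (f fz) _))

  sum-point : ∀ {n} (v : Fin n) (f : Fin n → ℤ) → sum (λ u → on ⌊ u Fin.≟ v ⌋ (f u)) ≡ f v
  sum-point fz f = trans (cong (λ x → f fz + x) (sum-zero {f = λ i → on ⌊ fs i Fin.≟ fz ⌋ (f (fs i))} (λ _ → refl)))
                         (ℤₚ.+-identityʳ (f fz))
  sum-point (fs v) f = trans (ℤₚ.+-identityˡ _)
    (trans (sum-cong-≗ (λ i → cong (λ b → on b (f (fs i))) (⌊≟⌋-suc i v))) (sum-point v (f ∘ fs)))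

sum-std₂ : ∀ {m n} (f : Fin m → Fin n → ℤ) → sum (λ i → sum (f i)) ≡ Std.sum (λ i → Std.sum (f i))
sum-std₂ f = trans (sum-cong-≗ (λ i → sum≡std (f i))) (sum≡std (λ i → Std.sum (f i)))

∑-comm : ∀ {m n} (f : Fin m → Fin n → ℤ) →
         sum (λ i → sum (f i)) ≡ sum (λ j → sum (λ i → f i j))
∑-comm f = trans (sum-std₂ f) (trans (Std.∑-comm f) (sym (sum-std₂ (λ j i → f i j))))

sum-nonneg : ∀ {n} {f : Fin n → ℤ} → (∀ i → 0ℤ ≤ f i) → 0ℤ ≤ sum f
sum-nonneg {n} {f} h = subst (_≤ sum f) (sum-zero {n} {λ _ → 0ℤ} (λ _ → refl)) (sum-mono h)

sum-sub : ∀ {n} (f g : Fin n → ℤ) → sum (λ i → f i - g i) ≡ sum f - sum g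
sum-sub f g = trans (∑-distrib-+ f (-_ ∘ g)) (cong (λ x → sum f + x) (sum-neg g))

term≤sum : ∀ {n} (f : Fin n → ℤ) → (∀ i → 0ℤ ≤ f i) → ∀ i → f i ≤ sum f
term≤sum f h i = subst (_≤ sum f) (sum-point i f) (sum-mono le)
  where
  le : ∀ u → on ⌊ u Fin.≟ i ⌋ (f u) ≤ f u
  le u with u Fin.≟ i
  ... | yes _ = ℤₚ.≤-refl
  ... | no  _ = h u

≟-refl : ∀ {n} (v : Fin n) → ⌊ v Fin.≟ v ⌋ ≡ true
≟-refl v with v Fin.≟ v
... | yes _ = refl
... | no ¬p = ⊥-elim (¬p refl)

≟-true : ∀ {n} {u v : Fin n} → ⌊ u Fin.≟ v ⌋ ≡ true → u ≡ v
≟-true {u = u} {v} eq with u Fin.≟ v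
... | yes p = p

VSet : ℕ → Set
VSet n = Fin n → Bool

⟦_⟧ : ∀ {n} → Fin n → VSet n
⟦ v ⟧ u = ⌊ u Fin.≟ v ⌋

data Sp : Bool → Bool → Bool → Set where
  inˡ : Sp true true false
  inʳ : Sp true false true
  out : Sp false false false

Split : ∀ {n} → VSet n → VSet n → VSet n → Set
Split U X R = ∀ u → Sp (U u) (X u) (R u)

lt : ℕ → ℕ → Bool
lt m n = ⌊ m ℕ.<? n ⌋

lt-true : ∀ {m n} → m ℕ.< n → lt m n ≡ true
lt-true {m} {n} h with m ℕ.<? n
... | yes _ = refl
... | no ¬h = ⊥-elim (¬h h)

lt-false : ∀ {m n} → n ℕ.≤ m → lt m n ≡ false
lt-false {m} {n} h with m ℕ.<? n
... | yes h′ = ⊥-elim (ℕₚ.<⇒≱ h′ h)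
... | no _ = refl

lt-shift : ∀ b m n → lt (b ℕ.+ m) (b ℕ.+ n) ≡ lt m n
lt-shift b m n with m ℕ.<? n
... | yes h = lt-true (ℕₚ.+-monoʳ-< b h)
... | no ¬h = lt-false (ℕₚ.+-monoʳ-≤ b (ℕₚ.≮⇒≥ ¬h))

false≢true : ∀ {b} → b ≡ false → b ≡ true → ⊥
false≢true refl ()

_∖_ : ∀ {n} → VSet n → VSet n → VSet n
(U ∖ S) u = U u ∧ not (S u)

Split-inX : ∀ {a b c} → Sp a b c → b ≡ true → a ≡ true × c ≡ false
Split-inX inˡ refl = refl , refl

Split-inR : ∀ {a b c} → Sp a b c → c ≡ true → a ≡ true × b ≡ false
Split-inR inʳ refl = refl , refl

Split-U : ∀ {a b c} → Sp a b c → a ≡ true → (b ≡ true) ⊎ (c ≡ true)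
Split-U inˡ refl = inj₁ refl
Split-U inʳ refl = inj₂ refl

split-∖ : ∀ {n} {U X : VSet n} → (∀ u → X u ≡ true → U u ≡ true) → Split U X (U ∖ X)
split-∖ {U = U} {X} h u with X u in eq | U u in eq′
... | true  | true  = inˡ
... | true  | false = ⊥-elim (false≢true eq′ (h u eq))
... | false | true  = inʳ
... | false | false = out

≰⇒≤ : ∀ {a b} → ¬ (a ≤ b) → b + 1ℤ ≤ a
≰⇒≤ {a} {b} h = subst (_≤ a) (ℤₚ.+-comm 1ℤ b) (ℤₚ.i<j⇒suc[i]≤j (ℤₚ.≰⇒> h))

anyVSet? : ∀ {n} {P : VSet n → Set} → (∀ X → Dec (P X)) →
           (∀ {X Y} → (∀ u → X u ≡ Y u) → P X → P Y) → Dec (∃ P)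
anyVSet? {P = P} P? resp with anySubset? (λ s → P? (Vec.lookup s))
... | yes (s , p) = yes (Vec.lookup s , p)
... | no ¬p = no λ where
  (X , p) → ¬p (Vec.tabulate X , resp (λ u → sym (Vecₚ.lookup∘tabulate X u)) p)

countB-mono : ∀ {n} {X Y : VSet n} → (∀ u → X u ≡ true → Y u ≡ true) → countB X ℕ.≤ countB Y
countB-mono {zero} h = ℕ.z≤n
countB-mono {suc n} {X} {Y} h with X fz in eq
... | false = ℕₚ.≤-trans (countB-mono (h ∘ fs)) (ℕₚ.m≤n+m _ (if Y fz then 1 else 0))
... | true rewrite h fz eq = ℕ.s≤s (countB-mono (h ∘ fs))

countB-strict : ∀ {n} {X Y : VSet n} → (∀ u → X u ≡ true → Y u ≡ true) →
                ∀ z → Y z ≡ true → X z ≡ false → countB X ℕ.< countB Y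
countB-strict {X = X} {Y} h fz hY hX rewrite hY | hX = ℕ.s≤s (countB-mono (h ∘ fs))
countB-strict {X = X} {Y} h (fs z) hY hX with X fz in eq
... | true rewrite h fz eq = ℕ.s≤s (countB-strict (h ∘ fs) z hY hX)
... | false = ℕₚ.≤-trans (countB-strict (h ∘ fs) z hY hX) (ℕₚ.m≤n+m _ (if Y fz then 1 else 0))

all-or-some : ∀ {n} (X : VSet n) → (∃ λ u → X u ≡ true) ⊎ (∀ u → X u ≡ false)
all-or-some X with Finₚ.any? (λ u → X u 𝔹.≟ true)
... | yes p = inj₁ p
... | no ¬p = inj₂ λ u → 𝔹ₚ.¬-not (λ h → ¬p (u , h))

∖-true : ∀ {n} {U X : VSet n} {u} → (U ∖ X) u ≡ true → U u ≡ true × X u ≡ false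
∖-true {U = U} {X} {u} h with U u | X u
... | true | false = refl , refl

_∪_ : ∀ {n} → VSet n → VSet n → VSet n
(X ∪ Y) u = X u ∨ Y u

split-∪ : ∀ {n} {X Y : VSet n} → (∀ u → X u ≡ true → Y u ≡ false) → Split (X ∪ Y) X Y
split-∪ {X = X} {Y} h u with X u in eq | Y u in eq′
... | true | true = ⊥-elim (false≢true (h u eq) eq′)
... | true | false = inˡ
... | false | true = inʳ
... | false | false = out

opaque
  -- The budget of a vertex that rests in the second step. For the initial κ, capacity at least 4
  -- means that there is no neighbour in `H`; then one unit of the first step is lost to the colour
  -- which may be missing in the second list. The value -1 bars all other vertices from `S`, as
  -- costs are non-negative.
  capS : ℤ → ℤ → ℤ
  capS k b = if ⌊ + 4 ≤? k ⌋ then k + b - 1ℤ else -1ℤ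

  capS-pos : ∀ k b → 0ℤ ≤ capS k b → + 4 ≤ k
  capS-pos k b h with + 4 ≤? k
  ... | yes p = p

  capS-neg : ∀ k b → ¬ (+ 4 ≤ k) → capS k b ≡ -1ℤ
  capS-neg k b ¬p with + 4 ≤? k
  ... | yes p = ⊥-elim (¬p p)
  ... | no _ = refl

  capS-val : ∀ k b → + 4 ≤ k → capS k b ≡ k + b - 1ℤ
  capS-val k b p with + 4 ≤? k
  ... | yes _ = refl
  ... | no ¬p = ⊥-elim (¬p p)

split-sym : ∀ {n} {U X R : VSet n} → Split U X R → Split U R X
split-sym sp u = go (sp u)
  where
  go : ∀ {a b c} → Sp a b c → Sp a c b
  go inˡ = inʳ
  go inʳ = inˡ
  go out = out

ι≤1 : ∀ b → ι b ≤ 1ℤ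
ι≤1 true = ℤₚ.≤-refl
ι≤1 false = +≤+ ℕ.z≤n

-- Potentials of vertex sets, and plans of recolouring.

module Graph {n : ℕ} (adj : Fin n → Fin n → Bool)
             (adj-sym : ∀ u v → adj u v ≡ adj v u) where

  deg : VSet n → Fin n → ℤ
  deg X v = sum (λ u → ι (X u ∧ adj v u))

  -- Every edge inside X is subtracted twice.
  ρ : (Fin n → ℤ) → VSet n → ℤ
  ρ κ X = sum (λ v → on (X v) (κ v - 1ℤ - deg X v))

  deg-cong : ∀ {X Y} → (∀ u → X u ≡ Y u) → ∀ v → deg X v ≡ deg Y v
  deg-cong h v = sum-cong-≗ (λ u → cong (λ b → ι (b ∧ adj v u)) (h u))

  ρ-cong : ∀ {κ κ′ X Y} → (∀ u → κ u ≡ κ′ u) → (∀ u → X u ≡ Y u) → ρ κ X ≡ ρ κ′ Y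
  ρ-cong {κ} {κ′} {X} {Y} hκ hX = sum-cong-≗ (λ v → cong₂ on (hX v)
     (cong₂ (λ a b → a - 1ℤ - b) (hκ v) (deg-cong hX v)))

  deg-split : ∀ {U X R} → Split U X R → ∀ v → deg U v ≡ deg X v + deg R v
  deg-split {U} {X} {R} sp v = trans (sum-cong-≗ pt) (∑-distrib-+ _ _)
    where
    pt : ∀ u → ι (U u ∧ adj v u) ≡ ι (X u ∧ adj v u) + ι (R u ∧ adj v u)
    pt u with U u | X u | R u | sp u
    ... | _ | _ | _ | inˡ = sym (ℤₚ.+-identityʳ _)
    ... | _ | _ | _ | inʳ = sym (ℤₚ.+-identityˡ _)
    ... | _ | _ | _ | out = refl

  0≤deg : ∀ X v → 0ℤ ≤ deg X v
  0≤deg X v = sum-nonneg (λ u → 0≤ι (X u ∧ adj v u))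

  deg-mono : ∀ {X Y} → (∀ u → X u ≡ true → Y u ≡ true) → ∀ v → deg X v ≤ deg Y v
  deg-mono {X} {Y} h v = sum-mono pt
    where
    pt : ∀ u → ι (X u ∧ adj v u) ≤ ι (Y u ∧ adj v u)
    pt u with X u in eq
    ... | false = 0≤ι _
    ... | true rewrite h u eq = ℤₚ.≤-refl

  deg-single : ∀ v u → deg ⟦ v ⟧ u ≡ ι (adj u v)
  deg-single v u = trans (sum-cong-≗ pt) (sum-point v (λ w → ι (adj u w)))
    where
    pt : ∀ w → ι (⟦ v ⟧ w ∧ adj u w) ≡ on (⟦ v ⟧ w) (ι (adj u w))
    pt w with w Fin.≟ v
    ... | yes _ = refl
    ... | no  _ = refl

  edges : VSet n → VSet n → ℤ
  edges X Y = sum (λ v → on (X v) (deg Y v))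

  on-sum : ∀ b (f : Fin n → ℤ) → on b (sum f) ≡ sum (λ u → on b (f u))
  on-sum true  f = refl
  on-sum false f = sym (sum-zero {f = λ _ → 0ℤ} (λ _ → refl))

  edges-sym : ∀ X Y → edges X Y ≡ edges Y X
  edges-sym X Y = begin
    sum (λ v → on (X v) (deg Y v))                               ≡⟨ sum-cong-≗ (λ v → on-sum (X v) _) ⟩
    sum (λ v → sum (λ u → on (X v) (ι (Y u ∧ adj v u))))         ≡⟨ ∑-comm (λ v u → on (X v) (ι (Y u ∧ adj v u))) ⟩
    sum (λ u → sum (λ v → on (X v) (ι (Y u ∧ adj v u))))         ≡⟨ sum-cong-≗ (λ u → sum-cong-≗ (λ v → pt u v)) ⟩
    sum (λ u → sum (λ v → on (Y u) (ι (X v ∧ adj u v))))         ≡⟨ sum-cong-≗ (λ u → sym (on-sum (Y u) _)) ⟩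
    sum (λ u → on (Y u) (deg X u))                               ∎
    where
    open ≡-Reasoning
    pt : ∀ u v → on (X v) (ι (Y u ∧ adj v u)) ≡ on (Y u) (ι (X v ∧ adj u v))
    pt u v rewrite adj-sym u v with X v | Y u
    ... | true  | true  = refl
    ... | true  | false = refl
    ... | false | true  = refl
    ... | false | false = refl

  ρ-sub : ∀ (κ f : Fin n → ℤ) X → ρ (λ v → κ v - f v) X ≡ ρ κ X - sum (λ v → on (X v) (f v))
  ρ-sub κ f X = trans (sum-cong-≗ pt) (sum-sub _ _)
    where
    arith : ∀ k x d → k - x - 1ℤ - d ≡ k - 1ℤ - d - x
    arith = solve-∀
    pt : ∀ v → on (X v) (κ v - f v - 1ℤ - deg X v) ≡ on (X v) (κ v - 1ℤ - deg X v) - on (X v) (f v)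
    pt v with X v
    ... | true  = arith (κ v) (f v) (deg X v)
    ... | false = refl

  ρ-split : ∀ {U X R} κ → Split U X R → ρ κ U ≡ ρ κ X + ρ κ R - (edges R X + edges R X)
  ρ-split {U} {X} {R} κ sp = begin
    ρ κ U                       ≡⟨ sum-cong-≗ pt ⟩
    sum (λ v → (a v + b v) - (c v + d v)) ≡⟨ sum-sub (λ v → a v + b v) (λ v → c v + d v) ⟩
    sum (λ v → a v + b v) - sum (λ v → c v + d v) ≡⟨ cong₂ _-_ (∑-distrib-+ a b) (∑-distrib-+ c d) ⟩
    (ρ κ X + ρ κ R) - (edges X R + edges R X) ≡⟨ cong (λ e → (ρ κ X + ρ κ R) - (e + edges R X)) (edges-sym X R) ⟩
    (ρ κ X + ρ κ R) - (edges R X + edges R X) ∎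
    where
    open ≡-Reasoning
    a b c d : Fin n → ℤ
    a v = on (X v) (κ v - 1ℤ - deg X v)
    b v = on (R v) (κ v - 1ℤ - deg R v)
    c v = on (X v) (deg R v)
    d v = on (R v) (deg X v)
    ar₁ : ∀ k x r → k - 1ℤ - (x + r) ≡ (k - 1ℤ - x + 0ℤ) - (r + 0ℤ)
    ar₁ = solve-∀
    ar₂ : ∀ k x r → k - 1ℤ - (x + r) ≡ (0ℤ + (k - 1ℤ - r)) - (0ℤ + x)
    ar₂ = solve-∀
    pt : ∀ v → on (U v) (κ v - 1ℤ - deg U v) ≡ (a v + b v) - (c v + d v)
    pt v rewrite deg-split sp v with U v | X v | R v | sp v
    ... | _ | _ | _ | inˡ = ar₁ (κ v) (deg X v) (deg R v)
    ... | _ | _ | _ | inʳ = ar₂ (κ v) (deg X v) (deg R v)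
    ... | _ | _ | _ | out = refl

  ρ-single : (∀ v → adj v v ≡ false) → ∀ κ v → ρ κ ⟦ v ⟧ ≡ κ v - 1ℤ
  ρ-single irr κ v = trans (sum-cong-≗ pt) (sum-point v (λ u → κ u - 1ℤ))
    where
    pt : ∀ u → on (⟦ v ⟧ u) (κ u - 1ℤ - deg ⟦ v ⟧ u) ≡ on (⟦ v ⟧ u) (κ u - 1ℤ)
    pt u with u Fin.≟ v
    ... | no _ = refl
    ... | yes refl rewrite deg-single u u | irr u = ℤₚ.+-identityʳ _

  edges-single : ∀ v X → edges ⟦ v ⟧ X ≡ deg X v
  edges-single v X = sum-point v (deg X)

  -- Deleting X after letting it cost its neighbours two units each.
  ρ-rest : ∀ {U X R} κ → Split U X R → ρ (λ v → κ v - (deg X v + deg X v)) R ≡ ρ κ U - ρ κ X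
  ρ-rest {U} {X} {R} κ sp = begin
    ρ (λ v → κ v - (deg X v + deg X v)) R  ≡⟨ ρ-sub κ (λ v → deg X v + deg X v) R ⟩
    ρ κ R - sum (λ v → on (R v) (deg X v + deg X v))
      ≡⟨ cong (λ x → ρ κ R - x) (trans (sum-cong-≗ pt) (∑-distrib-+ _ _)) ⟩
    ρ κ R - (edges R X + edges R X) ≡⟨ ar (ρ κ X) (ρ κ R) (edges R X) ⟩
    (ρ κ X + ρ κ R - (edges R X + edges R X)) - ρ κ X ≡⟨ cong (_- ρ κ X) (sym (ρ-split κ sp)) ⟩
    ρ κ U - ρ κ X ∎
    where
    open ≡-Reasoning
    ar : ∀ x r e → r - (e + e) ≡ (x + r - (e + e)) - x
    ar = solve-∀
    pt : ∀ v → on (R v) (deg X v + deg X v) ≡ on (R v) (deg X v) + on (R v) (deg X v)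
    pt v with R v
    ... | true = refl
    ... | false = refl

  ρ-insert : (∀ v → adj v v ≡ false) → ∀ {U R v} κ → Split U ⟦ v ⟧ R →
             ρ κ U ≡ ρ κ R + (κ v - 1ℤ) - (deg R v + deg R v)
  ρ-insert irr {U} {R} {v} κ sp = begin
    ρ κ U ≡⟨ ρ-split κ sp ⟩
    ρ κ ⟦ v ⟧ + ρ κ R - (edges R ⟦ v ⟧ + edges R ⟦ v ⟧)
      ≡⟨ cong₂ (λ a e → a + ρ κ R - (e + e)) (ρ-single irr κ v) (trans (edges-sym R ⟦ v ⟧) (edges-single v R)) ⟩
    κ v - 1ℤ + ρ κ R - (deg R v + deg R v) ≡⟨ cong (_- (deg R v + deg R v)) (ℤₚ.+-comm (κ v - 1ℤ) (ρ κ R)) ⟩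
    ρ κ R + (κ v - 1ℤ) - (deg R v + deg R v) ∎
    where open ≡-Reasoning

  -- If neither `p` nor `t` ties, the values for (v, u) and (u, v) add up to 2; this is why ρ
  -- subtracts each edge twice.
  val : (p t : Fin n → ℕ) → Fin n → Fin n → ℤ
  val p t v u = ι (lt (p u) (p v)) + ι (lt (t v) (t u))

  -- Number of colours forbidden at v when the new colours are chosen in the order p
  -- and the vertices are recoloured in the order t.
  cost : (p t : Fin n → ℕ) → VSet n → Fin n → ℤ
  cost p t U v = sum (λ u → on (U u ∧ adj v u) (val p t v u))

  cost-split : ∀ {p t U X R} → Split U X R → ∀ v → cost p t U v ≡ cost p t X v + cost p t R v
  cost-split {p} {t} {U} {X} {R} sp v = trans (sum-cong-≗ pt) (∑-distrib-+ _ _)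
    where
    pt : ∀ u → on (U u ∧ adj v u) (val p t v u) ≡ on (X u ∧ adj v u) (val p t v u) + on (R u ∧ adj v u) (val p t v u)
    pt u with U u | X u | R u | sp u
    ... | _ | _ | _ | inˡ = sym (ℤₚ.+-identityʳ _)
    ... | _ | _ | _ | inʳ = sym (ℤₚ.+-identityˡ _)
    ... | _ | _ | _ | out = refl

  cost-cong : ∀ {p t p′ t′ Y v} → (∀ u → Y u ≡ true → val p t v u ≡ val p′ t′ v u) →
              cost p t Y v ≡ cost p′ t′ Y v
  cost-cong {p} {t} {p′} {t′} {Y} {v} h = sum-cong-≗ pt
    where
    pt : ∀ u → on (Y u ∧ adj v u) (val p t v u) ≡ on (Y u ∧ adj v u) (val p′ t′ v u)
    pt u with Y u in eq | adj v u
    ... | false | _ = refl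
    ... | true  | false = refl
    ... | true  | true = h u eq

  cost-const : ∀ {p t Y v} k → (∀ u → Y u ≡ true → val p t v u ≡ k) → cost p t Y v ≡ k * deg Y v
  cost-const {p} {t} {Y} {v} k h = trans (sum-cong-≗ pt) (sum-scale k _)
    where
    pt : ∀ u → on (Y u ∧ adj v u) (val p t v u) ≡ k * ι (Y u ∧ adj v u)
    pt u with Y u in eq | adj v u
    ... | false | _ = sym (ℤₚ.*-zeroʳ k)
    ... | true  | false = sym (ℤₚ.*-zeroʳ k)
    ... | true  | true = trans (h u eq) (sym (ℤₚ.*-identityʳ k))

  0≤cost : ∀ p t Y v → 0ℤ ≤ cost p t Y v
  0≤cost p t Y v = sum-nonneg pt
    where
    pt : ∀ u → 0ℤ ≤ on (Y u ∧ adj v u) (val p t v u)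
    pt u with Y u ∧ adj v u
    ... | true = ℤₚ.+-mono-≤ (0≤ι (lt (p u) (p v))) (0≤ι (lt (t v) (t u)))
    ... | false = ℤₚ.≤-refl

  -- S is the set of vertices which keep their colour in the second step; c₁, cS and c₂ bound the
  -- numbers of colours which may be forbidden in the two steps.
  record Plan (U : VSet n) (c₁ cS c₂ : Fin n → ℤ) : Set where
    field
      p t   : Fin n → ℕ
      bnd   : ℕ
      p<    : ∀ v → p v ℕ.< bnd
      t<    : ∀ v → t v ℕ.< bnd
      p≢    : ∀ u v → U u ≡ true → U v ≡ true → adj u v ≡ true → p u ≢ p v
      t≢    : ∀ u v → U u ≡ true → U v ≡ true → adj u v ≡ true → t u ≢ t v
      S     : VSet n
      S⊂    : ∀ v → S v ≡ true → U v ≡ true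
      step₁ : ∀ v → U v ≡ true → S v ≡ false → cost p t U v ≤ c₁ v
      stepS : ∀ v → S v ≡ true → cost p t U v ≤ cS v
      step₂ : ∀ v → U v ≡ true → S v ≡ false → cost p t (U ∖ S) v + deg S v ≤ c₂ v

  S-cap : ∀ {U c₁ cS c₂} (P : Plan U c₁ cS c₂) → ∀ v → Plan.S P v ≡ true → 0ℤ ≤ cS v
  S-cap {U} P v h = ℤₚ.≤-trans (0≤cost (Plan.p P) (Plan.t P) U v) (Plan.stepS P v h)

  -- New colours on `X` are chosen before those on `R`, while the recolouring order `t` is left
  -- open. A vertex of `X` pays `kX`, a vertex of `R` pays `kR` for each neighbour on the other
  -- side; the pairs used below are (0, 2) and (1, 1).
  module Combine {U X R : VSet n} (sp : Split U X R)
      {cX₁ cXS cX₂ cR₁ cRS cR₂ : Fin n → ℤ}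
      (PX : Plan X cX₁ cXS cX₂) (PR : Plan R cR₁ cRS cR₂)
      (t : Fin n → ℕ) (bnd : ℕ) (kX kR : ℤ) where
    private
      module PX = Plan PX
      module PR = Plan PR

    p : Fin n → ℕ
    p u = if X u then PX.p u else PX.bnd ℕ.+ PR.p u

    S : VSet n
    S u = PX.S u ∨ PR.S u

    X-inR : ∀ u → X u ≡ true → R u ≡ false
    X-inR u h = proj₂ (Split-inX (sp u) h)

    R-inX : ∀ u → R u ≡ true → X u ≡ false
    R-inX u h = proj₂ (Split-inR (sp u) h)

    SX-R : ∀ u → PX.S u ≡ true → PR.S u ≡ false
    SX-R u h with PR.S u in eq
    ... | false = refl
    ... | true = ⊥-elim (false≢true (X-inR u (PX.S⊂ u h)) (PR.S⊂ u eq))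

    spS : Split S PX.S PR.S
    spS u with PX.S u in eq | PR.S u in eq′
    ... | true | true = ⊥-elim (false≢true (SX-R u eq) eq′)
    ... | true | false = inˡ
    ... | false | true = inʳ
    ... | false | false = out

    sp∖ : Split (U ∖ S) (X ∖ PX.S) (R ∖ PR.S)
    sp∖ u with U u | X u in eX | R u in eR | sp u | PX.S u in eq | PR.S u in eq′
    ... | _ | _ | _ | inˡ | _ | true = ⊥-elim (false≢true eR (PR.S⊂ u eq′))
    ... | _ | _ | _ | inˡ | true | false = out
    ... | _ | _ | _ | inˡ | false | false = inˡ
    ... | _ | _ | _ | inʳ | true | _ = ⊥-elim (false≢true eX (PX.S⊂ u eq))
    ... | _ | _ | _ | inʳ | false | true = out
    ... | _ | _ | _ | inʳ | false | false = inʳ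
    ... | _ | _ | _ | out | _ | _ = out

    pX : ∀ u → X u ≡ true → p u ≡ PX.p u
    pX u h rewrite h = refl

    pR : ∀ u → X u ≡ false → p u ≡ PX.bnd ℕ.+ PR.p u
    pR u h rewrite h = refl

    module _
      (t<bnd : ∀ v → t v ℕ.< bnd)
      (tXX : ∀ u v → X u ≡ true → X v ≡ true → lt (t u) (t v) ≡ lt (PX.t u) (PX.t v))
      (tRR : ∀ u v → R u ≡ true → R v ≡ true → lt (t u) (t v) ≡ lt (PR.t u) (PR.t v))
      (tXR : ∀ v u → X v ≡ true → R u ≡ true → ι (lt (t v) (t u)) ≡ kX)
      (tRX : ∀ v u → R v ≡ true → X u ≡ true → 1ℤ + ι (lt (t v) (t u)) ≡ kR)
      (t≢ : ∀ u v → U u ≡ true → U v ≡ true → adj u v ≡ true → t u ≢ t v)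
      where

      valXX : ∀ v u → X v ≡ true → X u ≡ true → val p t v u ≡ val PX.p PX.t v u
      valXX v u hv hu = cong₂ _+_ (cong ι (cong₂ lt (pX u hu) (pX v hv))) (cong ι (tXX v u hv hu))

      valRR : ∀ v u → R v ≡ true → R u ≡ true → val p t v u ≡ val PR.p PR.t v u
      valRR v u hv hu = cong₂ _+_
        (cong ι (trans (cong₂ lt (pR u (R-inX u hu)) (pR v (R-inX v hv))) (lt-shift PX.bnd _ _)))
        (cong ι (tRR v u hv hu))

      valXR : ∀ v u → X v ≡ true → R u ≡ true → val p t v u ≡ kX
      valXR v u hv hu = trans (cong₂ _+_
        (cong ι (trans (cong₂ lt (pR u (R-inX u hu)) (pX v hv))
          (lt-false (ℕₚ.≤-trans (ℕₚ.<⇒≤ (PX.p< v)) (ℕₚ.m≤m+n PX.bnd _)))))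
        (tXR v u hv hu)) (ℤₚ.+-identityˡ kX)

      valRX : ∀ v u → R v ≡ true → X u ≡ true → val p t v u ≡ kR
      valRX v u hv hu = trans (cong (_+ ι (lt (t v) (t u)))
        (cong ι (trans (cong₂ lt (pX u hu) (pR v (R-inX v hv)))
          (lt-true (ℕₚ.<-≤-trans (PX.p< u) (ℕₚ.m≤m+n PX.bnd _))))))
        (tRX v u hv hu)

      costX : ∀ {U′ X′ R′} → Split U′ X′ R′ → (∀ u → X′ u ≡ true → X u ≡ true) →
              (∀ u → R′ u ≡ true → R u ≡ true) → ∀ v → X v ≡ true →
              cost p t U′ v ≡ cost PX.p PX.t X′ v + kX * deg R′ v
      costX {U′} {X′} {R′} sp′ hX hR v hv = trans (cost-split {p} {t} {U′} {X′} {R′} sp′ v) (cong₂ _+_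
        (cost-cong {p} {t} {PX.p} {PX.t} {X′} {v} (λ u hu → valXX v u hv (hX u hu)))
        (cost-const {p} {t} {R′} {v} kX (λ u hu → valXR v u hv (hR u hu))))

      costR : ∀ {U′ X′ R′} → Split U′ X′ R′ → (∀ u → X′ u ≡ true → X u ≡ true) →
              (∀ u → R′ u ≡ true → R u ≡ true) → ∀ v → R v ≡ true →
              cost p t U′ v ≡ kR * deg X′ v + cost PR.p PR.t R′ v
      costR {U′} {X′} {R′} sp′ hX hR v hv = trans (cost-split {p} {t} {U′} {X′} {R′} sp′ v) (cong₂ _+_
        (cost-const {p} {t} {X′} {v} kR (λ u hu → valRX v u hv (hX u hu)))
        (cost-cong {p} {t} {PR.p} {PR.t} {R′} {v} (λ u hu → valRR v u hv (hR u hu))))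

      ∧-fst : ∀ {a b} → a ∧ b ≡ true → a ≡ true
      ∧-fst {true} _ = refl

      combined : ∀ {c₁ cS c₂ : Fin n → ℤ}
        (X₁ : ∀ v → X v ≡ true → cX₁ v + kX * deg R v ≤ c₁ v)
        (XS : ∀ v → PX.S v ≡ true → 0ℤ ≤ cXS v → cXS v + kX * deg R v ≤ cS v)
        (X₂ : ∀ v → X v ≡ true → PX.S v ≡ false → cX₂ v + (kX * deg (R ∖ PR.S) v + deg PR.S v) ≤ c₂ v)
        (R₁ : ∀ v → R v ≡ true → cR₁ v + kR * deg X v ≤ c₁ v)
        (RS : ∀ v → PR.S v ≡ true → 0ℤ ≤ cRS v → cRS v + kR * deg X v ≤ cS v)
        (R₂ : ∀ v → R v ≡ true → PR.S v ≡ false → cR₂ v + (kR * deg (X ∖ PX.S) v + deg PX.S v) ≤ c₂ v) →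
        Plan U c₁ cS c₂
      combined {c₁} {cS} {c₂} X₁ XS X₂ R₁ RS R₂ = record
        { p = p ; t = t ; bnd = PX.bnd ℕ.+ PR.bnd ℕ.+ bnd
        ; p< = p<′ ; t< = λ v → ℕₚ.<-≤-trans (t<bnd v) (ℕₚ.m≤n+m bnd _)
        ; p≢ = p≢′ ; t≢ = t≢ ; S = S
        ; S⊂ = λ v h → S⊂′ v h ; step₁ = st₁ ; stepS = stS ; step₂ = st₂ }
        where
        p<′ : ∀ v → p v ℕ.< PX.bnd ℕ.+ PR.bnd ℕ.+ bnd
        p<′ v with X v
        ... | true  = ℕₚ.<-≤-trans (PX.p< v) (ℕₚ.≤-trans (ℕₚ.m≤m+n PX.bnd PR.bnd) (ℕₚ.m≤m+n _ bnd))
        ... | false = ℕₚ.<-≤-trans (ℕₚ.+-monoʳ-< PX.bnd (PR.p< v)) (ℕₚ.m≤m+n _ bnd)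
        XR≢ : ∀ u v → X u ≡ true → R v ≡ true → p u ≢ p v
        XR≢ u v hu hv eq = ℕₚ.<⇒≢ (ℕₚ.<-≤-trans (PX.p< u) (ℕₚ.m≤m+n PX.bnd _))
          (trans (sym (pX u hu)) (trans eq (pR v (R-inX v hv))))
        p≢′ : ∀ u v → U u ≡ true → U v ≡ true → adj u v ≡ true → p u ≢ p v
        p≢′ u v hu hv a eq with Split-U (sp u) hu | Split-U (sp v) hv
        ... | inj₁ xu | inj₁ xv = PX.p≢ u v xu xv a (trans (sym (pX u xu)) (trans eq (pX v xv)))
        ... | inj₁ xu | inj₂ rv = XR≢ u v xu rv eq
        ... | inj₂ ru | inj₁ xv = XR≢ v u xv ru (sym eq)
        ... | inj₂ ru | inj₂ rv = PR.p≢ u v ru rv a (ℕₚ.+-cancelˡ-≡ PX.bnd _ _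
              (trans (sym (pR u (R-inX u ru))) (trans eq (pR v (R-inX v rv)))))
        S⊂′ : ∀ v → S v ≡ true → U v ≡ true
        S⊂′ v h with Split-U (spS v) h
        ... | inj₁ x = proj₁ (Split-inX (sp v) (PX.S⊂ v x))
        ... | inj₂ r = proj₁ (Split-inR (sp v) (PR.S⊂ v r))
        SX-f : ∀ v → S v ≡ false → PX.S v ≡ false
        SX-f v h with PX.S v
        ... | false = refl
        SR-f : ∀ v → S v ≡ false → PR.S v ≡ false
        SR-f v h with PX.S v | PR.S v
        ... | false | false = refl
        st₁ : ∀ v → U v ≡ true → S v ≡ false → cost p t U v ≤ c₁ v
        st₁ v hU hS with Split-U (sp v) hU
        ... | inj₁ x = ℤₚ.≤-trans (ℤₚ.≤-reflexive (costX sp (λ _ h → h) (λ _ h → h) v x))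
                (ℤₚ.≤-trans (ℤₚ.+-monoˡ-≤ (kX * deg R v) (PX.step₁ v x (SX-f v hS))) (X₁ v x))
        ... | inj₂ r = ℤₚ.≤-trans (ℤₚ.≤-reflexive (trans (costR sp (λ _ h → h) (λ _ h → h) v r) (ℤₚ.+-comm (kR * deg X v) (cost PR.p PR.t R v))))
                (ℤₚ.≤-trans (ℤₚ.+-monoˡ-≤ (kR * deg X v) (PR.step₁ v r (SR-f v hS))) (R₁ v r))
        stS : ∀ v → S v ≡ true → cost p t U v ≤ cS v
        stS v hS with Split-U (spS v) hS
        ... | inj₁ x = ℤₚ.≤-trans (ℤₚ.≤-reflexive (costX sp (λ _ h → h) (λ _ h → h) v (PX.S⊂ v x)))
                (ℤₚ.≤-trans (ℤₚ.+-monoˡ-≤ (kX * deg R v) (PX.stepS v x))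
                  (XS v x (ℤₚ.≤-trans (0≤cost PX.p PX.t X v) (PX.stepS v x))))
        ... | inj₂ r = ℤₚ.≤-trans (ℤₚ.≤-reflexive (trans (costR sp (λ _ h → h) (λ _ h → h) v (PR.S⊂ v r)) (ℤₚ.+-comm (kR * deg X v) (cost PR.p PR.t R v))))
                (ℤₚ.≤-trans (ℤₚ.+-monoˡ-≤ (kR * deg X v) (PR.stepS v r))
                  (RS v r (ℤₚ.≤-trans (0≤cost PR.p PR.t R v) (PR.stepS v r))))
        ar₁ : ∀ a b c d → a + b + (c + d) ≡ (a + c) + (b + d)
        ar₁ = solve-∀
        ar₂ : ∀ a b c d → a + b + (c + d) ≡ (b + d) + (a + c)
        ar₂ = solve-∀
        st₂ : ∀ v → U v ≡ true → S v ≡ false → cost p t (U ∖ S) v + deg S v ≤ c₂ v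
        st₂ v hU hS with Split-U (sp v) hU
        ... | inj₁ x = ℤₚ.≤-trans (ℤₚ.≤-reflexive (trans
                (cong₂ _+_ (costX sp∖ (λ _ → ∧-fst) (λ _ → ∧-fst) v x) (deg-split spS v))
                (ar₁ (cost PX.p PX.t (X ∖ PX.S) v) (kX * deg (R ∖ PR.S) v) (deg PX.S v) (deg PR.S v))))
                (ℤₚ.≤-trans (ℤₚ.+-monoˡ-≤ (kX * deg (R ∖ PR.S) v + deg PR.S v) (PX.step₂ v x (SX-f v hS)))
                  (X₂ v x (SX-f v hS)))
        ... | inj₂ r = ℤₚ.≤-trans (ℤₚ.≤-reflexive (trans
                (cong₂ _+_ (costR sp∖ (λ _ → ∧-fst) (λ _ → ∧-fst) v r) (deg-split spS v))
                (ar₂ (kR * deg (X ∖ PX.S) v) (cost PR.p PR.t (R ∖ PR.S) v) (deg PX.S v) (deg PR.S v))))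
                (ℤₚ.≤-trans (ℤₚ.+-monoˡ-≤ (kR * deg (X ∖ PX.S) v + deg PX.S v) (PR.step₂ v r (SR-f v hS)))
                  (R₂ v r (SR-f v hS)))

  module _ {U X R : VSet n} (sp : Split U X R)
      {cX₁ cXS cX₂ cR₁ cRS cR₂ c₁ cS c₂ : Fin n → ℤ}
      (PX : Plan X cX₁ cXS cX₂) (PR : Plan R cR₁ cRS cR₂) where
    private
      module PX = Plan PX
      module PR = Plan PR
      bR bX : ℕ
      bR = PR.bnd
      bX = PX.bnd

    -- X is coloured before R but recoloured after R.
    combine-late :
      (X₁ : ∀ v → X v ≡ true → cX₁ v ≤ c₁ v)
      (XS : ∀ v → PX.S v ≡ true → cXS v ≤ cS v)
      (X₂ : ∀ v → X v ≡ true → cX₂ v ≤ c₂ v)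
      (sep : ∀ v u → X v ≡ true → PX.S v ≡ false → PR.S u ≡ true → adj v u ≡ false)
      (R₁ : ∀ v → R v ≡ true → cR₁ v + + 2 * deg X v ≤ c₁ v)
      (RS : ∀ v → PR.S v ≡ true → 0ℤ ≤ cRS v → cRS v + + 2 * deg X v ≤ cS v)
      (R₂ : ∀ v → R v ≡ true → cR₂ v + (+ 2 * deg (X ∖ PX.S) v + deg PX.S v) ≤ c₂ v) →
      Plan U c₁ cS c₂
    combine-late X₁ XS X₂ sep R₁ RS R₂ =
      C.combined t<′ tXX tRR tXR tRX t≢′
        (λ v h → ℤₚ.≤-trans (ℤₚ.≤-reflexive (z₁ (cX₁ v) (deg R v))) (X₁ v h))
        (λ v h _ → ℤₚ.≤-trans (ℤₚ.≤-reflexive (z₁ (cXS v) (deg R v))) (XS v h))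
        -- A resting neighbour in `R` would cost one unit in the second step whatever the order is;
        -- `sep` excludes such neighbours.
        (λ v h hS → ℤₚ.≤-trans (ℤₚ.≤-reflexive (trans (cong (λ d → cX₂ v + (0ℤ * deg (R ∖ PR.S) v + d)) (deg0 v h hS))
           (z₂ (cX₂ v) (deg (R ∖ PR.S) v)))) (X₂ v h))
        R₁ RS (λ v h _ → R₂ v h)
      where
      t : Fin n → ℕ
      t u = if X u then bR ℕ.+ PX.t u else PR.t u
      module C = Combine sp PX PR t (bR ℕ.+ bX) 0ℤ (+ 2)
      z₁ : ∀ a d → a + 0ℤ * d ≡ a
      z₁ = solve-∀
      z₂ : ∀ a d → a + (0ℤ * d + 0ℤ) ≡ a
      z₂ = solve-∀
      deg0 : ∀ v → X v ≡ true → PX.S v ≡ false → deg PR.S v ≡ 0ℤ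
      deg0 v h hS = sum-zero pt
        where
        pt : ∀ u → ι (PR.S u ∧ adj v u) ≡ 0ℤ
        pt u with PR.S u in eq
        ... | false = refl
        ... | true rewrite sep v u h hS eq = refl
      tX : ∀ u → X u ≡ true → t u ≡ bR ℕ.+ PX.t u
      tX u h rewrite h = refl
      tR : ∀ u → R u ≡ true → t u ≡ PR.t u
      tR u h rewrite C.R-inX u h = refl
      t<′ : ∀ v → t v ℕ.< bR ℕ.+ bX
      t<′ v with X v
      ... | true = ℕₚ.+-monoʳ-< bR (PX.t< v)
      ... | false = ℕₚ.<-≤-trans (PR.t< v) (ℕₚ.m≤m+n bR bX)
      tXX : ∀ u v → X u ≡ true → X v ≡ true → lt (t u) (t v) ≡ lt (PX.t u) (PX.t v)
      tXX u v hu hv = trans (cong₂ lt (tX u hu) (tX v hv)) (lt-shift bR _ _)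
      tRR : ∀ u v → R u ≡ true → R v ≡ true → lt (t u) (t v) ≡ lt (PR.t u) (PR.t v)
      tRR u v hu hv = cong₂ lt (tR u hu) (tR v hv)
      tXR : ∀ v u → X v ≡ true → R u ≡ true → ι (lt (t v) (t u)) ≡ 0ℤ
      tXR v u hv hu = cong ι (trans (cong₂ lt (tX v hv) (tR u hu))
        (lt-false (ℕₚ.≤-trans (ℕₚ.<⇒≤ (PR.t< u)) (ℕₚ.m≤m+n bR _))))
      tRX : ∀ v u → R v ≡ true → X u ≡ true → 1ℤ + ι (lt (t v) (t u)) ≡ + 2
      tRX v u hv hu = cong (λ b → 1ℤ + ι b) (trans (cong₂ lt (tR v hv) (tX u hu))
        (lt-true (ℕₚ.<-≤-trans (PR.t< v) (ℕₚ.m≤m+n bR _))))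
      XR≢ : ∀ u v → X u ≡ true → R v ≡ true → t u ≢ t v
      XR≢ u v hu hv eq = ℕₚ.<⇒≢ (ℕₚ.<-≤-trans (PR.t< v) (ℕₚ.m≤m+n bR _))
        (trans (sym (tR v hv)) (trans (sym eq) (tX u hu)))
      t≢′ : ∀ u v → U u ≡ true → U v ≡ true → adj u v ≡ true → t u ≢ t v
      t≢′ u v hu hv a eq with Split-U (sp u) hu | Split-U (sp v) hv
      ... | inj₁ xu | inj₁ xv = PX.t≢ u v xu xv a (ℕₚ.+-cancelˡ-≡ bR _ _ (trans (sym (tX u xu)) (trans eq (tX v xv))))
      ... | inj₁ xu | inj₂ rv = XR≢ u v xu rv eq
      ... | inj₂ ru | inj₁ xv = XR≢ v u xv ru (sym eq)
      ... | inj₂ ru | inj₂ rv = PR.t≢ u v ru rv a (trans (sym (tR u ru)) (trans eq (tR v rv)))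

    -- X is coloured before R and recoloured before R.
    combine-early :
      (X₁ : ∀ v → X v ≡ true → cX₁ v + deg R v ≤ c₁ v)
      (XS : ∀ v → PX.S v ≡ true → 0ℤ ≤ cXS v → cXS v + deg R v ≤ cS v)
      (X₂ : ∀ v → X v ≡ true → cX₂ v + deg R v ≤ c₂ v)
      (R₁ : ∀ v → R v ≡ true → cR₁ v + deg X v ≤ c₁ v)
      (RS : ∀ v → PR.S v ≡ true → 0ℤ ≤ cRS v → cRS v + deg X v ≤ cS v)
      (R₂ : ∀ v → R v ≡ true → cR₂ v + deg X v ≤ c₂ v) →
      Plan U c₁ cS c₂
    combine-early X₁ XS X₂ R₁ RS R₂ =
      C.combined t<′ tXX tRR tXR tRX t≢′
        (λ v h → ℤₚ.≤-trans (ℤₚ.≤-reflexive (o₁ (cX₁ v) (deg R v))) (X₁ v h))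
        (λ v h h′ → ℤₚ.≤-trans (ℤₚ.≤-reflexive (o₁ (cXS v) (deg R v))) (XS v h h′))
        (λ v h _ → ℤₚ.≤-trans (ℤₚ.≤-reflexive (two R PR.S PR.S⊂ v (cX₂ v))) (X₂ v h))
        (λ v h → ℤₚ.≤-trans (ℤₚ.≤-reflexive (o₁ (cR₁ v) (deg X v))) (R₁ v h))
        (λ v h h′ → ℤₚ.≤-trans (ℤₚ.≤-reflexive (o₁ (cRS v) (deg X v))) (RS v h h′))
        (λ v h _ → ℤₚ.≤-trans (ℤₚ.≤-reflexive (two X PX.S PX.S⊂ v (cR₂ v))) (R₂ v h))
      where
      t : Fin n → ℕ
      t u = if X u then PX.t u else bX ℕ.+ PR.t u
      module C = Combine sp PX PR t (bX ℕ.+ bR) 1ℤ 1ℤ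
      o₁ : ∀ a d → a + 1ℤ * d ≡ a + d
      o₁ = solve-∀
      o₂ : ∀ a d e → a + (1ℤ * d + e) ≡ a + (e + d)
      o₂ = solve-∀
      -- At one unit per neighbour, resting and moving neighbours cost the same, so the resting sets
      -- drop out.
      two : ∀ Y T → (∀ u → T u ≡ true → Y u ≡ true) → ∀ v a → a + (1ℤ * deg (Y ∖ T) v + deg T v) ≡ a + deg Y v
      two Y T h v a = trans (o₂ a (deg (Y ∖ T) v) (deg T v)) (cong (λ d → a + d) (sym (deg-split (split-∖ h) v)))
      tX : ∀ u → X u ≡ true → t u ≡ PX.t u
      tX u h rewrite h = refl
      tR : ∀ u → R u ≡ true → t u ≡ bX ℕ.+ PR.t u
      tR u h rewrite C.R-inX u h = refl
      t<′ : ∀ v → t v ℕ.< bX ℕ.+ bR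
      t<′ v with X v
      ... | true = ℕₚ.<-≤-trans (PX.t< v) (ℕₚ.m≤m+n bX bR)
      ... | false = ℕₚ.+-monoʳ-< bX (PR.t< v)
      tXX : ∀ u v → X u ≡ true → X v ≡ true → lt (t u) (t v) ≡ lt (PX.t u) (PX.t v)
      tXX u v hu hv = cong₂ lt (tX u hu) (tX v hv)
      tRR : ∀ u v → R u ≡ true → R v ≡ true → lt (t u) (t v) ≡ lt (PR.t u) (PR.t v)
      tRR u v hu hv = trans (cong₂ lt (tR u hu) (tR v hv)) (lt-shift bX _ _)
      tXR : ∀ v u → X v ≡ true → R u ≡ true → ι (lt (t v) (t u)) ≡ 1ℤ
      tXR v u hv hu = cong ι (trans (cong₂ lt (tX v hv) (tR u hu))
        (lt-true (ℕₚ.<-≤-trans (PX.t< v) (ℕₚ.m≤m+n bX _))))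
      tRX : ∀ v u → R v ≡ true → X u ≡ true → 1ℤ + ι (lt (t v) (t u)) ≡ 1ℤ
      tRX v u hv hu = cong (λ b → 1ℤ + ι b) (trans (cong₂ lt (tR v hv) (tX u hu))
        (lt-false (ℕₚ.≤-trans (ℕₚ.<⇒≤ (PX.t< u)) (ℕₚ.m≤m+n bX _))))
      XR≢ : ∀ u v → X u ≡ true → R v ≡ true → t u ≢ t v
      XR≢ u v hu hv eq = ℕₚ.<⇒≢ (ℕₚ.<-≤-trans (PX.t< u) (ℕₚ.m≤m+n bX _))
        (trans (sym (tX u hu)) (trans eq (tR v hv)))
      t≢′ : ∀ u v → U u ≡ true → U v ≡ true → adj u v ≡ true → t u ≢ t v
      t≢′ u v hu hv a eq with Split-U (sp u) hu | Split-U (sp v) hv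
      ... | inj₁ xu | inj₁ xv = PX.t≢ u v xu xv a (trans (sym (tX u xu)) (trans eq (tX v xv)))
      ... | inj₁ xu | inj₂ rv = XR≢ u v xu rv eq
      ... | inj₂ ru | inj₁ xv = XR≢ v u xv ru (sym eq)
      ... | inj₂ ru | inj₂ rv = PR.t≢ u v ru rv a (ℕₚ.+-cancelˡ-≡ bX _ _ (trans (sym (tR u ru)) (trans eq (tR v rv))))

  empty-plan : ∀ {U c₁ cS c₂} → (∀ u → U u ≡ false) → Plan U c₁ cS c₂
  empty-plan h = record
    { p = λ _ → 0 ; t = λ _ → 0 ; bnd = 1 ; p< = λ _ → ℕ.s≤s ℕ.z≤n ; t< = λ _ → ℕ.s≤s ℕ.z≤n
    ; p≢ = λ u _ hu → ⊥-elim (false≢true (h u) hu) ; t≢ = λ u _ hu → ⊥-elim (false≢true (h u) hu)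
    ; S = λ _ → false ; S⊂ = λ _ () ; step₁ = λ v hv → ⊥-elim (false≢true (h v) hv)
    ; stepS = λ _ () ; step₂ = λ v hv → ⊥-elim (false≢true (h v) hv) }

  module _ (irr : ∀ v → adj v v ≡ false) (w : Fin n) where
    private
      alone : ∀ u v → ⟦ w ⟧ u ≡ true → ⟦ w ⟧ v ≡ true → adj u v ≡ true → ⊥
      alone u v hu hv a with ≟-true {u = u} hu | ≟-true {u = v} hv
      ... | refl | refl = false≢true (irr w) a

      cost0 : ∀ Y → (∀ u → Y u ≡ true → ⟦ w ⟧ u ≡ true) → ∀ v → ⟦ w ⟧ v ≡ true → cost (λ _ → 0) (λ _ → 0) Y v ≡ 0ℤ
      cost0 Y h v hv = sum-zero pt
        where
        pt : ∀ u → on (Y u ∧ adj v u) (val (λ _ → 0) (λ _ → 0) v u) ≡ 0ℤ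
        pt u with Y u in eq | adj v u in a
        ... | true | true = ⊥-elim (alone v u hv (h u eq) a)
        ... | true | false = refl
        ... | false | _ = refl

      deg-none : ∀ v → deg (λ _ → false) v ≡ 0ℤ
      deg-none v = sum-zero (λ _ → refl)

    single-plan : ∀ {c₁ cS c₂} → 0ℤ ≤ c₁ w → 0ℤ ≤ c₂ w → Plan ⟦ w ⟧ c₁ cS c₂
    single-plan {c₁} {cS} {c₂} h₁ h₂ = record
      { p = λ _ → 0 ; t = λ _ → 0 ; bnd = 1 ; p< = λ _ → ℕ.s≤s ℕ.z≤n ; t< = λ _ → ℕ.s≤s ℕ.z≤n
      ; p≢ = λ u v hu hv a → ⊥-elim (alone u v hu hv a) ; t≢ = λ u v hu hv a → ⊥-elim (alone u v hu hv a)
      ; S = λ _ → false ; S⊂ = λ _ () ; step₁ = st₁ ; stepS = λ _ () ; step₂ = st₂ }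
      where
      st₁ : ∀ v → ⟦ w ⟧ v ≡ true → false ≡ false → cost (λ _ → 0) (λ _ → 0) ⟦ w ⟧ v ≤ c₁ v
      st₁ v hv _ = ℤₚ.≤-trans (ℤₚ.≤-reflexive (cost0 ⟦ w ⟧ (λ _ h → h) v hv)) (subst (λ x → 0ℤ ≤ c₁ x) (sym (≟-true hv)) h₁)
      ∧-fst : ∀ {a b} → a ∧ b ≡ true → a ≡ true
      ∧-fst {true} _ = refl
      st₂ : ∀ v → ⟦ w ⟧ v ≡ true → false ≡ false → cost (λ _ → 0) (λ _ → 0) (⟦ w ⟧ ∖ (λ _ → false)) v + deg (λ _ → false) v ≤ c₂ v
      st₂ v hv _ = ℤₚ.≤-trans (ℤₚ.≤-reflexive (cong₂ _+_ (cost0 _ (λ _ → ∧-fst) v hv) (deg-none v)))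
        (subst (λ x → 0ℤ ≤ c₂ x) (sym (≟-true hv)) h₂)

    single-S-plan : ∀ {c₁ cS c₂} → 0ℤ ≤ cS w → Plan ⟦ w ⟧ c₁ cS c₂
    single-S-plan {c₁} {cS} {c₂} h = record
      { p = λ _ → 0 ; t = λ _ → 0 ; bnd = 1 ; p< = λ _ → ℕ.s≤s ℕ.z≤n ; t< = λ _ → ℕ.s≤s ℕ.z≤n
      ; p≢ = λ u v hu hv a → ⊥-elim (alone u v hu hv a) ; t≢ = λ u v hu hv a → ⊥-elim (alone u v hu hv a)
      ; S = ⟦ w ⟧ ; S⊂ = λ _ h → h ; step₁ = λ v hv hf → ⊥-elim (false≢true hf hv)
      ; stepS = λ v hv → ℤₚ.≤-trans (ℤₚ.≤-reflexive (cost0 ⟦ w ⟧ (λ _ h → h) v hv))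
          (subst (λ x → 0ℤ ≤ cS x) (sym (≟-true hv)) h)
      ; step₂ = λ v hv hf → ⊥-elim (false≢true hf hv) }

-- Plans for sets all of whose subsets have potential at least -1.

module Core {n : ℕ} (adj : Fin n → Fin n → Bool)
    (adj-sym : ∀ u v → adj u v ≡ adj v u)
    (irr : ∀ v → adj v v ≡ false)
    (tri : ∀ u v w → adj u v ≡ true → adj v w ≡ true → adj u w ≡ true → ⊥) where
  open Graph adj adj-sym

  deg-nbr : ∀ {Y v u} → Y u ≡ true → adj v u ≡ true → 1ℤ ≤ deg Y v
  deg-nbr {Y} {v} {u} hu a = ℤₚ.≤-trans (ℤₚ.≤-reflexive (sym (cong₂ (λ b c → ι (b ∧ c)) hu a)))
    (term≤sum _ (λ u → 0≤ι (Y u ∧ adj v u)) u)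

  deg-drop : ∀ {Y U w z} → (∀ u → Y u ≡ true → U u ≡ true) → U z ≡ true → Y z ≡ false → adj w z ≡ true →
             deg Y w + 1ℤ ≤ deg U w
  deg-drop {Y} {U} {w} {z} sub hz hY a = ℤₚ.≤-trans
    (ℤₚ.≤-reflexive (trans (cong (λ x → deg Y w + x) (sym (trans (deg-single z w) (cong ι a)))) (sym (∑-distrib-+ _ _))))
    (sum-mono pt)
    where
    pt : ∀ u → ι (Y u ∧ adj w u) + ι (⟦ z ⟧ u ∧ adj w u) ≤ ι (U u ∧ adj w u)
    pt u with u Fin.≟ z
    ... | yes refl rewrite hY | hz | a = ℤₚ.≤-refl
    ... | no _ with Y u in eq
    ...   | true rewrite sub u eq = ℤₚ.≤-reflexive (ℤₚ.+-identityʳ _)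
    ...   | false = 0≤ι (U u ∧ adj w u)

  deg-zero : ∀ {Y v} → (∀ u → Y u ≡ true → adj v u ≡ false) → deg Y v ≡ 0ℤ
  deg-zero {Y} {v} h = sum-zero pt
    where
    pt : ∀ u → ι (Y u ∧ adj v u) ≡ 0ℤ
    pt u with Y u in eq
    ... | true rewrite h u eq = refl
    ... | false = refl

  some-nbr : ∀ {Y v} → 1ℤ ≤ deg Y v → ∃ λ u → Y u ≡ true × adj v u ≡ true
  some-nbr {Y} {v} h with Finₚ.any? (λ u → (Y u 𝔹.≟ true) ×-dec (adj v u 𝔹.≟ true))
  ... | yes p = p
  ... | no ¬p = ⊥-elim (contra (subst (1ℤ ≤_) (deg-zero nb) h))
    where
    contra : 1ℤ ≤ 0ℤ → ⊥
    contra (+≤+ ())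
    nb : ∀ u → Y u ≡ true → adj v u ≡ false
    nb u hu with adj v u in eq
    ... | false = refl
    ... | true = ⊥-elim (¬p (u , hu , eq))

  -- Discharging: with ρ κ U = -1 the quantity 3 (deg - κ + 1) sums to 3 over U; every vertex of
  -- type G (κ = 5, degree 3) gives one unit from each of its neighbours, after which G-vertices
  -- hold 0, the others at least 1, and the neighbourhood of a G-vertex accounts for at least 4.
  stuck : ∀ (κ : Fin n → ℤ) (U G : VSet n) →
    (∀ v → G v ≡ true → U v ≡ true) →
    (∀ v → G v ≡ true → κ v ≡ + 5 × deg U v ≡ + 3) →
    (∀ v → U v ≡ true → G v ≡ false → κ v + 1ℤ ≤ deg U v) →
    (∀ v → U v ≡ true → κ v ≤ + 5) →
    (∀ u v → G u ≡ true → G v ≡ true → adj u v ≡ false) →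
    (∀ w → U w ≡ true → G w ≡ false → + 4 ≤ κ w → ∃ λ u → U u ≡ true × G u ≡ false × adj w u ≡ true) →
    (∃ λ v → U v ≡ true) → -1ℤ ≤ ρ κ U → (∀ v → G v ≡ true → ρ κ U ≤ -1ℤ) → ⊥
  stuck κ U G G⊂ Gdef Ndef κ≤5 indep noS (v₀ , hv₀) ρ≥ ρ≤ with Finₚ.any? (λ v → G v 𝔹.≟ true)
  -- Without vertices of type `G` every term of ρ is at most -2, and `U` is nonempty.
  ... | no ¬G = no-G (ℤₚ.≤-trans ρ≥ (ℤₚ.≤-trans (sum-mono le) bound))
    where
    G-false : ∀ v → G v ≡ false
    G-false v with G v in eq
    ... | false = refl
    ... | true = ⊥-elim (¬G (v , eq))
    ar : ∀ k d → - + 2 - (k - 1ℤ - d) ≡ (d - (k + 1ℤ)) + + 0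
    ar = solve-∀
    le : ∀ v → on (U v) (κ v - 1ℤ - deg U v) ≤ on ⌊ v Fin.≟ v₀ ⌋ (- + 2)
    le v with v Fin.≟ v₀
    ... | yes refl rewrite hv₀ = lin₁ 0 (Ndef v hv₀ (G-false v)) (ar (κ v) (deg U v))
    ... | no _ with U v in eq
    ...   | true = lin₁ 2 (Ndef v eq (G-false v)) (ar′ (κ v) (deg U v))
      where
      ar′ : ∀ k d → 0ℤ - (k - 1ℤ - d) ≡ (d - (k + 1ℤ)) + + 2
      ar′ = solve-∀
    ...   | false = ℤₚ.≤-refl
    bound : sum (λ v → on ⌊ v Fin.≟ v₀ ⌋ (- + 2)) ≤ - + 2
    bound = ℤₚ.≤-reflexive (sum-point v₀ (λ _ → - + 2))
    no-G : ¬ (-1ℤ ≤ - + 2)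
    no-G (_≤_.-≤- ())
  ... | yes (v , hv) = impossible four≤three
    where
    d : Fin n → ℤ
    d = deg U
    ch : Fin n → ℤ
    ch u = on (U u) (+ 3 * (d u - κ u + 1ℤ)) + (on (G u) (d u) - on (U u) (deg G u))
    ρ≡ : ρ κ U ≡ -1ℤ
    ρ≡ = ℤₚ.≤-antisym (ρ≤ v hv) ρ≥
    Σch : sum ch ≡ + 3
    Σch = begin
      sum ch ≡⟨ ∑-distrib-+ _ _ ⟩
      sum (λ u → on (U u) (+ 3 * (d u - κ u + 1ℤ))) + sum (λ u → on (G u) (d u) - on (U u) (deg G u))
        ≡⟨ cong₂ _+_ (trans (sum-cong-≗ pt) (sum-scale (- + 3) _)) (sum-sub _ _) ⟩
      - + 3 * ρ κ U + (edges G U - edges U G)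
        ≡⟨ cong₂ (λ a b → - + 3 * a + (b - edges U G)) ρ≡ (edges-sym G U) ⟩
      + 3 + (edges U G - edges U G) ≡⟨ cong (λ x → + 3 + x) (ℤₚ.+-inverseʳ (edges U G)) ⟩
      + 3 ∎
      where
      open ≡-Reasoning
      ar : ∀ k x → + 3 * (x - k + 1ℤ) ≡ - + 3 * (k - 1ℤ - x)
      ar = solve-∀
      pt : ∀ u → on (U u) (+ 3 * (d u - κ u + 1ℤ)) ≡ - + 3 * on (U u) (κ u - 1ℤ - d u)
      pt u with U u
      ... | true = ar (κ u) (d u)
      ... | false = refl
    G-le : ∀ u → deg G u ≤ d u
    G-le u = deg-mono G⊂ u
    NonG : Fin n → Set
    NonG w = ∃ λ u → U u ≡ true × G u ≡ false × adj w u ≡ true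
    f : Fin n → ℤ
    f u = + 3 * (d u - κ u + 1ℤ) - deg G u
    f≥-nonG : ∀ u → U u ≡ true → G u ≡ false → NonG u → 1ℤ ≤ f u
    f≥-nonG u hU hG (z , zU , zG , a) =
      lin₃ 0 (deg-drop {G} {U} {u} {z} G⊂ zU zG a) (ℤₚ.*-monoˡ-≤-nonNeg (+ 2) (Ndef u hU hG)) (κ≤5 u hU) (ar (d u) (κ u) (deg G u))
      where
      ar : ∀ x k g → + 3 * (x - k + 1ℤ) - g - 1ℤ ≡ (x - (g + 1ℤ)) + (+ 2 * x - + 2 * (k + 1ℤ)) + (+ 5 - k) + + 0
      ar = solve-∀
    f≥-small : ∀ u → U u ≡ true → G u ≡ false → κ u ≤ + 3 → + 2 ≤ f u
    f≥-small u hU hG hκ =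
      lin₃ 0 (G-le u) (ℤₚ.*-monoˡ-≤-nonNeg (+ 2) (Ndef u hU hG)) hκ (ar (d u) (κ u) (deg G u))
      where
      ar : ∀ x k g → + 3 * (x - k + 1ℤ) - g - + 2 ≡ (x - g) + (+ 2 * x - + 2 * (k + 1ℤ)) + (+ 3 - k) + + 0
      ar = solve-∀
    small : ∀ {k} → ¬ (+ 4 ≤ k) → k ≤ + 3
    small {k} h = lin₁ 0 (≰⇒≤ h) (ar k)
      where
      ar : ∀ k → + 3 - k ≡ (+ 4 - (k + 1ℤ)) + + 0
      ar = solve-∀
    f≥1 : ∀ u → U u ≡ true → G u ≡ false → 1ℤ ≤ f u
    f≥1 u hU hG with + 4 ≤? κ u
    ... | yes h = f≥-nonG u hU hG (noS u hU hG h)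
    ... | no h = ℤₚ.≤-trans (+≤+ (ℕ.s≤s ℕ.z≤n)) (f≥-small u hU hG (small h))
    w-ex : ∃ λ u → U u ≡ true × adj v u ≡ true
    w-ex = some-nbr {U} {v} (subst (1ℤ ≤_) (sym (proj₂ (Gdef v hv))) (+≤+ (ℕ.s≤s ℕ.z≤n)))
    w : Fin n
    w = proj₁ w-ex
    wU : U w ≡ true
    wU = proj₁ (proj₂ w-ex)
    vw : adj v w ≡ true
    vw = proj₂ (proj₂ w-ex)
    wG : G w ≡ false
    wG with G w in eq
    ... | false = refl
    ... | true = ⊥-elim (false≢true (indep v w hv eq) vw)
    -- The three neighbours of `v` hold one unit each; a fourth unit gives the contradiction. It
    -- lies at a neighbour of `w` outside `G`, which is not adjacent to `v` because there is no
    -- triangle, or `w` itself holds two units since its capacity is at most 3.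
    Extra : Fin n → Set
    Extra x = U x ≡ true × G x ≡ false × ι (adj v x) + 1ℤ ≤ f x
    extra : ∃ Extra
    extra with Finₚ.any? (λ u → (U u 𝔹.≟ true) ×-dec ((G u 𝔹.≟ false) ×-dec (adj w u 𝔹.≟ true)))
    ... | yes (x , xU , xG , a) = x , xU , xG , subst (λ b → ι b + 1ℤ ≤ f x) (sym not-adj) (f≥1 x xU xG)
      where
      not-adj : adj v x ≡ false
      not-adj with adj v x in eq
      ... | false = refl
      ... | true = ⊥-elim (tri v w x vw a eq)
    ... | no ¬nb with + 4 ≤? κ w
    ...   | yes h = ⊥-elim (¬nb (noS w wU wG h))
    ...   | no h = w , wU , wG , subst (λ b → ι b + 1ℤ ≤ f w) (sym vw) (f≥-small w wU wG (small h))
    x : Fin n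
    x = proj₁ extra
    l : Fin n → ℤ
    l u = ι (U u ∧ adj v u) + on ⌊ u Fin.≟ x ⌋ 1ℤ
    Σl : sum l ≡ + 4
    Σl = trans (∑-distrib-+ _ _) (cong₂ _+_ (proj₂ (Gdef v hv)) (sum-point x (λ _ → 1ℤ)))
    ar₀ : ∀ a b → a - b ≡ a + (0ℤ - b)
    ar₀ = solve-∀
    l≤ch : ∀ u → l u ≤ ch u
    l≤ch u with G u in eG
    l≤ch u | true rewrite G⊂ u eG | indep v u hv eG | deg-zero {G} {u} (λ z hz → indep u z eG hz)
                        | proj₁ (Gdef u eG) | proj₂ (Gdef u eG) with u Fin.≟ x
    ... | yes refl = ⊥-elim (false≢true (proj₁ (proj₂ (proj₂ extra))) eG)
    ... | no _ = ℤₚ.≤-refl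
    l≤ch u | false with U u in eU
    ... | false with u Fin.≟ x
    ...   | yes refl = ⊥-elim (false≢true eU (proj₁ (proj₂ extra)))
    ...   | no _ = ℤₚ.≤-refl
    l≤ch u | false | true with u Fin.≟ x
    ...   | yes refl = ℤₚ.≤-trans (proj₂ (proj₂ (proj₂ extra))) (ℤₚ.≤-reflexive (ar₀ (+ 3 * (d u - κ u + 1ℤ)) (deg G u)))
    ...   | no _ = ℤₚ.≤-trans (ℤₚ.≤-reflexive (ℤₚ.+-identityʳ _)) (ℤₚ.≤-trans (ι≤1 (adj v u))
                     (ℤₚ.≤-trans (f≥1 u eU eG) (ℤₚ.≤-reflexive (ar₀ (+ 3 * (d u - κ u + 1ℤ)) (deg G u)))))
    four≤three : + 4 ≤ + 3
    four≤three = subst₂ _≤_ Σl Σch (sum-mono l≤ch)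
    impossible : ¬ (+ 4 ≤ + 3)
    impossible (+≤+ (ℕ.s≤s (ℕ.s≤s (ℕ.s≤s ()))))

  Nonempty : VSet n → Set
  Nonempty X = ∃ λ u → X u ≡ true

  _⊂ᵇ_ : VSet n → VSet n → Set
  X ⊂ᵇ U = ∀ u → X u ≡ true → U u ≡ true

  Good : (Fin n → ℤ) → VSet n → Set
  Good κ U = ∀ X → Nonempty X → X ⊂ᵇ U → -1ℤ ≤ ρ κ X

  record Low (b : ℤ) (κ : Fin n → ℤ) (U X : VSet n) : Set where
    constructor low
    field
      ne     : Nonempty X
      sub    : X ⊂ᵇ U
      proper : ∃ λ u → U u ≡ true × X u ≡ false
      ρ≤     : ρ κ X ≤ b

  Low? : ∀ b κ U → Dec (∃ (Low b κ U))
  Low? b κ U = anyVSet? dec resp′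
    where
    sub? : ∀ (X : VSet n) u → Dec (X u ≡ true → U u ≡ true)
    sub? X u with U u
    ... | true = yes (λ _ → refl)
    ... | false with X u
    ...   | true = no (λ h → false≢true refl (h refl))
    ...   | false = yes (λ h → h)
    dec : ∀ X → Dec (Low b κ U X)
    dec X with Finₚ.any? (λ u → X u 𝔹.≟ true) | Finₚ.all? (sub? X)
             | Finₚ.any? (λ u → (U u 𝔹.≟ true) ×-dec (X u 𝔹.≟ false)) | ρ κ X ≤? b
    ... | yes a | yes b | yes c | yes d = yes (low a b c d)
    ... | no a | _ | _ | _ = no (a ∘ Low.ne)
    ... | yes _ | no a | _ | _ = no (a ∘ Low.sub)
    ... | yes _ | yes _ | no a | _ = no (a ∘ Low.proper)
    ... | yes _ | yes _ | yes _ | no a = no (a ∘ Low.ρ≤)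
    resp′ : ∀ {X Y} → (∀ u → X u ≡ Y u) → Low b κ U X → Low b κ U Y
    resp′ h (low (u , hu) s (z , hz , hz′) r) =
      low (u , trans (sym (h u)) hu) (λ u hu → s u (trans (h u) hu)) (z , hz , trans (sym (h z)) hz′)
          (subst (_≤ b) (ρ-cong {κ} {κ} (λ _ → refl) h) r)

  touch : ∀ κ v (Y : VSet n) → ρ (λ u → κ u - deg ⟦ v ⟧ u) Y ≡ ρ κ Y - deg Y v
  touch κ v Y = trans (ρ-sub κ (deg ⟦ v ⟧) Y) (cong (λ x → ρ κ Y - x)
    (trans (edges-sym Y ⟦ v ⟧) (edges-single v Y)))

  deg-∖self : ∀ {U v} → U v ≡ true → deg U v ≡ deg (U ∖ ⟦ v ⟧) v
  deg-∖self {U} {v} hv = trans (deg-split (split-∖ {U = U} {⟦ v ⟧} (λ u h → subst (λ x → U x ≡ true) (sym (≟-true h)) hv)) v)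
    (trans (cong (_+ deg (U ∖ ⟦ v ⟧) v) (trans (deg-single v v) (cong ι (irr v)))) (ℤₚ.+-identityˡ _))

  point⊂ : ∀ {U : VSet n} {v} → U v ≡ true → ⟦ v ⟧ ⊂ᵇ U
  point⊂ {U} hv u h = subst (λ x → U x ≡ true) (sym (≟-true h)) hv

  disjoint-point : ∀ {Y : VSet n} {v} → Y v ≡ false → ∀ u → ⟦ v ⟧ u ≡ true → Y u ≡ false
  disjoint-point {Y} hv u h = subst (λ x → Y x ≡ false) (sym (≟-true h)) hv

  -- The charge lowers ρ(Y) by the number e of neighbours of `v` in `Y`. For e ≤ 2 the bound ρ(Y) ≥
  -- 1 is enough. For e ≥ 3 the set Y + v is examined instead: its potential is ρ(Y) + κ(v) - 1 -
  -- 2e, so a lower bound on it gives more than is lost as κ(v) ≤ 5. If Y + v is all of `U`, the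
  -- last hypothesis is used.
  Good-touch : ∀ {κ U v} → (∀ X → Nonempty X → X ⊂ᵇ U → (∃ λ u → U u ≡ true × X u ≡ false) → 1ℤ ≤ ρ κ X) →
    U v ≡ true → κ v ≤ + 5 →
    (deg U v ≤ + 2) ⊎ (-1ℤ ≤ ρ κ U - κ v + 1ℤ + deg U v) →
    Good (λ u → κ u - deg ⟦ v ⟧ u) (U ∖ ⟦ v ⟧)
  Good-touch {κ} {U} {v} pr hv κ≤5 tot Y ne sub = subst (-1ℤ ≤_) (sym (touch κ v Y)) main
    where
    vY : Y v ≡ false
    vY with Y v in eq
    ... | false = refl
    ... | true = ⊥-elim (false≢true (proj₂ (∖-true {U = U} {⟦ v ⟧} {v} (sub v eq))) (≟-refl v))
    Y⊂U : Y ⊂ᵇ U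
    Y⊂U u hu = proj₁ (∖-true {U = U} {⟦ v ⟧} {u} (sub u hu))
    ρY : 1ℤ ≤ ρ κ Y
    ρY = pr Y ne Y⊂U (v , hv , vY)
    e : ℤ
    e = deg Y v
    small : e ≤ + 2 → -1ℤ ≤ ρ κ Y - e
    small h = lin₂ 0 ρY h (ar (ρ κ Y) e)
      where
      ar : ∀ r e → r - e - -1ℤ ≡ (r - 1ℤ) + (+ 2 - e) + + 0
      ar = solve-∀
    Z : VSet n
    Z = ⟦ v ⟧ ∪ Y
    spZ : Split Z ⟦ v ⟧ Y
    spZ = split-∪ (disjoint-point {Y} vY)
    ρZ : ρ κ Z ≡ ρ κ Y + (κ v - 1ℤ) - (e + e)
    ρZ = ρ-insert irr κ spZ
    Z⊂U : Z ⊂ᵇ U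
    Z⊂U u h with Split-U (spZ u) h
    ... | inj₁ x = point⊂ {U} hv u x
    ... | inj₂ y = Y⊂U u y
    full : ¬ (∃ λ u → U u ≡ true × Z u ≡ false) → + 3 ≤ e →
           (deg U v ≤ + 2) ⊎ (-1ℤ ≤ ρ κ U - κ v + 1ℤ + deg U v) → -1ℤ ≤ ρ κ Y - e
    full ¬p he cases = go cases
      where
      Z≗U : ∀ u → U u ≡ Z u
      Z≗U u with U u in eq | Z u in eq′
      ... | true | true = refl
      ... | true | false = ⊥-elim (¬p (u , eq , eq′))
      ... | false | false = refl
      ... | false | true = ⊥-elim (false≢true eq (Z⊂U u eq′))
      dU : deg U v ≡ e
      dU = trans (deg-cong Z≗U v) (trans (deg-split spZ v)
        (trans (cong (_+ e) (trans (deg-single v v) (cong ι (irr v)))) (ℤₚ.+-identityˡ e)))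
      contra : ¬ (+ 3 ≤ + 2)
      contra (+≤+ (ℕ.s≤s (ℕ.s≤s ())))
      ar : ∀ r k e → r + (k - 1ℤ) - (e + e) - k + 1ℤ + e ≡ r - e
      ar = solve-∀
      go : (deg U v ≤ + 2) ⊎ (-1ℤ ≤ ρ κ U - κ v + 1ℤ + deg U v) → -1ℤ ≤ ρ κ Y - e
      go (inj₁ d≤2) = ⊥-elim (contra (ℤₚ.≤-trans he (subst (_≤ + 2) dU d≤2)))
      go (inj₂ h) = ℤₚ.≤-trans h (ℤₚ.≤-reflexive (trans (cong₂ (λ r d → r - κ v + 1ℤ + d)
                       (trans (ρ-cong {κ} {κ} (λ _ → refl) Z≗U) ρZ) dU) (ar (ρ κ Y) (κ v) e)))
    big : + 3 ≤ e → -1ℤ ≤ ρ κ Y - e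
    big he with Finₚ.any? (λ u → (U u 𝔹.≟ true) ×-dec (Z u 𝔹.≟ false))
    ... | yes p = lin₃ 1 (subst (1ℤ ≤_) ρZ (pr Z (v , proj₁ (Split-inX (spZ v) (≟-refl v))) Z⊂U p)) he κ≤5 (ar (ρ κ Y) (κ v) e)
      where
      ar : ∀ r k e → r - e - -1ℤ ≡ (r + (k - 1ℤ) - (e + e) - 1ℤ) + (e - + 3) + (+ 5 - k) + + 1
      ar = solve-∀
    ... | no ¬p = full ¬p he tot
    main : -1ℤ ≤ ρ κ Y - e
    main with e ≤? + 2
    ... | yes h = small h
    ... | no h = big (≰⇒≤ h)

  -- `β` marks the vertices which still own the surplus unit of the first step, initially those with
  -- large lists. Only they may have capacity 5, so a vertex of capacity 5 can always afford a
  -- resting neighbour.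
  Inv : (Fin n → ℤ) → (Fin n → Bool) → VSet n → Set
  Inv κ β U = ∀ v → U v ≡ true → κ v ≤ + 4 + ι (β v)

  CorePlan : VSet n → (Fin n → ℤ) → (Fin n → Bool) → Set
  CorePlan U κ β = Plan U (λ v → κ v + ι (β v)) (λ v → capS (κ v) (ι (β v))) κ

  0≤2* : ∀ {x} → 0ℤ ≤ x → 0ℤ ≤ x + x
  0≤2* h = ℤₚ.+-mono-≤ h h

  -- A sparse set X is coloured first; the remaining vertices lose two per neighbour in X.
  module First {κ β U X} (inv : Inv κ β U) (X⊂U : X ⊂ᵇ U) where
    R : VSet n
    R = U ∖ X
    κR : Fin n → ℤ
    κR v = κ v - (deg X v + deg X v)

    κR≤ : ∀ v → κR v ≤ κ v
    κR≤ v = lin₁ 0 (0≤2* (0≤deg X v)) (ar (κ v) (deg X v + deg X v))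
      where
      ar : ∀ k d → k - (k - d) ≡ (d - 0ℤ) + + 0
      ar = solve-∀

    invR : Inv κR β R
    invR v h = ℤₚ.≤-trans (κR≤ v) (inv v (proj₁ (∖-true {U = U} {X} {v} h)))

    -- In the reduced capacities ρ(Y) equals ρ(X ∪ Y) - ρ(X), so a set of potential at most b raises
    -- a lower bound b - 1 to -1. The values used are b = 0 in `core` and b = -1 in `exceptional`.
    goodR : ∀ b → ρ κ X ≤ b → (∀ Y → Nonempty Y → Y ⊂ᵇ U → b - 1ℤ ≤ ρ κ Y) → Good κR R
    goodR b h hY Y ne sub = subst (-1ℤ ≤_) (sym (ρ-rest κ spZ))
      (lin₂ 0 (hY (X ∪ Y) (proj₁ ne , proj₁ (Split-inR (spZ _) (proj₂ ne))) Z⊂U) h (ar (ρ κ (X ∪ Y)) (ρ κ X) b))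
      where
      spZ : Split (X ∪ Y) X Y
      spZ = split-∪ dis
        where
        dis : ∀ u → X u ≡ true → Y u ≡ false
        dis u hu with Y u in eq
        ... | false = refl
        ... | true = ⊥-elim (false≢true (proj₂ (∖-true {U = U} {X} {u} (sub u eq))) hu)
      Z⊂U : (X ∪ Y) ⊂ᵇ U
      Z⊂U u hu with Split-U (spZ u) hu
      ... | inj₁ x = X⊂U u x
      ... | inj₂ y = proj₁ (∖-true {U = U} {X} {u} (sub u y))
      ar : ∀ z x b → z - x - -1ℤ ≡ (z - (b - 1ℤ)) + (b - x) + + 0
      ar = solve-∀

    module _ (PR : CorePlan R κR β) where
      -- A vertex of `R` with a neighbour in `X` has lost two units, so its capacity is at most 3
      -- and `capS` forbids it to rest.
      sep : ∀ v u → X v ≡ true → Plan.S PR u ≡ true → adj v u ≡ false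
      sep v u hv hu with adj v u in eq
      ... | false = refl
      ... | true = ⊥-elim (contra (lin₃ 0 (capS-pos _ _ (S-cap PR u hu)) inv′ two (ar (κ u) (deg X u))))
        where
        contra : ¬ (1ℤ ≤ 0ℤ)
        contra (+≤+ ())
        inv′ : κ u ≤ + 5
        inv′ with U u in eqU
        ... | true = ℤₚ.≤-trans (inv u eqU) (ℤₚ.+-monoʳ-≤ (+ 4) (ι≤1 (β u)))
        ... | false = ⊥-elim (bad (Plan.S⊂ PR u hu))
          where
          bad : R u ≡ true → ⊥
          bad h = false≢true eqU (proj₁ (∖-true {U = U} {X} {u} h))
        two : + 2 ≤ deg X u + deg X u
        two = ℤₚ.+-mono-≤ one one
          where
          one : 1ℤ ≤ deg X u
          one = deg-nbr {X} {u} {v} hv (trans (adj-sym u v) eq)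
        ar : ∀ k d → 0ℤ - 1ℤ ≡ (k - (d + d) - + 4) + (+ 5 - k) + (d + d - + 2) + + 0
        ar = solve-∀

      capS-rest : ∀ v → Plan.S PR v ≡ true → capS (κR v) (ι (β v)) + + 2 * deg X v ≤ capS (κ v) (ι (β v))
      capS-rest v h = ℤₚ.≤-reflexive (trans (cong (_+ + 2 * deg X v) (capS-val _ (ι (β v)) four))
        (trans (ar (κ v) (ι (β v)) (deg X v)) (sym (capS-val _ (ι (β v)) (ℤₚ.≤-trans four (κR≤ v))))))
        where
        four : + 4 ≤ κR v
        four = capS-pos _ _ (S-cap PR v h)
        ar : ∀ k b d → k - (d + d) + b - 1ℤ + + 2 * d ≡ k + b - 1ℤ
        ar = solve-∀

      extend : ∀ {c₁ cS c₂} → Plan X c₁ cS c₂ →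
        (∀ v → R v ≡ true → κ v + ι (β v) ≤ c₁ v) → (∀ v → Plan.S PR v ≡ true → capS (κ v) (ι (β v)) ≤ cS v) →
        (∀ v → R v ≡ true → κ v ≤ c₂ v) → Plan U c₁ cS c₂
      extend {c₁} {cS} {c₂} PX h₁ hS h₂ = combine-late (split-∖ X⊂U) PX PR
        (λ _ _ → ℤₚ.≤-refl) (λ _ _ → ℤₚ.≤-refl) (λ _ _ → ℤₚ.≤-refl)
        (λ v u hv _ hu → sep v u hv hu)
        (λ v hR → ℤₚ.≤-trans (ℤₚ.≤-reflexive (ar₁ (κ v) (deg X v) (ι (β v)))) (h₁ v hR))
        (λ v h _ → ℤₚ.≤-trans (capS-rest v h) (hS v h))
        (λ v hR → ℤₚ.≤-trans (r₂ v) (h₂ v hR))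
        where
        module PX = Plan PX
        ar₁ : ∀ k d b → k - (d + d) + b + + 2 * d ≡ k + b
        ar₁ = solve-∀
        ar₂ : ∀ k d s x → k - ((s + d) - 0ℤ + (s + d)) + (+ 2 * d + s) ≡ k - s
        ar₂ k d s x = ar₂′ k d s
          where
          ar₂′ : ∀ k d s → k - ((s + d) - 0ℤ + (s + d)) + (+ 2 * d + s) ≡ k - s
          ar₂′ = solve-∀
        ar₃ : ∀ d → d + d ≡ d - 0ℤ + d
        ar₃ = solve-∀
        ar₄ : ∀ k s → k - (k - s) ≡ (s - 0ℤ) + + 0
        ar₄ = solve-∀
        r₂ : ∀ v → κR v + (+ 2 * deg (X ∖ PX.S) v + deg PX.S v) ≤ κ v
        r₂ v = ℤₚ.≤-trans (ℤₚ.≤-reflexive (trans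
          (cong (λ e → κ v - e + (+ 2 * deg (X ∖ PX.S) v + deg PX.S v))
            (trans (cong (λ e → e + e) (deg-split (split-∖ PX.S⊂) v)) (ar₃ (deg PX.S v + deg (X ∖ PX.S) v))))
          (ar₂ (κ v) (deg (X ∖ PX.S) v) (deg PX.S v) 0ℤ)))
          (lin₁ 0 (0≤deg PX.S v) (ar₄ (κ v) (deg PX.S v)))

  -- v pays one unit per neighbour and so do its neighbours.
  mixed : ∀ {κ β U v} → U v ≡ true → deg U v ≤ κ v → 
          CorePlan (U ∖ ⟦ v ⟧) (λ u → κ u - deg ⟦ v ⟧ u) β → CorePlan U κ β
  mixed {κ} {β} {U} {v} hv hd PR = combine-early (split-∖ (point⊂ {U} hv))
      (single-plan irr v {λ _ → 0ℤ} {λ _ → -1ℤ} {λ _ → 0ℤ} ℤₚ.≤-refl ℤₚ.≤-refl) PR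
      (λ u hu → ℤₚ.≤-trans (pay u hu) (lin₁ 0 (0≤ι (β u)) (ar₁ (κ u) (ι (β u)))))
      (λ u ())
      pay
      (λ u _ → ℤₚ.≤-reflexive (ar₂ (κ u) (deg ⟦ v ⟧ u) (ι (β u))))
      (λ u _ h → ℤₚ.≤-reflexive (trans (cong (_+ deg ⟦ v ⟧ u) (capS-val _ (ι (β u)) (capS-pos _ _ h)))
         (trans (ar₃ (κ u) (deg ⟦ v ⟧ u) (ι (β u)))
           (sym (capS-val _ (ι (β u)) (lin₂ 0 (capS-pos _ _ h) (0≤deg ⟦ v ⟧ u) (ar₄ (κ u) (deg ⟦ v ⟧ u))))))))
      (λ u _ → ℤₚ.≤-reflexive (ar₅ (κ u) (deg ⟦ v ⟧ u)))
    where
    ar₁ : ∀ k b → k + b - k ≡ (b - 0ℤ) + + 0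
    ar₁ = solve-∀
    ar₂ : ∀ k d b → k - d + b + d ≡ k + b
    ar₂ = solve-∀
    ar₃ : ∀ k d b → k - d + b - 1ℤ + d ≡ k + b - 1ℤ
    ar₃ = solve-∀
    ar₄ : ∀ k d → k - + 4 ≡ (k - d - + 4) + (d - 0ℤ) + + 0
    ar₄ = solve-∀
    ar₅ : ∀ k d → k - d + d ≡ k
    ar₅ = solve-∀
    pay : ∀ u → ⟦ v ⟧ u ≡ true → 0ℤ + deg (U ∖ ⟦ v ⟧) u ≤ κ u
    pay u hu with ≟-true {u = u} hu
    ... | refl = ℤₚ.≤-trans (ℤₚ.≤-reflexive (trans (ℤₚ.+-identityˡ _) (sym (deg-∖self {U} hv)))) hd

  clear : Fin n → (Fin n → Bool) → Fin n → Bool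
  clear w β u = β u ∧ not (adj w u)

  -- w keeps its colour in the second step; all its neighbours can afford this.
  static : ∀ {κ β U w} → U w ≡ true → + 4 ≤ κ w → (∀ u → U u ≡ true → adj w u ≡ true → β u ≡ true) →
           CorePlan (U ∖ ⟦ w ⟧) (λ u → κ u - deg ⟦ w ⟧ u) (clear w β) → CorePlan U κ β
  static {κ} {β} {U} {w} hw h4 hβ PR = combine-late (split-∖ (point⊂ {U} hw))
      (single-S-plan irr w {λ v → κ v + ι (β v)} {λ v → capS (κ v) (ι (β v))} {κ} cap≥0) PR
      (λ _ _ → ℤₚ.≤-refl) (λ _ _ → ℤₚ.≤-refl) (λ _ _ → ℤₚ.≤-refl)
      (λ v u hv hf _ → ⊥-elim (false≢true hf hv))
      (λ u hu → lin₁ 0 (spare u hu) (ar₁ (κ u) (deg ⟦ w ⟧ u) (ι (β u)) (ι (clear w β u))))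
      rS
      (λ u _ → ℤₚ.≤-reflexive (trans (cong (λ d → κ u - deg ⟦ w ⟧ u + (+ 2 * d + deg ⟦ w ⟧ u)) (zero-diff u))
         (ar₂ (κ u) (deg ⟦ w ⟧ u))))
    where
    cap≥0 : 0ℤ ≤ capS (κ w) (ι (β w))
    cap≥0 = subst (0ℤ ≤_) (sym (capS-val _ (ι (β w)) h4)) (lin₂ 3 h4 (0≤ι (β w)) (ar (κ w) (ι (β w))))
      where
      ar : ∀ k b → k + b - 1ℤ - 0ℤ ≡ (k - + 4) + (b - 0ℤ) + + 3
      ar = solve-∀
    zero-diff : ∀ u → deg (⟦ w ⟧ ∖ ⟦ w ⟧) u ≡ 0ℤ
    zero-diff u = deg-zero {⟦ w ⟧ ∖ ⟦ w ⟧} {u} bad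
      where
      bad : ∀ z → (⟦ w ⟧ ∖ ⟦ w ⟧) z ≡ true → adj u z ≡ false
      bad z hz with ∖-true {U = ⟦ w ⟧} {⟦ w ⟧} {z} hz
      ... | a , b = ⊥-elim (false≢true b a)
    -- In the first step a neighbour of `w` pays two units: one out of its capacity and one by
    -- giving up `β`. In the second step the resting `w` costs it only one.
    spare : ∀ u → (U ∖ ⟦ w ⟧) u ≡ true → ι (clear w β u) + deg ⟦ w ⟧ u ≤ ι (β u)
    spare u hu rewrite deg-single w u | adj-sym u w with adj w u in eq
    ... | true rewrite hβ u (proj₁ (∖-true {U = U} {⟦ w ⟧} {u} hu)) eq = ℤₚ.≤-refl
    ... | false with β u
    ...   | true = ℤₚ.≤-refl
    ...   | false = ℤₚ.≤-refl
    ar₁ : ∀ k d b c → k + b - (k - d + c + + 2 * d) ≡ (b - (c + d)) + + 0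
    ar₁ = solve-∀
    ar₂ : ∀ k d → k - d + (+ 2 * 0ℤ + d) ≡ k
    ar₂ = solve-∀
    rS : ∀ u → Plan.S PR u ≡ true → 0ℤ ≤ capS (κ u - deg ⟦ w ⟧ u) (ι (clear w β u)) →
         capS (κ u - deg ⟦ w ⟧ u) (ι (clear w β u)) + + 2 * deg ⟦ w ⟧ u ≤ capS (κ u) (ι (β u))
    rS u hu h = subst₂ _≤_
        (cong (_+ + 2 * deg ⟦ w ⟧ u) (sym (capS-val _ (ι (clear w β u)) (capS-pos _ _ h))))
        (sym (capS-val _ (ι (β u)) (lin₂ 0 (capS-pos _ _ h) (0≤deg ⟦ w ⟧ u) (ar₄ (κ u) (deg ⟦ w ⟧ u)))))
        (lin₁ 0 (spare u (Plan.S⊂ PR u hu)) (ar₃ (κ u) (deg ⟦ w ⟧ u) (ι (β u)) (ι (clear w β u))))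
      where
      ar₃ : ∀ k d b c → k + b - 1ℤ - (k - d + c - 1ℤ + + 2 * d) ≡ (b - (c + d)) + + 0
      ar₃ = solve-∀
      ar₄ : ∀ k d → k - + 4 ≡ (k - d - + 4) + (d - 0ℤ) + + 0
      ar₄ = solve-∀

  size-∖ : ∀ {U X : VSet n} {m} → Nonempty X → X ⊂ᵇ U → countB U ℕ.≤ suc m → countB (U ∖ X) ℕ.≤ m
  size-∖ {U} {X} (z , hz) sub h = ℕₚ.≤-pred (ℕₚ.≤-trans
    (countB-strict {X = U ∖ X} {U} (λ u h → proj₁ (∖-true {U = U} {X} {u} h)) z (sub z hz) zf) h)
    where
    zf : (U ∖ X) z ≡ false
    zf rewrite hz = 𝔹ₚ.∧-zeroʳ (U z)

  Inv≤5 : ∀ {κ β U} → Inv κ β U → ∀ v → U v ≡ true → κ v ≤ + 5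
  Inv≤5 {κ} {β} inv v hv = ℤₚ.≤-trans (inv v hv) (ℤₚ.+-monoʳ-≤ (+ 4) (ι≤1 (β v)))

  -- Two adjacent vertices of capacity 5 and degree 3 are coloured last and recoloured first.
  pair-last : ∀ {κ β U v w} → U v ≡ true → U w ≡ true → adj v w ≡ true →
    κ v ≡ + 5 → deg U v ≡ + 3 → κ w ≡ + 5 → deg U w ≡ + 3 →
    CorePlan (U ∖ (⟦ v ⟧ ∪ ⟦ w ⟧)) κ β → CorePlan U κ β
  pair-last {κ} {β} {U} {v} {w} hv hw a κv dv κw dw PX = combine-late (split-sym (split-∖ P⊂U)) PX PP
      (λ _ _ → ℤₚ.≤-refl) (λ _ _ → ℤₚ.≤-refl) (λ _ _ → ℤₚ.≤-refl)
      (λ _ u _ _ hu → ⊥-elim (noS u hu))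
      (λ u hu → ℤₚ.≤-trans (ℤₚ.≤-reflexive (cong (λ d → 1ℤ + + 2 * d) (proj₂ (both u hu))))
          (ℤₚ.≤-trans (ℤₚ.≤-reflexive (sym (proj₁ (both u hu)))) (lin₁ 0 (0≤ι (β u)) (ar₁ (κ u) (ι (β u))))))
      (λ u hu → ⊥-elim (noS u hu))
      (λ u hu → lin₁ 0 (0≤deg PX.S u) (ar₂′ u hu))
    where
    module PX = Plan PX
    P R : VSet n
    P = ⟦ v ⟧ ∪ ⟦ w ⟧
    R = U ∖ P
    v≢w : v ≢ w
    v≢w refl = false≢true (irr v) a
    wv : ⟦ v ⟧ w ≡ false
    wv with w Fin.≟ v
    ... | yes e = ⊥-elim (v≢w (sym e))
    ... | no _ = refl
    spP : Split P ⟦ v ⟧ ⟦ w ⟧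
    spP = split-sym {U = P} {⟦ w ⟧} {⟦ v ⟧} λ u → comm u (split-∪ (disjoint-point {⟦ v ⟧} wv) u)
      where
      comm : ∀ u → Sp ((⟦ w ⟧ ∪ ⟦ v ⟧) u) (⟦ w ⟧ u) (⟦ v ⟧ u) → Sp (P u) (⟦ w ⟧ u) (⟦ v ⟧ u)
      comm u = subst (λ b → Sp b (⟦ w ⟧ u) (⟦ v ⟧ u)) (𝔹ₚ.∨-comm (⟦ w ⟧ u) (⟦ v ⟧ u))
    P⊂U : P ⊂ᵇ U
    P⊂U u h with Split-U (spP u) h
    ... | inj₁ x = point⊂ {U} hv u x
    ... | inj₂ y = point⊂ {U} hw u y
    -- Inside the pair each vertex pays one unit; its two neighbours outside, at two units each, use
    -- up the other four of its capacity 5.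
    PP : Plan P (λ _ → 1ℤ) (λ _ → -1ℤ) (λ _ → 1ℤ)
    PP = combine-early spP
      (single-plan irr v {λ _ → 0ℤ} {λ _ → -1ℤ} {λ _ → 0ℤ} ℤₚ.≤-refl ℤₚ.≤-refl)
      (single-plan irr w {λ _ → 0ℤ} {λ _ → -1ℤ} {λ _ → 0ℤ} ℤₚ.≤-refl ℤₚ.≤-refl)
      (λ u _ → one w u) (λ _ ()) (λ u _ → one w u) (λ u _ → one v u) (λ _ ()) (λ u _ → one v u)
      where
      one : ∀ x u → 0ℤ + deg ⟦ x ⟧ u ≤ 1ℤ
      one x u = ℤₚ.≤-trans (ℤₚ.≤-reflexive (trans (ℤₚ.+-identityˡ _) (deg-single x u))) (ι≤1 (adj u x))
    noS : ∀ u → Plan.S PP u ≡ true → ⊥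
    noS u h with S-cap PP u h
    ... | ()
    out-deg : ∀ u → deg U u ≡ + 3 → deg P u ≡ 1ℤ → deg R u ≡ + 2
    out-deg u d d′ = trans (ar (deg R u)) (cong (_- 1ℤ)
        (trans (cong (_+ deg R u) (sym d′)) (trans (sym (deg-split (split-∖ P⊂U) u)) d)))
      where
      ar : ∀ x → x ≡ 1ℤ + x - 1ℤ
      ar = solve-∀
    both : ∀ u → P u ≡ true → κ u ≡ + 5 × deg R u ≡ + 2
    both u h with Split-U (spP u) h
    ... | inj₁ x with ≟-true {u = u} x
    ...   | refl = κv , out-deg v dv (trans (deg-split spP v) (cong₂ _+_ (trans (deg-single v v) (cong ι (irr v)))
                     (trans (deg-single w v) (cong ι a))))
    both u h | inj₂ y with ≟-true {u = u} y
    ...   | refl = κw , out-deg w dw (trans (deg-split spP w) (cong₂ _+_ (trans (deg-single v w) (cong ι (trans (adj-sym w v) a)))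
                     (trans (deg-single w w) (cong ι (irr w)))))
    ar₁ : ∀ k b → k + b - k ≡ (b - 0ℤ) + + 0
    ar₁ = solve-∀
    ar₂′ : ∀ u → P u ≡ true → κ u - (1ℤ + (+ 2 * deg (R ∖ PX.S) u + deg PX.S u)) ≡ (deg PX.S u - 0ℤ) + + 0
    ar₂′ u hu = trans (cong (_- (1ℤ + (+ 2 * deg (R ∖ PX.S) u + deg PX.S u))) κ≡) (ar₃ (deg (R ∖ PX.S) u) (deg PX.S u))
      where
      ar₃ : ∀ x s → 1ℤ + + 2 * (s + x) - (1ℤ + (+ 2 * x + s)) ≡ (s - 0ℤ) + + 0
      ar₃ = solve-∀
      κ≡ : κ u ≡ 1ℤ + + 2 * (deg PX.S u + deg (R ∖ PX.S) u)
      κ≡ = trans (proj₁ (both u hu)) (cong (λ d → 1ℤ + + 2 * d)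
        (trans (sym (proj₂ (both u hu))) (deg-split (split-∖ PX.S⊂) u)))

  -- If no proper nonempty subset has potential at most 0, then by integrality all of them have
  -- potential at least 1; this gap of two above -1 is what the removal of a vertex may consume.
  core : ∀ m κ β U → countB U ℕ.≤ m → Inv κ β U → Good κ U → CorePlan U κ β
  core m κ β U size inv good with all-or-some U
  ... | inj₂ none = empty-plan none
  core zero κ β U size inv good | inj₁ (z , hz) =
    ⊥-elim (ℕₚ.<⇒≱ (countB-strict {X = λ _ → false} {U} (λ _ ()) z hz refl) (ℕₚ.≤-trans size ℕ.z≤n))
  core (suc m) κ β U size inv good | inj₁ neU with Low? 0ℤ κ U
  ... | yes (X , low ne sub (z , hz , hzX) ρ≤) = F.extend PR PX
          (λ _ _ → ℤₚ.≤-refl) (λ _ _ → ℤₚ.≤-refl) (λ _ _ → ℤₚ.≤-refl)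
    where
    module F = First {κ} {β} {U} {X} inv sub
    PX : CorePlan X κ β
    PX = core m κ β X (ℕₚ.≤-pred (ℕₚ.≤-trans (countB-strict {X = X} {U} sub z hz hzX) size))
           (λ v h → inv v (sub v h)) (λ Y neY subY → good Y neY (λ u h → sub u (subY u h)))
    PR : CorePlan F.R F.κR β
    PR = core m F.κR β F.R (size-∖ {U} {X} ne sub size) F.invR (F.goodR 0ℤ ρ≤ good)
  ... | no ¬low = moves
    where
    pr : ∀ X → Nonempty X → X ⊂ᵇ U → (∃ λ u → U u ≡ true × X u ≡ false) → 1ℤ ≤ ρ κ X
    pr X ne sub p = ≰⇒≤ (λ h → ¬low (X , low ne sub p h))
    κ≤5 : ∀ v → U v ≡ true → κ v ≤ + 5
    κ≤5 = Inv≤5 {κ} {β} {U} inv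
    r : ℤ
    r = ρ κ U
    r≥ : -1ℤ ≤ r
    r≥ = good U neU (λ _ h → h)
    -- The right-hand side is the potential of `U` without `v` after the neighbours of `v` have paid
    -- one unit each.
    Tot : Fin n → Set
    Tot v = -1ℤ ≤ r - κ v + 1ℤ + deg U v
    κ-touch : ∀ w u → κ u - deg ⟦ w ⟧ u ≤ κ u
    κ-touch w u = lin₁ 0 (0≤deg ⟦ w ⟧ u) (ar (κ u) (deg ⟦ w ⟧ u))
      where
      ar : ∀ k d → k - (k - d) ≡ (d - 0ℤ) + + 0
      ar = solve-∀
    remove : ∀ v β′ → U v ≡ true → (deg U v ≤ + 2) ⊎ Tot v →
             Inv (λ u → κ u - deg ⟦ v ⟧ u) β′ (U ∖ ⟦ v ⟧) → CorePlan (U ∖ ⟦ v ⟧) (λ u → κ u - deg ⟦ v ⟧ u) β′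
    remove v β′ hv tot inv′ = core m _ β′ (U ∖ ⟦ v ⟧) (size-∖ {U} {⟦ v ⟧} (v , ≟-refl v) (point⊂ {U} hv) size) inv′
      (Good-touch {κ} {U} {v} pr hv (κ≤5 v hv) tot)
    GG : Fin n → Set
    GG v = U v ≡ true × κ v ≡ + 5 × deg U v ≡ + 3
    GG? : ∀ v → Dec (GG v)
    GG? v = (U v 𝔹.≟ true) ×-dec ((κ v ℤₚ.≟ + 5) ×-dec (deg U v ℤₚ.≟ + 3))
    Tot? : ∀ v → Dec (Tot v)
    Tot? v = -1ℤ ≤? r - κ v + 1ℤ + deg U v
    moves : CorePlan U κ β
    moves with Finₚ.any? (λ v → (U v 𝔹.≟ true) ×-dec ((deg U v ≤? κ v) ×-dec ((deg U v ≤? + 2) ⊎-dec Tot? v)))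
    ... | yes (v , hv , hd , tot) = mixed {κ} {β} {U} {v} hv hd
          (remove v β hv tot (λ u h → ℤₚ.≤-trans (κ-touch v u) (inv u (proj₁ (∖-true {U = U} {⟦ v ⟧} {u} h)))))
    ... | no ¬mix with Finₚ.any? (λ w → (U w 𝔹.≟ true) ×-dec ((+ 4 ≤? κ w) ×-dec
                       (Tot? w ×-dec Finₚ.all? (λ u → ((U u ∧ adj w u) ∧ not (β u)) 𝔹.≟ false))))
    ...   | yes (w , hw , h4 , tot , hβ) = static {κ} {β} {U} {w} hw h4 hβ′ (remove w (clear w β) hw (inj₂ tot) inv′)
      where
      hβ′ : ∀ u → U u ≡ true → adj w u ≡ true → β u ≡ true
      hβ′ u hu a with hβ u
      ... | e rewrite hu | a = 𝔹ₚ.not-injective e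
      inv′ : Inv (λ u → κ u - deg ⟦ w ⟧ u) (clear w β) (U ∖ ⟦ w ⟧)
      inv′ u h rewrite deg-single w u | adj-sym u w with adj w u in eq
      ... | true = lin₁ 0 (κ≤5 u uU) (trans (cong (λ b → + 4 + ι b - (κ u - 1ℤ)) (𝔹ₚ.∧-zeroʳ (β u))) (ar (κ u)))
        where
        uU : U u ≡ true
        uU = proj₁ (∖-true {U = U} {⟦ w ⟧} {u} h)
        ar : ∀ k → + 4 + 0ℤ - (k - 1ℤ) ≡ (+ 5 - k) + + 0
        ar = solve-∀
      ... | false = ℤₚ.≤-trans (ℤₚ.≤-reflexive (ℤₚ.+-identityʳ _))
            (subst (λ b → κ u ≤ + 4 + ι b) (sym (𝔹ₚ.∧-identityʳ (β u))) (inv u (proj₁ (∖-true {U = U} {⟦ w ⟧} {u} h))))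
    ...   | no ¬stat with Finₚ.any? (λ v → Finₚ.any? (λ w → (adj v w 𝔹.≟ true) ×-dec (GG? v ×-dec GG? w)))
    ...     | yes (v , w , a , (hv , κv , dv) , (hw , κw , dw)) = pair-last {κ} {β} {U} {v} {w} hv hw a κv dv κw dw
                (core m κ β (U ∖ P) (size-∖ {U} {P} (v , cong (_∨ ⟦ w ⟧ v) (≟-refl v)) P⊂U size)
                  (λ u h → inv u (sub u h)) (λ Y ne s → good Y ne (λ u h → sub u (s u h))))
      where
      P : VSet n
      P = ⟦ v ⟧ ∪ ⟦ w ⟧
      P⊂U : P ⊂ᵇ U
      P⊂U u h with ⟦ v ⟧ u in e₁ | ⟦ w ⟧ u in e₂
      ... | true | _ = point⊂ {U} hv u e₁
      ... | false | true = point⊂ {U} hw u e₂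
      sub : (U ∖ P) ⊂ᵇ U
      sub u h = proj₁ (∖-true {U = U} {P} {u} h)
    ...     | no ¬pair = ⊥-elim (stuck κ U G G⊂ Gdef Ndef κ≤5 indep noS neU r≥ ρ≤)
      where
      G : VSet n
      G v = ⌊ GG? v ⌋
      isG : ∀ v → G v ≡ true → GG v
      isG v h with GG? v
      ... | yes p = p
      G-yes : ∀ v → GG v → G v ≡ true
      G-yes v p with GG? v
      ... | yes _ = refl
      ... | no ¬p = ⊥-elim (¬p p)
      G⊂ : ∀ v → G v ≡ true → U v ≡ true
      G⊂ v h = proj₁ (isG v h)
      Gdef : ∀ v → G v ≡ true → κ v ≡ + 5 × deg U v ≡ + 3
      Gdef v h = proj₂ (isG v h)
      Ndef : ∀ v → U v ≡ true → G v ≡ false → κ v + 1ℤ ≤ deg U v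
      Ndef v hv hG with deg U v ≤? κ v
      ... | no h = ≰⇒≤ h
      ... | yes d≤κ = ⊥-elim (false≢true hG (G-yes v (hv , κ5 , d3)))
        where
        -- Since `mixed` does not apply, 3 ≤ deg ≤ κ - 2 ≤ 3, and all these inequalities are
        -- equalities.
        d≥3 : + 3 ≤ deg U v
        d≥3 = ≰⇒≤ (λ h → ¬mix (v , hv , d≤κ , inj₁ h))
        gap : deg U v ≤ κ v - + 2
        gap = lin₂ 0 (≰⇒≤ (λ h → ¬mix (v , hv , d≤κ , inj₂ h))) r≥ (ar r (κ v) (deg U v))
          where
          ar : ∀ r k d → k - + 2 - d ≡ (-1ℤ - (r - k + 1ℤ + d + 1ℤ)) + (r - -1ℤ) + + 0
          ar = solve-∀
        κ5 : κ v ≡ + 5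
        κ5 = ℤₚ.≤-antisym (κ≤5 v hv) (lin₂ 0 d≥3 gap (ar (κ v) (deg U v)))
          where
          ar : ∀ k d → k - + 5 ≡ (d - + 3) + (k - + 2 - d) + + 0
          ar = solve-∀
        d3 : deg U v ≡ + 3
        d3 = ℤₚ.≤-antisym (subst (λ k → deg U v ≤ k - + 2) κ5 gap) d≥3
      ρ≤ : ∀ v → G v ≡ true → r ≤ -1ℤ
      ρ≤ v h with isG v h
      ... | hv , κv , dv = lin₁ 0 (≰⇒≤ (λ t → ¬mix (v , hv , subst₂ _≤_ (sym dv) (sym κv) (+≤+ (ℕ.s≤s (ℕ.s≤s (ℕ.s≤s ℕ.z≤n)))) ,
               inj₂ (subst₂ (λ k d → -1ℤ ≤ r - k + 1ℤ + d) (sym κv) (sym dv) t)))) (ar r)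
        where
        ar : ∀ r → -1ℤ - r ≡ (-1ℤ - (r - + 5 + 1ℤ + + 3 + 1ℤ)) + + 0
        ar = solve-∀
      indep : ∀ u v → G u ≡ true → G v ≡ true → adj u v ≡ false
      indep u v hu hv = 𝔹ₚ.¬-not (λ a → ¬pair (u , v , a , isG u hu , isG v hv))
      noS : ∀ w → U w ≡ true → G w ≡ false → + 4 ≤ κ w → ∃ λ u → U u ≡ true × G u ≡ false × adj w u ≡ true
      noS w hw hG h4 with Finₚ.any? (λ u → (U u 𝔹.≟ true) ×-dec ((G u 𝔹.≟ false) ×-dec (adj w u 𝔹.≟ true)))
      ... | yes p = p
      ... | no ¬p = ⊥-elim (¬stat (w , hw , h4 , tot , hβ))
        where
        tot : Tot w
        tot = lin₂ 2 (Ndef w hw hG) r≥ (ar r (κ w) (deg U w))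
          where
          ar : ∀ r k d → r - k + 1ℤ + d - -1ℤ ≡ (d - (k + 1ℤ)) + (r - -1ℤ) + + 2
          ar = solve-∀
        hβ : ∀ u → (U u ∧ adj w u) ∧ not (β u) ≡ false
        hβ u with U u in eU | adj w u in ea | β u in eβ
        ... | false | _ | _ = refl
        ... | true | false | _ = refl
        ... | true | true | true = refl
        ... | true | true | false with G u in eG
        ...   | false = ⊥-elim (¬p (u , eU , eG , ea))
        -- A vertex of type `G` has capacity 5, hence `β` by the invariant; so `static` would have
        -- applied to `w`.
        ...   | true = ⊥-elim (five (subst₂ (λ k b → k ≤ + 4 + ι b) (proj₁ (Gdef u eG)) eβ (inv u eU)))
          where
          five : ¬ (+ 5 ≤ + 4)
          five (+≤+ (ℕ.s≤s (ℕ.s≤s (ℕ.s≤s (ℕ.s≤s ())))))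

-- Plans for sets whose potential may drop to -2.

module Exceptional {n : ℕ} (adj : Fin n → Fin n → Bool)
    (adj-sym : ∀ u v → adj u v ≡ adj v u)
    (irr : ∀ v → adj v v ≡ false)
    (tri : ∀ u v w → adj u v ≡ true → adj v w ≡ true → adj u w ≡ true → ⊥)
    (κ : Fin n → ℤ) (β : Fin n → Bool) (cS : Fin n → ℤ)
    (cS≥ : ∀ v → capS (κ v) (ι (β v)) ≤ cS v) where
  open Graph adj adj-sym
  open Core adj adj-sym irr tri

  -- Rest is measured by `cS` instead of `capS`, because a pivot has capacity 2 and `capS` would bar
  -- it from resting.
  Final : VSet n → Set
  Final U = Plan U (λ v → κ v + ι (β v)) cS κ

  core⇒final : ∀ {U} → CorePlan U κ β → Final U
  core⇒final P = record
    { p = P.p ; t = P.t ; bnd = P.bnd ; p< = P.p< ; t< = P.t< ; p≢ = P.p≢ ; t≢ = P.t≢ ; S = P.S ; S⊂ = P.S⊂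
    ; step₁ = P.step₁ ; stepS = λ v h → ℤₚ.≤-trans (P.stepS v h) (cS≥ v) ; step₂ = P.step₂ }
    where module P = Plan P

  _∩_ : VSet n → VSet n → VSet n
  (X ∩ Y) u = X u ∧ Y u

  -- A vertex through which a set of potential -2 can be attacked.
  record Pivot (X : VSet n) : Set where
    field
      v      : Fin n
      vX     : X v ≡ true
      κv     : κ v ≡ + 2
      cSv    : 0ℤ ≤ cS v
      choice : (deg X v ≤ + 2) ⊎ (+ 2 ≤ deg (X ∩ β) v)

  module PivotStep {U : VSet n} (inv : Inv κ β U) (P : Pivot U)
      (pr : ∀ X → Nonempty X → X ⊂ᵇ U → (∃ λ u → U u ≡ true × X u ≡ false) → 0ℤ ≤ ρ κ X)
      (ρ≥ : ∀ X → Nonempty X → X ⊂ᵇ U → - + 2 ≤ ρ κ X) where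
    open Pivot P
    R : VSet n
    R = U ∖ ⟦ v ⟧

    module _ {Y : VSet n} (neY : Nonempty Y) (sub : Y ⊂ᵇ R) where
      vY : Y v ≡ false
      vY with Y v in eq
      ... | false = refl
      ... | true = ⊥-elim (false≢true (proj₂ (∖-true {U = U} {⟦ v ⟧} {v} (sub v eq))) (≟-refl v))
      Y⊂U : Y ⊂ᵇ U
      Y⊂U u hu = proj₁ (∖-true {U = U} {⟦ v ⟧} {u} (sub u hu))
      Z : VSet n
      Z = ⟦ v ⟧ ∪ Y
      spZ : Split Z ⟦ v ⟧ Y
      spZ = split-∪ (disjoint-point {Y} vY)
      vZ : Z v ≡ true
      vZ = proj₁ (Split-inX (spZ v) (≟-refl v))
      ρZ : ρ κ Z ≡ ρ κ Y + 1ℤ - (deg Y v + deg Y v)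
      ρZ = trans (ρ-insert irr κ spZ) (cong (λ k → ρ κ Y + (k - 1ℤ) - (deg Y v + deg Y v)) κv)
      Z⊂U : Z ⊂ᵇ U
      Z⊂U u h with Split-U (spZ u) h
      ... | inj₁ x = point⊂ {U} vX u x
      ... | inj₂ y = Y⊂U u y
      ρY : 0ℤ ≤ ρ κ Y
      ρY = pr Y neY Y⊂U (v , vX , vY)

    -- For a set Y with e neighbours of the pivot, ρ(Y + v) = ρ(Y) + 1 - 2e, and ρ(Y) - e ≥ -1 is
    -- required. If e ≤ 1 this follows from ρ(Y) ≥ 0, otherwise from ρ(Y + v) ≥ -2.
    by-mixed : deg U v ≤ + 2 → Final U
    by-mixed d≤2 = core⇒final (mixed {κ} {β} {U} {v} vX (subst (deg U v ≤_) (sym κv) d≤2)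
      (core (countB R) _ β R ℕₚ.≤-refl inv′ good))
      where
      inv′ : Inv (λ u → κ u - deg ⟦ v ⟧ u) β R
      inv′ u h = ℤₚ.≤-trans (lin₁ 0 (0≤deg ⟦ v ⟧ u) (ar (κ u) (deg ⟦ v ⟧ u))) (inv u (proj₁ (∖-true {U = U} {⟦ v ⟧} {u} h)))
        where
        ar : ∀ k d → k - (k - d) ≡ (d - 0ℤ) + + 0
        ar = solve-∀
      good : Good (λ u → κ u - deg ⟦ v ⟧ u) R
      good Y ne sub = subst (-1ℤ ≤_) (sym (touch κ v Y)) main
        where
        main : -1ℤ ≤ ρ κ Y - deg Y v
        main with deg Y v ≤? 1ℤ
        ... | yes h = lin₂ 0 (ρY ne sub) h (ar (ρ κ Y) (deg Y v))
          where
          ar : ∀ r d → r - d - -1ℤ ≡ (r - 0ℤ) + (1ℤ - d) + + 0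
          ar = solve-∀
        ... | no h = lin₂ 0 (subst (- + 2 ≤_) (ρZ ne sub) (ρ≥ (Z ne sub) (v , vZ ne sub) (Z⊂U ne sub))) (≰⇒≤ h)
                (ar (ρ κ Y) (deg Y v))
          where
          ar : ∀ r d → r - d - -1ℤ ≡ (r + 1ℤ - (d + d) - - + 2) + (d - (1ℤ + 1ℤ)) + + 0
          ar = solve-∀

    -- The pivot is chosen first and rests, so it pays nothing itself. Of e neighbours in Y let b
    -- own `β`; the charge turns ρ(Y) into ρ(Y) - 2e + b = ρ(Y + v) - 1 + b. If Y + v is a proper
    -- subset, ρ(Y + v) ≥ 0 is enough; if it is all of `U`, only -3 + b is certain, and two
    -- neighbours with `β` make up for the deficit.
    by-static : + 2 ≤ deg (U ∩ β) v → Final U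
    by-static hb = combine-late (split-∖ (point⊂ {U} vX))
        (single-S-plan irr v {λ u → κ u + ι (β u)} {cS} {κ} cSv) PR
        (λ _ _ → ℤₚ.≤-refl) (λ _ _ → ℤₚ.≤-refl) (λ _ _ → ℤₚ.≤-refl)
        (λ x u hx hf _ → ⊥-elim (false≢true hf hx))
        (λ u hu → ℤₚ.≤-reflexive (r₁ u))
        rS
        (λ u _ → r₂ u)
      where
      -- Neighbours with β pay one unit and lose β, the others pay two.
      fee : Fin n → ℤ
      fee u = deg ⟦ v ⟧ u + ι (adj v u ∧ not (β u))
      κ′ : Fin n → ℤ
      κ′ u = κ u - fee u
      deg-v : ∀ u → deg ⟦ v ⟧ u ≡ ι (adj v u)
      deg-v u = trans (deg-single v u) (cong ι (adj-sym u v))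
      fee≥0 : ∀ u → 0ℤ ≤ fee u
      fee≥0 u = ℤₚ.+-mono-≤ (0≤deg ⟦ v ⟧ u) (0≤ι _)
      inv′ : Inv κ′ (clear v β) R
      inv′ u h rewrite deg-v u with adj v u | β u | inv u (proj₁ (∖-true {U = U} {⟦ v ⟧} {u} h))
      ... | false | b | q = ℤₚ.≤-trans (ℤₚ.≤-reflexive (ℤₚ.+-identityʳ _)) (subst (λ b → κ u ≤ + 4 + ι b) (sym (𝔹ₚ.∧-identityʳ b)) q)
      ... | true | true | q = lin₁ 0 q (ar (κ u))
        where
        ar : ∀ k → + 4 + 0ℤ - (k - (1ℤ + 0ℤ)) ≡ (+ 4 + 1ℤ - k) + + 0
        ar = solve-∀
      ... | true | false | q = lin₁ 2 q (ar (κ u))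
        where
        ar : ∀ k → + 4 + 0ℤ - (k - (1ℤ + 1ℤ)) ≡ (+ 4 + 0ℤ - k) + + 2
        ar = solve-∀
      r₁ : ∀ u → κ′ u + ι (clear v β u) + + 2 * deg ⟦ v ⟧ u ≡ κ u + ι (β u)
      r₁ u rewrite deg-v u with adj v u | β u
      ... | false | true = ar (κ u)
        where
        ar : ∀ k → k - (0ℤ + 0ℤ) + 1ℤ + + 2 * 0ℤ ≡ k + 1ℤ
        ar = solve-∀
      ... | false | false = ar (κ u)
        where
        ar : ∀ k → k - (0ℤ + 0ℤ) + 0ℤ + + 2 * 0ℤ ≡ k + 0ℤ
        ar = solve-∀
      ... | true | true = ar (κ u)
        where
        ar : ∀ k → k - (1ℤ + 0ℤ) + 0ℤ + + 2 * 1ℤ ≡ k + 1ℤ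
        ar = solve-∀
      ... | true | false = ar (κ u)
        where
        ar : ∀ k → k - (1ℤ + 1ℤ) + 0ℤ + + 2 * 1ℤ ≡ k + 0ℤ
        ar = solve-∀
      good : Good κ′ R
      good Y ne sub = subst (-1ℤ ≤_) (sym ρ′) main
        where
        e b : ℤ
        e = deg Y v
        b = deg (Y ∩ β) v
        ρ′ : ρ κ′ Y ≡ ρ κ Y - (e + e - b)
        ρ′ = trans (ρ-sub κ fee Y) (cong (λ x → ρ κ Y - x)
          (trans (sum-cong-≗ pt) (trans (sum-sub (λ u → ι (Y u ∧ adj v u) + ι (Y u ∧ adj v u)) (λ u → ι ((Y ∩ β) u ∧ adj v u)))
            (cong (_- b) (∑-distrib-+ _ _)))))
          where
          pt : ∀ u → on (Y u) (fee u) ≡ ι (Y u ∧ adj v u) + ι (Y u ∧ adj v u) - ι ((Y ∩ β) u ∧ adj v u)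
          pt u rewrite deg-v u with Y u | adj v u | β u
          ... | false | _ | _ = refl
          ... | true | true | true = refl
          ... | true | true | false = refl
          ... | true | false | true = refl
          ... | true | false | false = refl
        main : -1ℤ ≤ ρ κ Y - (e + e - b)
        main with Finₚ.any? (λ u → (U u 𝔹.≟ true) ×-dec (Z ne sub u 𝔹.≟ false))
        ... | yes p = lin₂ 0 (subst (0ℤ ≤_) (ρZ ne sub) (pr (Z ne sub) (v , vZ ne sub) (Z⊂U ne sub) p)) (0≤deg (Y ∩ β) v)
                (ar (ρ κ Y) e b)
          where
          ar : ∀ r e b → r - (e + e - b) - -1ℤ ≡ (r + 1ℤ - (e + e) - 0ℤ) + (b - 0ℤ) + + 0
          ar = solve-∀
        ... | no ¬p = lin₂ 0 (subst (- + 2 ≤_) (ρZ ne sub) (ρ≥ (Z ne sub) (v , vZ ne sub) (Z⊂U ne sub))) b≥2 (ar (ρ κ Y) e b)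
          where
          ar : ∀ r e b → r - (e + e - b) - -1ℤ ≡ (r + 1ℤ - (e + e) - - + 2) + (b - + 2) + + 0
          ar = solve-∀
          b≥2 : + 2 ≤ b
          b≥2 = ℤₚ.≤-trans hb (sum-mono le)
            where
            le : ∀ u → ι ((U ∩ β) u ∧ adj v u) ≤ ι ((Y ∩ β) u ∧ adj v u)
            le u with U u in eU | Y u in eY
            ... | false | y = 0≤ι ((y ∧ β u) ∧ adj v u)
            ... | true | true = ℤₚ.≤-refl
            ... | true | false with u Fin.≟ v
            ...   | yes refl rewrite irr v | 𝔹ₚ.∧-zeroʳ (β v) = ℤₚ.≤-refl
            ...   | no u≢v = ⊥-elim (¬p (u , eU , zf))
              where
              zf : Z ne sub u ≡ false
              zf with u Fin.≟ v
              ... | yes e = ⊥-elim (u≢v e)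
              ... | no _ = eY
      PR : CorePlan R κ′ (clear v β)
      PR = core (countB R) κ′ (clear v β) R ℕₚ.≤-refl inv′ good
      rS : ∀ u → Plan.S PR u ≡ true → 0ℤ ≤ capS (κ′ u) (ι (clear v β u)) →
           capS (κ′ u) (ι (clear v β u)) + + 2 * deg ⟦ v ⟧ u ≤ cS u
      rS u _ h = ℤₚ.≤-trans (ℤₚ.≤-reflexive (trans (cong (_+ + 2 * deg ⟦ v ⟧ u) (capS-val _ (ι (clear v β u)) (capS-pos _ _ h)))
          (trans (ar (κ′ u) (ι (clear v β u)) (deg ⟦ v ⟧ u)) (trans (cong (_- 1ℤ) (r₁ u))
            (sym (capS-val _ (ι (β u)) (lin₂ 0 (capS-pos _ _ h) (fee≥0 u) (ar₄ (κ u) (fee u))))))))) (cS≥ u)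
        where
        ar : ∀ k c d → k + c - 1ℤ + + 2 * d ≡ k + c + + 2 * d - 1ℤ
        ar = solve-∀
        ar₄ : ∀ k d → k - + 4 ≡ (k - d - + 4) + (d - 0ℤ) + + 0
        ar₄ = solve-∀
      r₂ : ∀ u → κ′ u + (+ 2 * deg (⟦ v ⟧ ∖ ⟦ v ⟧) u + deg ⟦ v ⟧ u) ≤ κ u
      r₂ u = ℤₚ.≤-trans (ℤₚ.≤-reflexive (cong (λ d → κ′ u + (+ 2 * d + deg ⟦ v ⟧ u)) (deg-zero {⟦ v ⟧ ∖ ⟦ v ⟧} {u} bad)))
          (lin₁ 0 (0≤ι (adj v u ∧ not (β u))) (ar (κ u) (deg ⟦ v ⟧ u) (ι (adj v u ∧ not (β u)))))
        where
        bad : ∀ z → (⟦ v ⟧ ∖ ⟦ v ⟧) z ≡ true → adj u z ≡ false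
        bad z hz with ∖-true {U = ⟦ v ⟧} {⟦ v ⟧} {z} hz
        ... | a , b = ⊥-elim (false≢true b a)
        ar : ∀ k d i → k - (k - (d + i) + (+ 2 * 0ℤ + d)) ≡ (i - 0ℤ) + + 0
        ar = solve-∀

  -- Colouring a proper subset of potential at most -1 first leaves a remainder to which `core`
  -- applies. If there is none, all proper subsets have potential at least 0, so that only `U`
  -- itself can violate the hypothesis of `core`; a pivot then absorbs the deficit.
  exceptional : ∀ m U → countB U ℕ.≤ m → Inv κ β U →
    (∀ X → Nonempty X → X ⊂ᵇ U → - + 2 ≤ ρ κ X) →
    (∀ X → Nonempty X → X ⊂ᵇ U → ¬ (-1ℤ ≤ ρ κ X) → ∃ (Low -1ℤ κ X) ⊎ Pivot X) →
    Final U
  exceptional m U size inv good st with all-or-some U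
  ... | inj₂ none = empty-plan none
  exceptional zero U size inv good st | inj₁ (z , hz) =
    ⊥-elim (ℕₚ.<⇒≱ (countB-strict {X = λ _ → false} {U} (λ _ ()) z hz refl) (ℕₚ.≤-trans size ℕ.z≤n))
  exceptional (suc m) U size inv good st | inj₁ neU with Low? -1ℤ κ U
  ... | yes (X , low ne sub (z , hz , hzX) ρ≤) = F.extend PR PX
          (λ _ _ → ℤₚ.≤-refl) (λ v _ → cS≥ v) (λ _ _ → ℤₚ.≤-refl)
    where
    module F = First {κ} {β} {U} {X} inv sub
    PX : Final X
    PX = exceptional m X (ℕₚ.≤-pred (ℕₚ.≤-trans (countB-strict {X = X} {U} sub z hz hzX) size))
           (λ v h → inv v (sub v h)) (λ Y neY subY → good Y neY (λ u h → sub u (subY u h)))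
           (λ Y neY subY → st Y neY (λ u h → sub u (subY u h)))
    PR : CorePlan F.R F.κR β
    PR = core m F.κR β F.R (size-∖ {U} {X} ne sub size) F.invR (F.goodR -1ℤ ρ≤ good)
  ... | no ¬low with -1ℤ ≤? ρ κ U
  ...   | yes h = core⇒final (core (suc m) κ β U size inv goodU)
    where
    goodU : Good κ U
    goodU Y ne sub with Finₚ.any? (λ u → (U u 𝔹.≟ true) ×-dec (Y u 𝔹.≟ false))
    ... | yes p = ℤₚ.≤-trans -≤+ (≰⇒≤ (λ h → ¬low (Y , low ne sub p h)))
    ... | no ¬p = ℤₚ.≤-trans h (ℤₚ.≤-reflexive (ρ-cong {κ} {κ} (λ _ → refl) same))
      where
      same : ∀ u → U u ≡ Y u
      same u with U u in e | Y u in e′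
      ... | true | true = refl
      ... | true | false = ⊥-elim (¬p (u , e , e′))
      ... | false | false = refl
      ... | false | true = ⊥-elim (false≢true e (sub u e′))
  ...   | no ¬h with st U neU (λ _ h → h) ¬h
  ...     | inj₁ l = ⊥-elim (¬low l)
  ...     | inj₂ P = finish (Pivot.choice P)
    where
    open PivotStep inv P (λ X ne sub p → ≰⇒≤ (λ h → ¬low (X , low ne sub p h))) good
    finish : (deg U (Pivot.v P) ≤ + 2) ⊎ (+ 2 ≤ deg (U ∩ β) (Pivot.v P)) → Final U
    finish (inj₁ h) = by-mixed h
    finish (inj₂ h) = by-static h

-- Greedy colouring from lists.

index-injective : ∀ {A : Set} {x y : A} {xs} (p : x ∈ xs) (q : y ∈ xs) → index p ≡ index q → x ≡ y
index-injective {xs = xs} p q eq = trans (Anyₚ.lookup-index p) (trans (cong (lookup xs) eq) (sym (Anyₚ.lookup-index q)))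

unique⊆⇒length≤ : ∀ {A : Set} {xs ys : List A} → Unique xs → (∀ {x} → x ∈ xs → x ∈ ys) → length xs ℕ.≤ length ys
unique⊆⇒length≤ {xs = xs} {ys} u sub = Finₚ.injective⇒≤ {f = f} f-inj
  where
  f : Fin (length xs) → Fin (length ys)
  f i = index (sub (∈-lookup i))
  lookup-inj : ∀ {A : Set} {xs : List A} → Unique xs → ∀ i j → lookup xs i ≡ lookup xs j → i ≡ j
  lookup-inj (x∉ ∷ u) fz fz eq = refl
  lookup-inj (x∉ ∷ u) fz (fs j) eq = ⊥-elim (All.lookup x∉ (∈-lookup j) eq)
  lookup-inj (x∉ ∷ u) (fs i) fz eq = ⊥-elim (All.lookup x∉ (∈-lookup i) (sym eq))
  lookup-inj (x∉ ∷ u) (fs i) (fs j) eq = cong fs (lookup-inj u i j eq)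
  f-inj : ∀ {i j} → f i ≡ f j → i ≡ j
  f-inj {i} {j} eq = lookup-inj u i j (index-injective {xs = ys} (sub (∈-lookup i)) (sub (∈-lookup j)) eq)

pick : ∀ (xs F : List ℕ) → length F ℕ.< length (deduplicate ℕ._≟_ xs) → ∃ λ c → c ∈ xs × c ∉ F
pick xs F h with any? (λ c → ¬? (DecMem._∈?_ ℕ._≟_ c F)) (deduplicate ℕ._≟_ xs)
... | yes p = let (c , c∈ , c∉) = find p in c , ∈-deduplicate⁻ ℕ._≟_ xs c∈ , c∉
... | no ¬p = ⊥-elim (ℕₚ.<⇒≱ h (unique⊆⇒length≤ (DecUniqueₚ.deduplicate-! ℕ._≟_ xs) sub))
  where
  sub : ∀ {c} → c ∈ deduplicate ℕ._≟_ xs → c ∈ F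
  sub {c} c∈ with DecMem._∈?_ ℕ._≟_ c F
  ... | yes q = q
  ... | no ¬q = ⊥-elim (¬p (lose c∈ ¬q))

collect : ∀ {n} → (Fin n → List ℕ) → List ℕ
collect {zero}  f = []
collect {suc n} f = f fz ++ collect (f ∘ fs)

length-collect : ∀ {n} (f : Fin n → List ℕ) → + length (collect f) ≡ sum (λ i → + length (f i))
length-collect {zero} f = sym (sum-[] _)
length-collect {suc n} f = trans (cong +_ (Listₚ.length-++ (f fz)))
  (trans (ℤₚ.pos-+ (length (f fz)) _) (trans (cong (λ x → + length (f fz) + x) (length-collect (f ∘ fs))) (sym (sum-∷ _))))

∈-collect : ∀ {n} (f : Fin n → List ℕ) i {x} → x ∈ f i → x ∈ collect f
∈-collect f fz h = ∈-++⁺ˡ h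
∈-collect f (fs i) h = ∈-++⁺ʳ (f fz) (∈-collect (f ∘ fs) i h)

collect-cong : ∀ {n} {f g : Fin n → List ℕ} → (∀ i → f i ≡ g i) → collect f ≡ collect g
collect-cong {zero} h = refl
collect-cong {suc n} h = cong₂ _++_ (h fz) (collect-cong (h ∘ fs))

module _ {n : ℕ} (W : VSet n) (t : Fin n → ℕ) where
  private
    open Data.List.Sort (On.decTotalOrder ℕₚ.≤-decTotalOrder t)
    base : List (Fin n)
    base = filter (λ v → W v 𝔹.≟ true) (allFin n)

  by-time : List (Fin n)
  by-time = sort base

  by-time-∈⁺ : ∀ v → W v ≡ true → v ∈ by-time
  by-time-∈⁺ v h = ∈-resp-↭ (↭-sym (sort-↭ base)) (∈-filter⁺ (λ v → W v 𝔹.≟ true) (∈-allFin v) h)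

  by-time-∈⁻ : ∀ {v} → v ∈ by-time → W v ≡ true
  by-time-∈⁻ h = proj₂ (∈-filter⁻ (λ v → W v 𝔹.≟ true) {xs = allFin n} (∈-resp-↭ (sort-↭ base) h))

  by-time-unique : Unique by-time
  by-time-unique = PermSₚ.Unique-resp-↭ (setoid (Fin n)) (↭⇒↭ₛ (↭-sym (sort-↭ base)))
    (Uniqueₚ.filter⁺ (λ v → W v 𝔹.≟ true) (Uniqueₚ.allFin⁺ n))

  by-time-sorted : AllPairs (λ u v → t u ℕ.≤ t v) by-time
  by-time-sorted = Linkedₚ.Linked⇒AllPairs ℕₚ.≤-trans (sort-↗ base)

module Greedy {n : ℕ} (adj : Fin n → Fin n → Bool) (adj-sym : ∀ u v → adj u v ≡ adj v u)
    (W : VSet n) (p t : Fin n → ℕ) (bnd : ℕ) (p< : ∀ v → p v ℕ.< bnd)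
    (ψ : Fin n → ℕ) (ext : Fin n → Fin n → List ℕ) where
  open Graph adj adj-sym

  when : Bool → ℕ → List ℕ
  when true  x = x ∷ []
  when false x = []

  block : (Fin n → ℕ) → Fin n → Fin n → List ℕ
  block c v u = if adj v u then (if W u then when (lt (p u) (p v)) (c u) ++ when (lt (t v) (t u)) (ψ u) else ext v u) else []

  forbidden : (Fin n → ℕ) → Fin n → List ℕ
  forbidden c v = collect (block c v)

  budget : Fin n → ℤ
  budget v = cost p t W v + sum (λ u → on (not (W u) ∧ adj v u) (+ length (ext v u)))

  length-when : ∀ b x → + length (when b x) ≡ ι b
  length-when true x = refl
  length-when false x = refl

  forbidden-length : ∀ c v → + length (forbidden c v) ≡ budget v
  forbidden-length c v = trans (length-collect (block c v)) (trans (sum-cong-≗ pt) (∑-distrib-+ _ _))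
    where
    pt : ∀ u → + length (block c v u) ≡ on (W u ∧ adj v u) (val p t v u) + on (not (W u) ∧ adj v u) (+ length (ext v u))
    pt u with W u | adj v u
    ... | true | true = trans (cong +_ (Listₚ.length-++ (when (lt (p u) (p v)) (c u))))
           (trans (ℤₚ.pos-+ (length (when (lt (p u) (p v)) (c u))) _) (trans (cong₂ _+_ (length-when (lt (p u) (p v)) (c u)) (length-when (lt (t v) (t u)) (ψ u)))
             (sym (ℤₚ.+-identityʳ _))))
    ... | true | false = refl
    ... | false | true = sym (ℤₚ.+-identityˡ _)
    ... | false | false = refl

  Outcome : (Fin n → ℕ → Set) → Set
  Outcome Q = ∃ λ (c : Fin n → ℕ) → ∀ v → W v ≡ true →
        Q v (c v) ×
        (∀ u → adj v u ≡ true → W u ≡ true → p u ℕ.< p v → c v ≢ c u) ×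
        (∀ u → adj v u ≡ true → W u ≡ true → t v ℕ.< t u → c v ≢ ψ u) ×
        (∀ u → adj v u ≡ true → W u ≡ false → c v ∉ ext v u)

  module _ (Q : Fin n → ℕ → Set)
      (avail : ∀ v → W v ≡ true → ∀ F → + length F ≡ budget v → ∃ λ c → c ∉ F × Q v c) where

    OK : (Fin n → ℕ) → Fin n → Set
    OK c v = c v ∉ forbidden c v × Q v (c v)

    private
      choose : ∀ c v → W v ≡ true → ∃ λ x → x ∉ forbidden c v × Q v x
      choose c v h = avail v h (forbidden c v) (forbidden-length c v)

      -- Old colours and the colours outside `W` do not depend on the choice, and new colours enter
      -- only from smaller ranks. Hence a colour chosen at one stage stays admissible when larger
      -- ranks are assigned later.
      forbidden-local : ∀ c c′ v → (∀ u → p u ℕ.< p v → c u ≡ c′ u) → forbidden c v ≡ forbidden c′ v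
      forbidden-local c c′ v h = collect-cong pt
        where
        pt : ∀ u → block c v u ≡ block c′ v u
        pt u with adj v u | W u
        ... | false | _ = refl
        ... | true | false = refl
        ... | true | true with p u ℕ.<? p v
        ...   | yes l rewrite h u l = refl
        ...   | no _ = refl

      upto : ∀ m → ∃ λ c → ∀ v → W v ≡ true → p v ℕ.< m → OK c v
      upto zero = (λ _ → 0) , λ _ _ ()
      upto (suc m) = c′ , ok
        where
        c : Fin n → ℕ
        c = proj₁ (upto m)
        c′ : Fin n → ℕ
        c′ v with W v 𝔹.≟ true | p v ℕ.≟ m
        ... | yes h | yes _ = proj₁ (choose c v h)
        ... | _ | _ = c v
        c′-low : ∀ u → p u ℕ.< m → c u ≡ c′ u
        c′-low u l with W u 𝔹.≟ true | p u ℕ.≟ m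
        ... | yes _ | yes e = ⊥-elim (ℕₚ.<⇒≢ l e)
        ... | yes _ | no _ = refl
        ... | no _ | yes _ = refl
        ... | no _ | no _ = refl
        c′-at : ∀ v h → p v ≡ m → proj₁ (choose c v h) ≡ c′ v
        c′-at v h e with W v 𝔹.≟ true | p v ℕ.≟ m
        ... | yes h′ | yes _ = cong (λ h → proj₁ (choose c v h)) (Decidable⇒UIP.≡-irrelevant 𝔹._≟_ h h′)
        ... | yes _ | no ¬e = ⊥-elim (¬e e)
        ... | no ¬h | _ = ⊥-elim (¬h h)
        ok : ∀ v → W v ≡ true → p v ℕ.< suc m → OK c′ v
        ok v h l = go (p v ℕ.≟ m)
          where
          go : Dec (p v ≡ m) → OK c′ v
          go (yes e) = subst₂ (λ F x → x ∉ F × Q v x)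
            (forbidden-local c c′ v (λ u l → c′-low u (subst (p u ℕ.<_) e l))) (c′-at v h e) (proj₂ (choose c v h))
          go (no ¬e) = subst₂ (λ F x → x ∉ F × Q v x)
            (forbidden-local c c′ v (λ u l′ → c′-low u (ℕₚ.<-trans l′ l″))) (c′-low v l″) (proj₂ (upto m) v h l″)
            where
            l″ : p v ℕ.< m
            l″ = ℕₚ.≤∧≢⇒< (ℕₚ.≤-pred l) ¬e

    greedy : Outcome Q
    greedy = c , λ v h → proj₂ (ok v h) ,
        (λ u a w l e → proj₁ (ok v h) (∈-collect (block c v) u (in₁ v u a w l e))) ,
        (λ u a w l e → proj₁ (ok v h) (∈-collect (block c v) u (in₂ v u a w l e))) ,
        (λ u a w m → proj₁ (ok v h) (∈-collect (block c v) u (in₃ v u a w m)))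
      where
      c : Fin n → ℕ
      c = proj₁ (upto bnd)
      ok : ∀ v → W v ≡ true → OK c v
      ok v h = proj₂ (upto bnd) v h (p< v)
      in₁ : ∀ v u → adj v u ≡ true → W u ≡ true → p u ℕ.< p v → c v ≡ c u → c v ∈ block c v u
      in₁ v u a w l e rewrite a | w | lt-true l = here e
      in₂ : ∀ v u → adj v u ≡ true → W u ≡ true → t v ℕ.< t u → c v ≡ ψ u → c v ∈ block c v u
      in₂ v u a w l e rewrite a | w | lt-true l = ∈-++⁺ʳ (when (lt (p u) (p v)) (c u)) (here e)
      in₃ : ∀ v u → adj v u ≡ true → W u ≡ false → c v ∈ ext v u → c v ∈ block c v u
      in₃ v u a w m rewrite a | w = m

-- Proper once-only recolouring sequences.

eqF-refl : ∀ {n} (u : Fin n) → eqF u u ≡ true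
eqF-refl = ≟-refl

eqF-≢ : ∀ {n} {u v : Fin n} → u ≢ v → eqF u v ≡ false
eqF-≢ {u = u} {v} h with u Fin.≟ v
... | yes e = ⊥-elim (h e)
... | no _ = refl

module Steps (G : PlaneGraph) where
  open PlaneGraph G
  open Colouring G

  update-at : ∀ χ v a → update χ v a v ≡ a
  update-at χ v a rewrite eqF-refl v = refl

  update-off : ∀ χ v a {u} → u ≢ v → update χ v a u ≡ χ u
  update-off χ v a h rewrite eqF-≢ h = refl

  Adj-sym : ∀ {u v} → Adj u v → Adj v u
  Adj-sym (d , e , e′) = α d , e′ , trans (cong vert (α-invol d)) e

  Adj-≢ : ∀ {u v} → Adj u v → u ≢ v
  Adj-≢ (d , e , e′) refl = noLoop d (trans e′ (sym e))

  run-++ : ∀ s s′ χ v → run χ (s ++ s′) v ≡ run (run χ s) s′ v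
  run-++ [] s′ χ v = refl
  run-++ ((x , a) ∷ s) s′ χ v = run-++ s s′ (update χ x a) v

  run-local : ∀ s {χ χ′ v} → χ v ≡ χ′ v → run χ s v ≡ run χ′ s v
  run-local [] e = e
  run-local ((x , a) ∷ s) {χ} {χ′} {v} e = run-local s step
    where
    step : update χ x a v ≡ update χ′ x a v
    step with eqF v x
    ... | true = refl
    ... | false = e

  run-untouched : ∀ s {χ v} → v ∉ map proj₁ s → run χ s v ≡ χ v
  run-untouched [] h = refl
  run-untouched ((x , a) ∷ s) {χ} {v} h = trans (run-untouched s (λ m → h (there m)))
    (update-off χ x a (λ e → h (here e)))

  seq-++ : ∀ s s′ χ → ProperSeqOn allV χ s → ProperSeqOn allV (run χ s) s′ → ProperSeqOn allV χ (s ++ s′)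
  seq-++ [] s′ χ _ h = h
  seq-++ ((x , a) ∷ s) s′ χ (p , q) h = p , seq-++ s s′ (update χ x a) q h

  module _ (c : Colouring) where
    moves : List (Fin n) → Recolouring
    moves = map (λ v → (v , c v))

    moves-fst : ∀ xs → map proj₁ (moves xs) ≡ xs
    moves-fst [] = refl
    moves-fst (x ∷ xs) = cong (x ∷_) (moves-fst xs)

    run-moves-∉ : ∀ xs {χ v} → v ∉ xs → run χ (moves xs) v ≡ χ v
    run-moves-∉ xs {v = v} h = run-untouched (moves xs) (subst (v ∉_) (sym (moves-fst xs)) h)

    run-moves-∈ : ∀ xs {χ v} → Unique xs → v ∈ xs → run χ (moves xs) v ≡ c v
    run-moves-∈ (x ∷ xs) {χ} (x∉ ∷ u) (here refl) =
      trans (run-moves-∉ xs (λ m → All.lookup x∉ m refl)) (update-at χ x (c x))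
    run-moves-∈ (x ∷ xs) (x∉ ∷ u) (there m) = run-moves-∈ xs u m

    Before : Colouring → Fin n → Fin n → Set
    Before χ u v = Adj u v → c u ≢ χ v × c u ≢ c v

    moves-proper : ∀ xs χ → ProperOn allV χ → AllPairs (Before χ) xs →
      (∀ u → u ∈ xs → ∀ v → v ∉ xs → Adj u v → c u ≢ χ v) → Unique xs → ProperSeqOn allV χ (moves xs)
    moves-proper [] χ pχ _ _ _ = pχ
    moves-proper (x ∷ xs) χ pχ (bx ∷ bs) oth (x∉ ∷ u) = pχ , moves-proper xs χ′ pχ′ bs′ out′ u
      where
      χ′ : Colouring
      χ′ = update χ x (c x)
      x≢ : ∀ {v} → v ∈ xs → v ≢ x
      x≢ m e = All.lookup x∉ m (sym e)
      new : ∀ v → Adj x v → c x ≢ χ v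
      new v a with any? (v Fin.≟_) xs
      ... | yes m = proj₁ (All.lookup bx m a)
      ... | no ¬m = oth x (here refl) v (λ { (here e) → Adj-≢ a (sym e) ; (there m) → ¬m m }) a
      pχ′ : ProperOn allV χ′
      pχ′ u v _ _ a with u Fin.≟ x | v Fin.≟ x
      ... | yes refl | yes refl = ⊥-elim (Adj-≢ a refl)
      ... | yes refl | no _ = new v a
      ... | no _ | yes refl = λ e → new u (Adj-sym a) (sym e)
      ... | no _ | no _ = pχ u v refl refl a
      bs′ : AllPairs (Before χ′) xs
      bs′ = go xs (λ m → m) bs
        where
        go : ∀ ys → (∀ {v} → v ∈ ys → v ∈ xs) → AllPairs (Before χ) ys → AllPairs (Before χ′) ys
        go [] _ [] = []
        go (y ∷ ys) s (b ∷ bs) = All.tabulate (λ {v} m a → subst (c y ≢_) (sym (update-off χ x (c x) (x≢ (s (there m)))))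
            (proj₁ (All.lookup b m a)) , proj₂ (All.lookup b m a)) ∷ go ys (s ∘ there) bs
      out′ : ∀ u → u ∈ xs → ∀ v → v ∉ xs → Adj u v → c u ≢ χ′ v
      out′ u m v v∉ a with v Fin.≟ x
      ... | yes refl = λ e → proj₂ (All.lookup bx m (Adj-sym a)) (sym e)
      ... | no v≢x = oth u (there m) v (λ { (here e) → v≢x e ; (there m) → v∉ m }) a

  -- A vertex of `H` is recoloured at most once, so it shows only its initial and its final colour;
  -- avoiding these two keeps every intermediate colouring proper on the edges leaving `H`.
  H-phase : ∀ hv s χ δ → Within hv s → OnceOnly s → ProperSeqOn hv δ s → AgreeOn hv χ δ →
    (∀ u v → hv u ≡ false → hv v ≡ false → Adj u v → χ u ≢ χ v) →
    (∀ v h → hv v ≡ false → hv h ≡ true → Adj v h → χ v ≢ δ h × χ v ≢ run δ s h) →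
    ProperSeqOn allV χ s
  H-phase hv s χ δ w o q agree oth cross = go s χ δ w o q agree oth cross
    where
    proper : ∀ χ δ s → ProperOn hv δ → AgreeOn hv χ δ →
      (∀ u v → hv u ≡ false → hv v ≡ false → Adj u v → χ u ≢ χ v) →
      (∀ v h → hv v ≡ false → hv h ≡ true → Adj v h → χ v ≢ δ h × χ v ≢ run δ s h) → ProperOn allV χ
    proper χ δ s pδ agree oth cross u v _ _ a with hv u in eu | hv v in ev
    ... | true | true = λ e → pδ u v eu ev a (trans (sym (agree u eu)) (trans e (agree v ev)))
    ... | true | false = λ e → proj₁ (cross v u ev eu (Adj-sym a)) (trans (sym e) (agree u eu))
    ... | false | true = λ e → proj₁ (cross u v eu ev a) (trans e (agree v ev))
    ... | false | false = oth u v eu ev a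
    go : ∀ s χ δ → Within hv s → OnceOnly s → ProperSeqOn hv δ s → AgreeOn hv χ δ →
      (∀ u v → hv u ≡ false → hv v ≡ false → Adj u v → χ u ≢ χ v) →
      (∀ v h → hv v ≡ false → hv h ≡ true → Adj v h → χ v ≢ δ h × χ v ≢ run δ s h) →
      ProperSeqOn allV χ s
    go [] χ δ _ _ q agree oth cross = proper χ δ [] q agree oth cross
    go ((x , a) ∷ s) χ δ (hx ∷ w) (x∉ ∷ o) (q , qs) agree oth cross =
        proper χ δ ((x , a) ∷ s) q agree oth cross ,
        go s (update χ x a) (update δ x a) w o qs agree′ out′ cross′
      where
      x≢ : ∀ {v} → hv v ≡ false → v ≢ x
      x≢ hf refl = false≢true hf hx
      agree′ : AgreeOn hv (update χ x a) (update δ x a)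
      agree′ v hv′ with eqF v x
      ... | true = refl
      ... | false = agree v hv′
      out′ : ∀ u v → hv u ≡ false → hv v ≡ false → Adj u v → update χ x a u ≢ update χ x a v
      out′ u v hu hv′ ad e = oth u v hu hv′ ad
        (trans (sym (update-off χ x a (x≢ hu))) (trans e (update-off χ x a (x≢ hv′))))
      cross′ : ∀ v h → hv v ≡ false → hv h ≡ true → Adj v h →
               update χ x a v ≢ update δ x a h × update χ x a v ≢ run (update δ x a) s h
      cross′ v h hf ht ad rewrite update-off χ x a (x≢ hf) = first , proj₂ (cross v h hf ht ad)
        where
        first : χ v ≢ update δ x a h
        first with h Fin.≟ x
        ... | no _ = proj₁ (cross v h hf ht ad)
        ... | yes refl = λ e → proj₂ (cross v h hf ht ad)
              (trans e (sym (trans (run-untouched s (λ m → All.lookup x∉ m refl)) (update-at δ h a))))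

  -- One step: first W is recoloured to c in the order t, then H follows its own sequence.
  module Step (hv : VSet n) (ψ δ δ′ : Colouring) (pψ : ProperOn allV ψ) (agree : AgreeOn hv δ ψ)
      (pδ′ : ProperOn hv δ′) (st : StepOn hv δ δ′)
      (W : VSet n) (W-out : ∀ v → W v ≡ true → hv v ≡ false) (t : Fin n → ℕ) (c : Colouring)
      (t≢ : ∀ u v → W u ≡ true → W v ≡ true → Adj u v → t u ≢ t v)
      (WW : ∀ u v → W u ≡ true → W v ≡ true → Adj u v → c u ≢ c v)
      (Wt : ∀ u v → W u ≡ true → W v ≡ true → Adj u v → t u ℕ.< t v → c u ≢ ψ v)
      (WV : ∀ u v → W u ≡ true → W v ≡ false → hv v ≡ false → Adj u v → c u ≢ ψ v)
      (WH : ∀ u h → W u ≡ true → hv h ≡ true → Adj u h → c u ≢ ψ h × c u ≢ δ′ h)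
      (VH : ∀ u h → W u ≡ false → hv u ≡ false → hv h ≡ true → Adj u h → ψ u ≢ δ′ h) where

    φ′ : Colouring
    φ′ v = if hv v then δ′ v else (if W v then c v else ψ v)

    private
      xs : List (Fin n)
      xs = by-time W t
      χ : Colouring
      χ = run ψ (moves c xs)
      χW : ∀ v → W v ≡ true → χ v ≡ c v
      χW v h = run-moves-∈ c xs (by-time-unique W t) (by-time-∈⁺ W t v h)
      χ∉ : ∀ v → W v ≡ false → χ v ≡ ψ v
      χ∉ v h = run-moves-∉ c xs (λ m → false≢true h (by-time-∈⁻ W t m))
      WnotH : ∀ h → hv h ≡ true → W h ≡ false
      WnotH h hh with W h in eq
      ... | false = refl
      ... | true = ⊥-elim (false≢true (W-out h eq) hh)

      before : AllPairs (Before c ψ) xs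
      before = go xs (λ m → by-time-∈⁻ W t m) (by-time-sorted W t)
        where
        go : ∀ ys → (∀ {v} → v ∈ ys → W v ≡ true) → AllPairs (λ u v → t u ℕ.≤ t v) ys → AllPairs (Before c ψ) ys
        go [] _ [] = []
        go (y ∷ ys) w (s ∷ ss) = All.tabulate (λ {v} m a →
            Wt y v (w (here refl)) (w (there m)) a (ℕₚ.≤∧≢⇒< (All.lookup s m) (t≢ y v (w (here refl)) (w (there m)) a)) ,
            WW y v (w (here refl)) (w (there m)) a) ∷ go ys (w ∘ there) ss

      first-phase : ProperSeqOn allV ψ (moves c xs)
      first-phase = moves-proper c xs ψ pψ before oth (by-time-unique W t)
        where
        oth : ∀ u → u ∈ xs → ∀ v → v ∉ xs → Adj u v → c u ≢ ψ v
        oth u m v v∉ a with hv v in eh | W v in ew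
        ... | _ | true = ⊥-elim (v∉ (by-time-∈⁺ W t v ew))
        ... | true | false = proj₁ (WH u v (by-time-∈⁻ W t m) eh a)
        ... | false | false = WV u v (by-time-∈⁻ W t m) ew eh a

      s₂ : Recolouring
      s₂ = proj₁ st
      within : Within hv s₂
      within = proj₁ (proj₂ st)
      once : OnceOnly s₂
      once = proj₁ (proj₂ (proj₂ (proj₂ st)))
      reach : AgreeOn hv (run δ s₂) δ′
      reach = proj₂ (proj₂ (proj₂ (proj₂ st)))

      outV : ∀ u v → hv u ≡ false → hv v ≡ false → Adj u v → χ u ≢ χ v
      outV u v hu hv′ a with W u in eu | W v in ev
      ... | true | true = subst₂ _≢_ (sym (χW u eu)) (sym (χW v ev)) (WW u v eu ev a)
      ... | true | false = subst₂ _≢_ (sym (χW u eu)) (sym (χ∉ v ev)) (WV u v eu ev hv′ a)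
      ... | false | true = subst₂ _≢_ (sym (χ∉ u eu)) (sym (χW v ev)) (λ e → WV v u ev eu hu (Adj-sym a) (sym e))
      ... | false | false = subst₂ _≢_ (sym (χ∉ u eu)) (sym (χ∉ v ev)) (pψ u v refl refl a)

      cross : ∀ v h → hv v ≡ false → hv h ≡ true → Adj v h → χ v ≢ δ h × χ v ≢ δ′ h
      cross v h hv′ hh a with W v in ew
      ... | true = subst₂ _≢_ (sym (χW v ew)) (sym (agree h hh)) (proj₁ (WH v h ew hh a)) ,
                   subst (_≢ δ′ h) (sym (χW v ew)) (proj₂ (WH v h ew hh a))
      ... | false = subst₂ _≢_ (sym (χ∉ v ew)) (sym (agree h hh)) (pψ v h refl refl a) ,
                    subst (_≢ δ′ h) (sym (χ∉ v ew)) (VH v h ew hv′ hh a)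

      second-phase : ProperSeqOn allV χ s₂
      second-phase = H-phase hv s₂ χ δ within once (proj₁ (proj₂ (proj₂ st)))
        (λ h hh → trans (χ∉ h (WnotH h hh)) (sym (agree h hh))) outV
        (λ v h hv′ hh a → proj₁ (cross v h hv′ hh a) ,
           subst (χ v ≢_) (sym (reach h hh)) (proj₂ (cross v h hv′ hh a)))

      s₂-in : ∀ {v} → v ∈ map proj₁ s₂ → hv v ≡ true
      s₂-in m with ∈-map⁻ proj₁ m
      ... | r , r∈ , refl = All.lookup within r∈

      final : ∀ v → run ψ (moves c xs ++ s₂) v ≡ φ′ v
      final v with hv v in eh
      ... | true = trans (run-++ (moves c xs) s₂ ψ v) (trans (run-local s₂ (trans (χ∉ v (WnotH v eh)) (sym (agree v eh)))) (reach v eh))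
      ... | false with W v in ew
      ...   | true = trans (run-++ (moves c xs) s₂ ψ v) (trans (run-untouched s₂ (λ m → false≢true eh (s₂-in m))) (χW v ew))
      ...   | false = trans (run-++ (moves c xs) s₂ ψ v) (trans (run-untouched s₂ (λ m → false≢true eh (s₂-in m))) (χ∉ v ew))

    late-step : LateStep hv ψ φ′
    late-step = moves c xs ++ s₂ , seq-++ (moves c xs) s₂ ψ first-phase second-phase ,
        subst Unique (sym (trans (Listₚ.map-++ proj₁ (moves c xs) s₂) (cong (_++ map proj₁ s₂) (moves-fst c xs))))
          (Uniqueₚ.++⁺ (by-time-unique W t) once (λ (m , m′) → false≢true (W-out _ (by-time-∈⁻ W t m)) (s₂-in m′))) ,
        (moves c xs , s₂ , refl , Allₚ.map⁺ (All.tabulate (λ m → W-out _ (by-time-∈⁻ W t m))) , within) , final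

    φ′-V : ∀ v → hv v ≡ false → φ′ v ≡ χ v
    φ′-V v h rewrite h with W v in ew
    ... | true = sym (χW v ew)
    ... | false = sym (χ∉ v ew)

    φ′-H : ∀ v → hv v ≡ true → φ′ v ≡ δ′ v
    φ′-H v h rewrite h = refl

    φ′-proper : ProperOn allV φ′
    φ′-proper u v _ _ a e = go (hv u) (hv v) refl refl
      where
      go : ∀ b b′ → hv u ≡ b → hv v ≡ b′ → ⊥
      go true true eu ev = pδ′ u v eu ev a (trans (sym (φ′-H u eu)) (trans e (φ′-H v ev)))
      go true false eu ev = proj₂ (cross v u ev eu (Adj-sym a)) (trans (sym (φ′-V v ev)) (trans (sym e) (φ′-H u eu)))
      go false true eu ev = proj₂ (cross u v eu ev a) (trans (sym (φ′-V u eu)) (trans e (φ′-H v ev)))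
      go false false eu ev = outV u v eu ev a (trans (sym (φ′-V u eu)) (trans e (φ′-V v ev)))

anyF-true : ∀ {n} (p : Fin n → Bool) → anyF p ≡ true → ∃ λ i → p i ≡ true
anyF-true {suc n} p h with p fz in eq
... | true = fz , eq
... | false = let (i , e) = anyF-true (p ∘ fs) h in fs i , e

anyF-intro : ∀ {n} (p : Fin n → Bool) i → p i ≡ true → anyF p ≡ true
anyF-intro p fz h rewrite h = refl
anyF-intro p (fs i) h with p fz
... | true = refl
... | false = anyF-intro (p ∘ fs) i h

∧-true : ∀ {a b} → a ∧ b ≡ true → a ≡ true × b ≡ true
∧-true {true} {true} _ = refl , refl

module Adjacency (G : PlaneGraph) where
  open PlaneGraph G

  adjB⇒Adj : ∀ {u v} → adjB u v ≡ true → Adj u v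
  adjB⇒Adj {u} {v} h with anyF-true _ h
  ... | d , e = d , ≟-true (proj₁ (∧-true e)) , ≟-true (proj₂ (∧-true {eqF (vert d) u} e))

  Adj⇒adjB : ∀ {u v} → Adj u v → adjB u v ≡ true
  Adj⇒adjB (d , refl , refl) = anyF-intro _ d (cong₂ _∧_ (≟-refl (vert d)) (≟-refl (vert (α d))))

  adjB-sym : ∀ u v → adjB u v ≡ adjB v u
  adjB-sym u v with adjB u v in e | adjB v u in e′
  ... | true | true = refl
  ... | false | false = refl
  ... | true | false = ⊥-elim (false≢true e′ (Adj⇒adjB (Steps.Adj-sym G (adjB⇒Adj e))))
  ... | false | true = ⊥-elim (false≢true e (Adj⇒adjB (Steps.Adj-sym G (adjB⇒Adj e′))))

  adjB-irr : ∀ v → adjB v v ≡ false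
  adjB-irr v = 𝔹ₚ.¬-not (λ h → Steps.Adj-≢ G (adjB⇒Adj h) refl)

-- From a plan to a trajectory.

module Assemble (G : PlaneGraph) (Sc : Colouring.Scene G) (T : Colouring.TValidScene G Sc) where
  open PlaneGraph G
  open Colouring G
  open Scene Sc
  open TValid T
  open Adjacency G
  open Steps G using (Adj-sym)
  open Graph adjB adjB-sym

  V : VSet n
  V v = not (hv v)

  Big? : ∀ v → Dec (Big v L₁ L₂)
  Big? v = (7 ℕ.≤? ∣ L₁ v ∣) ×-dec (6 ℕ.≤? ∣ L₂ v ∣)

  big : VSet n
  big v = ⌊ Big? v ⌋

  dH : Fin n → ℤ
  dH = deg hv

  κ : Fin n → ℤ
  κ v = + 4 + ι (big v) - (dH v + dH v)

  L₁-size : ∀ v → + 5 + + 2 * ι (big v) ≤ + ∣ L₁ v ∣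
  L₁-size v with Big? v
  ... | yes (b , _) = +≤+ b
  ... | no _ = +≤+ (Ta-size₁ v)

  L₂-size : ∀ v → + 5 + ι (big v) ≤ + ∣ L₂ v ∣
  L₂-size v with Big? v
  ... | yes (_ , b) = +≤+ b
  ... | no _ = +≤+ (Ta-size₂ v)

  V-not : ∀ {v} → V v ≡ true → hv v ≡ false
  V-not {v} h with hv v
  ... | false = refl

  V-yes : ∀ {v} → hv v ≡ false → V v ≡ true
  V-yes h rewrite h = refl

  -- A neighbour in `H` excludes two colours in each step from a moving vertex. A resting vertex has
  -- to avoid all three colours of such a neighbour at once, whence the term 3 `dH`; the constant 3
  -- is 4 minus the colour that may be absent from the second list.
  trajectory : ∀ {cS} → Plan V (λ v → κ v + ι (big v)) cS κ →
    (∀ v → 0ℤ ≤ cS v → cS v + + 3 * dH v ≤ + 3 + + 2 * ι (big v)) → HasTrajectory Sc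
  trajectory {cS} P cS≤ = φ₁ , φ₂ , (St₁.φ′-proper , in-L₁) , (St₂.φ′-proper , in-L₂) ,
      δ₀-restr , (λ v h → sym (St₁.φ′-H v h)) , (λ v h → sym (St₂.φ′-H v h)) , St₁.late-step , St₂.late-step
    where
    open Plan P
    H₁ : LColOn hv L₁ δ₁
    H₁ = proj₁ (proj₂ δ-traj)
    H₂ : LColOn hv L₂ δ₂
    H₂ = proj₁ (proj₂ (proj₂ δ-traj))
    st₁ : StepOn hv δ₀ δ₁
    st₁ = proj₁ (proj₂ (proj₂ (proj₂ δ-traj)))
    st₂ : StepOn hv δ₁ δ₂
    st₂ = proj₂ (proj₂ (proj₂ (proj₂ δ-traj)))

    ext₁ : Fin n → Fin n → List ℕ
    ext₁ v u = φ₀ u ∷ δ₁ u ∷ (if S v then δ₂ u ∷ [] else [])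
    module G₁ = Greedy adjB adjB-sym V p t bnd p< φ₀ ext₁
    Q₁ : Fin n → ℕ → Set
    Q₁ v c = c ∈ L₁ v × (S v ≡ true → c ∈ L₂ v)

    ext₁-sum : ∀ v → sum (λ u → on (not (V u) ∧ adjB v u) (+ length (ext₁ v u))) ≡ (+ 2 + ι (S v)) * dH v
    ext₁-sum v = trans (sum-cong-≗ pt) (sum-scale (+ 2 + ι (S v)) _)
      where
      pt : ∀ u → on (not (V u) ∧ adjB v u) (+ length (ext₁ v u)) ≡ (+ 2 + ι (S v)) * ι (hv u ∧ adjB v u)
      pt u with hv u | adjB v u | S v
      ... | true | true | true = refl
      ... | true | true | false = refl
      ... | true | false | true = refl
      ... | true | false | false = refl
      ... | false | _ | true = refl
      ... | false | _ | false = refl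

    avail₁ : ∀ v → V v ≡ true → ∀ F → + length F ≡ G₁.budget v → ∃ λ c → c ∉ F × Q₁ v c
    avail₁ v hV F len = go (S v) refl
      where
      go : ∀ b → S v ≡ b → ∃ λ c → c ∉ F × Q₁ v c
      go false e = let (c , c∈ , c∉) = pick (L₁ v) F (ℤₚ.drop‿+≤+ (ℤₚ.≤-trans (ℤₚ.+-monoʳ-≤ 1ℤ small) five)) in
          c , c∉ , c∈ , λ s → ⊥-elim (false≢true e s)
        where
        ar : ∀ c k d → (k + (d + d)) - (c + (+ 2 + 0ℤ) * d) ≡ (k - c) + + 0
        ar = solve-∀
        ar′ : ∀ b d → + 4 + b - (d + d) + b + (d + d) ≡ + 4 + + 2 * b
        ar′ = solve-∀
        small : + length F ≤ + 4 + + 2 * ι (big v)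
        small = subst₂ _≤_ (sym (trans len (cong (λ x → cost p t V v + x) (trans (ext₁-sum v) (cong (λ b → (+ 2 + ι b) * dH v) e)))))
          (ar′ (ι (big v)) (dH v))
          (lin₁ 0 (step₁ v hV e) (ar (cost p t V v) (κ v + ι (big v)) (dH v)))
        five : 1ℤ + (+ 4 + + 2 * ι (big v)) ≤ + ∣ L₁ v ∣
        five = ℤₚ.≤-trans (ℤₚ.≤-reflexive (suc4 (ι (big v)))) (L₁-size v)
          where
          suc4 : ∀ b → 1ℤ + (+ 4 + + 2 * b) ≡ + 5 + + 2 * b
          suc4 = solve-∀
      go true e with any? (λ a → ¬? (DecMem._∈?_ ℕ._≟_ a (L₂ v))) (L₁ v)
      -- By (Ta) `a` is the only colour of the first list outside the second one; forbidding it
      -- makes the chosen colour suit both lists.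
      ... | yes w = let (c , c∈ , c∉) = pick (L₁ v) (a ∷ F) room in
          c , (λ m → c∉ (there m)) , c∈ , λ _ → inL₂ c c∈ (λ e → c∉ (here e))
        where
        a : ℕ
        a = proj₁ (find w)
        inL₂ : ∀ c → c ∈ L₁ v → c ≢ a → c ∈ L₂ v
        inL₂ c c∈ c≢ with DecMem._∈?_ ℕ._≟_ c (L₂ v)
        ... | yes m = m
        ... | no ¬m = ⊥-elim (c≢ (Ta-diff v c a c∈ ¬m (proj₁ (proj₂ (find w))) (proj₂ (proj₂ (find w)))))
        ar : ∀ c s d b → + 4 + + 2 * b - (1ℤ + (c + (+ 2 + 1ℤ) * d)) ≡ (s - c) + (+ 3 + + 2 * b - (s + + 3 * d)) + + 0
        ar = solve-∀
        suc5 : ∀ b → 1ℤ + (+ 4 + + 2 * b) ≡ + 5 + + 2 * b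
        suc5 = solve-∀
        room : suc (length F) ℕ.< ∣ L₁ v ∣
        room = ℤₚ.drop‿+≤+ (ℤₚ.≤-trans (ℤₚ.+-monoʳ-≤ 1ℤ (subst (λ x → 1ℤ + x ≤ + 4 + + 2 * ι (big v))
            (sym (trans len (cong (λ x → cost p t V v + x) (trans (ext₁-sum v) (cong (λ b → (+ 2 + ι b) * dH v) e)))))
            (lin₂ 0 (stepS v e) (cS≤ v (S-cap P v e)) (ar (cost p t V v) (cS v) (dH v) (ι (big v))))))
            (ℤₚ.≤-trans (ℤₚ.≤-reflexive (suc5 (ι (big v)))) (L₁-size v)))
      ... | no ¬w = let (c , c∈ , c∉) = pick (L₁ v) F room in c , c∉ , c∈ , λ _ → inL₂ c c∈
        where
        inL₂ : ∀ c → c ∈ L₁ v → c ∈ L₂ v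
        inL₂ c c∈ with DecMem._∈?_ ℕ._≟_ c (L₂ v)
        ... | yes m = m
        ... | no ¬m = ⊥-elim (¬w (lose c∈ ¬m))
        ar : ∀ c s d b → + 5 + + 2 * b - (1ℤ + (c + (+ 2 + 1ℤ) * d)) ≡ (s - c) + (+ 3 + + 2 * b - (s + + 3 * d)) + + 1
        ar = solve-∀
        room : length F ℕ.< ∣ L₁ v ∣
        room = ℤₚ.drop‿+≤+ (ℤₚ.≤-trans (subst (λ x → 1ℤ + x ≤ + 5 + + 2 * ι (big v))
            (sym (trans len (cong (λ x → cost p t V v + x) (trans (ext₁-sum v) (cong (λ b → (+ 2 + ι b) * dH v) e)))))
            (lin₂ 1 (stepS v e) (cS≤ v (S-cap P v e)) (ar (cost p t V v) (cS v) (dH v) (ι (big v))))) (L₁-size v))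

    opaque
      g₁ : G₁.Outcome Q₁
      g₁ = G₁.greedy Q₁ avail₁
    c₁ : Colouring
    c₁ = proj₁ g₁
    module C₁ (v : Fin n) (h : V v ≡ true) where
      q = proj₁ (proj₂ g₁ v h)
      early = proj₁ (proj₂ (proj₂ g₁ v h))
      late = proj₁ (proj₂ (proj₂ (proj₂ g₁ v h)))
      outer = proj₂ (proj₂ (proj₂ (proj₂ g₁ v h)))
    t≢₁ : ∀ u v → V u ≡ true → V v ≡ true → Adj u v → t u ≢ t v
    t≢₁ u v hu hv′ a = t≢ u v hu hv′ (Adj⇒adjB a)
    WW₁ : ∀ u v → V u ≡ true → V v ≡ true → Adj u v → c₁ u ≢ c₁ v
    WW₁ u v hu hv′ a e with ℕₚ.<-cmp (p u) (p v)
    ... | tri< l _ _ = C₁.early v hv′ u (Adj⇒adjB (Adj-sym a)) hu l (sym e)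
    ... | tri≈ _ q _ = p≢ u v hu hv′ (Adj⇒adjB a) q
    ... | tri> _ _ l = C₁.early u hu v (Adj⇒adjB a) hv′ l e
    WH₁ : ∀ u h → V u ≡ true → hv h ≡ true → Adj u h → c₁ u ≢ φ₀ h × c₁ u ≢ δ₁ h
    WH₁ u h hu hh a = (λ e → C₁.outer u hu h (Adj⇒adjB a) (cong not hh) (here e)) ,
                      (λ e → C₁.outer u hu h (Adj⇒adjB a) (cong not hh) (there (here e)))
    module St₁ = Steps.Step G hv φ₀ δ₀ δ₁ φ₀-proper δ₀-restr (proj₁ H₁) st₁ V (λ v h → V-not h) t c₁
      t≢₁ WW₁ (λ u v hu hv′ a l → C₁.late u hu v (Adj⇒adjB a) hv′ l)
      (λ u v _ hf hf′ → ⊥-elim (false≢true hf (V-yes hf′))) WH₁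
      (λ u h hf hf′ → ⊥-elim (false≢true hf (V-yes hf′)))
    φ₁ : Colouring
    φ₁ = St₁.φ′
    φ₁-V : ∀ v → hv v ≡ false → φ₁ v ≡ c₁ v
    φ₁-V v h rewrite h = refl
    in-L₁ : ∀ v → allV v ≡ true → φ₁ v ∈ L₁ v
    in-L₁ v _ with hv v in e
    ... | true = proj₂ H₁ v e
    ... | false = proj₁ (C₁.q v (V-yes e))

    W : VSet n
    W = V ∖ S
    W-V : ∀ {v} → W v ≡ true → V v ≡ true
    W-V h = proj₁ (∧-true h)
    W-S : ∀ {v} → W v ≡ true → S v ≡ false
    W-S {v} h = 𝔹ₚ.not-injective (proj₂ (∧-true {V v} h))
    notW : ∀ {v} → W v ≡ false → hv v ≡ false → S v ≡ true
    notW {v} hf h rewrite h with S v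
    ... | true = refl
    -- Outside `W` a resting neighbour shows one colour during the second step, a neighbour in `H`
    -- its old and its new one.
    ext₂ : Fin n → Fin n → List ℕ
    ext₂ v u = φ₁ u ∷ (if S u then [] else δ₂ u ∷ [])
    module G₂ = Greedy adjB adjB-sym W p t bnd p< φ₁ ext₂
    Q₂ : Fin n → ℕ → Set
    Q₂ v c = c ∈ L₂ v
    ext₂-sum : ∀ v → sum (λ u → on (not (W u) ∧ adjB v u) (+ length (ext₂ v u))) ≡ deg S v + (dH v + dH v)
    ext₂-sum v = trans (sum-cong-≗ pt) (trans (∑-distrib-+ _ _) (cong (λ x → deg S v + x) (∑-distrib-+ _ _)))
      where
      pt : ∀ u → on (not (W u) ∧ adjB v u) (+ length (ext₂ v u)) ≡ ι (S u ∧ adjB v u) + (ι (hv u ∧ adjB v u) + ι (hv u ∧ adjB v u))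
      pt u with hv u in eh | S u in es | adjB v u
      ... | true | true | _ = ⊥-elim (false≢true (V-not (S⊂ u es)) eh)
      ... | true | false | true = refl
      ... | true | false | false = refl
      ... | false | true | true = refl
      ... | false | true | false = refl
      ... | false | false | _ = refl
    avail₂ : ∀ v → W v ≡ true → ∀ F → + length F ≡ G₂.budget v → ∃ λ c → c ∉ F × Q₂ v c
    avail₂ v hW F len = let (c , c∈ , c∉) = pick (L₂ v) F room in c , c∉ , c∈
      where
      ar : ∀ c s d b → + 5 + b - (1ℤ + (c + (s + (d + d)))) ≡ (+ 4 + b - (d + d) - (c + s)) + + 0
      ar = solve-∀
      room : length F ℕ.< ∣ L₂ v ∣
      room = ℤₚ.drop‿+≤+ (ℤₚ.≤-trans (subst (λ x → 1ℤ + x ≤ + 5 + ι (big v))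
          (sym (trans len (cong (λ x → cost p t W v + x) (ext₂-sum v))))
          (lin₁ 0 (step₂ v (W-V hW) (W-S hW)) (ar (cost p t W v) (deg S v) (dH v) (ι (big v))))) (L₂-size v))
    opaque
      g₂ : G₂.Outcome Q₂
      g₂ = G₂.greedy Q₂ avail₂
    c₂ : Colouring
    c₂ = proj₁ g₂
    module C₂ (v : Fin n) (h : W v ≡ true) where
      q = proj₁ (proj₂ g₂ v h)
      early = proj₁ (proj₂ (proj₂ g₂ v h))
      late = proj₁ (proj₂ (proj₂ (proj₂ g₂ v h)))
      outer = proj₂ (proj₂ (proj₂ (proj₂ g₂ v h)))
    WW₂ : ∀ u v → W u ≡ true → W v ≡ true → Adj u v → c₂ u ≢ c₂ v
    WW₂ u v hu hv′ a e with ℕₚ.<-cmp (p u) (p v)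
    ... | tri< l _ _ = C₂.early v hv′ u (Adj⇒adjB (Adj-sym a)) hu l (sym e)
    ... | tri≈ _ q _ = p≢ u v (W-V hu) (W-V hv′) (Adj⇒adjB a) q
    ... | tri> _ _ l = C₂.early u hu v (Adj⇒adjB a) hv′ l e
    Wh : ∀ {h} → hv h ≡ true → W h ≡ false × S h ≡ false
    Wh {h} hh rewrite hh with S h in es
    ... | false = refl , refl
    ... | true = ⊥-elim (false≢true (V-not (S⊂ h es)) hh)
    WH₂ : ∀ u h → W u ≡ true → hv h ≡ true → Adj u h → c₂ u ≢ φ₁ h × c₂ u ≢ δ₂ h
    WH₂ u h hu hh a = (λ e → C₂.outer u hu h (Adj⇒adjB a) (proj₁ (Wh hh)) (here e)) ,
        (λ e → C₂.outer u hu h (Adj⇒adjB a) (proj₁ (Wh hh)) (there (subst (λ b → c₂ u ∈ (if b then [] else δ₂ h ∷ [])) (sym (proj₂ (Wh hh))) (here e))))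
    VH₂ : ∀ u h → W u ≡ false → hv u ≡ false → hv h ≡ true → Adj u h → φ₁ u ≢ δ₂ h
    VH₂ u h hf hf′ hh a e = C₁.outer u (V-yes hf′) h (Adj⇒adjB a) (cong not hh)
        (there (there (subst (λ b → c₁ u ∈ (if b then δ₂ h ∷ [] else [])) (sym (notW hf hf′)) (here (trans (sym (φ₁-V u hf′)) e)))))
    module St₂ = Steps.Step G hv φ₁ δ₁ δ₂ St₁.φ′-proper (λ v h → sym (St₁.φ′-H v h)) (proj₁ H₂) st₂ W
      (λ v h → V-not (W-V h)) t c₂ (λ u v hu hv′ a → t≢₁ u v (W-V hu) (W-V hv′) a)
      WW₂ (λ u v hu hv′ a l → C₂.late u hu v (Adj⇒adjB a) hv′ l)
      (λ u v hu hf hf′ a e → C₂.outer u hu v (Adj⇒adjB a) hf (here e)) WH₂ VH₂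
    φ₂ : Colouring
    φ₂ = St₂.φ′
    in-L₂ : ∀ v → allV v ≡ true → φ₂ v ∈ L₂ v
    in-L₂ v _ with hv v in e
    ... | true = proj₂ H₂ v e
    ... | false with S v in es
    ...   | true = proj₂ (C₁.q v (V-yes e)) es
    ...   | false = C₂.q v (cong₂ (λ a b → not a ∧ not b) e es)

-- Counting classes of generated equivalences, and orbits of permutations.

eqF-true : ∀ {n} {a b : Fin n} → eqF a b ≡ true → a ≡ b
eqF-true = ≟-true

eqF-false : ∀ {n} {a b : Fin n} → a ≢ b → eqF a b ≡ false
eqF-false {a = a} {b} h with a Fin.≟ b
... | yes e = ⊥-elim (h e)
... | no _ = refl

-- Classes of the equivalence relation generated by a list of pairs; each point is sent to a
-- representative of its class.
opaque
  cls : ∀ {N} → List (Fin N × Fin N) → Fin N → Fin N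
  cls [] x = x
  cls ((a , b) ∷ ps) x = if eqF (cls ps x) (cls ps b) then cls ps a else cls ps x

  cls-mono : ∀ {N} p (ps : List (Fin N × Fin N)) {x y} → cls ps x ≡ cls ps y → cls (p ∷ ps) x ≡ cls (p ∷ ps) y
  cls-mono (a , b) ps e rewrite e = refl

  cls-join : ∀ {N} {ps : List (Fin N × Fin N)} {a b} → (a , b) ∈ ps → cls ps a ≡ cls ps b
  cls-join {ps = (a , b) ∷ ps} (here refl) rewrite ≟-refl (cls ps b) with eqF (cls ps a) (cls ps b)
  ... | true = refl
  ... | false = refl
  cls-join {ps = p ∷ ps} (there m) = cls-mono p ps (cls-join m)

  -- The elimination rule for classes: two points are shown to be inequivalent by a function which
  -- respects all generating pairs but separates them.
  cls-inv : ∀ {N} {A : Set} (F : Fin N → A) (ps : List (Fin N × Fin N)) →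
            (∀ {a b} → (a , b) ∈ ps → F a ≡ F b) → ∀ x → F (cls ps x) ≡ F x
  cls-inv F [] h x = refl
  cls-inv F ((a , b) ∷ ps) h x with eqF (cls ps x) (cls ps b) in eq
  ... | false = cls-inv F ps (h ∘ there) x
  ... | true = trans (ih a) (trans (h (here refl)) (trans (sym (ih b)) (trans (cong F (sym (eqF-true eq))) (ih x))))
    where
    ih : ∀ x → F (cls ps x) ≡ F x
    ih = cls-inv F ps (h ∘ there)

cls-idem : ∀ {N} (ps : List (Fin N × Fin N)) x → cls ps (cls ps x) ≡ cls ps x
cls-idem ps x = cls-inv (cls ps) ps cls-join x

root : ∀ {N} → List (Fin N × Fin N) → Fin N → Bool
root ps x = eqF (cls ps x) x

roots : ∀ {N} → List (Fin N × Fin N) → ℤ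
roots ps = sum (λ x → ι (root ps x))

splits : ∀ {N} → List (Fin N × Fin N) → Fin N → Fin N → ℤ
splits ps a b = ι (not (eqF (cls ps a) (cls ps b)))

opaque
  unfolding cls
  -- Adding (a, b) redirects the class of `b` to the representative of `a`, so the only root that
  -- can disappear is that of `b`, and it does so exactly if the classes were different.
  roots-∷ : ∀ {N} a b (ps : List (Fin N × Fin N)) → roots ((a , b) ∷ ps) + splits ps a b ≡ roots ps
  roots-∷ {N} a b ps = trans (cong (λ x → roots ((a , b) ∷ ps) + x) (sym (sum-point (l b) (λ _ → splits ps a b))))
      (trans (sym (∑-distrib-+ _ _)) (sum-cong-≗ pt))
    where
    l : Fin N → Fin N
    l = cls ps
    pt : ∀ x → ι (root ((a , b) ∷ ps) x) + on ⌊ x Fin.≟ l b ⌋ (splits ps a b) ≡ ι (root ps x)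
    pt x with l x Fin.≟ l b
    pt x | yes e with x Fin.≟ l b
    ... | yes refl with l a Fin.≟ l b
    ...   | yes e′ = sym (cong ι (trans (cong (λ z → eqF z (l b)) (cls-idem ps b)) (≟-refl (l b))))
    ...   | no ¬e = sym (cong ι (trans (cong (λ z → eqF z (l b)) (cls-idem ps b)) (≟-refl (l b))))
    pt x | yes e | no x≢ = trans (ℤₚ.+-identityʳ _) (trans (cong ι (eqF-false la≢)) (sym (cong ι (eqF-false (λ e′ → x≢ (trans (sym e′) e))))))
      where
      la≢ : l a ≢ x
      la≢ e′ = x≢ (trans (sym e′) (trans (sym (cls-idem ps a)) (trans (cong l e′) e)))
    pt x | no ¬e with x Fin.≟ l b
    ... | yes refl = ⊥-elim (¬e (cls-idem ps b))
    ... | no _ = ℤₚ.+-identityʳ _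

  roots-[] : ∀ {N} → roots {N} [] ≡ sum {N} (λ _ → 1ℤ)
  roots-[] = sum-cong-≗ (λ x → cong ι (≟-refl x))

countB≡sum : ∀ {n} (p : Fin n → Bool) → + countB p ≡ sum (λ x → ι (p x))
countB≡sum {zero} p = sym (sum-[] _)
countB≡sum {suc n} p = trans (ℤₚ.pos-+ (if p fz then 1 else 0) _)
  (trans (cong₂ _+_ (bit (p fz)) (countB≡sum (p ∘ fs))) (sym (sum-∷ _)))
  where
  bit : ∀ b → + (if b then 1 else 0) ≡ ι b
  bit true = refl
  bit false = refl

sum-const : ∀ n → sum {n} (λ _ → 1ℤ) ≡ + n
sum-const zero = sum-[] _
sum-const (suc n) = trans (sum-∷ _) (cong (λ x → 1ℤ + x) (sum-const n))

sum-inject : ∀ {m n} (P : Fin m → Bool) (Q : Fin n → Bool) (f : ∀ x → P x ≡ true → Fin n) →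
  (∀ x h → Q (f x h) ≡ true) → (∀ x y h h′ → f x h ≡ f y h′ → x ≡ y) → sum (λ x → ι (P x)) ≤ sum (λ y → ι (Q y))
sum-inject {zero} P Q f hf inj = subst (_≤ sum (λ y → ι (Q y))) (sym (sum-[] _)) (sum-nonneg (λ y → 0≤ι (Q y)))
sum-inject {suc m} {n} P Q f hf inj = subst (_≤ sum (λ y → ι (Q y))) (sym (sum-∷ _)) (go (P fz) refl)
  where
  go : ∀ b → P fz ≡ b → ι (P fz) + sum (λ x → ι (P (fs x))) ≤ sum (λ y → ι (Q y))
  go false e = subst (λ b → ι b + sum (λ x → ι (P (fs x))) ≤ sum (λ y → ι (Q y))) (sym e)
    (subst (_≤ sum (λ y → ι (Q y))) (sym (ℤₚ.+-identityˡ _))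
      (sum-inject (P ∘ fs) Q (λ x h → f (fs x) h) (λ x h → hf (fs x) h) (λ x y h h′ e → Finₚ.suc-injective (inj _ _ h h′ e))))
  go true e = subst₂ _≤_ (cong (_+ sum (λ x → ι (P (fs x)))) (sym (cong ι e))) fin
      (ℤₚ.+-monoʳ-≤ 1ℤ (sum-inject (P ∘ fs) Q′ (λ x h → f (fs x) h) hf′ (λ x y h h′ e → Finₚ.suc-injective (inj _ _ h h′ e))))
    where
    y₀ : Fin n
    y₀ = f fz e
    Q′ : Fin n → Bool
    Q′ y = Q y ∧ not ⌊ y Fin.≟ y₀ ⌋
    hf′ : ∀ x h → Q′ (f (fs x) h) ≡ true
    hf′ x h with f (fs x) h Fin.≟ y₀
    ... | yes e′ with inj (fs x) fz h e e′
    ...   | ()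
    hf′ x h | no _ = trans (𝔹ₚ.∧-identityʳ _) (hf (fs x) h)
    fin : 1ℤ + sum (λ y → ι (Q′ y)) ≡ sum (λ y → ι (Q y))
    fin = trans (cong (_+ sum (λ y → ι (Q′ y))) (sym (sum-point y₀ (λ _ → 1ℤ)))) (trans (sym (∑-distrib-+ _ _)) (sum-cong-≗ pt))
      where
      pt : ∀ y → on ⌊ y Fin.≟ y₀ ⌋ 1ℤ + ι (Q′ y) ≡ ι (Q y)
      pt y with y Fin.≟ y₀
      ... | yes refl rewrite hf fz e = refl
      ... | no _ = trans (ℤₚ.+-identityˡ _) (cong ι (𝔹ₚ.∧-identityʳ (Q y)))

iter-+ : ∀ {A : Set} (f : A → A) i j x → iter f (i ℕ.+ j) x ≡ iter f i (iter f j x)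
iter-+ f zero j x = refl
iter-+ f (suc i) j x = cong f (iter-+ f i j x)

iter-suc : ∀ {A : Set} (f : A → A) i x → iter f (suc i) x ≡ iter f i (f x)
iter-suc f zero x = refl
iter-suc f (suc i) x = cong f (iter-suc f i x)

module Cyclic {k : ℕ} (f : Fin k → Fin k) (inj : Injective _≡_ _≡_ f) where
  iter-inj : ∀ i {x y} → iter f i x ≡ iter f i y → x ≡ y
  iter-inj zero e = e
  iter-inj (suc i) e = iter-inj i (inj e)

  period : ∀ d → ∃ λ m → m ℕ.< k × iter f (suc m) d ≡ d
  period d with Finₚ.pigeonhole (ℕₚ.n<1+n k) (λ i → iter f (Fin.toℕ i) d)
  ... | i , j , i<j , e = m , m<k , iter-inj (Fin.toℕ i) (trans (sym (iter-+ f (Fin.toℕ i) (suc m) d))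
        (trans (cong (λ x → iter f x d) ij) (sym e)))
    where
    m : ℕ
    m = Fin.toℕ j ℕ.∸ suc (Fin.toℕ i)
    ij : Fin.toℕ i ℕ.+ suc m ≡ Fin.toℕ j
    ij = trans (ℕₚ.+-suc (Fin.toℕ i) m) (ℕₚ.m+[n∸m]≡n i<j)
    m<k : m ℕ.< k
    m<k = ℕₚ.≤-trans (ℕₚ.≤-trans (ℕₚ.m≤n+m (suc m) (Fin.toℕ i)) (ℕₚ.≤-reflexive ij)) (ℕₚ.≤-pred (Finₚ.toℕ<n j))

  back : Fin k → Fin k
  back d = iter f (proj₁ (period d)) d

  f-back : ∀ d → f (back d) ≡ d
  f-back d = proj₂ (proj₂ (period d))

  back-f : ∀ d → back (f d) ≡ d
  back-f d = inj (f-back (f d))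

  perm : Perm.Permutation k k
  perm = Perm.permutation f back f-back back-f

  sum-perm : ∀ (g : Fin k → ℤ) → sum (λ x → g (f x)) ≡ sum g
  sum-perm g = trans (sum≡std (λ x → g (f x))) (trans (sym (Std.sum-permute g perm)) (sym (sum≡std g)))

  iter-period : ∀ m d → iter f (suc m) d ≡ d → ∀ q → iter f (q ℕ.* suc m) d ≡ d
  iter-period m d e zero = refl
  iter-period m d e (suc q) = trans (iter-+ f (suc m) (q ℕ.* suc m) d) (trans (cong (iter f (suc m)) (iter-period m d e q)) e)

  -- `orbitB` inspects only the first `k` iterates; reducing the exponent modulo the period, which
  -- is at most `k`, shows that these suffice.
  reach-short : ∀ d i → ∃ λ (j : Fin k) → iter f (Fin.toℕ j) d ≡ iter f i d
  reach-short d i with period d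
  ... | m , m<k , e = Fin.fromℕ< r<k , trans (cong (λ x → iter f x d) (Finₚ.toℕ-fromℕ< r<k)) (sym eq)
    where
    open import Data.Nat.DivMod using (_%_; _/_; m%n<n; m≡m%n+[m/n]*n)
    r<k : i % suc m ℕ.< k
    r<k = ℕₚ.<-≤-trans (m%n<n i (suc m)) m<k
    eq : iter f i d ≡ iter f (i % suc m) d
    eq = trans (cong (λ x → iter f x d) (m≡m%n+[m/n]*n i (suc m)))
      (trans (iter-+ f (i % suc m) _ d) (cong (iter f (i % suc m)) (iter-period m d e (i / suc m))))

allF-true : ∀ {n} (p : Fin n → Bool) → allF p ≡ true → ∀ i → p i ≡ true
allF-true p h fz = proj₁ (∧-true h)
allF-true p h (fs i) = allF-true (p ∘ fs) (proj₂ (∧-true {p fz} h)) i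

allF-intro : ∀ {n} (p : Fin n → Bool) → (∀ i → p i ≡ true) → allF p ≡ true
allF-intro {zero} p h = refl
allF-intro {suc n} p h = cong₂ _∧_ (h fz) (allF-intro (p ∘ fs) (h ∘ fs))

leF-true : ∀ {n} {a b : Fin n} → leF a b ≡ true → Fin.toℕ a ℕ.≤ Fin.toℕ b
leF-true {a = a} {b} h with Fin.toℕ a ℕ.≤? Fin.toℕ b
... | yes p = p

leF-intro : ∀ {n} {a b : Fin n} → Fin.toℕ a ℕ.≤ Fin.toℕ b → leF a b ≡ true
leF-intro {a = a} {b} h with Fin.toℕ a ℕ.≤? Fin.toℕ b
... | yes p = refl
... | no ¬p = ⊥-elim (¬p h)

opaque
  least : ∀ {n} (P : Fin n → Bool) x → P x ≡ true →
          ∃ λ y → P y ≡ true × (∀ z → P z ≡ true → Fin.toℕ y ℕ.≤ Fin.toℕ z)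
  least {suc n} P x h with P fz in e
  ... | true = fz , e , λ _ _ → ℕ.z≤n
  least {suc n} P fz h | false = ⊥-elim (false≢true e h)
  least {suc n} P (fs x) h | false with least (P ∘ fs) x h
  ... | y , hy , min = fs y , hy , λ where
    fz hz → ⊥-elim (false≢true e hz)
    (fs z) hz → ℕ.s≤s (min z hz)

implies : ∀ {a b} → not a ∨ b ≡ true → a ≡ true → b ≡ true
implies {true} h _ = h

implies-intro : ∀ {a b} → (a ≡ true → b ≡ true) → not a ∨ b ≡ true
implies-intro {true} h = h refl
implies-intro {false} h = refl

∨-true : ∀ {a b} → a ∨ b ≡ true → a ≡ true ⊎ b ≡ true
∨-true {true} _ = inj₁ refl
∨-true {false} h = inj₂ h

∨-inʳ : ∀ a {b} → b ≡ true → a ∨ b ≡ true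
∨-inʳ true _ = refl
∨-inʳ false h = h

opaque
  sel : ∀ {k} → (Fin k → Bool) → List (Fin k)
  sel Q = filter (λ d → Q d 𝔹.≟ true) (allFin _)

  length-sel : ∀ {k} (Q : Fin k → Bool) → + length (sel Q) ≡ sum (λ d → ι (Q d))
  length-sel Q = trans (cong +_ (go Q (λ x → x))) (countB≡sum Q)
    where
    go : ∀ {k m} (Q : Fin m → Bool) (f : Fin k → Fin m) →
         length (filter (λ d → Q d 𝔹.≟ true) (tabulate f)) ≡ countB (Q ∘ f)
    go {zero} Q f = refl
    go {suc k} Q f with Q (f fz)
    ... | true = cong suc (go Q (f ∘ fs))
    ... | false = go Q (f ∘ fs)

  ∈-sel : ∀ {k} (Q : Fin k → Bool) {d} → Q d ≡ true → d ∈ sel Q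
  ∈-sel Q {d} h = ∈-filter⁺ (λ d → Q d 𝔹.≟ true) (∈-allFin d) h

  sel-∈ : ∀ {k} (Q : Fin k → Bool) {d} → d ∈ sel Q → Q d ≡ true
  sel-∈ {k} Q h = proj₂ (∈-filter⁻ (λ d → Q d 𝔹.≟ true) {xs = allFin k} h)

count-list : ∀ {k} (Q : Fin k → Bool) xs → Unique xs → All (λ d → Q d ≡ true) xs → + length xs ≤ sum (λ d → ι (Q d))
count-list Q xs u a = subst (+ length xs ≤_) (length-sel Q) (+≤+ (unique⊆⇒length≤ u (λ m → ∈-sel Q (All.lookup a m))))

opaque
  first : ∀ (Q : ℕ → Bool) m → Q m ≡ true → ∃ λ j → j ℕ.≤ m × Q j ≡ true × (∀ i → i ℕ.< j → Q i ≡ false)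
  first Q m h with Q 0 in e
  ... | true = 0 , ℕ.z≤n , e , λ _ ()
  first Q zero h | false = ⊥-elim (false≢true e h)
  first Q (suc m) h | false with first (Q ∘ suc) m h
  ... | j , j≤ , hj , min = suc j , ℕ.s≤s j≤ , hj , λ where
    zero _ → e
    (suc i) (ℕ.s≤s l) → min i l

-- Components and faces of a plane map; Euler's formula for subgraphs.

module Plane (G : PlaneGraph) where
  open PlaneGraph G
  open Adjacency G
  open Graph adjB adjB-sym

  -- Connectivity.
  reach-in : ∀ t u v x → reachB t u x ≡ true → Adj x v → reachB (suc t) u v ≡ true
  reach-in t u v x h a = ∨-inʳ (reachB t u v) (anyF-intro _ x (cong₂ _∧_ h (Adj⇒adjB a)))

  reach-out : ∀ t u v → reachB (suc t) u v ≡ true → (reachB t u v ≡ true) ⊎ (∃ λ x → reachB t u x ≡ true × Adj x v)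
  reach-out t u v h with ∨-true {reachB t u v} h
  ... | inj₁ r = inj₁ r
  ... | inj₂ r with anyF-true _ r
  ...   | x , e = inj₂ (x , proj₁ (∧-true e) , adjB⇒Adj (proj₂ (∧-true {reachB t u x} e)))

  reach-up : ∀ t u v → reachB t u v ≡ true → reachB (suc t) u v ≡ true
  reach-up t u v h rewrite h = refl

  Stable : ℕ → Fin n → Set
  Stable t u = ∀ v → reachB (suc t) u v ≡ true → reachB t u v ≡ true

  stable-suc : ∀ t u → Stable t u → Stable (suc t) u
  stable-suc t u s v h with reach-out (suc t) u v h
  ... | inj₁ r = r
  ... | inj₂ (x , r , a) = reach-in t u v x (s x r) a

  -- Each round that is not yet stable reaches a new vertex, so `n` rounds exhaust the component.
  grow : ∀ u t → (suc t ℕ.≤ countB (reachB t u)) ⊎ Stable t u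
  grow u zero = inj₁ (ℕₚ.≤-trans (ℕ.s≤s ℕ.z≤n) (countB-strict {X = λ _ → false} {reachB zero u} (λ _ ()) u (≟-refl u) refl))
  grow u (suc t) with grow u t
  ... | inj₂ s = inj₂ (stable-suc t u s)
  ... | inj₁ c with Finₚ.any? (λ v → (reachB (suc t) u v 𝔹.≟ true) ×-dec (reachB t u v 𝔹.≟ false))
  ...   | yes (v , h , h′) = inj₁ (ℕₚ.≤-<-trans c (countB-strict {X = reachB t u} {reachB (suc t) u} (reach-up t u) v h h′))
  ...   | no ¬p = inj₂ (stable-suc t u s)
    where
    s : Stable t u
    s v h with reachB t u v 𝔹.≟ true
    ... | yes r = r
    ... | no ¬r = ⊥-elim (¬p (v , h , 𝔹ₚ.¬-not ¬r))

  countB≤n : ∀ {m} (p : Fin m → Bool) → countB p ℕ.≤ m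
  countB≤n {zero} p = ℕ.z≤n
  countB≤n {suc m} p with p fz
  ... | true = ℕ.s≤s (countB≤n (p ∘ fs))
  ... | false = ℕₚ.m≤n⇒m≤1+n (countB≤n (p ∘ fs))

  stable-n : ∀ u → Stable n u
  stable-n u with grow u n
  ... | inj₁ c = ⊥-elim (ℕₚ.<⇒≱ c (countB≤n (reachB n u)))
  ... | inj₂ s = s

  same-refl : ∀ u → SameComp u u
  same-refl u = go n
    where
    go : ∀ t → reachB t u u ≡ true
    go zero = ≟-refl u
    go (suc t) = reach-up t u u (go t)

  same-adj : ∀ {u x v} → SameComp u x → Adj x v → SameComp u v
  same-adj {u} {x} {v} h a = stable-n u v (reach-in n u v x h a)

  same-ind : ∀ {u} (P : Fin n → Set) → P u → (∀ x v → P x → Adj x v → P v) → ∀ {v} → SameComp u v → P v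
  same-ind {u} P pu st {v} h = go n v h
    where
    go : ∀ t v → reachB t u v ≡ true → P v
    go zero v h = subst P (eqF-true h) pu
    go (suc t) v h with reach-out t u v h
    ... | inj₁ r = go t v r
    ... | inj₂ (x , r , a) = st x v (go t x r) a

  same-trans : ∀ {u v w} → SameComp u v → SameComp v w → SameComp u w
  same-trans {u} h h′ = same-ind (SameComp u) h (λ x v → same-adj) h′

  private
    Adj-sym : ∀ {u v} → Adj u v → Adj v u
    Adj-sym (d , e , e′) = α d , e′ , trans (cong vert (α-invol d)) e

  same-sym : ∀ {u v} → SameComp u v → SameComp v u
  same-sym {u} = same-ind (λ v → SameComp v u) (same-refl u) (λ x v h a → same-trans (same-adj (same-refl v) (Adj-sym a)) h)

  opaque
    compRep : ∀ v → ∃ λ r → compRepB r ≡ true × SameComp v r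
    compRep v with least (λ u → reachB n v u) v (same-refl v)
    ... | r , hr , min = r , allF-intro _ (λ u → implies-intro {reachB n u r} (λ h → leF-intro (min u (same-trans hr (same-sym h))))) , hr

  compRep-unique : ∀ {r s} → compRepB r ≡ true → compRepB s ≡ true → SameComp r s → r ≡ s
  compRep-unique {r} {s} hr hs h = Finₚ.toℕ-injective (ℕₚ.≤-antisym
    (leF-true (implies {reachB n s r} (allF-true _ hr s) (same-sym h))) (leF-true (implies {reachB n r s} (allF-true _ hs r) h)))

  -- Faces.
  α-inj : Injective _≡_ _≡_ α
  α-inj {d} {e} h = trans (sym (α-invol d)) (trans (cong α h) (α-invol e))

  φ-inj : Injective _≡_ _≡_ φ
  φ-inj h = α-inj (σ-inj h)

  φ-vert : ∀ d → vert (φ d) ≡ vert (α d)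
  φ-vert d = σ-vert (α d)

  φ-α : ∀ d → φ (α d) ≡ σ d
  φ-α d = cong σ (α-invol d)

  module Φ = Cyclic φ φ-inj
  module Σ′ = Cyclic σ σ-inj
  module A′ = Cyclic α α-inj

  orbit-intro : ∀ d i → orbitB d (iter φ i d) ≡ true
  orbit-intro d i with Φ.reach-short d i
  ... | j , e = anyF-intro _ j (trans (cong (λ x → eqF x (iter φ i d)) e) (≟-refl (iter φ i d)))

  orbit-elim : ∀ {d e} → orbitB d e ≡ true → ∃ λ i → iter φ i d ≡ e
  orbit-elim {d} {e} h with anyF-true (λ (j : Fin k) → eqF (iter φ (Fin.toℕ j) d) e) h
  ... | j , e = Fin.toℕ j , eqF-true e

  orbit-φ : ∀ d e → orbitB d e ≡ orbitB d (φ e)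
  orbit-φ d e with orbitB d e in h | orbitB d (φ e) in h′
  ... | true | true = refl
  ... | false | false = refl
  ... | true | false with orbit-elim {d} {e} h
  ...   | i , refl = ⊥-elim (false≢true h′ (orbit-intro d (suc i)))
  orbit-φ d e | false | true with orbit-elim {d} {φ e} h′
  ... | suc i , q with φ-inj q
  ...   | refl = ⊥-elim (false≢true h (orbit-intro d i))
  orbit-φ d e | false | true | zero , q with Φ.period d
  ... | m , _ , q′ = ⊥-elim (false≢true h (subst (λ x → orbitB d x ≡ true) (φ-inj (trans q′ q)) (orbit-intro d m)))

  faceP : List (Fin k × Fin k)
  faceP = map (λ d → (d , φ d)) (allFin k)

  -- `prim A` joins vertices along the edges in `A`. `dual B` joins darts along facial walks and
  -- across the edges in `B`, so its classes are the components of the dual graph with edge set `B`: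
  -- the regions into which faces merge when `B` is deleted.
  prim dual : List (Fin k) → List _
  prim = map (λ d → (vert d , vert (α d)))
  dual B = map (λ d → (d , α d)) B ++ faceP

  cP : List (Fin k) → Fin n → Fin n
  cP A = cls (prim A)

  cD : List (Fin k) → Fin k → Fin k
  cD B = cls (dual B)

  cD-φ : ∀ B d → cD B d ≡ cD B (φ d)
  cD-φ B d = cls-join (∈-++⁺ʳ (map (λ d → (d , α d)) B) (∈-map⁺ (λ d → (d , φ d)) (∈-allFin d)))

  cD-iter : ∀ B i d → cD B d ≡ cD B (iter φ i d)
  cD-iter B zero d = refl
  cD-iter B (suc i) d = trans (cD-iter B i d) (cD-φ B (iter φ i d))

  cD-orbit : ∀ B {d e} → orbitB d e ≡ true → cD B d ≡ cD B e
  cD-orbit B {d} {e} h with orbit-elim {d} {e} h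
  ... | i , refl = cD-iter B i d

  Has : List (Fin k) → Fin k → Set
  Has xs d = d ∈ xs ⊎ α d ∈ xs

  cD-α : ∀ {B d} → Has B d → cD B d ≡ cD B (α d)
  cD-α (inj₁ m) = cls-join (∈-++⁺ˡ (∈-map⁺ (λ d → (d , α d)) m))
  cD-α {B} {d} (inj₂ m) = sym (trans (cls-join (∈-++⁺ˡ (∈-map⁺ (λ d → (d , α d)) m))) (cong (cD B) (α-invol d)))

  cP-α : ∀ {A d} → Has A d → cP A (vert d) ≡ cP A (vert (α d))
  cP-α (inj₁ m) = cls-join (∈-map⁺ (λ d → (vert d , vert (α d))) m)
  cP-α {A} {d} (inj₂ m) = sym (trans (cls-join (∈-map⁺ (λ d → (vert d , vert (α d))) m)) (cong (cP A ∘ vert) (α-invol d)))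

  cD-elim : ∀ {C : Set} (F : Fin k → C) B → (∀ d → F d ≡ F (φ d)) → (∀ d → d ∈ B → F d ≡ F (α d)) → ∀ x → F (cD B x) ≡ F x
  cD-elim F B hφ hα = cls-inv F (dual B) step
    where
    step : ∀ {a b} → (a , b) ∈ dual B → F a ≡ F b
    step m with ∈-++⁻ (map (λ d → (d , α d)) B) m
    ... | inj₁ m′ with ∈-map⁻ (λ d → (d , α d)) m′
    ...   | d , d∈ , refl = hα d d∈
    step m | inj₂ m′ with ∈-map⁻ (λ d → (d , φ d)) m′
    ... | d , _ , refl = hφ d

  -- A primal bridge is a dual loop: the walks around the faces of W leave one side of the
  -- bridge as often as they enter it, and all other edges of the cut have both sides in W or none.
  bridge : ∀ A x B → (∀ d → Has A d ⊎ (d ≡ x ⊎ α d ≡ x) ⊎ Has B d) →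
           cP A (vert x) ≢ cP A (vert (α x)) → cD B x ≡ cD B (α x)
  bridge A x B cover apart with cD B x Fin.≟ cD B (α x)
  ... | yes e = e
  ... | no ¬e = ⊥-elim (contra total)
    where
    W : Fin k → Bool
    W d = eqF (cD B d) (cD B x)
    U : Fin n → Bool
    U v = eqF (cP A v) (cP A (vert x))
    g h : Fin k → ℤ
    g d = on (W d) (ι (U (vert d)))
    h d = g (φ d) - g d
    Σh : sum h ≡ 0ℤ
    Σh = trans (sum-sub (g ∘ φ) g) (trans (cong (_- sum g) (Φ.sum-perm g)) (ℤₚ.+-inverseʳ (sum g)))
    h≡ : ∀ d → h d ≡ on (W d) (ι (U (vert (α d))) - ι (U (vert d)))
    h≡ d rewrite sym (cD-φ B d) | φ-vert d with W d
    ... | true = refl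
    ... | false = refl
    Wx : W x ≡ true
    Wx = ≟-refl _
    Wαx : W (α x) ≡ false
    Wαx = eqF-false (λ e → ¬e (sym e))
    Ux : U (vert x) ≡ true
    Ux = ≟-refl _
    Uαx : U (vert (α x)) ≡ false
    Uαx = eqF-false (λ e → apart (sym e))
    pair : ∀ d → h d + h (α d) ≡ on ⌊ d Fin.≟ x ⌋ -1ℤ + on ⌊ d Fin.≟ α x ⌋ -1ℤ
    pair d with d Fin.≟ x | d Fin.≟ α x
    ... | yes refl | yes e = ⊥-elim (α-nofix x (sym e))
    ... | yes refl | no _ rewrite h≡ x | h≡ (α x) | Wx | Wαx | Ux | Uαx = refl
    ... | no _ | yes refl rewrite h≡ (α x) | h≡ (α (α x)) | α-invol x | Wx | Wαx | Ux | Uαx = refl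
    ... | no ¬x | no ¬αx rewrite h≡ d | h≡ (α d) | α-invol d with cover d
    ...   | inj₁ a rewrite sym (cP-α {A} {d} a) | ℤₚ.+-inverseʳ (ι (U (vert d))) with W d | W (α d)
    ...     | true | true = refl
    ...     | true | false = refl
    ...     | false | true = refl
    ...     | false | false = refl
    pair d | no ¬x | no ¬αx | inj₂ (inj₁ (inj₁ e)) = ⊥-elim (¬x e)
    pair d | no ¬x | no ¬αx | inj₂ (inj₁ (inj₂ e)) = ⊥-elim (¬αx (trans (sym (α-invol d)) (cong α e)))
    pair d | no ¬x | no ¬αx | inj₂ (inj₂ b) rewrite sym (cD-α {B} {d} b) with W d
    ... | true = ar (ι (U (vert (α d)))) (ι (U (vert d)))
      where
      ar : ∀ a b → a - b + (b - a) ≡ 0ℤ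
      ar = solve-∀
    ... | false = refl
    total : 0ℤ ≡ - + 2
    total = begin
      0ℤ                                      ≡⟨ cong₂ _+_ Σh (trans (A′.sum-perm h) Σh) ⟨
      sum h + sum (h ∘ α)                     ≡⟨ ∑-distrib-+ h (h ∘ α) ⟨
      sum (λ d → h d + h (α d))               ≡⟨ sum-cong-≗ pair ⟩
      sum (λ d → on ⌊ d Fin.≟ x ⌋ -1ℤ + on ⌊ d Fin.≟ α x ⌋ -1ℤ) ≡⟨ ∑-distrib-+ _ _ ⟩
      sum (λ d → on ⌊ d Fin.≟ x ⌋ -1ℤ) + sum (λ d → on ⌊ d Fin.≟ α x ⌋ -1ℤ)
        ≡⟨ cong₂ _+_ (sum-point x (λ _ → -1ℤ)) (sum-point (α x) (λ _ → -1ℤ)) ⟩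
      - + 2 ∎
      where open ≡-Reasoning
    contra : 0ℤ ≡ - + 2 → ⊥
    contra ()

  -- Moving an edge from the primal to the dual side never decreases Φ, and by Euler's formula the
  -- two extreme values agree; hence Φ is constant.
  rP rD : List (Fin k) → ℤ
  rP A = roots (prim A)
  rD B = roots (dual B)

  Cover : List (Fin k) → List (Fin k) → Set
  Cover A B = ∀ d → Has A d ⊎ Has B d

  Φ[_,_] : List (Fin k) → List (Fin k) → ℤ
  Φ[ A , B ] = rD B - rP A - + length A

  -- The value changes by 1 - r - s, where r and s tell whether `x` joins two primal or two dual
  -- classes; by `bridge` it cannot do both.
  move : ∀ A x B → Cover (x ∷ A) B → Φ[ x ∷ A , B ] ≤ Φ[ A , x ∷ B ]
  move A x B cover = lin₁ 0 r+s≤1 (trans (cong₂ (λ a b → (rD (x ∷ B) - a - + length A) - (b - rP (x ∷ A) - + length (x ∷ A)))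
        (sym (roots-∷ (vert x) (vert (α x)) (prim A))) (sym (roots-∷ x (α x) (dual B))))
      (trans (cong (λ l → rD (x ∷ B) - (rP (x ∷ A) + r) - + length A - (rD (x ∷ B) + s - rP (x ∷ A) - l)) (ℤₚ.pos-+ 1 (length A)))
      (ar (rD (x ∷ B)) (rP (x ∷ A)) (+ length A) r s)))
    where
    r s : ℤ
    r = splits (prim A) (vert x) (vert (α x))
    s = splits (dual B) x (α x)
    ar : ∀ D P l r s → D - (P + r) - l - (D + s - P - (1ℤ + l)) ≡ (1ℤ - (r + s)) + + 0
    ar = solve-∀
    cover′ : ∀ d → Has A d ⊎ (d ≡ x ⊎ α d ≡ x) ⊎ Has B d
    cover′ d with cover d
    ... | inj₂ b = inj₂ (inj₂ b)
    ... | inj₁ (inj₁ (here e)) = inj₂ (inj₁ (inj₁ e))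
    ... | inj₁ (inj₁ (there m)) = inj₁ (inj₁ m)
    ... | inj₁ (inj₂ (here e)) = inj₂ (inj₁ (inj₂ e))
    ... | inj₁ (inj₂ (there m)) = inj₁ (inj₂ m)
    r+s≤1 : r + s ≤ 1ℤ
    r+s≤1 with cP A (vert x) Fin.≟ cP A (vert (α x)) | cD B x Fin.≟ cD B (α x)
    ... | yes _ | yes _ = +≤+ ℕ.z≤n
    ... | yes _ | no _ = ℤₚ.≤-refl
    ... | no _ | yes _ = ℤₚ.≤-refl
    ... | no p | no q = ⊥-elim (q (bridge A x B cover′ p))

  cover-shift : ∀ A x B → Cover A (x ∷ B) → Cover (x ∷ A) B
  cover-shift A x B c d with c d
  ... | inj₁ (inj₁ m) = inj₁ (inj₁ (there m))
  ... | inj₁ (inj₂ m) = inj₁ (inj₂ (there m))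
  ... | inj₂ (inj₁ (here e)) = inj₁ (inj₁ (here e))
  ... | inj₂ (inj₁ (there m)) = inj₂ (inj₁ m)
  ... | inj₂ (inj₂ (here e)) = inj₁ (inj₂ (here e))
  ... | inj₂ (inj₂ (there m)) = inj₂ (inj₂ m)

  cover-unshift : ∀ A x B → Cover (x ∷ A) B → Cover A (x ∷ B)
  cover-unshift A x B c d with c d
  ... | inj₂ (inj₁ m) = inj₂ (inj₁ (there m))
  ... | inj₂ (inj₂ m) = inj₂ (inj₂ (there m))
  ... | inj₁ (inj₁ (here e)) = inj₂ (inj₁ (here e))
  ... | inj₁ (inj₁ (there m)) = inj₁ (inj₁ m)
  ... | inj₁ (inj₂ (here e)) = inj₂ (inj₂ (here e))
  ... | inj₁ (inj₂ (there m)) = inj₁ (inj₂ m)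

  all-primal : ∀ B A → Cover A B → Φ[ B ʳ++ A , [] ] ≤ Φ[ A , B ]
  all-primal [] A c = ℤₚ.≤-refl
  all-primal (x ∷ B) A c = ℤₚ.≤-trans (all-primal B (x ∷ A) (cover-shift A x B c)) (move A x B (cover-shift A x B c))

  all-dual : ∀ A B → Cover A B → Φ[ A , B ] ≤ Φ[ [] , A ʳ++ B ]
  all-dual [] B c = ℤₚ.≤-refl
  all-dual (x ∷ A) B c = ℤₚ.≤-trans (move A x B c) (all-dual A (x ∷ B) (cover-unshift A x B c))

  isolated-alone : ∀ {v u} → isolatedB v ≡ true → SameComp v u → u ≡ v
  isolated-alone {v} iso = same-ind (_≡ v) refl step
    where
    step : ∀ x w → x ≡ v → Adj x w → w ≡ v
    step x w refl (d , refl , _) = ⊥-elim (false≢true (𝔹ₚ.not-injective iso) (anyF-intro (λ d → eqF (vert d) v) d (≟-refl v)))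

  dart-not-isolated : ∀ d → isolatedB (vert d) ≡ false
  dart-not-isolated d = cong not (anyF-intro (λ e → eqF (vert e) (vert d)) d (≟-refl (vert d)))

  isolated-rep : ∀ v → isolatedB v ≡ true → compRepB v ≡ true
  isolated-rep v iso = allF-intro _ (λ u → implies-intro {reachB n u v} (λ h →
    leF-intro (ℕₚ.≤-reflexive (cong Fin.toℕ (sym (isolated-alone iso (same-sym h)))))))

  faces≤ : + numFaces ≤ rD []
  faces≤ = subst (_≤ rD []) (sym (countB≡sum faceRepB)) (sum-inject faceRepB (root (dual [])) (λ d _ → cD [] d)
      (λ d _ → trans (cong (λ z → eqF z (cD [] d)) (cls-idem (dual []) d)) (≟-refl _)) inj)
    where
    same : ∀ d e → cD [] d ≡ cD [] e → orbitB d e ≡ true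
    same d e h = trans (trans (sym (F e)) (trans (cong (orbitB d) (sym h)) (F d))) (orbit-intro d 0)
      where
      F : ∀ x → orbitB d (cD [] x) ≡ orbitB d x
      F = cD-elim (orbitB d) [] (orbit-φ d) (λ _ ())
    inj : ∀ d e (h : faceRepB d ≡ true) (h′ : faceRepB e ≡ true) → cD [] d ≡ cD [] e → d ≡ e
    inj d e h h′ q = Finₚ.toℕ-injective (ℕₚ.≤-antisym
      (leF-true (implies {orbitB d e} (allF-true _ h e) (same d e q)))
      (leF-true (implies {orbitB e d} (allF-true _ h′ d) (same e d (sym q)))))

  module _ (E : List (Fin k)) (cover : ∀ d → Has E d) where
    comps≤ : rP E ≤ + numComp
    comps≤ = subst (rP E ≤_) (sym (countB≡sum compRepB)) (sum-inject (root (prim E)) compRepB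
        (λ v _ → proj₁ (compRep v)) (λ v _ → proj₁ (proj₂ (compRep v))) inj)
      where
      same : ∀ {u v} → SameComp u v → cP E u ≡ cP E v
      same {u} = same-ind (λ v → cP E u ≡ cP E v) refl step
        where
        step : ∀ x v → cP E u ≡ cP E x → Adj x v → cP E u ≡ cP E v
        step x v h (d , refl , refl) = trans h (cP-α (cover d))
      inj : ∀ u v (h : root (prim E) u ≡ true) (h′ : root (prim E) v ≡ true) → proj₁ (compRep u) ≡ proj₁ (compRep v) → u ≡ v
      inj u v h h′ q = trans (sym (eqF-true h)) (trans (same (same-trans (proj₂ (proj₂ (compRep u)))
        (subst (λ r → SameComp r v) (sym q) (same-sym (proj₂ (proj₂ (compRep v))))))) (eqF-true h′))

    -- If all edges may be crossed, turning around a vertex never leaves the class, and neither does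
    -- passing from a dart to its reverse.
    comp-class : ∀ {d e} → SameComp (vert d) (vert e) → cD E d ≡ cD E e
    comp-class {d} {e} h = same-ind (λ v → ∀ e → vert e ≡ v → cD E d ≡ cD E e) (λ e q → at d e (sym q)) step h e refl
      where
      turn : ∀ i d → cD E d ≡ cD E (iter σ i d)
      turn zero d = refl
      turn (suc i) d = trans (turn i d) (trans (cD-α (cover (iter σ i d))) (trans (cD-φ E _) (cong (cD E) (φ-α _))))
      at : ∀ d e → vert d ≡ vert e → cD E d ≡ cD E e
      at d e q with σ-trans d e q
      ... | i , refl = turn i d
      step : ∀ x v → (∀ e → vert e ≡ x → cD E d ≡ cD E e) → Adj x v → ∀ e → vert e ≡ v → cD E d ≡ cD E e
      step x v h (a , refl , refl) e q = trans (h a refl) (trans (cD-α (cover a)) (at (α a) e (sym q)))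

    dual≤ : rD E + + countB isolatedB ≤ + numComp
    dual≤ = ℤₚ.≤-trans (ℤₚ.+-monoˡ-≤ (+ countB isolatedB) (sum-inject (root (dual E)) Q f hf inj))
      (ℤₚ.≤-reflexive (trans (cong (λ x → sum (λ y → ι (Q y)) + x) (countB≡sum isolatedB))
        (trans (sym (∑-distrib-+ _ _)) (trans (sum-cong-≗ pt) (sym (countB≡sum compRepB))))))
      where
      Q : Fin n → Bool
      Q v = compRepB v ∧ not (isolatedB v)
      f : ∀ d → root (dual E) d ≡ true → Fin n
      f d _ = proj₁ (compRep (vert d))
      hf : ∀ d h → Q (f d h) ≡ true
      hf d _ = cong₂ (λ a b → a ∧ not b) (proj₁ (proj₂ (compRep (vert d)))) (𝔹ₚ.¬-not (λ iso → false≢true (dart-not-isolated d)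
        (subst (λ v → isolatedB v ≡ true) (sym (isolated-alone iso (same-sym (proj₂ (proj₂ (compRep (vert d))))))) iso)))
      inj : ∀ d e h h′ → f d h ≡ f e h′ → d ≡ e
      inj d e h h′ q = trans (sym (eqF-true h)) (trans (comp-class (same-trans (proj₂ (proj₂ (compRep (vert d))))
        (subst (λ r → SameComp r (vert e)) (sym q) (same-sym (proj₂ (proj₂ (compRep (vert e)))))))) (eqF-true h′))
      pt : ∀ v → ι (Q v) + ι (isolatedB v) ≡ ι (compRepB v)
      pt v with isolatedB v in iso
      ... | true rewrite isolated-rep v iso = refl
      ... | false = trans (ℤₚ.+-identityʳ _) (cong ι (𝔹ₚ.∧-identityʳ (compRepB v)))

  c₀ : ℤ
  c₀ = + numComp - + n - + countB isolatedB

  euler-ℤ : ∀ m → m ℕ.+ m ≡ k → + numFaces ≡ + 2 * + numComp + + m - + n - + countB isolatedB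
  euler-ℤ m h = half (trans (sym L) (trans (cong +_ euler) R))
    where
    c i F : ℕ
    c = numComp
    i = countB isolatedB
    F = numFaces
    L : + (2 ℕ.* (n ℕ.+ F ℕ.+ i)) ≡ + 2 * (+ n + + F + + i)
    L = trans (ℤₚ.pos-* 2 (n ℕ.+ F ℕ.+ i)) (cong (+ 2 *_) (trans (ℤₚ.pos-+ (n ℕ.+ F) i) (cong (_+ + i) (ℤₚ.pos-+ n F))))
    R : + (4 ℕ.* c ℕ.+ k) ≡ + 4 * + c + (+ m + + m)
    R = trans (ℤₚ.pos-+ (4 ℕ.* c) k) (cong₂ _+_ (ℤₚ.pos-* 4 c) (trans (cong +_ (sym h)) (ℤₚ.pos-+ m m)))
    half : + 2 * (+ n + + F + + i) ≡ + 4 * + c + (+ m + + m) → + F ≡ + 2 * + c + + m - + n - + i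
    half e = ℤₚ.*-cancelˡ-≡ (+ 2) _ _ (trans (ar₁ (+ n) (+ F) (+ i)) (trans (cong (λ x → x - + 2 * + n - + 2 * + i) e) (ar₂ (+ c) (+ m) (+ n) (+ i))))
      where
      ar₁ : ∀ a f i → + 2 * f ≡ + 2 * (a + f + i) - + 2 * a - + 2 * i
      ar₁ = solve-∀
      ar₂ : ∀ c m a i → + 4 * c + (m + m) - + 2 * a - + 2 * i ≡ + 2 * (+ 2 * c + m - a - i)
      ar₂ = solve-∀

  cover-all : ∀ B A → Cover A B → ∀ d → Has (B ʳ++ A) d
  cover-all [] A c d with c d
  ... | inj₁ h = h
  ... | inj₂ (inj₁ ())
  ... | inj₂ (inj₂ ())
  cover-all (x ∷ B) A c = cover-all B (x ∷ A) (cover-shift A x B c)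

  cover-all′ : ∀ A B → Cover A B → ∀ d → Has (A ʳ++ B) d
  cover-all′ [] B c d with c d
  ... | inj₂ h = h
  ... | inj₁ (inj₁ ())
  ... | inj₁ (inj₂ ())
  cover-all′ (x ∷ A) B c = cover-all′ A (x ∷ B) (cover-unshift A x B c)

  -- Euler's formula for the subgraph with edge set `A`, whose regions are counted by `rD B`; each
  -- component of the whole map with darts is counted in a plane of its own. The values with all
  -- edges primal and with all edges dual squeeze the one in between.
  euler-tight : ∀ A B → Cover A B → (length A ℕ.+ length B) ℕ.+ (length A ℕ.+ length B) ≡ k → Φ[ A , B ] ≡ c₀
  euler-tight A B cover len = ℤₚ.≤-antisym (ℤₚ.≤-trans (all-dual A B cover) upper) (ℤₚ.≤-trans lower (all-primal B A cover))
    where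
    m : ℕ
    m = length A ℕ.+ length B
    lenP : length (B ʳ++ A) ≡ m
    lenP = trans (Listₚ.length-ʳ++ B) (ℕₚ.+-comm (length B) (length A))
    lower : c₀ ≤ Φ[ B ʳ++ A , [] ]
    lower = lin₂ 0 faces≤ (comps≤ (B ʳ++ A) (cover-all B A cover))
      (trans (cong (λ l → rD [] - rP (B ʳ++ A) - + l - c₀) lenP)
        (trans (ar (rD []) (rP (B ʳ++ A)) (+ m) (+ numComp) (+ n) (+ countB isolatedB))
          (cong (λ f → (rD [] - f) + (+ numComp - rP (B ʳ++ A)) + + 0) (sym (euler-ℤ m len)))))
      where
      ar : ∀ D P m c a i → D - P - m - (c - a - i) ≡ (D - (+ 2 * c + m - a - i)) + (c - P) + + 0
      ar = solve-∀
    upper : Φ[ [] , A ʳ++ B ] ≤ c₀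
    upper = lin₁ 0 (dual≤ (A ʳ++ B) (cover-all′ A B cover))
      (trans (cong (λ p → c₀ - (rD (A ʳ++ B) - p - + 0)) (trans roots-[] (sum-const n)))
        (ar (rD (A ʳ++ B)) (+ numComp) (+ n) (+ countB isolatedB)))
      where
      ar : ∀ D c a i → c - a - i - (D - a - + 0) ≡ (c - (D + i)) + + 0
      ar = solve-∀

  -- Conversely to `bridge`, a dual loop is a primal bridge.
  loop : ∀ A x B → Cover (x ∷ A) B → (suc (length A) ℕ.+ length B) ℕ.+ (suc (length A) ℕ.+ length B) ≡ k →
         cD B x ≡ cD B (α x) → cP A (vert x) ≢ cP A (vert (α x))
  loop A x B cover len e e′ = contra (trans (sym one) (cong₂ _+_ r0 s0))
    where
    lemma : Φ[ x ∷ A , B ] ≡ Φ[ A , x ∷ B ]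
    lemma = trans (euler-tight (x ∷ A) B cover len) (sym (euler-tight A (x ∷ B) (cover-unshift A x B cover)
      (trans (cong₂ ℕ._+_ (ℕₚ.+-suc (length A) (length B)) (ℕₚ.+-suc (length A) (length B))) len)))
    r s : ℤ
    r = splits (prim A) (vert x) (vert (α x))
    s = splits (dual B) x (α x)
    after : ℤ
    after = rD (x ∷ B) - (rP (x ∷ A) + r) - + length A
    eq : rD (x ∷ B) + s - rP (x ∷ A) - (1ℤ + + length A) ≡ after
    eq = trans (cong₂ (λ d l → d - rP (x ∷ A) - l) (roots-∷ x (α x) (dual B)) (sym (ℤₚ.pos-+ 1 (length A))))
      (trans lemma (cong (λ p → rD (x ∷ B) - p - + length A) (sym (roots-∷ (vert x) (vert (α x)) (prim A)))))
    one : r + s ≡ 1ℤ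
    one = trans (ar (rD (x ∷ B)) (rP (x ∷ A)) (+ length A) r s)
      (cong (λ z → 1ℤ + z) (trans (cong (_- after) eq) (ℤₚ.+-inverseʳ after)))
      where
      ar : ∀ E Q l r s → r + s ≡ 1ℤ + (E + s - Q - (1ℤ + l) - (E - (Q + r) - l))
      ar = solve-∀
    r0 : r ≡ 0ℤ
    r0 = cong (λ b → ι (not b)) (trans (cong (λ z → eqF z (cP A (vert (α x)))) e′) (≟-refl _))
    s0 : s ≡ 0ℤ
    s0 = cong (λ b → ι (not b)) (trans (cong (λ z → eqF z (cD B (α x))) e) (≟-refl _))
    contra : 1ℤ ≡ 0ℤ → ⊥
    contra ()

  -- Selects one of the two darts of every edge.
  lowB : Fin k → Bool
  lowB d = ⌊ Fin.toℕ d ℕ.<? Fin.toℕ (α d) ⌋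

  low-or : ∀ d → lowB d ≡ not (lowB (α d))
  low-or d rewrite α-invol d with Fin.toℕ d ℕ.<? Fin.toℕ (α d) | Fin.toℕ (α d) ℕ.<? Fin.toℕ d
  ... | yes a | yes b = ⊥-elim (ℕₚ.<-asym a b)
  ... | yes _ | no _ = refl
  ... | no _ | yes _ = refl
  ... | no a | no b = ⊥-elim (α-nofix d (Finₚ.toℕ-injective (ℕₚ.≤-antisym (ℕₚ.≮⇒≥ a) (ℕₚ.≮⇒≥ b))))

  Symm : (Fin k → Bool) → Set
  Symm P = ∀ d → P (α d) ≡ P d

  edgesOf : (Fin k → Bool) → List (Fin k)
  edgesOf P = sel (λ d → P d ∧ lowB d)

  edges-has : ∀ P → Symm P → ∀ {d} → P d ≡ true → Has (edgesOf P) d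
  edges-has P sy {d} h with lowB d in e
  ... | true = inj₁ (∈-sel (λ d → P d ∧ lowB d) (cong₂ _∧_ h e))
  ... | false = inj₂ (∈-sel (λ d → P d ∧ lowB d) (cong₂ _∧_ (trans (sy d) h) (𝔹ₚ.not-injective (trans (sym (low-or d)) e))))

  edges-in : ∀ P {d} → d ∈ edgesOf P → P d ≡ true
  edges-in P m = proj₁ (∧-true (sel-∈ (λ d → P d ∧ lowB d) m))

  edges-length : ∀ P → Symm P → + length (edgesOf P) + + length (edgesOf P) ≡ sum (λ d → ι (P d))
  edges-length P sy = trans (cong₂ _+_ (length-sel (λ d → P d ∧ lowB d)) (trans (length-sel (λ d → P d ∧ lowB d))
      (sym (A′.sum-perm (λ d → ι (P d ∧ lowB d)))))) (trans (sym (∑-distrib-+ _ _)) (sum-cong-≗ pt))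
    where
    pt : ∀ d → ι (P d ∧ lowB d) + ι (P (α d) ∧ lowB (α d)) ≡ ι (P d)
    pt d rewrite sy d | low-or d with P d | lowB (α d)
    ... | true | true = refl
    ... | true | false = refl
    ... | false | true = refl
    ... | false | false = refl

  dual-step : ∀ {B d} → Has B d → cD B d ≡ cD B (σ d)
  dual-step {B} {d} h = trans (cD-α h) (trans (cD-φ B (α d)) (cong (cD B) (φ-α d)))

  α-σ : ∀ B d → cD B (α d) ≡ cD B (σ d)
  α-σ B d = trans (cD-φ B (α d)) (cong (cD B) (φ-α d))

  iter-σ-vert : ∀ i d → vert (iter σ i d) ≡ vert d
  iter-σ-vert zero d = refl
  iter-σ-vert (suc i) d = trans (σ-vert _) (iter-σ-vert i d)

  -- The difference `n` minus the number of classes is the rank of the edge set. Vertices outside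
  -- `Z` are classes of their own, and `Z` contains at least one further class.
  rank< : ∀ P (Z : VSet n) → (∀ d → P d ≡ true → Z (vert d) ≡ true) → Symm P →
          ∀ z → Z z ≡ true → + n - rP (edgesOf P) + 1ℤ ≤ sum (λ v → ι (Z v))
  rank< P Z hZ sy z hz = lin₁ 0 many (trans (cong (λ q → sum (λ v → ι (Z v)) - (q - rP A + 1ℤ)) (sym total)) (ar (sum (λ v → ι (Z v))) (sum (λ v → ι (not (Z v)))) (rP A)))
    where
    A : List (Fin k)
    A = edgesOf P
    c : Fin n
    c = cP A z
    pair-Z : ∀ {a b} → (a , b) ∈ prim A → Z a ≡ true × Z b ≡ true
    pair-Z m with ∈-map⁻ (λ d → (vert d , vert (α d))) m
    ... | d , d∈ , refl = hZ d (edges-in P d∈) , hZ (α d) (trans (sy d) (edges-in P d∈))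
    cZ : Z c ≡ true
    cZ = trans (cls-inv Z (prim A) (λ m → trans (proj₁ (pair-Z m)) (sym (proj₂ (pair-Z m)))) z) hz
    alone : ∀ x → Z x ≡ false → root (prim A) x ≡ true
    alone x hx = trans (cong (λ b → b) (eqF-swap (cP A x) x)) (trans (cls-inv (eqF x) (prim A) (λ m → trans (ne (proj₁ (pair-Z m))) (sym (ne (proj₂ (pair-Z m))))) x) (≟-refl x))
      where
      ne : ∀ {a} → Z a ≡ true → eqF x a ≡ false
      ne ha = eqF-false (λ { refl → false≢true hx ha })
      eqF-swap : ∀ (a b : Fin n) → eqF a b ≡ eqF b a
      eqF-swap a b with a Fin.≟ b | b Fin.≟ a
      ... | yes _ | yes _ = refl
      ... | no _ | no _ = refl
      ... | yes e | no ¬e = ⊥-elim (¬e (sym e))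
      ... | no ¬e | yes e = ⊥-elim (¬e (sym e))
    many : sum (λ v → ι (not (Z v))) + 1ℤ ≤ rP A
    many = subst (_≤ rP A) (trans (∑-distrib-+ _ _) (cong (λ x → sum (λ v → ι (not (Z v))) + x) (sum-point c (λ _ → 1ℤ)))) (sum-mono pt)
      where
      pt : ∀ x → ι (not (Z x)) + on ⌊ x Fin.≟ c ⌋ 1ℤ ≤ ι (root (prim A) x)
      pt x with x Fin.≟ c
      ... | yes refl rewrite cZ | cls-idem (prim A) z | ≟-refl (cP A z) = ℤₚ.≤-refl
      ... | no _ with Z x in e
      ...   | true = 0≤ι (root (prim A) x)
      ...   | false rewrite alone x e = ℤₚ.≤-refl
    total : sum (λ v → ι (Z v)) + sum (λ v → ι (not (Z v))) ≡ + n
    total = trans (sym (∑-distrib-+ _ _)) (trans (sum-cong-≗ pt) (sum-const n))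
      where
      pt : ∀ v → ι (Z v) + ι (not (Z v)) ≡ 1ℤ
      pt v with Z v
      ... | true = refl
      ... | false = refl
    ar : ∀ a b r → a - (a + b - r + 1ℤ) ≡ (r - (b + 1ℤ)) + + 0
    ar = solve-∀

  -- The darts met between a and b when turning around their tail, from the lo-th one on.
  module Arc (lo : ℕ) (a b : Fin k) (q : vert a ≡ vert b) where
    private
      s : ∃ λ i → iter σ i a ≡ b
      s = σ-trans a b q
      f = first (λ j → eqF (iter σ j a) b) (proj₁ s) (trans (cong (λ x → eqF x b) (proj₂ s)) (≟-refl b))
    opaque
      len : ℕ
      len = proj₁ f
      at : iter σ len a ≡ b
      at = eqF-true (proj₁ (proj₂ (proj₂ f)))
      before : ∀ i → i ℕ.< len → iter σ i a ≢ b
      before i l p = false≢true (proj₂ (proj₂ (proj₂ f)) i l) (trans (cong (λ x → eqF x b) p) (≟-refl b))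
    -- A return to `a` would let `b` be reached at an earlier index.
    no-loop : ∀ i → 1 ℕ.≤ i → i ℕ.< len → iter σ i a ≢ a
    no-loop i 1≤i i<l p = before (len ℕ.∸ i) (ℕₚ.∸-monoʳ-< 1≤i (ℕₚ.<⇒≤ i<l))
      (trans (cong (iter σ (len ℕ.∸ i)) (sym p)) (trans (sym (iter-+ σ (len ℕ.∸ i) i a)) (trans (cong (λ m → iter σ m a) (ℕₚ.m∸n+n≡m (ℕₚ.<⇒≤ i<l))) at)))
    len-pos : a ≢ b → 0 ℕ.< len
    len-pos a≢b = ℕₚ.n≢0⇒n>0 (λ z → a≢b (trans (cong (λ m → iter σ m a) (sym z)) at))
    opaque
      arc : Fin k → Bool
      arc d = ⌊ Finₚ.any? (λ (i : Fin len) → (lo ℕ.≤? Fin.toℕ i) ×-dec (iter σ (Fin.toℕ i) a Fin.≟ d)) ⌋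
      arc-in : ∀ i → lo ℕ.≤ i → i ℕ.< len → arc (iter σ i a) ≡ true
      arc-in i lo≤i l with Finₚ.any? (λ (j : Fin len) → (lo ℕ.≤? Fin.toℕ j) ×-dec (iter σ (Fin.toℕ j) a Fin.≟ iter σ i a))
      ... | yes _ = refl
      ... | no ¬p = ⊥-elim (¬p (Fin.fromℕ< l , subst (lo ℕ.≤_) (sym (Finₚ.toℕ-fromℕ< l)) lo≤i , cong (λ j → iter σ j a) (Finₚ.toℕ-fromℕ< l)))
      arc-out : ∀ {d} → arc d ≡ true → ∃ λ i → lo ℕ.≤ i × i ℕ.< len × iter σ i a ≡ d
      arc-out {d} h with Finₚ.any? (λ (j : Fin len) → (lo ℕ.≤? Fin.toℕ j) ×-dec (iter σ (Fin.toℕ j) a Fin.≟ d))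
      ... | yes (i , p , q) = Fin.toℕ i , p , Finₚ.toℕ<n i , q
    arc-vert : ∀ {d} → arc d ≡ true → vert d ≡ vert a
    arc-vert h = let (i , _ , _ , q) = arc-out h in trans (cong vert (sym q)) (iter-σ-vert i a)

  module Edge (d₁ : Fin k) where
    isD : Fin k → Bool
    isD d = ⌊ d Fin.≟ d₁ ⌋ ∨ ⌊ d Fin.≟ α d₁ ⌋

    isD-α : Symm isD
    isD-α d with d Fin.≟ d₁ | d Fin.≟ α d₁ | α d Fin.≟ d₁ | α d Fin.≟ α d₁
    ... | yes refl | _ | _ | no ne = ⊥-elim (ne refl)
    ... | yes refl | _ | yes _ | yes _ = refl
    ... | yes refl | _ | no _ | yes _ = refl
    ... | no _ | yes refl | no ne | _ = ⊥-elim (ne (α-invol d₁))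
    ... | no _ | yes refl | yes _ | _ = refl
    ... | no _ | no ne | yes q | _ = ⊥-elim (ne (trans (sym (α-invol d)) (cong α q)))
    ... | no ne | no _ | no _ | yes q = ⊥-elim (ne (α-inj q))
    ... | no _ | no _ | no _ | no _ = refl

    isD-out : ∀ {d} → isD d ≡ true → d ≡ d₁ ⊎ d ≡ α d₁
    isD-out {d} h with ∨-true {⌊ d Fin.≟ d₁ ⌋} h
    ... | inj₁ q = inj₁ (≟-true q)
    ... | inj₂ q = inj₂ (≟-true q)

    -- An edge set, the edge d₁ outside it, and all other edges.
    module Around (P′ : Fin k → Bool) (P′-α : Symm P′) (P′-d₁ : P′ d₁ ≡ false) where
      N : Fin k → Bool
      N d = not (P′ d) ∧ not (isD d)

      N-α : Symm N
      N-α d = cong₂ (λ a b → not a ∧ not b) (P′-α d) (isD-α d)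

      A″ B″ : List (Fin k)
      A″ = edgesOf P′
      B″ = edgesOf N

      cover″ : Cover (d₁ ∷ A″) B″
      cover″ d with P′ d in p
      ... | true with edges-has P′ P′-α {d} p
      ...   | inj₁ m = inj₁ (inj₁ (there m))
      ...   | inj₂ m = inj₁ (inj₂ (there m))
      cover″ d | false with isD d in q
      ... | true with isD-out {d} q
      ...   | inj₁ x = inj₁ (inj₁ (here x))
      ...   | inj₂ x = inj₁ (inj₂ (here (trans (cong α x) (α-invol d₁))))
      cover″ d | false | false = inj₂ (edges-has N N-α {d} (cong₂ (λ a b → not a ∧ not b) p q))

      size″ : (suc (length A″) ℕ.+ length B″) ℕ.+ (suc (length A″) ℕ.+ length B″) ≡ k
      size″ = ℤₚ.+-injective (trans (pos (length A″) (length B″)) (trans (ar (+ length A″) (+ length B″))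
          (trans (cong₂ (λ a b → a + + 2 + b) (edges-length P′ P′-α) (edges-length N N-α)) total)))
        where
        pos : ∀ a b → + ((suc a ℕ.+ b) ℕ.+ (suc a ℕ.+ b)) ≡ (1ℤ + + a + + b) + (1ℤ + + a + + b)
        pos a b = trans (ℤₚ.pos-+ (suc a ℕ.+ b) (suc a ℕ.+ b)) (cong₂ _+_ (one a b) (one a b))
          where
          one : ∀ a b → + (suc a ℕ.+ b) ≡ 1ℤ + + a + + b
          one a b = trans (ℤₚ.pos-+ (suc a) b) (cong (_+ + b) (ℤₚ.pos-+ 1 a))
        ar : ∀ a b → (1ℤ + a + b) + (1ℤ + a + b) ≡ (a + a) + + 2 + (b + b)
        ar = solve-∀
        pt : ∀ d → ι (P′ d) + (on ⌊ d Fin.≟ d₁ ⌋ 1ℤ + on ⌊ d Fin.≟ α d₁ ⌋ 1ℤ) + ι (N d) ≡ 1ℤ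
        pt d with d Fin.≟ d₁ | d Fin.≟ α d₁
        ... | yes refl | yes q = ⊥-elim (α-nofix d₁ (sym q))
        ... | yes refl | no _ rewrite P′-d₁ = refl
        ... | no _ | yes refl rewrite P′-α d₁ | P′-d₁ = refl
        ... | no _ | no _ with P′ d
        ...   | true = refl
        ...   | false = refl
        total : sum (λ d → ι (P′ d)) + + 2 + sum (λ d → ι (N d)) ≡ + k
        total = trans (cong (λ t → sum (λ d → ι (P′ d)) + t + sum (λ d → ι (N d))) (sym (trans (∑-distrib-+ _ _) (cong₂ _+_ (sum-point d₁ (λ _ → 1ℤ)) (sum-point (α d₁) (λ _ → 1ℤ))))))
          (trans (cong (_+ sum (λ d → ι (N d))) (sym (∑-distrib-+ _ _))) (trans (sym (∑-distrib-+ _ _)) (trans (sum-cong-≗ pt) (sum-const k))))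

  -- Regions and the face permutation of a subgraph; the chosen region of each component.

  module Faces (P : Fin k → Bool) (P-α : Symm P) where
    A B : List (Fin k)
    A = edgesOf P
    B = edgesOf (λ d → not (P d))

    D : Fin k → Fin k
    D = cD B

    hasB : ∀ {d} → P d ≡ false → Has B d
    hasB h = edges-has (λ d → not (P d)) (λ d → cong not (P-α d)) (cong not h)

    cover : Cover A B
    cover d with P d in e
    ... | true = inj₁ (edges-has P P-α e)
    ... | false = inj₂ (hasB e)

    D-out : ∀ {d} → P d ≡ false → D d ≡ D (α d)
    D-out h = cD-α (hasB h)

    -- The first edge of P met when turning around the tail of d.
    module _ (d e : Fin k) (same : vert d ≡ vert e) (Pe : P e ≡ true) where
      private
        start = σ-trans d e same
        found = first (λ j → P (iter σ j d)) (proj₁ start) (trans (cong P (proj₂ start)) Pe)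
      hit-index : ℕ
      hit-index = proj₁ found
      hit : Fin k
      hit = iter σ hit-index d
      hit-P : P hit ≡ true
      hit-P = proj₁ (proj₂ (proj₂ found))
      hit-min : ∀ i → i ℕ.< hit-index → P (iter σ i d) ≡ false
      hit-min = proj₂ (proj₂ (proj₂ found))
      hit-vert : vert hit ≡ vert d
      hit-vert = iter-σ-vert hit-index d
      hit-D : D hit ≡ D d
      hit-D = go hit-index hit-min
        where
        go : ∀ j → (∀ i → i ℕ.< j → P (iter σ i d) ≡ false) → D (iter σ j d) ≡ D d
        go zero _ = refl
        go (suc j) h = trans (sym (dual-step (hasB (h j ℕₚ.≤-refl)))) (go j (λ i l → h i (ℕₚ.m≤n⇒m≤1+n l)))
      hit-self : P d ≡ true → hit ≡ d
      hit-self h = go hit-index hit-min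
        where
        go : ∀ j → (∀ i → i ℕ.< j → P (iter σ i d) ≡ false) → iter σ j d ≡ d
        go zero _ = refl
        go (suc j) m = ⊥-elim (false≢true (m 0 (ℕ.s≤s ℕ.z≤n)) h)

    turn : ∀ u → P u ≡ true → Fin k
    turn u h = hit (σ u) u (σ-vert u) h

    -- If two turns of different lengths ended at the same dart, the longer one would have passed
    -- the starting dart of the shorter one, which belongs to `P`, and stopped there.
    turn-inj : ∀ u v (hu : P u ≡ true) (hv : P v ≡ true) → turn u hu ≡ turn v hv → u ≡ v
    turn-inj u v hu hv e = go (ℕₚ.<-cmp i j)
      where
      i j : ℕ
      i = hit-index (σ u) u (σ-vert u) hu
      j = hit-index (σ v) v (σ-vert v) hv
      e′ : iter σ (suc i) u ≡ iter σ (suc j) v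
      e′ = trans (iter-suc σ i u) (trans e (sym (iter-suc σ j v)))
      clash : ∀ a b x y → a ℕ.< b → iter σ (suc a) x ≡ iter σ (suc b) y → P x ≡ true →
              (∀ i → i ℕ.< b → P (iter σ i (σ y)) ≡ false) → ⊥
      clash a b x y l q hx min = false≢true (min c c<b) (trans (cong P (sym x≡)) hx)
        where
        c : ℕ
        c = b ℕ.∸ suc a
        bc : suc b ≡ suc a ℕ.+ suc c
        bc = cong suc (trans (sym (ℕₚ.m+[n∸m]≡n l)) (sym (ℕₚ.+-suc a c)))
        c<b : c ℕ.< b
        c<b = ℕₚ.≤-trans (ℕₚ.m≤n+m (suc c) a) (ℕₚ.≤-reflexive (ℕₚ.suc-injective (sym bc)))
        x≡ : x ≡ iter σ c (σ y)
        x≡ = trans (Σ′.iter-inj (suc a) (trans q (trans (cong (λ m → iter σ m y) bc) (iter-+ σ (suc a) (suc c) y)))) (iter-suc σ c y)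
      go : Tri (i ℕ.< j) (i ≡ j) (j ℕ.< i) → u ≡ v
      go (tri≈ _ q _) = Σ′.iter-inj (suc i) (trans e′ (cong (λ m → iter σ (suc m) v) (sym q)))
      go (tri< l _ _) = ⊥-elim (clash i j u v l e′ hu (hit-min (σ v) v (σ-vert v) hv))
      go (tri> _ _ l) = ⊥-elim (clash j i v u l (sym e′) hv (hit-min (σ u) u (σ-vert u) hu))

    -- The face permutation of the subgraph.
    ψ′ : ∀ d b → P d ≡ b → Fin k
    ψ′ d true h = turn (α d) (trans (P-α d) h)
    ψ′ d false h = d

    opaque
      ψ : Fin k → Fin k
      ψ d = ψ′ d (P d) refl

      ψ-true : ∀ d (h : P d ≡ true) → ψ d ≡ turn (α d) (trans (P-α d) h)
      ψ-true d h = go (P d) refl h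
        where
        go : ∀ b (e : P d ≡ b) (h : P d ≡ true) → ψ′ d b e ≡ turn (α d) (trans (P-α d) h)
        go true e h = cong (λ h → turn (α d) (trans (P-α d) h)) (Decidable⇒UIP.≡-irrelevant 𝔹._≟_ e h)
        go false e h = ⊥-elim (false≢true e h)

      ψ-false : ∀ d → P d ≡ false → ψ d ≡ d
      ψ-false d h = go (P d) refl
        where
        go : ∀ b (e : P d ≡ b) → ψ′ d b e ≡ d
        go true e = ⊥-elim (false≢true h e)
        go false e = refl

    module _ {d : Fin k} (h : P d ≡ true) where
      private
        h′ : P (α d) ≡ true
        h′ = trans (P-α d) h
      ψ-P : P (ψ d) ≡ true
      ψ-P = trans (cong P (ψ-true d h)) (hit-P (φ d) (α d) (σ-vert (α d)) h′)
      ψ-vert : vert (ψ d) ≡ vert (α d)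
      ψ-vert = trans (cong vert (ψ-true d h)) (trans (hit-vert (φ d) (α d) (σ-vert (α d)) h′) (σ-vert (α d)))
      ψ-D : D (ψ d) ≡ D d
      ψ-D = trans (cong D (ψ-true d h)) (trans (hit-D (φ d) (α d) (σ-vert (α d)) h′) (sym (cD-φ B d)))
      ψ-φ : P (φ d) ≡ true → ψ d ≡ φ d
      ψ-φ q = trans (ψ-true d h) (hit-self (φ d) (α d) (σ-vert (α d)) h′ q)

    ψ-inj : Injective _≡_ _≡_ ψ
    ψ-inj {d} {e} q = go (P d) (P e) refl refl
      where
      go : ∀ b c → P d ≡ b → P e ≡ c → d ≡ e
      go true true hd he = α-inj (turn-inj (α d) (α e) _ _ (trans (sym (ψ-true d hd)) (trans q (ψ-true e he))))
      go true false hd he = ⊥-elim (false≢true (trans (cong P (trans q (ψ-false e he))) he) (ψ-P hd))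
      go false true hd he = ⊥-elim (false≢true (trans (cong P (trans (sym q) (ψ-false d hd))) hd) (ψ-P he))
      go false false hd he = trans (sym (ψ-false d hd)) (trans q (ψ-false e he))

    module Ψ = Cyclic ψ ψ-inj

    opaque
      ψ⁻ : ∀ {d} → P d ≡ true → ∃ λ z → P z ≡ true × ψ z ≡ d × D z ≡ D d
      ψ⁻ {d} h with P (Ψ.back d) in e
      ... | true = Ψ.back d , e , Ψ.f-back d , trans (sym (ψ-D e)) (cong D (Ψ.f-back d))
      ... | false = ⊥-elim (false≢true (trans (cong P (trans (sym (Ψ.f-back d)) (ψ-false _ e))) e) h)

  no-dart-sum : ∀ {v} (f : Fin k → ℤ) → (∀ d → vert d ≡ v → f d ≤ 0ℤ) → ∀ e → vert e ≡ v → f e ≤ -1ℤ →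
                sum (λ d → on (eqF (vert d) v) (f d)) ≤ -1ℤ
  no-dart-sum {v} f h e he hf = subst (sum (λ d → on (eqF (vert d) v) (f d)) ≤_) (sum-point e (λ _ → -1ℤ)) (sum-mono pt)
    where
    pt : ∀ d → on (eqF (vert d) v) (f d) ≤ on ⌊ d Fin.≟ e ⌋ -1ℤ
    pt d with d Fin.≟ e | vert d Fin.≟ v
    ... | yes refl | yes _ = hf
    ... | yes refl | no ¬q = ⊥-elim (¬q he)
    ... | no _ | yes q = h d q
    ... | no _ | no _ = ℤₚ.≤-refl

  module Chosen (P : Fin k → Bool) (P-α : Symm P) where
    open Faces P P-α public

    -- A dart of the component of v, on the outer face if the component reaches it.
    Choice : Fin n → Set
    Choice v = ∃ λ d → SameComp v (vert d) × (∀ e → outerD e ≡ true → SameComp v (vert e) → outerD d ≡ true)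

    same? : ∀ u v → Dec (SameComp u v)
    same? u v = reachB n u v 𝔹.≟ true

    opaque
      choice : ∀ v → Choice v ⊎ (∀ d → ¬ SameComp v (vert d))
      choice v with Finₚ.any? (λ d → (outerD d 𝔹.≟ true) ×-dec same? v (vert d))
      ... | yes (d , o , s) = inj₁ (d , s , λ _ _ _ → o)
      ... | no ¬o with Finₚ.any? (λ d → same? v (vert d))
      ...   | yes (d , s) = inj₁ (d , s , λ e o s′ → ⊥-elim (¬o (e , o , s′)))
      ...   | no ¬d = inj₂ (λ d s → ¬d (d , s))

    test : ∀ v → Choice v ⊎ (∀ d → ¬ SameComp v (vert d)) → Fin k → Bool
    test v (inj₁ c) x = eqF (D (proj₁ c)) x
    test v (inj₂ _) x = false

    chosen : Fin k → Bool
    chosen x = anyF (λ v → compRepB v ∧ test v (choice v) x)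

    Ω : Fin k → Bool
    Ω d = chosen (D d)

    Ω-cong : ∀ {d e} → D d ≡ D e → Ω d ≡ Ω e
    Ω-cong = cong chosen

    chosen-dart : ∀ v → (∃ λ d → SameComp v (vert d)) →
      ∃ λ c → SameComp v (vert c) × chosen (D c) ≡ true × (∀ e → outerD e ≡ true → SameComp v (vert e) → outerD c ≡ true)
    chosen-dart v (d , s) with compRep v
    ... | r , hr , vr with choice r in eq
    ...   | inj₂ no-darts = ⊥-elim (no-darts d (same-trans (same-sym vr) s))
    ...   | inj₁ (c , rc , oc) = c , same-trans vr rc ,
            anyF-intro (λ v → compRepB v ∧ test v (choice v) (D c)) r
              (cong₂ _∧_ hr (trans (cong (λ z → test r z (D c)) eq) (≟-refl (D c)))) ,
            (λ e o s′ → oc e o (same-trans (same-sym vr) s′))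

    -- All outer darts of a component lie on one facial walk, and the choice for the component
    -- prefers an outer dart.
    outer-Ω : ∀ d → outerD d ≡ true → Ω d ≡ true
    outer-Ω d o with chosen-dart (vert d) (d , same-refl (vert d))
    ... | c , s , ch , oc = trans (Ω-cong (cD-orbit B (outer-one d c o (oc d o (same-refl (vert d))) s))) ch

    same-choice : ∀ v c x y → test v c x ≡ true → test v c y ≡ true → x ≡ y
    same-choice v (inj₁ c) x y hx hy = trans (sym (eqF-true hx)) (eqF-true hy)

    private
      rep : Fin n → Fin n
      rep v = proj₁ (compRep v)

      rep-eq : ∀ {x y} → SameComp x y → rep x ≡ rep y
      rep-eq {x} {y} s = compRep-unique (proj₁ (proj₂ (compRep x))) (proj₁ (proj₂ (compRep y)))
        (same-trans (same-sym (proj₂ (proj₂ (compRep x)))) (same-trans s (proj₂ (proj₂ (compRep y)))))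

      rep-D : ∀ x → rep (vert (D x)) ≡ rep (vert x)
      rep-D = cD-elim (λ x → rep (vert x)) B (λ d → rep-eq (same-adj (same-refl (vert d)) (d , refl , sym (φ-vert d))))
        (λ d _ → rep-eq (same-adj (same-refl (vert d)) (d , refl , refl)))

      rep-of : ∀ {v x} → compRepB v ≡ true → SameComp v x → v ≡ rep x
      rep-of {v} {x} rv s = compRep-unique rv (proj₁ (proj₂ (compRep x))) (same-trans s (proj₂ (proj₂ (compRep x))))

      Ω-rep : ∀ a → Ω a ≡ true → ∃ λ v → v ≡ rep (vert a) × test v (choice v) (D a) ≡ true
      Ω-rep a h = v , go (choice v) q , q
        where
        found = anyF-true (λ v → compRepB v ∧ test v (choice v) (D a)) h
        v : Fin n
        v = proj₁ found
        q : test v (choice v) (D a) ≡ true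
        q = proj₂ (∧-true {compRepB v} (proj₂ found))
        go : ∀ c → test v c (D a) ≡ true → v ≡ rep (vert a)
        go (inj₁ (c , s , _)) q = trans (rep-of (proj₁ (∧-true (proj₂ found))) s)
          (trans (sym (rep-D c)) (trans (cong (λ x → rep (vert x)) (eqF-true q)) (rep-D a)))

    -- A region never leaves its component of the map, and only one region is chosen for each
    -- component.
    Ω-same : ∀ {a b} → Ω a ≡ true → Ω b ≡ true → SameComp (vert a) (vert b) → D a ≡ D b
    Ω-same {a} {b} ha hb s = go (Ω-rep a ha) (Ω-rep b hb)
      where
      go : (∃ λ v → v ≡ rep (vert a) × test v (choice v) (D a) ≡ true) → (∃ λ v → v ≡ rep (vert b) × test v (choice v) (D b) ≡ true) → D a ≡ D b
      go (v , va , qa) (v′ , vb , qb) = same-choice v (choice v) (D a) (D b) qa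
        (subst (λ v → test v (choice v) (D b) ≡ true) (trans vb (trans (sym (rep-eq s)) (sym va))) qb)

    chosen-count : sum (λ x → ι (root (dual B) x ∧ chosen x)) ≤ + numComp - + countB isolatedB
    chosen-count = ℤₚ.≤-trans (sum-inject (λ x → root (dual B) x ∧ chosen x) Q f hf inj) (ℤₚ.≤-reflexive count)
      where
      Q : Fin n → Bool
      Q v = compRepB v ∧ not (isolatedB v)
      wit : ∀ x → root (dual B) x ∧ chosen x ≡ true → ∃ λ v → compRepB v ∧ test v (choice v) x ≡ true
      wit x h = anyF-true _ (proj₂ (∧-true {root (dual B) x} h))
      f : ∀ x → root (dual B) x ∧ chosen x ≡ true → Fin n
      f x h = proj₁ (wit x h)
      niso : ∀ v (c : Choice v ⊎ (∀ d → ¬ SameComp v (vert d))) x → test v c x ≡ true → isolatedB v ≡ false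
      niso v (inj₁ (c , s , _)) x h = 𝔹ₚ.¬-not (λ iso → false≢true (dart-not-isolated c)
        (subst (λ u → isolatedB u ≡ true) (sym (isolated-alone iso s)) iso))
      hf : ∀ x h → Q (f x h) ≡ true
      hf x h = cong₂ (λ a b → a ∧ not b) (proj₁ (∧-true (proj₂ (wit x h))))
        (niso (f x h) (choice (f x h)) x (proj₂ (∧-true {compRepB (f x h)} (proj₂ (wit x h)))))
      inj : ∀ x y h h′ → f x h ≡ f y h′ → x ≡ y
      inj x y h h′ q = same-choice (f x h) (choice (f x h)) x y (proj₂ (∧-true {compRepB (f x h)} (proj₂ (wit x h))))
        (subst (λ v → test v (choice v) y ≡ true) (sym q) (proj₂ (∧-true {compRepB (f y h′)} (proj₂ (wit y h′)))))
      ar : ∀ a b → a ≡ a + b - b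
      ar = solve-∀
      pt : ∀ v → ι (Q v) + ι (isolatedB v) ≡ ι (compRepB v)
      pt v with isolatedB v in iso
      ... | true rewrite isolated-rep v iso = refl
      ... | false = trans (ℤₚ.+-identityʳ _) (cong ι (𝔹ₚ.∧-identityʳ (compRepB v)))
      count : sum (λ v → ι (Q v)) ≡ + numComp - + countB isolatedB
      count = trans (ar _ (sum (λ v → ι (isolatedB v)))) (cong₂ _-_
        (trans (sym (∑-distrib-+ _ _)) (trans (sum-cong-≗ pt) (sym (countB≡sum compRepB)))) (sym (countB≡sum isolatedB)))

    -- The darts with `W` on one side only can be followed from vertex to vertex; those with `W` on
    -- both sides are ignored. Such a walk cannot turn back, since the reverse dart borders another
    -- region, nor close up after three steps, so it contains four different darts.
    module Long (tf : TriangleFree) (x : Fin k) (rx : root (dual B) x ≡ true) (nx : chosen x ≡ false) where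
      W : Fin k → Bool
      W d = ⌊ x Fin.≟ D d ⌋

      W-cong : ∀ {d e} → D d ≡ D e → W d ≡ W e
      W-cong q = cong (λ z → ⌊ x Fin.≟ z ⌋) q

      Wx : W x ≡ true
      Wx = trans (cong (λ z → ⌊ x Fin.≟ z ⌋) (eqF-true rx)) (≟-refl x)

      Bd : Fin k → Set
      Bd d = W d ≡ true × W (α d) ≡ false

      Bd-P : ∀ {d} → Bd d → P d ≡ true
      Bd-P {d} (h , h′) with P d in e
      ... | true = refl
      ... | false = ⊥-elim (false≢true h′ (trans (sym (W-cong (D-out e))) h))

      start : ∃ Bd
      start with Finₚ.any? (λ d → (W d 𝔹.≟ true) ×-dec (W (α d) 𝔹.≟ false))
      ... | yes p = p
      -- Otherwise `W` is closed under crossing edges and fills the whole component, including its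
      -- chosen dart.
      ... | no ¬p = ⊥-elim (false≢true nx (subst (λ z → chosen z ≡ true) (sym (≟-true (everywhere c refl))) (proj₁ (proj₂ (proj₂ ch)))))
        where
        ch = chosen-dart (vert x) (x , same-refl (vert x))
        c : Fin k
        c = proj₁ ch
        W-α : ∀ d → W d ≡ true → W (α d) ≡ true
        W-α d h with W (α d) in e
        ... | true = refl
        ... | false = ⊥-elim (¬p (d , h , e))
        W-σ : ∀ d → W d ≡ true → W (σ d) ≡ true
        W-σ d h = trans (sym (W-cong (α-σ B d))) (W-α d h)
        around : ∀ d e → vert d ≡ vert e → W d ≡ true → W e ≡ true
        around d e q h with σ-trans d e q
        ... | i , refl = go i
          where
          go : ∀ i → W (iter σ i d) ≡ true
          go zero = h
          go (suc i) = W-σ _ (go i)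
        everywhere : ∀ e → e ≡ c → W e ≡ true
        everywhere e refl = same-ind (λ v → ∀ e → vert e ≡ v → W e ≡ true) (λ e q → around x e (sym q) Wx)
          (λ { u v h (a , refl , refl) e q → around (α a) e (sym q) (W-α a (h a refl)) }) (proj₁ (proj₂ ch)) c refl

      -- Around a vertex, the corners of W are entered as often as they are left.
      next : ∀ e → Bd e → ∃ λ e′ → vert e′ ≡ vert (α e) × Bd e′
      next e (h , h′) with Finₚ.any? (λ d → (vert d Fin.≟ vert (α e)) ×-dec ((W d 𝔹.≟ true) ×-dec (W (α d) 𝔹.≟ false)))
      ... | yes p = p
      ... | no ¬p = ⊥-elim (contra (subst (_≤ -1ℤ) zero-sum (no-dart-sum f f≤0 (α e) refl f≤-1)))
        where
        f : Fin k → ℤ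
        f d = ι (W d) - ι (W (α d))
        f≤0 : ∀ d → vert d ≡ vert (α e) → f d ≤ 0ℤ
        f≤0 d q with W d in a | W (α d) in b
        ... | true | true = ℤₚ.≤-refl
        ... | true | false = ⊥-elim (¬p (d , q , a , b))
        ... | false | true = -≤+
        ... | false | false = ℤₚ.≤-refl
        f≤-1 : f (α e) ≤ -1ℤ
        f≤-1 rewrite h′ | α-invol e | h = ℤₚ.≤-refl
        v : Fin n
        v = vert (α e)
        g : Fin k → ℤ
        g d = on (eqF (vert d) v) (ι (W d))
        zero-sum : sum (λ d → on (eqF (vert d) v) (f d)) ≡ 0ℤ
        zero-sum = trans (sum-cong-≗ pt) (trans (sum-sub g (g ∘ σ)) (trans (cong (λ z → sum g - z) (Σ′.sum-perm g)) (ℤₚ.+-inverseʳ (sum g))))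
          where
          pt : ∀ d → on (eqF (vert d) v) (f d) ≡ g d - g (σ d)
          pt d rewrite σ-vert d | sym (W-cong (α-σ B d)) with eqF (vert d) v
          ... | true = refl
          ... | false = refl
        contra : 0ℤ ≤ -1ℤ → ⊥
        contra ()

      no-return : ∀ {e e′} → Bd e → Bd e′ → vert e′ ≡ vert (α e) → vert (α e′) ≢ vert e
      no-return {e} {e′} b b′ q r = false≢true (proj₂ b) (trans (cong W (sym e≡)) (proj₁ b′))
        where
        e≡ : e′ ≡ α e
        e≡ = noMulti e′ (α e) q (trans r (cong vert (sym (α-invol e))))

      four : + 4 ≤ sum (λ d → ι (P d ∧ W d))
      four = count-list (λ d → P d ∧ W d) (e₁ ∷ e₂ ∷ e₃ ∷ e₄ ∷ [])
          ((t₁₂ ∷ t₁₃ ∷ t₁₄ ∷ []) ∷ (t₂₃ ∷ t₂₄ ∷ []) ∷ (t₃₄ ∷ []) ∷ [] ∷ [])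
          (ok b₁ ∷ ok b₂ ∷ ok b₃ ∷ ok b₄ ∷ [])
        where
        e₁ = proj₁ start
        b₁ = proj₂ start
        e₂ = proj₁ (next e₁ b₁)
        b₂ = proj₂ (proj₂ (next e₁ b₁))
        e₃ = proj₁ (next e₂ b₂)
        b₃ = proj₂ (proj₂ (next e₂ b₂))
        e₄ = proj₁ (next e₃ b₃)
        b₄ = proj₂ (proj₂ (next e₃ b₃))
        q₁ : vert e₂ ≡ vert (α e₁)
        q₁ = proj₁ (proj₂ (next e₁ b₁))
        q₂ : vert e₃ ≡ vert (α e₂)
        q₂ = proj₁ (proj₂ (next e₂ b₂))
        q₃ : vert e₄ ≡ vert (α e₃)
        q₃ = proj₁ (proj₂ (next e₃ b₃))
        ok : ∀ {d} → Bd d → P d ∧ W d ≡ true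
        ok b = cong₂ _∧_ (Bd-P b) (proj₁ b)
        consecutive : ∀ {e e′} → vert e′ ≡ vert (α e) → e ≢ e′
        consecutive {e} q refl = noLoop e (sym q)
        skip : ∀ {e e′ e″} → Bd e → Bd e′ → vert e′ ≡ vert (α e) → vert e″ ≡ vert (α e′) → e ≢ e″
        skip b b′ q q′ refl = no-return b b′ q (sym q′)
        t₁₂ = consecutive q₁
        t₂₃ = consecutive q₂
        t₃₄ = consecutive q₃
        t₁₃ = skip b₁ b₂ q₁ q₂
        t₂₄ = skip b₂ b₃ q₂ q₃
        t₁₄ : e₁ ≢ e₄
        t₁₄ q = tf (vert e₁) (vert e₂) (vert e₃) (e₁ , refl , sym q₁) (e₂ , refl , sym q₂)
                  (α e₃ , trans (sym q₃) (cong vert (sym q)) , cong vert (α-invol e₃))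

    -- Each region that is not chosen has at least four darts, and at most one region per component
    -- with darts is chosen. Inserted into Euler's formula for the subgraph, this bounds twice the
    -- number of edges by 4 times the rank, with the darts on chosen regions as a gain.
    face-bound : TriangleFree → sum (λ d → ι (P d)) + sum (λ d → ι (P d ∧ Ω d)) ≤ + 4 * (+ n - rP A)
    face-bound tf = lin₂ 0 (ℤₚ.*-monoˡ-≤-nonNeg (+ 4) chosen-count) long arith
      where
      nonC : Fin k → Bool
      nonC x = root (dual B) x ∧ not (chosen x)
      sP sΩ sN c u : ℤ
      sP = sum (λ d → ι (P d))
      sΩ = sum (λ d → ι (P d ∧ Ω d))
      sN = sum (λ d → ι (P d ∧ not (Ω d)))
      c = sum (λ x → ι (root (dual B) x ∧ chosen x))
      u = sum (λ x → ι (nonC x))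
      two-parts : sP ≡ sΩ + sN
      two-parts = trans (sum-cong-≗ pt) (∑-distrib-+ _ _)
        where
        pt : ∀ d → ι (P d) ≡ ι (P d ∧ Ω d) + ι (P d ∧ not (Ω d))
        pt d with P d | Ω d
        ... | true | true = refl
        ... | true | false = refl
        ... | false | _ = refl
      root-parts : rD B ≡ c + u
      root-parts = trans (sum-cong-≗ pt) (∑-distrib-+ _ _)
        where
        pt : ∀ x → ι (root (dual B) x) ≡ ι (root (dual B) x ∧ chosen x) + ι (nonC x)
        pt x with root (dual B) x | chosen x
        ... | true | true = refl
        ... | true | false = refl
        ... | false | _ = refl
      long : + 4 * u ≤ sN
      long = subst₂ _≤_ (sum-scale (+ 4) (λ x → ι (nonC x))) swap (sum-mono pt)
        where
        F : Fin k → ℤ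
        F x = on (not (chosen x)) (sum (λ d → ι (P d ∧ ⌊ x Fin.≟ D d ⌋)))
        pt : ∀ x → + 4 * ι (nonC x) ≤ F x
        pt x with root (dual B) x in r | chosen x in e
        ... | true | false = Long.four tf x r e
        ... | true | true = ℤₚ.≤-refl
        ... | false | true = ℤₚ.≤-refl
        ... | false | false = sum-nonneg (λ d → 0≤ι (P d ∧ ⌊ x Fin.≟ D d ⌋))
        swap : sum F ≡ sN
        swap = begin
          sum F ≡⟨ sum-cong-≗ (λ x → push (not (chosen x)) (λ d → ι (P d ∧ ⌊ x Fin.≟ D d ⌋))) ⟩
          sum (λ x → sum (λ d → on (not (chosen x)) (ι (P d ∧ ⌊ x Fin.≟ D d ⌋)))) ≡⟨ ∑-comm (λ x d → on (not (chosen x)) (ι (P d ∧ ⌊ x Fin.≟ D d ⌋))) ⟩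
          sum (λ d → sum (λ x → on (not (chosen x)) (ι (P d ∧ ⌊ x Fin.≟ D d ⌋)))) ≡⟨ sum-cong-≗ (λ d → sum-cong-≗ (λ x → pt′ d x)) ⟩
          sum (λ d → sum (λ x → on ⌊ x Fin.≟ D d ⌋ (ι (P d ∧ not (chosen x))))) ≡⟨ sum-cong-≗ (λ d → sum-point (D d) (λ x → ι (P d ∧ not (chosen x)))) ⟩
          sN ∎
          where
          open ≡-Reasoning
          push : ∀ b (f : Fin k → ℤ) → on b (sum f) ≡ sum (λ d → on b (f d))
          push true f = refl
          push false f = sym (sum-zero {f = λ _ → 0ℤ} (λ _ → refl))
          pt′ : ∀ d x → on (not (chosen x)) (ι (P d ∧ ⌊ x Fin.≟ D d ⌋)) ≡ on ⌊ x Fin.≟ D d ⌋ (ι (P d ∧ not (chosen x)))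
          pt′ d x with chosen x | P d | x Fin.≟ D d
          ... | true | true | yes _ = refl
          ... | true | true | no _ = refl
          ... | true | false | yes _ = refl
          ... | true | false | no _ = refl
          ... | false | true | yes _ = refl
          ... | false | true | no _ = refl
          ... | false | false | yes _ = refl
          ... | false | false | no _ = refl
      lA lB : ℤ
      lA = + length A
      lB = + length B
      halfA : lA + lA ≡ sP
      halfA = edges-length P P-α
      len : (length A ℕ.+ length B) ℕ.+ (length A ℕ.+ length B) ≡ k
      len = ℤₚ.+-injective (trans (trans (ℤₚ.pos-+ (length A ℕ.+ length B) (length A ℕ.+ length B))
          (cong₂ _+_ (ℤₚ.pos-+ (length A) (length B)) (ℤₚ.pos-+ (length A) (length B))))
          (trans (ar lA lB) (trans (cong₂ _+_ halfA (edges-length (λ d → not (P d)) (λ d → cong not (P-α d))))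
          (trans (sym (∑-distrib-+ _ _)) (trans (sum-cong-≗ pt) (sum-const k))))))
        where
        ar : ∀ a b → a + b + (a + b) ≡ (a + a) + (b + b)
        ar = solve-∀
        pt : ∀ d → ι (P d) + ι (not (P d)) ≡ 1ℤ
        pt d with P d
        ... | true = refl
        ... | false = refl
      tight : rD B - rP A - lA ≡ c₀
      tight = euler-tight A B cover len
      arith : + 4 * (+ n - rP A) - (sP + sΩ) ≡
              (+ 4 * (+ numComp - + countB isolatedB) - + 4 * c) + (sN - + 4 * u) + + 0
      arith = trans (cong (λ z → + 4 * (+ n - rP A) - (z + sΩ)) (sym halfA)) (trans (ar₁ (+ n) (rP A) lA sΩ (c + u))
         (trans (cong (λ z → + 4 * (+ n + z) + (lA + lA) - sΩ - + 4 * (c + u)) (trans (cong (λ z → z - rP A - lA) (sym root-parts)) tight))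
          (trans (cong (λ z → + 4 * (+ n + c₀) + z - sΩ - + 4 * (c + u)) (trans halfA two-parts))
           (ar₂ (+ n) (+ numComp) (+ countB isolatedB) sΩ sN c u))))
        where
        ar₁ : ∀ N r l o q → + 4 * (N - r) - (l + l + o) ≡ + 4 * (N + (q - r - l)) + (l + l) - o - + 4 * q
        ar₁ = solve-∀
        ar₂ : ∀ N m i o s c u → + 4 * (N + (m - N - i)) + (o + s) - o - + 4 * (c + u) ≡ (+ 4 * (m - i) - + 4 * c) + (s - + 4 * u) + + 0
        ar₂ = solve-∀

  -- Counting darts by their tails, and the basic lower bound on ρ.

  darts-between : ∀ v u → sum (λ d → ι (eqF (vert d) v ∧ eqF (vert (α d)) u)) ≡ ι (adjB v u)
  darts-between v u with adjB v u in e
  ... | false = sum-zero pt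
    where
    pt : ∀ d → ι (eqF (vert d) v ∧ eqF (vert (α d)) u) ≡ 0ℤ
    pt d with eqF (vert d) v ∧ eqF (vert (α d)) u in e′
    ... | false = refl
    ... | true = ⊥-elim (false≢true e (anyF-intro _ d e′))
  ... | true with adjB⇒Adj {v} {u} e
  ...   | d₀ , p , q = trans (sum-cong-≗ pt) (sum-point d₀ (λ _ → 1ℤ))
    where
    pt : ∀ d → ι (eqF (vert d) v ∧ eqF (vert (α d)) u) ≡ on ⌊ d Fin.≟ d₀ ⌋ 1ℤ
    pt d with d Fin.≟ d₀
    ... | yes refl rewrite p | q | ≟-refl v | ≟-refl u = refl
    ... | no ne with eqF (vert d) v in e₁ | eqF (vert (α d)) u in e₂
    ...   | true | true = ⊥-elim (ne (noMulti d d₀ (trans (eqF-true e₁) (sym p)) (trans (eqF-true e₂) (sym q))))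
    ...   | true | false = refl
    ...   | false | _ = refl

  on-push : ∀ {m} b (f : Fin m → ℤ) → on b (sum f) ≡ sum (λ d → on b (f d))
  on-push true f = refl
  on-push false f = sym (sum-zero {f = λ _ → 0ℤ} (λ _ → refl))

  eqF-swap : ∀ {m} (a b : Fin m) → eqF a b ≡ ⌊ b Fin.≟ a ⌋
  eqF-swap a b with a Fin.≟ b | b Fin.≟ a
  ... | yes _ | yes _ = refl
  ... | no _ | no _ = refl
  ... | yes e | no ¬e = ⊥-elim (¬e (sym e))
  ... | no ¬e | yes e = ⊥-elim (¬e (sym e))

  deg-darts : ∀ Y v → sum (λ d → ι (eqF (vert d) v ∧ Y (vert (α d)))) ≡ deg Y v
  deg-darts Y v = begin
    sum (λ d → ι (eqF (vert d) v ∧ Y (vert (α d))))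
      ≡⟨ sum-cong-≗ (λ d → sym (trans (sum-cong-≗ (pt d)) (sum-point (vert (α d)) (λ u → ι (eqF (vert d) v ∧ Y u))))) ⟩
    sum (λ d → sum (λ u → on (Y u) (ι (eqF (vert d) v ∧ eqF (vert (α d)) u))))
      ≡⟨ ∑-comm (λ d u → on (Y u) (ι (eqF (vert d) v ∧ eqF (vert (α d)) u))) ⟩
    sum (λ u → sum (λ d → on (Y u) (ι (eqF (vert d) v ∧ eqF (vert (α d)) u))))
      ≡⟨ sum-cong-≗ (λ u → trans (sym (on-push (Y u) _)) (trans (cong (on (Y u)) (darts-between v u)) (fold u))) ⟩
    deg Y v ∎
    where
    open ≡-Reasoning
    pt : ∀ d u → on (Y u) (ι (eqF (vert d) v ∧ eqF (vert (α d)) u)) ≡ on ⌊ u Fin.≟ vert (α d) ⌋ (ι (eqF (vert d) v ∧ Y u))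
    pt d u rewrite eqF-swap (vert (α d)) u with Y u | eqF (vert d) v | u Fin.≟ vert (α d)
    ... | true | true | yes _ = refl
    ... | true | true | no _ = refl
    ... | true | false | yes _ = refl
    ... | true | false | no _ = refl
    ... | false | true | yes _ = refl
    ... | false | true | no _ = refl
    ... | false | false | yes _ = refl
    ... | false | false | no _ = refl
    fold : ∀ u → on (Y u) (ι (adjB v u)) ≡ ι (Y u ∧ adjB v u)
    fold u with Y u
    ... | true = refl
    ... | false = refl

  by-tail : ∀ (Q : Fin k → Bool) → sum (λ d → ι (Q d)) ≡ sum (λ v → sum (λ d → ι (eqF (vert d) v ∧ Q d)))
  by-tail Q = trans (sum-cong-≗ (λ d → sym (trans (sum-cong-≗ (pt d)) (sum-point (vert d) (λ _ → ι (Q d))))))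
    (∑-comm (λ d v → ι (eqF (vert d) v ∧ Q d)))
    where
    pt : ∀ d v → ι (eqF (vert d) v ∧ Q d) ≡ on ⌊ v Fin.≟ vert d ⌋ (ι (Q d))
    pt d v rewrite eqF-swap (vert d) v with v Fin.≟ vert d
    ... | yes _ = refl
    ... | no _ = refl

  inside : VSet n → Fin k → Bool
  inside Y d = Y (vert d) ∧ Y (vert (α d))

  inside-α : ∀ Y → Symm (inside Y)
  inside-α Y d rewrite α-invol d = 𝔹ₚ.∧-comm (Y (vert (α d))) (Y (vert d))

  inside-sum : ∀ Y → sum (λ d → ι (inside Y d)) ≡ edges Y Y
  inside-sum Y = trans (by-tail (inside Y)) (sum-cong-≗ (λ v → trans (sum-cong-≗ (pt v)) (trans (sym (on-push (Y v) _)) (cong (on (Y v)) (deg-darts Y v)))))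
    where
    pt : ∀ v d → ι (eqF (vert d) v ∧ inside Y d) ≡ on (Y v) (ι (eqF (vert d) v ∧ Y (vert (α d))))
    pt v d with vert d Fin.≟ v
    ... | no _ with Y v
    ...   | true = refl
    ...   | false = refl
    pt v d | yes refl with Y (vert d)
    ... | true = refl
    ... | false = refl

  OuterOK : VSet n → VSet n → Set
  OuterOK X big = ∀ v → X v ≡ true → big v ≡ false → OuterVertex v

  module Count (tf : TriangleFree) (H X big : VSet n) (Y : VSet n) (sp : Split Y H X) (outerA : OuterOK X big) where
    P : Fin k → Bool
    P = inside Y
    open Chosen P (inside-α Y) public

    κ : Fin n → ℤ
    κ v = + 4 + ι (big v) - (deg H v + deg H v)

    weight : ℤ
    weight = sum (λ v → on (X v) (+ 3 + ι (big v)))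

    -- An edge between `X` and `H` is charged twice through κ, an edge inside `X` through the
    -- degrees of both ends, matching their two darts. Only the darts inside `H` have to be added
    -- back.
    ρ-weight : ρ κ X ≡ weight - sum (λ d → ι (P d)) + edges H H
    ρ-weight = trans (trans (sum-cong-≗ pt) (trans (sum-sub _ _) (cong (λ z → weight - z) (∑-distrib-+ _ _))))
      (trans (ar weight (edges X X) (sum (λ v → on (X v) (deg H v + deg H v))) (edges H H))
        (cong (λ z → weight - z + edges H H) (sym (trans (inside-sum Y) total))))
      where
      ar₀ : ∀ b h x → + 4 + b - (h + h) - 1ℤ - x ≡ + 3 + b - (x + (h + h))
      ar₀ = solve-∀
      pt : ∀ v → on (X v) (κ v - 1ℤ - deg X v) ≡ on (X v) (+ 3 + ι (big v)) - (on (X v) (deg X v) + on (X v) (deg H v + deg H v))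
      pt v with X v
      ... | true = ar₀ (ι (big v)) (deg H v) (deg X v)
      ... | false = refl
      ar : ∀ w x y h → w - (x + y) ≡ w - (x + y + h) + h
      ar = solve-∀
      total : edges Y Y ≡ edges X X + sum (λ v → on (X v) (deg H v + deg H v)) + edges H H
      total = trans (sum-cong-≗ pt′) (trans (∑-distrib-+ _ _) (trans (cong₂ _+_ (∑-distrib-+ _ _) (∑-distrib-+ _ _))
        (trans (cong (λ z → edges X X + edges X H + (edges H H + z)) (edges-sym H X))
          (trans (ar′ (edges X X) (edges X H) (edges H H)) (cong (λ z → edges X X + z + edges H H)
            (trans (sym (∑-distrib-+ _ _)) (sum-cong-≗ both)))))))
        where
        ar′ : ∀ a b c → a + b + (c + b) ≡ a + (b + b) + c
        ar′ = solve-∀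
        both : ∀ v → on (X v) (deg H v) + on (X v) (deg H v) ≡ on (X v) (deg H v + deg H v)
        both v with X v
        ... | true = refl
        ... | false = refl
        ar₁ : ∀ h x → h + x ≡ 0ℤ + 0ℤ + (h + x)
        ar₁ = solve-∀
        ar₂ : ∀ h x → h + x ≡ x + h + (0ℤ + 0ℤ)
        ar₂ = solve-∀
        pt′ : ∀ v → on (Y v) (deg Y v) ≡ (on (X v) (deg X v) + on (X v) (deg H v)) + (on (H v) (deg H v) + on (H v) (deg X v))
        pt′ v rewrite deg-split sp v with Y v | H v | X v | sp v
        ... | _ | _ | _ | inˡ = ar₁ (deg H v) (deg X v)
        ... | _ | _ | _ | inʳ = ar₂ (deg H v) (deg X v)
        ... | _ | _ | _ | out = refl

    0≤weight : 0ℤ ≤ weight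
    0≤weight = sum-nonneg pt
      where
      pt : ∀ v → 0ℤ ≤ on (X v) (+ 3 + ι (big v))
      pt v with X v | big v
      ... | true | true = +≤+ ℕ.z≤n
      ... | true | false = +≤+ ℕ.z≤n
      ... | false | _ = ℤₚ.≤-refl

    0≤edges : ∀ S T → 0ℤ ≤ edges S T
    0≤edges S T = sum-nonneg pt
      where
      pt : ∀ v → 0ℤ ≤ on (S v) (deg T v)
      pt v with S v
      ... | true = 0≤deg T v
      ... | false = ℤₚ.≤-refl

    ρ-no-edges : (∀ d → P d ≡ false) → 0ℤ ≤ ρ κ X
    ρ-no-edges h = subst (0ℤ ≤_) (sym (trans ρ-weight (cong (λ z → weight - z + edges H H) (sum-zero (λ d → cong ι (h d))))))
      (subst (0ℤ ≤_) (cong (_+ edges H H) (sym (ℤₚ.+-identityʳ weight))) (ℤₚ.+-mono-≤ 0≤weight (0≤edges H H)))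

    P-tail : ∀ {d} → P d ≡ true → Y (vert d) ≡ true
    P-tail h = proj₁ (∧-true h)

    P-head : ∀ {d} → P d ≡ true → Y (vert (α d)) ≡ true
    P-head {d} h = proj₂ (∧-true {Y (vert d)} h)

    opaque
      -- A vertex with small lists is on the outer face. Turning from an outer dart to the first
      -- edge of the subgraph crosses deleted edges only and stays in the chosen region.
      outer-dart : ∀ v → X v ≡ true → big v ≡ false → ∀ e → vert e ≡ v → P e ≡ true →
                   ∃ λ z → vert z ≡ v × P z ≡ true × Ω z ≡ true
      outer-dart v hX hb e he Pe with outerA v hX hb
      ... | inj₂ iso = ⊥-elim (false≢true (dart-not-isolated e) (trans (cong isolatedB he) (outerIso-iso v iso)))
      ... | inj₁ (d , o , hd) = hit d e q Pe , trans (hit-vert d e q Pe) hd , hit-P d e q Pe ,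
            trans (Ω-cong (hit-D d e q Pe)) (outer-Ω d o)
        where
        q : vert d ≡ vert e
        q = trans hd (sym he)

    -- Each vertex with small lists that meets an edge keeps one dart of a chosen region for itself,
    -- to pay for the unit missing in its capacity; the darts in `qs` are a gain beyond that.
    Reserve : List (Fin k) → Set
    Reserve qs = ∀ v → X v ≡ true → big v ≡ false → ∀ e → vert e ≡ v → P e ≡ true →
                 ∃ λ z → vert z ≡ v × P z ≡ true × Ω z ≡ true × z ∉ qs

    h : ℤ
    h = sum (λ v → ι (H v))

    -- `face-bound` and `rank<` bound the number of all darts by 4 (|Z| - 1) minus the number of
    -- chosen darts. A vertex of `X` in `Z` contributes 4 to this, covered by its weight 4, or by
    -- its weight 3 and its reserved dart. There remain 4 from the rank, -4 for each vertex of `H`,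
    -- and the darts in `qs`.
    ρ-bound : ∀ d₀ → P d₀ ≡ true → ∀ qs → Unique qs → All (λ d → P d ≡ true × Ω d ≡ true) qs → Reserve qs →
              + 4 + edges H H - + 4 * h + + length qs ≤ ρ κ X
    ρ-bound d₀ Pd₀ qs uq allq res = subst (+ 4 + edges H H - + 4 * h + + length qs ≤_) (sym ρ-weight)
        (lin₃ 0 (face-bound tf) (ℤₚ.*-monoˡ-≤-nonNeg (+ 4) (rank< P Z P-Z (inside-α Y) (vert d₀) (P-Z d₀ Pd₀))) gain
          (ar (sum (λ d → ι (P d))) (sum (λ d → ι (P d ∧ Ω d))) (+ n) (rP A) (sum (λ v → ι (Z v))) weight (edges H H) h (+ length qs)))
      where
      T : VSet n
      T v = anyF (λ d → eqF (vert d) v ∧ P d)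
      -- Vertices of `X` without an edge are left out: with small lists such a vertex has weight 3
      -- and no dart to supply the fourth unit.
      Z : VSet n
      Z v = H v ∨ (X v ∧ T v)
      P-Z : ∀ d → P d ≡ true → Z (vert d) ≡ true
      P-Z d Pd with Split-U (sp (vert d)) (P-tail Pd)
      ... | inj₁ hH rewrite hH = refl
      ... | inj₂ hX = ∨-inʳ (H (vert d)) (cong₂ _∧_ hX (anyF-intro _ d (cong₂ _∧_ (≟-refl (vert d)) Pd)))
      Q : Fin k → Bool
      Q d = ⌊ DecMem._∈?_ Fin._≟_ d qs ⌋
      Q-in : ∀ {d} → Q d ≡ true → d ∈ qs
      Q-in {d} e with DecMem._∈?_ Fin._≟_ d qs
      ... | yes m = m
      Q-yes : ∀ {d} → d ∈ qs → Q d ≡ true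
      Q-yes {d} m with DecMem._∈?_ Fin._≟_ d qs
      ... | yes _ = refl
      ... | no ¬m = ⊥-elim (¬m m)
      ω q : Fin n → ℤ
      ω v = sum (λ d → ι (eqF (vert d) v ∧ (P d ∧ Ω d)))
      q v = sum (λ d → ι (eqF (vert d) v ∧ Q d))
      q-pt : ∀ v d → ι (eqF (vert d) v ∧ Q d) ≤ ι (eqF (vert d) v ∧ (P d ∧ Ω d))
      q-pt v d with eqF (vert d) v | Q d in e
      ... | false | _ = ℤₚ.≤-refl
      ... | true | false = 0≤ι (P d ∧ Ω d)
      ... | true | true rewrite proj₁ (All.lookup allq (Q-in {d} e)) | proj₂ (All.lookup allq (Q-in {d} e)) = ℤₚ.≤-refl
      q≤ω : ∀ v → q v ≤ ω v
      q≤ω v = sum-mono (q-pt v)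
      q<ω : ∀ v z → vert z ≡ v → P z ≡ true → Ω z ≡ true → z ∉ qs → q v + 1ℤ ≤ ω v
      q<ω v z hz Pz Ωz z∉ = subst (_≤ ω v) (trans (∑-distrib-+ _ _) (cong (λ s → q v + s) (sum-point z (λ _ → 1ℤ)))) (sum-mono pt)
        where
        pt : ∀ d → ι (eqF (vert d) v ∧ Q d) + on ⌊ d Fin.≟ z ⌋ 1ℤ ≤ ι (eqF (vert d) v ∧ (P d ∧ Ω d))
        pt d with d Fin.≟ z
        ... | no _ = ℤₚ.≤-trans (ℤₚ.≤-reflexive (ℤₚ.+-identityʳ _)) (q-pt v d)
        ... | yes refl rewrite hz | ≟-refl v | Pz | Ωz with Q d in e
        ...   | true = ⊥-elim (z∉ (Q-in {d} e))
        ...   | false = ℤₚ.≤-refl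
      gain : + length qs - + 4 * h + + 4 * sum (λ v → ι (Z v)) ≤ sum (λ d → ι (P d ∧ Ω d)) + weight
      gain = ℤₚ.≤-trans (ℤₚ.+-monoˡ-≤ (+ 4 * sum (λ v → ι (Z v))) (ℤₚ.+-monoˡ-≤ (- (+ 4 * h))
               (count-list Q qs uq (All.tabulate (λ m → Q-yes m)))))
          (subst₂ _≤_ (trans (∑-distrib-+ _ _) (cong₂ _+_ (trans (sum-sub q _) (cong₂ _-_ (sym (by-tail Q)) (sum-scale (+ 4) _))) (sum-scale (+ 4) _)))
             (trans (∑-distrib-+ ω _) (cong (_+ weight) (sym (by-tail (λ d → P d ∧ Ω d))))) (sum-mono pt))
        where
        q-ω : ∀ v x y → x ≡ y → q v + x ≤ ω v + y
        q-ω v x y refl = ℤₚ.+-monoˡ-≤ x (q≤ω v)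
        ar₁ : ∀ q c e → q - c + e ≡ q + (e - c)
        ar₁ = solve-∀
        ar₂ : ∀ q w → w + (+ 3 + 0ℤ) - (q - + 4 * 0ℤ + + 4 * 1ℤ) ≡ (w - (q + 1ℤ)) + + 0
        ar₂ = solve-∀
        ar₃ : ∀ q w → w + (+ 3 + 1ℤ) - (q - + 4 * 0ℤ + + 4 * 1ℤ) ≡ (w - q) + + 0
        ar₃ = solve-∀
        ar₄ : ∀ q w → w + (+ 3 + 0ℤ) - (q - + 4 * 0ℤ + + 4 * 0ℤ) ≡ (w - q) + + 3
        ar₄ = solve-∀
        ar₅ : ∀ q w → w + (+ 3 + 1ℤ) - (q - + 4 * 0ℤ + + 4 * 0ℤ) ≡ (w - q) + + 4
        ar₅ = solve-∀
        pt : ∀ v → q v - + 4 * ι (H v) + + 4 * ι (Z v) ≤ ω v + on (X v) (+ 3 + ι (big v))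
        pt v with H v in eH | X v in eX
        pt v | true | true = ⊥-elim (false≢true (proj₂ (Split-inX (sp v) eH)) eX)
        pt v | true | false = ℤₚ.≤-trans (ℤₚ.≤-reflexive (ar₁ (q v) (+ 4 * 1ℤ) (+ 4 * 1ℤ))) (q-ω v _ _ refl)
        pt v | false | false = ℤₚ.≤-trans (ℤₚ.≤-reflexive (ar₁ (q v) (+ 4 * 0ℤ) (+ 4 * 0ℤ))) (q-ω v _ _ refl)
        pt v | false | true with T v in eT | big v in eb
        ... | false | true = lin₁ 4 (q≤ω v) (ar₅ (q v) (ω v))
        ... | false | false = lin₁ 3 (q≤ω v) (ar₄ (q v) (ω v))
        ... | true | true = lin₁ 0 (q≤ω v) (ar₃ (q v) (ω v))
        ... | true | false with anyF-true _ eT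
        ...   | e , he = let (z , hz , Pz , Ωz , z∉) = res v eX eb e (eqF-true (proj₁ (∧-true he))) (proj₂ (∧-true {eqF (vert e) v} he))
                         in lin₁ 0 (q<ω v z hz Pz Ωz z∉) (ar₂ (q v) (ω v))
      ar : ∀ p o N r z w e h l → w - p + e - (+ 4 + e - + 4 * h + l) ≡
           (+ 4 * (N - r) - (p + o)) + (+ 4 * z - + 4 * (N - r + 1ℤ)) + (o + w - (l - + 4 * h + + 4 * z)) + + 0
      ar = solve-∀

-- The boundary walk of `H` and the resulting bounds on ρ.

-- Here τ is the length of the boundary walk and m the order of `H`. The three cases are those in
-- which the darts of the walk and the next one do not yet give ρ ≥ -1; see `long`.
numbers : ∀ τ m → m ℕ.≤ suc τ → m ℕ.≤ 5 → ¬ (2 ℕ.* m ℕ.≤ τ ℕ.+ 4) →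
          (τ ≡ 3 × m ≡ 4) ⊎ (τ ≡ 4 × m ≡ 5) ⊎ (τ ≡ 5 × m ≡ 5)
numbers τ 0 _ _ h = ⊥-elim (h ℕ.z≤n)
numbers τ 1 _ _ h = ⊥-elim (h (ℕₚ.≤-trans (ℕ.s≤s (ℕ.s≤s ℕ.z≤n)) (ℕₚ.m≤n+m 4 τ)))
numbers τ 2 _ _ h = ⊥-elim (h (ℕₚ.m≤n+m 4 τ))
numbers τ 3 (ℕ.s≤s l) _ h = ⊥-elim (h (ℕₚ.+-monoˡ-≤ 4 l))
numbers τ 4 (ℕ.s≤s l) _ h with τ ℕ.≟ 3
... | yes e = inj₁ (e , refl)
... | no ne = ⊥-elim (h (ℕₚ.+-monoˡ-≤ 4 (ℕₚ.≤∧≢⇒< l (λ e → ne (sym e)))))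
numbers τ 5 (ℕ.s≤s l) _ h with τ ℕ.≟ 4 | τ ℕ.≟ 5
... | yes e | _ = inj₂ (inj₁ (e , refl))
... | no _ | yes e = inj₂ (inj₂ (e , refl))
... | no ne | no ne′ = ⊥-elim (h (ℕₚ.+-monoˡ-≤ 4 (ℕₚ.≤∧≢⇒< (ℕₚ.≤∧≢⇒< l (λ e → ne (sym e))) (λ e → ne′ (sym e)))))
numbers τ (suc (suc (suc (suc (suc (suc m)))))) _ (ℕ.s≤s (ℕ.s≤s (ℕ.s≤s (ℕ.s≤s (ℕ.s≤s ()))))) _

module Bounds (G : PlaneGraph) (tf : PlaneGraph.TriangleFree G) (hv big : VSet (PlaneGraph.n G)) where
  open PlaneGraph G
  open Adjacency G
  open Graph adjB adjB-sym
  open Plane G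

  -- Both end vertices of the walk occur only once on it. This makes its darts distinct and
  -- separates them from the darts just before and just after the walk, which have to be counted as
  -- well.
  record Segment : Set where
    field
      d     : Fin k
      τ     : ℕ
      outer : outerD d ≡ true
    w : ℕ → Fin n
    w i = vert (iter φ i d)
    field
      in-H  : ∀ i → i ℕ.≤ τ → hv (w i) ≡ true
      cover-H : ∀ v → hv v ≡ true → ∃ λ i → i ℕ.≤ τ × w i ≡ v
      start-once : ∀ i → i ℕ.< τ → w (suc i) ≢ w 0
      end-once   : ∀ i → i ℕ.< τ → w i ≢ w τ

  shrink : ∀ τ d → outerD d ≡ true → (∀ i → i ℕ.≤ τ → hv (vert (iter φ i d)) ≡ true) →
           (∀ v → hv v ≡ true → ∃ λ i → i ℕ.≤ τ × vert (iter φ i d) ≡ v) → Segment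
  shrink zero d o inH cov = record { d = d ; τ = 0 ; outer = o ; in-H = inH ; cover-H = cov
                                   ; start-once = λ _ () ; end-once = λ _ () }
  shrink (suc τ) d o inH cov with Finₚ.any? (λ (i : Fin (suc τ)) → vert (iter φ (suc (Fin.toℕ i)) d) Fin.≟ vert d)
  ... | yes (i , e) = shrink τ (φ d) (outerD-closed d o) (λ j l → subst (λ x → hv (vert x) ≡ true) (iter-suc φ j d) (inH (suc j) (ℕ.s≤s l))) cov′
    where
    cov′ : ∀ v → hv v ≡ true → ∃ λ j → j ℕ.≤ τ × vert (iter φ j (φ d)) ≡ v
    cov′ v h with cov v h
    ... | suc j , ℕ.s≤s l , q = j , l , trans (cong vert (sym (iter-suc φ j d))) q
    ... | zero , _ , q = Fin.toℕ i , ℕₚ.≤-pred (Finₚ.toℕ<n i) , trans (cong vert (sym (iter-suc φ (Fin.toℕ i) d))) (trans e q)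
  ... | no ¬first with Finₚ.any? (λ (i : Fin (suc τ)) → vert (iter φ (Fin.toℕ i) d) Fin.≟ vert (iter φ (suc τ) d))
  ...   | yes (i , e) = shrink τ d o (λ j l → inH j (ℕₚ.m≤n⇒m≤1+n l)) cov′
    where
    cov′ : ∀ v → hv v ≡ true → ∃ λ j → j ℕ.≤ τ × vert (iter φ j d) ≡ v
    cov′ v h with cov v h
    ... | j , l , q with j ℕ.≟ suc τ
    ...   | yes refl = Fin.toℕ i , ℕₚ.≤-pred (Finₚ.toℕ<n i) , trans e q
    ...   | no ne = j , ℕₚ.≤-pred (ℕₚ.≤∧≢⇒< l ne) , q
  ...   | no ¬last = record { d = d ; τ = suc τ ; outer = o ; in-H = inH ; cover-H = cov
            ; start-once = λ i l e → ¬first (Fin.fromℕ< l , trans (cong (λ j → vert (iter φ (suc j) d)) (Finₚ.toℕ-fromℕ< l)) e)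
            ; end-once = λ i l e → ¬last (Fin.fromℕ< l , trans (cong (λ j → vert (iter φ j d)) (Finₚ.toℕ-fromℕ< l)) e) }

  h : ℤ
  h = sum (λ v → ι (hv v))

  module Seg (sg : Segment) where
    open Segment sg public

    dart : ℕ → Fin k
    dart i = iter φ i d

    outer-i : ∀ i → outerD (dart i) ≡ true
    outer-i zero = outer
    outer-i (suc i) = outerD-closed (dart i) (outer-i i)

    head : ∀ i → vert (α (dart i)) ≡ w (suc i)
    head i = sym (φ-vert (dart i))

    -- Equal darts stay equal after further steps, so the last vertex of the walk would occur
    -- earlier.
    dart-inj : ∀ i j → i ℕ.< j → j ℕ.< τ → dart i ≢ dart j
    dart-inj i j i<j j<τ e = end-once (m ℕ.+ i) short (cong vert same)
      where
      m : ℕ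
      m = τ ℕ.∸ j
      mj : m ℕ.+ j ≡ τ
      mj = ℕₚ.m∸n+n≡m (ℕₚ.<⇒≤ j<τ)
      short : m ℕ.+ i ℕ.< τ
      short = ℕₚ.<-≤-trans (ℕₚ.+-monoʳ-< m i<j) (ℕₚ.≤-reflexive mj)
      same : dart (m ℕ.+ i) ≡ dart τ
      same = trans (iter-+ φ m i d) (trans (cong (iter φ m) e) (trans (sym (iter-+ φ m j d)) (cong dart mj)))

    h≤ : h ≤ + suc τ
    h≤ = subst (h ≤_) (sum-const (suc τ)) (sum-inject hv (λ (_ : Fin (suc τ)) → true)
        (λ v e → Fin.fromℕ< (ℕ.s≤s (proj₁ (proj₂ (cover-H v e))))) (λ _ _ → refl)
        (λ u v hu hv′ e → trans (sym (at u hu)) (trans (cong w (trans (sym (Finₚ.toℕ-fromℕ< _)) (trans (cong Fin.toℕ e) (Finₚ.toℕ-fromℕ< _)))) (at v hv′))))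
      where
      at : ∀ v e → w (proj₁ (cover-H v e)) ≡ v
      at v e = proj₂ (proj₂ (cover-H v e))

    -- `cover-H` selects one index per vertex, so at least one of i and j is never selected and `τ`
    -- indices suffice.
    repeat : ∀ i j → i ℕ.< j → j ℕ.≤ τ → w i ≡ w j → h ≤ + τ
    repeat i j i<j j≤τ q = subst (h ≤_) (trans (ar _) (cong (_- 1ℤ) (trans total (sum-const (suc τ))))) inject
      where
      idx : ∀ v → hv v ≡ true → ℕ
      idx v e = proj₁ (cover-H v e)
      hw : hv (w i) ≡ true
      hw = in-H i (ℕₚ.≤-trans (ℕₚ.<⇒≤ i<j) j≤τ)
      skip : ∃ λ b → b ℕ.≤ τ × (∀ v e → idx v e ≢ b)
      skip with idx (w i) hw ℕ.≟ i
      ... | yes e₀ = j , j≤τ , λ v e e′ → ℕₚ.<⇒≢ i<j (trans (sym e₀) (trans (same v e e′) e′))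
        where
        same : ∀ v e → idx v e ≡ j → idx (w i) hw ≡ idx v e
        same v e e′ = go v e (trans q (trans (cong w (sym e′)) (proj₂ (proj₂ (cover-H v e)))))
          where
          go : ∀ v e → w i ≡ v → idx (w i) hw ≡ idx v e
          go .(w i) e refl = cong (idx (w i)) (Decidable⇒UIP.≡-irrelevant 𝔹._≟_ hw e)
      ... | no ne = i , ℕₚ.≤-trans (ℕₚ.<⇒≤ i<j) j≤τ , λ v e e′ → ne (trans (same v e e′) e′)
        where
        same : ∀ v e → idx v e ≡ i → idx (w i) hw ≡ idx v e
        same v e e′ = go v e (trans (cong w (sym e′)) (proj₂ (proj₂ (cover-H v e))))
          where
          go : ∀ v e → w i ≡ v → idx (w i) hw ≡ idx v e
          go .(w i) e refl = cong (idx (w i)) (Decidable⇒UIP.≡-irrelevant 𝔹._≟_ hw e)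
      b : Fin (suc τ)
      b = Fin.fromℕ< (ℕ.s≤s (proj₁ (proj₂ skip)))
      f : ∀ v → hv v ≡ true → Fin (suc τ)
      f v e = Fin.fromℕ< (ℕ.s≤s (proj₁ (proj₂ (cover-H v e))))
      inject : h ≤ sum (λ x → ι (not ⌊ x Fin.≟ b ⌋))
      inject = sum-inject hv (λ x → not ⌊ x Fin.≟ b ⌋) f ok
        (λ u v hu hv′ e → trans (sym (proj₂ (proj₂ (cover-H u hu)))) (trans (cong w (trans (sym (Finₚ.toℕ-fromℕ< _)) (trans (cong Fin.toℕ e) (Finₚ.toℕ-fromℕ< _)))) (proj₂ (proj₂ (cover-H v hv′)))))
        where
        ok : ∀ v e → not ⌊ f v e Fin.≟ b ⌋ ≡ true
        ok v e with f v e Fin.≟ b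
        ... | no _ = refl
        ... | yes p = ⊥-elim (proj₂ (proj₂ skip) v e (trans (sym (Finₚ.toℕ-fromℕ< _)) (trans (cong Fin.toℕ p) (Finₚ.toℕ-fromℕ< _))))
      total : sum (λ x → ι (not ⌊ x Fin.≟ b ⌋)) + 1ℤ ≡ sum {suc τ} (λ _ → 1ℤ)
      total = trans (cong (λ z → sum (λ x → ι (not ⌊ x Fin.≟ b ⌋)) + z) (sym (sum-point b (λ _ → 1ℤ)))) (trans (sym (∑-distrib-+ _ _)) (sum-cong-≗ pt))
        where
        pt : ∀ x → ι (not ⌊ x Fin.≟ b ⌋) + on ⌊ x Fin.≟ b ⌋ 1ℤ ≡ 1ℤ
        pt x with x Fin.≟ b
        ... | yes _ = refl
        ... | no _ = refl
      ar : ∀ s → s ≡ s + 1ℤ - 1ℤ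
      ar = solve-∀

    rank≤length : ∀ A → + n ≤ rP A + + length A
    rank≤length [] = ℤₚ.≤-reflexive (sym (trans (ℤₚ.+-identityʳ _) (trans roots-[] (sum-const n))))
    rank≤length (x ∷ A) = ℤₚ.≤-trans (rank≤length A) (lin₁ 0 r≤1
        (trans (cong₂ (λ a b → rP (x ∷ A) + a - (b + + length A)) (ℤₚ.pos-+ 1 (length A)) (sym (roots-∷ (vert x) (vert (α x)) (prim A))))
          (ar (rP (x ∷ A)) (+ length A) (splits (prim A) (vert x) (vert (α x))))))
      where
      r≤1 : splits (prim A) (vert x) (vert (α x)) ≤ 1ℤ
      r≤1 with eqF (cP A (vert x)) (cP A (vert (α x)))
      ... | true = +≤+ ℕ.z≤n
      ... | false = ℤₚ.≤-refl
      ar : ∀ R l r → R + (1ℤ + l) - (R + r + l) ≡ (1ℤ - r) + + 0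
      ar = solve-∀

    connect : ∀ P → Symm P → (∀ i → i ℕ.< τ → P (dart i) ≡ true) →
              ∀ i → i ℕ.≤ τ → cP (edgesOf P) (w i) ≡ cP (edgesOf P) (w 0)
    connect P sy hP zero _ = refl
    connect P sy hP (suc i) l = trans (sym (trans (cP-α (edges-has P sy (hP i l))) (cong (cP (edgesOf P)) (head i)))) (connect P sy hP i (ℕₚ.<⇒≤ l))

    -- An edge set containing the walk connects all of `H`, hence has at least |H| - 1 edges, each
    -- with two darts.
    spanning : ∀ P → Symm P → (∀ i → i ℕ.< τ → P (dart i) ≡ true) →
               + 2 * h - + 2 ≤ sum (λ d → ι (P d))
    spanning P sy hP = subst (+ 2 * h - + 2 ≤_) (edges-length P sy)
        (lin₂ 0 (ℤₚ.*-monoˡ-≤-nonNeg (+ 2) (rank≤length A)) (ℤₚ.*-monoˡ-≤-nonNeg (+ 2) few)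
          (ar (+ length A) h (+ n) (rP A)))
      where
      A : List (Fin k)
      A = edgesOf P
      c : Fin n
      c = cP A (w 0)
      not-total : sum (λ v → ι (not (hv v))) ≡ + n - h
      not-total = trans (ar′ _ h) (cong (_- h) (trans (sym (∑-distrib-+ _ _)) (trans (sum-cong-≗ pt) (sum-const n))))
        where
        ar′ : ∀ s h → s ≡ s + h - h
        ar′ = solve-∀
        pt : ∀ v → ι (not (hv v)) + ι (hv v) ≡ 1ℤ
        pt v with hv v
        ... | true = refl
        ... | false = refl
      few : rP A ≤ + n - h + 1ℤ
      few = subst (rP A ≤_) (trans (∑-distrib-+ _ _) (cong₂ _+_ not-total (sum-point c (λ _ → 1ℤ)))) (sum-mono pt)
        where
        pt : ∀ v → ι (root (prim A) v) ≤ ι (not (hv v)) + on ⌊ v Fin.≟ c ⌋ 1ℤ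
        pt v with hv v in e
        ... | false with v Fin.≟ c | root (prim A) v
        ...   | yes _ | true = +≤+ (ℕ.s≤s ℕ.z≤n)
        ...   | yes _ | false = +≤+ ℕ.z≤n
        ...   | no _ | true = ℤₚ.≤-refl
        ...   | no _ | false = +≤+ ℕ.z≤n
        pt v | true with v Fin.≟ c
        ... | yes _ with root (prim A) v
        ...   | true = ℤₚ.≤-refl
        ...   | false = +≤+ ℕ.z≤n
        pt v | true | no ne with root (prim A) v in r
        ... | false = ℤₚ.≤-refl
        ... | true with cover-H v e
        ...   | i , l , q = ⊥-elim (ne (trans (sym (eqF-true r)) (trans (cong (cP A) (sym q)) (connect P sy hP i l))))
      ar : ∀ l h N r → l + l - (+ 2 * h - + 2) ≡ (+ 2 * (r + l) - + 2 * N) + (+ 2 * (N - h + 1ℤ) - + 2 * r) + + 0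
      ar = solve-∀

    inside-walk : ∀ i → i ℕ.< τ → inside hv (dart i) ≡ true
    inside-walk i l = cong₂ _∧_ (in-H i (ℕₚ.<⇒≤ l)) (trans (cong hv (head i)) (in-H (suc i) l))

    tree-edges : + 2 * h - + 2 ≤ edges hv hv
    tree-edges = subst (+ 2 * h - + 2 ≤_) (inside-sum hv) (spanning (inside hv) (inside-α hv) inside-walk)

    -- An edge of H which is not on the walk closes a cycle.
    extra-edge : ∀ x → inside hv x ≡ true → (∀ i → i ℕ.< τ → dart i ≢ x × dart i ≢ α x) → + 2 * h ≤ edges hv hv
    extra-edge x hx off = subst (+ 2 * h ≤_) (inside-sum hv) (subst (_≤ sum (λ d → ι (inside hv d))) (ar h)
        (ℤₚ.≤-trans (ℤₚ.+-monoˡ-≤ (+ 2) (spanning P sy hP)) (ℤₚ.≤-reflexive count)))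
      where
      ar : ∀ h → + 2 * h - + 2 + + 2 ≡ + 2 * h
      ar = solve-∀
      P : Fin k → Bool
      P d = inside hv d ∧ not (⌊ d Fin.≟ x ⌋ ∨ ⌊ d Fin.≟ α x ⌋)
      swap : ∀ d → (⌊ α d Fin.≟ x ⌋ ∨ ⌊ α d Fin.≟ α x ⌋) ≡ (⌊ d Fin.≟ x ⌋ ∨ ⌊ d Fin.≟ α x ⌋)
      swap d with d Fin.≟ x | d Fin.≟ α x | α d Fin.≟ x | α d Fin.≟ α x
      ... | yes refl | _ | _ | no ne = ⊥-elim (ne refl)
      ... | yes refl | _ | yes _ | yes _ = refl
      ... | yes refl | _ | no _ | yes _ = refl
      ... | no _ | yes refl | no ne | _ = ⊥-elim (ne (α-invol x))
      ... | no _ | yes refl | yes _ | _ = refl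
      ... | no _ | no ne | yes e | _ = ⊥-elim (ne (trans (sym (α-invol d)) (cong α e)))
      ... | no ne | no _ | no _ | yes e = ⊥-elim (ne (α-inj e))
      ... | no _ | no _ | no _ | no _ = refl
      sy : Symm P
      sy d = cong₂ (λ a b → a ∧ not b) (inside-α hv d) (swap d)
      hP : ∀ i → i ℕ.< τ → P (dart i) ≡ true
      hP i l rewrite inside-walk i l with dart i Fin.≟ x | dart i Fin.≟ α x
      ... | yes e | _ = ⊥-elim (proj₁ (off i l) e)
      ... | no _ | yes e = ⊥-elim (proj₂ (off i l) e)
      ... | no _ | no _ = refl
      count : sum (λ d → ι (P d)) + + 2 ≡ sum (λ d → ι (inside hv d))
      count = trans (cong (λ z → sum (λ d → ι (P d)) + z) (sym (cong₂ _+_ (sum-point x (λ _ → 1ℤ)) (sum-point (α x) (λ _ → 1ℤ)))))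
        (trans (cong (λ z → sum (λ d → ι (P d)) + z) (sym (∑-distrib-+ _ _))) (trans (sym (∑-distrib-+ _ _)) (sum-cong-≗ pt)))
        where
        pt : ∀ d → ι (P d) + (on ⌊ d Fin.≟ x ⌋ 1ℤ + on ⌊ d Fin.≟ α x ⌋ 1ℤ) ≡ ι (inside hv d)
        pt d with d Fin.≟ x | d Fin.≟ α x
        ... | yes refl | yes e = ⊥-elim (α-nofix d (sym e))
        ... | yes refl | no _ rewrite hx = refl
        ... | no _ | yes refl rewrite inside-α hv x | hx = refl
        ... | no _ | no _ rewrite 𝔹ₚ.∧-identityʳ (inside hv d) = ℤₚ.+-identityʳ _

  open Colouring G using (IsPathOf; AtLeastEnds)

  GoodE : Fin n → Set
  GoodE x = ∀ v → hv v ≡ false → Adj x v → big v ≡ true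

  Ends : Set
  Ends = ∀ m p → IsPathOf hv m p → AtLeastEnds (suc m ℕ.∸ 3) (GoodE (p Fin.zero)) (GoodE (p (Fin.fromℕ m)))

  NoShare : Set
  NoShare = ∀ p → IsPathOf hv 4 p → ∀ v → hv v ≡ false → ∀ x y → hv x ≡ true → hv y ≡ true → Adj v x → Adj v y → x ≡ y

  ends₃ : Ends → ∀ m → m ≡ 3 → ∀ p → IsPathOf hv m p → GoodE (p Fin.zero) ⊎ GoodE (p (Fin.fromℕ m))
  ends₃ E .3 refl p ip = E 3 p ip

  ends₄ : Ends → ∀ m → m ≡ 4 → ∀ p → IsPathOf hv m p → GoodE (p Fin.zero) × GoodE (p (Fin.fromℕ m))
  ends₄ E .4 refl p ip = E 4 p ip

  noShare₄ : NoShare → ∀ m → m ≡ 4 → ∀ p → IsPathOf hv m p →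
    ∀ v → hv v ≡ false → ∀ x y → hv x ≡ true → hv y ≡ true → Adj v x → Adj v y → x ≡ y
  noShare₄ N .4 refl = N

  module Over (X Y : VSet n) (sp : Split Y hv X) (outerA : OuterOK X big) where
    open Count tf hv X big Y sp outerA public hiding (h)

    H⊂Y : ∀ {v} → hv v ≡ true → Y v ≡ true
    H⊂Y {v} h = proj₁ (Split-inX (sp v) h)

    X-not-H : ∀ {v} → X v ≡ true → hv v ≡ false
    X-not-H {v} h = proj₂ (Split-inR (sp v) h)

    Tail : Fin k → Set
    Tail q = hv (vert q) ≡ true ⊎ big (vert q) ≡ true

    PΩ : Fin k → Set
    PΩ q = P q ≡ true × Ω q ≡ true

    -- No dart of `qs` starts at a vertex of `X` with small lists, so `qs` cannot compete for the
    -- reserved darts.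
    reserve : ∀ qs → All Tail qs → Reserve qs
    reserve qs ts v hX hb e he Pe with outer-dart v hX hb e he Pe
    ... | z , hz , Pz , Ωz = z , hz , Pz , Ωz , λ m → bad (All.lookup ts m)
      where
      bad : ¬ Tail z
      bad (inj₁ t) = false≢true (X-not-H hX) (trans (cong hv (sym hz)) t)
      bad (inj₂ t) = false≢true hb (trans (cong big (sym hz)) t)

    bound : ∀ qs b → b ≤ 0ℤ → Unique qs → All PΩ qs → Reserve qs → b ≤ + 4 + edges hv hv - + 4 * h + + length qs → b ≤ ρ κ X
    bound qs b b≤0 u a r le with Finₚ.any? (λ d → P d 𝔹.≟ true)
    ... | yes (d , Pd) = ℤₚ.≤-trans le (ρ-bound d Pd qs u a r)
    ... | no ¬p = ℤₚ.≤-trans b≤0 (ρ-no-edges (λ d → 𝔹ₚ.¬-not (λ e → ¬p (d , e))))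

    small-H : h ≤ 1ℤ → -1ℤ ≤ ρ κ X
    small-H h≤1 = bound [] -1ℤ -≤+ [] [] (reserve [] [])
      (lin₂ 1 (0≤edges hv hv) (ℤₚ.*-monoˡ-≤-nonNeg (+ 4) h≤1) (ar (edges hv hv) h))
      where
      ar : ∀ e h → + 4 + e - + 4 * h + + 0 - -1ℤ ≡ (e - 0ℤ) + (+ 4 * 1ℤ - + 4 * h) + + 1
      ar = solve-∀

    -- The situation in which only ρ ≥ -2 is guaranteed.
    record Exception (sg : Segment) : Set where
      module S = Seg sg
      field
        y      : Fin k
        y-PΩ   : PΩ y
        y-end  : vert y ≡ S.w S.τ
        r-X    : X (vert (α y)) ≡ true
        r-A    : big (vert (α y)) ≡ false
        only   : ∀ s → vert s ≡ vert (α y) → PΩ s → s ≡ ψ y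
        ρ≥     : - + 2 ≤ ρ κ X

    module With (sg : Segment) (τ′ : ℕ) (τ≡ : Segment.τ sg ≡ suc τ′) where
      open Seg sg

      dP : ∀ i → i ℕ.< τ → P (dart i) ≡ true
      dP i l = cong₂ _∧_ (H⊂Y (proj₁ (∧-true (inside-walk i l)))) (H⊂Y (proj₂ (∧-true {hv (vert (dart i))} (inside-walk i l))))

      dΩ : ∀ i → Ω (dart i) ≡ true
      dΩ i = outer-Ω (dart i) (outer-i i)

      τ′<τ : τ′ ℕ.< τ
      τ′<τ = subst (τ′ ℕ.<_) (sym τ≡) ℕₚ.≤-refl

      -- The dart following the walk on the chosen region of the subgraph; it leaves the last vertex
      -- of `H`.
      y : Fin k
      y = ψ (dart τ′)
      yP : P y ≡ true
      yP = ψ-P (dP τ′ τ′<τ)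
      y-Ω : Ω y ≡ true
      y-Ω = trans (Ω-cong (ψ-D (dP τ′ τ′<τ))) (dΩ τ′)
      y-vert : vert y ≡ w τ
      y-vert = trans (ψ-vert (dP τ′ τ′<τ)) (trans (head τ′) (cong w (sym τ≡)))

      r : Fin n
      r = vert (α y)

      qs₀ qs₁ : List (Fin k)
      qs₀ = applyUpTo dart τ
      qs₁ = y ∷ qs₀

      ∉qs₀ : ∀ {x} → (∀ i → i ℕ.< τ → x ≢ dart i) → x ∉ qs₀
      ∉qs₀ h m with ∈-applyUpTo⁻ dart m
      ... | i , l , refl = h i l refl

      ∉⇒All : ∀ {x : Fin k} {xs} → x ∉ xs → All (x ≢_) xs
      ∉⇒All {xs = []} h = []
      ∉⇒All {xs = z ∷ zs} h = (λ e → h (here e)) ∷ ∉⇒All (h ∘ there)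

      y-new : y ∉ qs₀
      y-new = ∉qs₀ (λ i l e → end-once i l (trans (cong vert (sym e)) y-vert))

      u₁ : Unique qs₁
      u₁ = ∉⇒All y-new ∷ Uniqueₚ.applyUpTo⁺₁ dart τ (λ {i} {j} i<j j<τ → dart-inj i j i<j j<τ)

      a₁ : All PΩ qs₁
      a₁ = (yP , y-Ω) ∷ Allₚ.applyUpTo⁺₁ dart τ (λ {i} l → dP i l , dΩ i)

      t₁ : All Tail qs₁
      t₁ = inj₁ (trans (cong hv y-vert) (in-H τ ℕₚ.≤-refl)) ∷ Allₚ.applyUpTo⁺₁ dart τ (λ {i} l → inj₁ (in-H i (ℕₚ.<⇒≤ l)))

      len₁ : length qs₁ ≡ suc τ
      len₁ = cong suc (Listₚ.length-applyUpTo dart τ)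

      -- The dart following y on the outer face.
      y₂ : Fin k
      y₂ = ψ y
      y₂P : P y₂ ≡ true
      y₂P = ψ-P yP
      y₂Ω : Ω y₂ ≡ true
      y₂Ω = trans (Ω-cong (ψ-D yP)) y-Ω
      y₂-vert : vert y₂ ≡ r
      y₂-vert = ψ-vert yP

      ψ-dart : ∀ i → suc i ℕ.< τ → ψ (dart i) ≡ dart (suc i)
      ψ-dart i l = ψ-φ (dP i (ℕₚ.<-trans ℕₚ.≤-refl l)) (dP (suc i) l)

      y₂-new : r ≢ w 0 → y₂ ∉ qs₁
      y₂-new r≢ (here e) = noLoop y (trans (sym y₂-vert) (cong vert e))
      y₂-new r≢ (there m) = ∉qs₀ not-dart m
        where
        not-dart : ∀ i → i ℕ.< τ → y₂ ≢ dart i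
        not-dart zero l e = r≢ (trans (sym y₂-vert) (cong vert e))
        not-dart (suc i) l e = y-new (subst (_∈ qs₀) (sym (ψ-inj (trans e (sym (ψ-dart i l)))))
            (∈-applyUpTo⁺ dart (ℕₚ.<-trans ℕₚ.≤-refl l)))

      X-or-H : ∀ {q} → P q ≡ true → hv (vert (α q)) ≡ true ⊎ X (vert (α q)) ≡ true
      X-or-H {q} h = Split-U (sp _) (P-head h)

      y-Adj : Adj (w τ) r
      y-Adj = y , y-vert , refl

      -- With 2h darts inside `H` the basic bound is 4 + 2h - 4h + (τ + 1), which is at least 4 - h
      -- because h ≤ τ + 1.
      cyclic : + 2 * h ≤ edges hv hv → h ≤ + 5 → -1ℤ ≤ ρ κ X
      cyclic hE h≤5 = bound qs₁ -1ℤ -≤+ u₁ a₁ (reserve qs₁ t₁)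
        (lin₃ 0 hE h≤ h≤5 (trans (cong (λ l → + 4 + edges hv hv - + 4 * h + + l - -1ℤ) len₁) (ar (edges hv hv) h (+ suc τ))))
        where
        ar : ∀ e h t → + 4 + e - + 4 * h + t - -1ℤ ≡ (e - + 2 * h) + (t - h) + (+ 5 - h) + + 0
        ar = solve-∀

      long : + 2 * h ≤ + τ + + 4 → -1ℤ ≤ ρ κ X
      long hτ = bound qs₁ -1ℤ -≤+ u₁ a₁ (reserve qs₁ t₁)
        (lin₂ 0 tree-edges hτ (trans (cong (λ l → + 4 + edges hv hv - + 4 * h + l - -1ℤ) (trans (cong +_ len₁) (ℤₚ.pos-+ 1 τ))) (ar (edges hv hv) h (+ τ))))
        where
        ar : ∀ e h t → + 4 + e - + 4 * h + (1ℤ + t) - -1ℤ ≡ (e - (+ 2 * h - + 2)) + (t + + 4 - + 2 * h) + + 0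
        ar = solve-∀

      -- Connectivity of `H` gives 2h - 2 darts inside it, so the basic bound becomes 2 - 2h + |qs|:
      -- five vertices require seven darts, four vertices five.
      enough : ∀ qs → Unique qs → All PΩ qs → Reserve qs → + 2 * h ≤ + length qs + + 3 → -1ℤ ≤ ρ κ X
      enough qs u a r le = bound qs -1ℤ -≤+ u a r (lin₂ 0 tree-edges le (ar (edges hv hv) h (+ length qs)))
        where
        ar : ∀ e h l → + 4 + e - + 4 * h + l - -1ℤ ≡ (e - (+ 2 * h - + 2)) + (l + + 3 - + 2 * h) + + 0
        ar = solve-∀

      Off : Fin k → Set
      Off x = inside hv x ≡ true × ¬ (∃ λ (i : Fin τ) → dart (Fin.toℕ i) ≡ x ⊎ dart (Fin.toℕ i) ≡ α x)

      off-edge : ∀ {x} → Off x → + 2 * h ≤ edges hv hv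
      off-edge {x} (hx , ¬w) = extra-edge x hx (λ i l →
        (λ e → ¬w (Fin.fromℕ< l , inj₁ (trans (cong dart (Finₚ.toℕ-fromℕ< l)) e))) ,
        (λ e → ¬w (Fin.fromℕ< l , inj₂ (trans (cong dart (Finₚ.toℕ-fromℕ< l)) e))))

      Off? : Dec (∃ Off)
      Off? = Finₚ.any? (λ x → (inside hv x 𝔹.≟ true) ×-dec ¬? (Finₚ.any? (λ i → (dart (Fin.toℕ i) Fin.≟ x) ⊎-dec (dart (Fin.toℕ i) Fin.≟ α x))))

      -- Seven darts are required and the walk with `y` provides six. If `r` lies in `H`, either `y`
      -- is an edge off the walk or `y₂` is the seventh dart. If `r` has large lists, `y₂` counts
      -- again. If `r` has small lists, `y₂` may be its only chosen dart and thus be reserved; this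
      -- is the exception.
      exceptional : h ≡ + 5 → τ ≡ 5 → -1ℤ ≤ ρ κ X ⊎ Exception sg
      exceptional h5 τ5 with X-or-H {y} yP
      ... | inj₁ rH with r Fin.≟ w τ′
      ...   | no r≢ = inj₁ (cyclic (off-edge {y} (cong₂ _∧_ (trans (cong hv y-vert) (in-H τ ℕₚ.≤-refl)) rH , off)) (ℤₚ.≤-reflexive h5))
        where
        off : ¬ (∃ λ (i : Fin τ) → dart (Fin.toℕ i) ≡ y ⊎ dart (Fin.toℕ i) ≡ α y)
        off (i , inj₁ e) = end-once (Fin.toℕ i) (Finₚ.toℕ<n i) (trans (cong vert e) y-vert)
        off (i , inj₂ e) with suc (Fin.toℕ i) ℕ.≟ τ
        ... | yes q = r≢ (trans (sym (cong vert e)) (cong w (ℕₚ.suc-injective (trans q τ≡))))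
        ... | no ne = end-once (suc (Fin.toℕ i)) (ℕₚ.≤∧≢⇒< (Finₚ.toℕ<n i) ne)
              (trans (sym (head (Fin.toℕ i))) (trans (cong (vert ∘ α) e) (trans (cong vert (α-invol y)) y-vert)))
      ...   | yes r≡ = inj₁ (enough (y₂ ∷ qs₁) (∉⇒All (y₂-new r≢0) ∷ u₁) ((y₂P , y₂Ω) ∷ a₁)
                (reserve (y₂ ∷ qs₁) (inj₁ (trans (cong hv y₂-vert) rH) ∷ t₁)) (ℤₚ.≤-reflexive (trans (cong (+ 2 *_) h5) (cong (λ l → + suc l + + 3) (sym (trans len₁ (cong suc τ5)))))))
        where
        r≢0 : r ≢ w 0
        r≢0 e = start-once (ℕ.pred τ′) (subst (ℕ.pred τ′ ℕ.<_) (sym τ5) (subst (λ t → ℕ.pred t ℕ.< 5) (sym τ′4) (ℕ.s≤s (ℕ.s≤s (ℕ.s≤s (ℕ.s≤s ℕ.z≤n))))))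
                  (trans (cong w (trans (cong (suc ∘ ℕ.pred) τ′4) (sym τ′4))) (trans (sym r≡) e))
          where
          τ′4 : τ′ ≡ 4
          τ′4 = ℕₚ.suc-injective (trans (sym τ≡) τ5)
      exceptional h5 τ5 | inj₂ rX with big r in eb
      ... | true = inj₁ (enough (y₂ ∷ qs₁) (∉⇒All (y₂-new (λ e → false≢true (X-not-H rX) (trans (cong hv e) (in-H 0 ℕ.z≤n)))) ∷ u₁) ((y₂P , y₂Ω) ∷ a₁)
                (reserve (y₂ ∷ qs₁) (inj₂ (trans (cong big y₂-vert) eb) ∷ t₁)) (ℤₚ.≤-reflexive (trans (cong (+ 2 *_) h5) (cong (λ l → + suc l + + 3) (sym (trans len₁ (cong suc τ5)))))))
      ... | false with Finₚ.any? (λ s → (vert s Fin.≟ r) ×-dec (((P s 𝔹.≟ true) ×-dec (Ω s 𝔹.≟ true)) ×-dec ¬? (s Fin.≟ y₂)))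
      ...   | no ¬s = inj₂ (record { y = y ; y-PΩ = yP , y-Ω ; y-end = y-vert ; r-X = rX ; r-A = eb
               ; only = only′
               ; ρ≥ = bound qs₁ (- + 2) -≤+ u₁ a₁ (reserve qs₁ t₁)
                   (lin₁ 0 tree-edges (trans (cong₂ (λ a l → + 4 + edges hv hv - + 4 * a + + l - - + 2) h5 (trans len₁ (cong suc τ5)))
                      (trans (ar (edges hv hv)) (cong (λ a → edges hv hv - (+ 2 * a - + 2) + + 0) (sym h5))))) })
        where
        only′ : ∀ s → vert s ≡ r → PΩ s → s ≡ y₂
        only′ s q p with s Fin.≟ y₂
        ... | yes e = e
        ... | no ne = ⊥-elim (¬s (s , q , p , ne))
        ar : ∀ e → + 4 + e - + 4 * + 5 + + 6 - - + 2 ≡ e - (+ 2 * + 5 - + 2) + + 0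
        ar = solve-∀
      ...   | yes (s , sr , (sP , sΩ) , s≢) = inj₁ (enough (s ∷ qs₁) (∉⇒All s-new ∷ u₁) ((sP , sΩ) ∷ a₁) res
                (ℤₚ.≤-reflexive (trans (cong (+ 2 *_) h5) (cong (λ l → + suc l + + 3) (sym (trans len₁ (cong suc τ5)))))))
        where
        tailH : ∀ {q} → q ∈ qs₁ → hv (vert q) ≡ true
        tailH (here refl) = trans (cong hv y-vert) (in-H τ ℕₚ.≤-refl)
        tailH (there m) with ∈-applyUpTo⁻ dart m
        ... | i , l , refl = in-H i (ℕₚ.<⇒≤ l)
        s-new : s ∉ qs₁
        s-new m = false≢true (X-not-H rX) (trans (cong hv (sym sr)) (tailH m))
        -- At `r` the dart `y₂` serves as the reserve, which sets `s` free.
        res : Reserve (s ∷ qs₁)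
        res v hX hb e he Pe with v Fin.≟ r
        ... | yes refl = y₂ , y₂-vert , y₂P , y₂Ω , λ { (here q) → s≢ (sym q) ; (there m) → false≢true (X-not-H rX) (trans (cong hv (sym y₂-vert)) (tailH m)) }
        ... | no ne with outer-dart v hX hb e he Pe
        ...   | z , hz , Pz , Ωz = z , hz , Pz , Ωz , λ { (here refl) → ne (trans (sym hz) sr)
                    ; (there m) → false≢true (X-not-H hX) (trans (cong hv (sym hz)) (tailH m)) }

      -- As h = τ + 1, the walk repeats no vertex. Unless an edge of `H` lies off the walk, in which
      -- case `cyclic` applies, `H` is an induced path and its good ends supply further darts.
      module Straight (E : Ends) (N : NoShare) (h≡ : h ≡ + suc τ) (two : 2 ℕ.≤ τ) where
        w-inj : ∀ i j → i ℕ.≤ τ → j ℕ.≤ τ → w i ≡ w j → i ≡ j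
        w-inj i j hi hj e with ℕₚ.<-cmp i j
        ... | tri≈ _ q _ = q
        ... | tri< l _ _ = ⊥-elim (ℕₚ.1+n≰n (ℤₚ.drop‿+≤+ (subst (_≤ + τ) h≡ (repeat i j l hj e))))
        ... | tri> _ _ l = ⊥-elim (ℕₚ.1+n≰n (ℤₚ.drop‿+≤+ (subst (_≤ + τ) h≡ (repeat j i l hi (sym e)))))

        p : Fin (suc τ) → Fin n
        p i = w (Fin.toℕ i)

        p≤ : ∀ (i : Fin (suc τ)) → Fin.toℕ i ℕ.≤ τ
        p≤ i = ℕₚ.≤-pred (Finₚ.toℕ<n i)

        module _ (¬off : ¬ ∃ Off) where
          onwalk : ∀ x → inside hv x ≡ true → ∃ λ i → i ℕ.< τ × (dart i ≡ x ⊎ dart i ≡ α x)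
          onwalk x hx with Finₚ.any? (λ (i : Fin τ) → (dart (Fin.toℕ i) Fin.≟ x) ⊎-dec (dart (Fin.toℕ i) Fin.≟ α x))
          ... | yes (i , e) = Fin.toℕ i , Finₚ.toℕ<n i , e
          ... | no ¬w = ⊥-elim (¬off (x , hx , ¬w))

          step : ∀ i j → i ℕ.≤ τ → j ℕ.≤ τ → Adj (w i) (w j) → (i ≡ suc j) ⊎ (j ≡ suc i)
          step i j hi hj (x , e , e′) with onwalk x (cong₂ _∧_ (trans (cong hv e) (in-H i hi)) (trans (cong hv e′) (in-H j hj)))
          ... | l , l<τ , inj₁ q = inj₂ (trans (w-inj j (suc l) hj l<τ (trans (sym e′) (trans (cong (vert ∘ α) (sym q)) (head l))))
                  (cong suc (w-inj l i (ℕₚ.<⇒≤ l<τ) hi (trans (cong vert q) e))))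
          ... | l , l<τ , inj₂ q = inj₁ (trans (w-inj i (suc l) hi l<τ (trans (sym e) (trans (cong vert (trans (sym (α-invol x)) (cong α (sym q)))) (head l))))
                  (cong suc (w-inj l j (ℕₚ.<⇒≤ l<τ) hj (trans (cong vert q) e′))))

          isPath : IsPathOf hv τ p
          isPath = (λ {i} {j} e → Finₚ.toℕ-injective (w-inj _ _ (p≤ i) (p≤ j) e)) ,
              (λ v → mk⇔ (λ e → let (i , l , q) = cover-H v e in Fin.fromℕ< (ℕ.s≤s l) , trans (cong w (Finₚ.toℕ-fromℕ< (ℕ.s≤s l))) q)
                         (λ { (i , refl) → in-H (Fin.toℕ i) (p≤ i) })) ,
              (λ i j → mk⇔ (step (Fin.toℕ i) (Fin.toℕ j) (p≤ i) (p≤ j)) (λ { (inj₁ e) → back i j e ; (inj₂ e) → Adj-flip (back j i e) }))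
            where
            Adj-flip : ∀ {u v} → Adj u v → Adj v u
            Adj-flip (x , e , e′) = α x , e′ , trans (cong vert (α-invol x)) e
            back : ∀ i j → Fin.toℕ i ≡ suc (Fin.toℕ j) → Adj (p i) (p j)
            back i j e = α (dart (Fin.toℕ j)) , trans (head (Fin.toℕ j)) (cong w (sym e)) , cong vert (α-invol (dart (Fin.toℕ j)))

          not-ends : ¬ Adj (w τ) (w 0)
          not-ends a with step τ 0 ℕₚ.≤-refl ℕ.z≤n a
          ... | inj₁ e = ℕₚ.1+n≰n (subst (2 ℕ.≤_) e two)
          ... | inj₂ ()

          r≢0 : r ≢ w 0
          r≢0 e = not-ends (subst (Adj (w τ)) e y-Adj)

          tail₂ : GoodE (p (Fin.fromℕ τ)) → Tail y₂
          tail₂ g with X-or-H {y} yP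
          ... | inj₁ rH = inj₁ (trans (cong hv y₂-vert) rH)
          ... | inj₂ rX = inj₂ (trans (cong big y₂-vert) (g r (X-not-H rX) (subst (λ v → Adj v r) (cong w (sym (Finₚ.toℕ-fromℕ τ))) y-Adj)))

          private
            zz = ψ⁻ {dart 0} (dP 0 (ℕₚ.<-≤-trans (ℕ.s≤s ℕ.z≤n) two))
          -- The dart before the walk on the chosen region; it enters the first vertex of `H`, and
          -- its tail has large lists or lies in `H` if this end is good.
          z : Fin k
          z = proj₁ zz
          zP : P z ≡ true
          zP = proj₁ (proj₂ zz)
          zψ : ψ z ≡ dart 0
          zψ = proj₁ (proj₂ (proj₂ zz))
          zΩ : Ω z ≡ true
          zΩ = trans (Ω-cong (proj₂ (proj₂ (proj₂ zz)))) (dΩ 0)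
          z-head : vert (α z) ≡ w 0
          z-head = trans (sym (ψ-vert zP)) (cong vert zψ)
          z-Adj : Adj (w 0) (vert z)
          z-Adj = α z , z-head , cong vert (α-invol z)

          tail₀ : GoodE (p Fin.zero) → Tail z
          tail₀ g with Split-U (sp (vert z)) (P-tail zP)
          ... | inj₁ qH = inj₁ qH
          ... | inj₂ qX = inj₂ (g (vert z) (X-not-H qX) z-Adj)

          z-new : z ∉ qs₁
          z-new (here e) = r≢0 (trans (cong (vert ∘ α) (sym e)) z-head)
          z-new (there m) with ∈-applyUpTo⁻ dart m
          ... | i , l , e = start-once i l (trans (sym (head i)) (trans (cong (vert ∘ α) (sym e)) z-head))

          -- If both were the same dart, `r` would be adjacent to both ends of the path. Outside `H`
          -- this contradicts (Tc), inside `H` the distance of the ends.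
          z≢y₂ : τ ≡ 4 → z ≢ y₂
          z≢y₂ τ4 e = go (X-or-H {y} yP)
            where
            four≢zero : 4 ≢ 0
            four≢zero ()
            four≢two : 4 ≢ 2
            four≢two ()
            z-r : Adj (w 0) r
            z-r = subst (Adj (w 0)) (trans (cong vert e) y₂-vert) z-Adj
            clash : ∀ j → j ℕ.≤ τ → (τ ≡ suc j) ⊎ (j ≡ suc τ) → (0 ≡ suc j) ⊎ (j ≡ 1) → ⊥
            clash j l (inj₁ a) (inj₂ b) = four≢two (trans (sym τ4) (trans a (cong suc b)))
            clash j l (inj₂ a) _ = ℕₚ.1+n≰n (subst (ℕ._≤ τ) a l)
            clash j l (inj₁ a) (inj₁ ())
            go : hv r ≡ true ⊎ X r ≡ true → ⊥
            go (inj₁ rH) = let (j , l , q) = cover-H r rH in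
              clash j l (step τ j ℕₚ.≤-refl l (subst (Adj (w τ)) (sym q) y-Adj)) (step 0 j ℕ.z≤n l (subst (Adj (w 0)) (sym q) z-r))
            go (inj₂ rX) = four≢zero (trans (sym τ4) (w-inj τ 0 ℕₚ.≤-refl ℕ.z≤n
                (noShare₄ N τ τ4 p isPath r (X-not-H rX) (w τ) (w 0) (in-H τ ℕₚ.≤-refl) (in-H 0 ℕ.z≤n)
                  (α y , refl , trans (cong vert (α-invol y)) y-vert) (z , trans (cong vert e) y₂-vert , z-head))))

        straight₃ : τ ≡ 3 → -1ℤ ≤ ρ κ X
        straight₃ τ3 with Off?
        ... | yes (x , o) = cyclic (off-edge {x} o) (subst (_≤ + 5) (sym (trans h≡ (cong (λ t → + suc t) τ3))) (+≤+ (ℕ.s≤s (ℕ.s≤s (ℕ.s≤s (ℕ.s≤s ℕ.z≤n))))))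
        ... | no ¬off with ends₃ E τ τ3 p (isPath ¬off)
        ...   | inj₁ g = enough (z ¬off ∷ qs₁) (∉⇒All (z-new ¬off) ∷ u₁) ((zP ¬off , zΩ ¬off) ∷ a₁) (reserve _ (tail₀ ¬off g ∷ t₁)) len
          where
          len : + 2 * h ≤ + suc (length qs₁) + + 3
          len = ℤₚ.≤-reflexive (trans (cong (+ 2 *_) (trans h≡ (cong (λ t → + suc t) τ3))) (cong (λ l → + suc l + + 3) (sym (trans len₁ (cong suc τ3)))))
        ...   | inj₂ g = enough (y₂ ∷ qs₁) (∉⇒All (y₂-new (r≢0 ¬off)) ∷ u₁) ((y₂P , y₂Ω) ∷ a₁) (reserve _ (tail₂ ¬off g ∷ t₁)) len
          where
          len : + 2 * h ≤ + suc (length qs₁) + + 3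
          len = ℤₚ.≤-reflexive (trans (cong (+ 2 *_) (trans h≡ (cong (λ t → + suc t) τ3))) (cong (λ l → + suc l + + 3) (sym (trans len₁ (cong suc τ3)))))

        straight₄ : τ ≡ 4 → -1ℤ ≤ ρ κ X
        straight₄ τ4 with Off?
        ... | yes (x , o) = cyclic (off-edge {x} o) (subst (_≤ + 5) (sym (trans h≡ (cong (λ t → + suc t) τ4))) ℤₚ.≤-refl)
        ... | no ¬off with ends₄ E τ τ4 p (isPath ¬off)
        ...   | g , g′ = enough (z ¬off ∷ y₂ ∷ qs₁)
                 (∉⇒All (λ { (here e) → z≢y₂ ¬off τ4 e ; (there m) → z-new ¬off m }) ∷ ∉⇒All (y₂-new (r≢0 ¬off)) ∷ u₁)
                 ((zP ¬off , zΩ ¬off) ∷ (y₂P , y₂Ω) ∷ a₁) (reserve _ (tail₀ ¬off g ∷ tail₂ ¬off g′ ∷ t₁)) len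
          where
          len : + 2 * h ≤ + suc (suc (length qs₁)) + + 3
          len = ℤₚ.≤-reflexive (trans (cong (+ 2 *_) (trans h≡ (cong (λ t → + suc t) τ4))) (cong (λ l → + suc (suc l) + + 3) (sym (trans len₁ (cong suc τ4)))))

    planar-bound : Ends → NoShare → (sg : Segment) → countB hv ℕ.≤ 5 → -1ℤ ≤ ρ κ X ⊎ Exception sg
    planar-bound E N sg size = go (Segment.τ sg) refl
      where
      open Seg sg
      hc : h ≡ + countB hv
      hc = sym (countB≡sum hv)
      m≤ : countB hv ℕ.≤ suc τ
      m≤ = ℤₚ.drop‿+≤+ (subst (_≤ + suc τ) hc h≤)
      go : ∀ t → τ ≡ t → -1ℤ ≤ ρ κ X ⊎ Exception sg
      go zero e = inj₁ (small-H (subst (λ t → h ≤ + suc t) e h≤))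
      go (suc τ′) e with 2 ℕ.* countB hv ℕ.≤? τ ℕ.+ 4
      ... | yes l = inj₁ (With.long sg τ′ e (subst₂ _≤_ (trans (ℤₚ.pos-* 2 (countB hv)) (cong (+ 2 *_) (sym hc))) (ℤₚ.pos-+ τ 4) (+≤+ l)))
      ... | no ¬l with numbers τ (countB hv) m≤ size ¬l
      ...   | inj₁ (τ3 , m4) = inj₁ (With.Straight.straight₃ sg τ′ e E N (trans hc (trans (cong +_ m4) (cong (λ t → + suc t) (sym τ3))))
                (subst (2 ℕ.≤_) (sym τ3) (ℕ.s≤s (ℕ.s≤s ℕ.z≤n))) τ3)
      ...   | inj₂ (inj₁ (τ4 , m5)) = inj₁ (With.Straight.straight₄ sg τ′ e E N (trans hc (trans (cong +_ m5) (cong (λ t → + suc t) (sym τ4))))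
                (subst (2 ℕ.≤_) (sym τ4) (ℕ.s≤s (ℕ.s≤s ℕ.z≤n))) τ4)
      ...   | inj₂ (inj₂ (τ5 , m5)) = With.exceptional sg τ′ e (trans hc (cong +_ m5)) τ5

    -- Separating chords and pivots in the exceptional case.

    -- A chord r u between two vertices of the outer face separates the graph: turning around r
    -- and around u from the chord to the outer face gives a closed walk in the dual.
    module Chord (sg : Segment) (ex : Exception sg) (e : Fin k) (e-r : vert e ≡ vert (α (Exception.y ex)))
        (uX : X (vert (α e)) ≡ true) (uA : big (vert (α e)) ≡ false)
        (u≢z : vert (α e) ≢ vert (α (ψ (Exception.y ex)))) where
      open Exception ex
      open Seg sg

      r u z : Fin n
      r = vert (α y)
      u = vert (α e)
      d₁ : Fin k
      d₁ = ψ y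
      z = vert (α d₁)
      yP : P y ≡ true
      yP = proj₁ y-PΩ
      d₁P : P d₁ ≡ true
      d₁P = ψ-P yP
      d₁Ω : Ω d₁ ≡ true
      d₁Ω = trans (Ω-cong (ψ-D yP)) (proj₂ y-PΩ)
      d₁-r : vert d₁ ≡ r
      d₁-r = ψ-vert yP
      Y-X : ∀ {v} → X v ≡ true → Y v ≡ true
      Y-X {v} h = proj₁ (Split-inR (sp v) h)
      eP : P e ≡ true
      eP = cong₂ _∧_ (trans (cong Y e-r) (Y-X r-X)) (Y-X uX)
      αeP : P (α e) ≡ true
      αeP = trans (inside-α Y e) eP
      e≢d₁ : e ≢ d₁
      e≢d₁ q = u≢z (cong (vert ∘ α) q)
      u≢r : u ≢ r
      u≢r q = noLoop e (trans q (sym e-r))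
      z≢r : z ≢ r
      z≢r q = noLoop d₁ (trans q (sym d₁-r))
      w-H : hv (vert y) ≡ true
      w-H = trans (cong hv y-end) (in-H τ ℕₚ.≤-refl)

      private
        od = outer-dart u uX uA (α e) refl αeP
      dᵤ : Fin k
      dᵤ = proj₁ od
      dᵤ-u : vert dᵤ ≡ u
      dᵤ-u = proj₁ (proj₂ od)
      dᵤΩ : Ω dᵤ ≡ true
      dᵤΩ = proj₂ (proj₂ (proj₂ od))

      -- If `α e` were on the chosen region, its successor would be a chosen dart at `r`, hence
      -- `ψ y` by `only`. Then `α e` is `y`, but `y` starts in `H` and `u` does not lie there.
      dᵤ≢αe : dᵤ ≢ α e
      dᵤ≢αe q = false≢true (X-not-H uX) (trans (cong hv (sym y-u)) w-H)
        where
        αeΩ : Ω (α e) ≡ true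
        αeΩ = trans (cong Ω (sym q)) dᵤΩ
        same : ψ (α e) ≡ ψ y
        same = only (ψ (α e)) (trans (ψ-vert αeP) (trans (cong vert (α-invol e)) e-r))
          (ψ-P αeP , trans (Ω-cong (ψ-D αeP)) αeΩ)
        y-u : vert y ≡ u
        y-u = cong vert (sym (ψ-inj same))

      module A₁ = Arc 0 d₁ e (trans d₁-r (sym e-r))
      module A₂ = Arc 1 (α e) dᵤ (sym dᵤ-u)
      open A₁ using () renaming (arc to arc₁; arc-out to arc₁-out)
      open A₂ using () renaming (arc to arc₂; arc-out to arc₂-out)
      open Edge d₁

      -- The edges to be cut: at `r` those from `d₁`, inclusive, to the chord, at `u` those strictly
      -- between the chord and `dᵤ`. The chord is kept, so `u` stays connected to `r`.
      arcs : Fin k → Bool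
      arcs d = (arc₁ d ∨ arc₂ d) ∨ (arc₁ (α d) ∨ arc₂ (α d))

      arc₁-r : ∀ {d} → arc₁ d ≡ true → vert d ≡ r
      arc₁-r h = trans (A₁.arc-vert h) d₁-r

      arc₂-u : ∀ {d} → arc₂ d ≡ true → vert d ≡ u
      arc₂-u = A₂.arc-vert

      arcs-cases : ∀ {d} → arcs d ≡ true → (arc₁ d ≡ true ⊎ arc₂ d ≡ true) ⊎ (arc₁ (α d) ≡ true ⊎ arc₂ (α d) ≡ true)
      arcs-cases {d} h = Sum.map ∨-true ∨-true (∨-true {arc₁ d ∨ arc₂ d} h)

      arcs-α : Symm arcs
      arcs-α d rewrite α-invol d = 𝔹ₚ.∨-comm (arc₁ (α d) ∨ arc₂ (α d)) (arc₁ d ∨ arc₂ d)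

      P′ : Fin k → Bool
      P′ d = P d ∧ not (arcs d)

      P′-α : Symm P′
      P′-α d = cong₂ (λ a b → a ∧ not b) (inside-α Y d) (arcs-α d)

      len₁-pos : 0 ℕ.< A₁.len
      len₁-pos = A₁.len-pos (e≢d₁ ∘ sym)

      len₂-pos : 0 ℕ.< A₂.len
      len₂-pos = A₂.len-pos (dᵤ≢αe ∘ sym)

      d₁-arcs : arcs d₁ ≡ true
      d₁-arcs rewrite A₁.arc-in 0 ℕ.z≤n len₁-pos = refl

      P′-d₁ : P′ d₁ ≡ false
      P′-d₁ = trans (cong (λ b → P d₁ ∧ not b) d₁-arcs) (𝔹ₚ.∧-zeroʳ (P d₁))

      open Around P′ P′-α P′-d₁ using (N; N-α; A″; B″; cover″; size″)

      D″ : Fin k → Fin k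
      D″ = cD B″

      -- Edges outside P or on an arc, other than d₁, are crossed freely.
      cross : ∀ {d} → (P d ≡ false ⊎ arcs d ≡ true) → d ≢ d₁ → d ≢ α d₁ → D″ d ≡ D″ (σ d)
      cross {d} h n₁ n₂ = dual-step {B″} (edges-has N N-α {d} (cong₂ (λ a b → not a ∧ not b) (p′ h) (cong₂ _∨_ (eqF-false n₁) (eqF-false n₂))))
        where
        p′ : (P d ≡ false ⊎ arcs d ≡ true) → P′ d ≡ false
        p′ (inj₁ q) rewrite q = refl
        p′ (inj₂ q) rewrite q = 𝔹ₚ.∧-zeroʳ (P d)

      along₁ : ∀ i → 1 ℕ.≤ i → i ℕ.≤ A₁.len → D″ (α d₁) ≡ D″ (iter σ i d₁)
      along₁ (suc zero) _ _ = α-σ B″ d₁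
      along₁ (suc (suc i)) _ l = trans (along₁ (suc i) (ℕ.s≤s ℕ.z≤n) (ℕₚ.<⇒≤ l))
        (cross (inj₂ (cong (λ b → (b ∨ arc₂ x) ∨ (arc₁ (α x) ∨ arc₂ (α x))) (A₁.arc-in (suc i) ℕ.z≤n l)))
          (A₁.no-loop (suc i) (ℕ.s≤s ℕ.z≤n) l)
          (λ q → z≢r (trans (cong vert (sym q)) (trans (iter-σ-vert (suc i) d₁) d₁-r))))
        where
        x : Fin k
        x = iter σ (suc i) d₁

      along₂ : ∀ i → 1 ℕ.≤ i → i ℕ.≤ A₂.len → D″ e ≡ D″ (iter σ i (α e))
      along₂ (suc zero) _ _ = trans (cong D″ (sym (α-invol e))) (α-σ B″ (α e))
      along₂ (suc (suc i)) _ l = trans (along₂ (suc i) (ℕ.s≤s ℕ.z≤n) (ℕₚ.<⇒≤ l))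
        (cross (inj₂ (trans (cong (_∨ (arc₁ (α x) ∨ arc₂ (α x))) (∨-inʳ (arc₁ x) (A₂.arc-in (suc i) (ℕ.s≤s ℕ.z≤n) l))) refl))
          (λ q → u≢r (trans (sym (iter-σ-vert (suc i) (α e))) (trans (cong vert q) d₁-r)))
          (λ q → u≢z (trans (sym (iter-σ-vert (suc i) (α e))) (cong vert q))))
        where
        x : Fin k
        x = iter σ (suc i) (α e)

      D⇒D″ : ∀ {a b} → D a ≡ D b → D″ a ≡ D″ b
      D⇒D″ {a} {b} q = trans (sym (F a)) (trans (cong D″ q) (F b))
        where
        F : ∀ x → D″ (D x) ≡ D″ x
        F = cD-elim D″ B (cD-φ B″) step
          where
          step : ∀ d → d ∈ B → D″ d ≡ D″ (α d)
          step d m = cD-α {B″} (edges-has N N-α {d} (cong₂ (λ a b → not a ∧ not b) p′ notD))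
            where
            notP : P d ≡ false
            notP = 𝔹ₚ.not-injective (edges-in (λ d → not (P d)) m)
            p′ : P′ d ≡ false
            p′ rewrite notP = refl
            notD : isD d ≡ false
            notD with isD d in x
            ... | false = refl
            ... | true with isD-out {d} x
            ...   | inj₁ q = ⊥-elim (false≢true notP (trans (cong P q) d₁P))
            ...   | inj₂ q = ⊥-elim (false≢true notP (trans (cong P q) (trans (inside-α Y d₁) d₁P)))

      closed : D″ d₁ ≡ D″ (α d₁)
      closed = begin
        -- Both darts lie on the region chosen for their common component.
        D″ d₁                     ≡⟨ D⇒D″ (Ω-same d₁Ω dᵤΩ (same-adj (same-refl (vert d₁)) (e , trans e-r (sym d₁-r) , sym dᵤ-u))) ⟩
        D″ dᵤ                     ≡⟨ cong D″ A₂.at ⟨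
        D″ (iter σ A₂.len (α e))  ≡⟨ along₂ A₂.len len₂-pos ℕₚ.≤-refl ⟨
        D″ e                      ≡⟨ cong D″ A₁.at ⟨
        D″ (iter σ A₁.len d₁)     ≡⟨ along₁ A₁.len len₁-pos ℕₚ.≤-refl ⟨
        D″ (α d₁)                 ∎
        where open ≡-Reasoning

      C : Fin n → Fin n
      C = cP A″

      apart : C r ≢ C z
      apart q = loop A″ d₁ B″ cover″ size″ closed (trans (cong C d₁-r) q)

      C-edge : ∀ {d} → P′ d ≡ true → C (vert d) ≡ C (vert (α d))
      C-edge {d} h = cP-α (edges-has P′ P′-α {d} h)

      not-arcs : ∀ {d} → arc₁ d ≡ false → arc₂ d ≡ false → arc₁ (α d) ≡ false → arc₂ (α d) ≡ false → arcs d ≡ false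
      not-arcs a b c d rewrite a | b | c | d = refl

      C-u : C u ≡ C r
      C-u = trans (sym (C-edge {e} (cong₂ (λ a b → a ∧ not b) eP (not-arcs
          (𝔹ₚ.¬-not (λ h → let (i , _ , l , q) = arc₁-out h in A₁.before i l q))
          (𝔹ₚ.¬-not (λ h → u≢r (trans (sym (arc₂-u h)) e-r)))
          (𝔹ₚ.¬-not (λ h → u≢r (arc₁-r h)))
          (𝔹ₚ.¬-not (λ h → let (i , 1≤i , l , q) = arc₂-out h in A₂.no-loop i 1≤i l q)))))) (cong C e-r)

      H≢ : ∀ {v x} → hv v ≡ true → X x ≡ true → v ≢ x
      H≢ hh hX refl = false≢true (X-not-H hX) hh

      -- No edge of the walk meets `r` or `u`, so the walk survives the cut, and the edge of `y`
      -- joins its last vertex to `r`.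
      C-H : ∀ v → hv v ≡ true → C v ≡ C r
      C-H v hh with cover-H v hh
      ... | i , l , refl = trans (connect P′ P′-α walk i l) (trans (sym (connect P′ P′-α walk τ ℕₚ.≤-refl)) end)
        where
        walk : ∀ i → i ℕ.< τ → P′ (dart i) ≡ true
        walk i l = cong₂ (λ a b → a ∧ not b) (cong₂ _∧_ (H⊂Y (in-H i (ℕₚ.<⇒≤ l))) (H⊂Y headH)) (not-arcs
            (𝔹ₚ.¬-not (λ h → H≢ (in-H i (ℕₚ.<⇒≤ l)) r-X (arc₁-r h)))
            (𝔹ₚ.¬-not (λ h → H≢ (in-H i (ℕₚ.<⇒≤ l)) uX (arc₂-u h)))
            (𝔹ₚ.¬-not (λ h → H≢ headH r-X (arc₁-r h)))
            (𝔹ₚ.¬-not (λ h → H≢ headH uX (arc₂-u h))))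
          where
          headH : hv (vert (α (dart i))) ≡ true
          headH = trans (cong hv (head i)) (in-H (suc i) l)
        -- Turning from α y the first edge of P is d₁, so α y is not on the arc from d₁ to e.
        late : arc₁ (α y) ≡ true → ⊥
        late h with arc₁-out h
        ... | i , _ , i<l , q = go (ℕₚ.<-cmp m (suc j))
          where
          j m : ℕ
          j = hit-index (φ y) (α y) (σ-vert (α y)) (trans (inside-α Y y) yP)
          m = A₁.len ℕ.∸ i
          d₁≡ : iter σ (suc j) (α y) ≡ d₁
          d₁≡ = trans (iter-suc σ j (α y)) (sym (ψ-true y yP))
          e≡ : iter σ m (α y) ≡ e
          e≡ = trans (cong (iter σ m) (sym q)) (trans (sym (iter-+ σ m i d₁)) (trans (cong (λ t → iter σ t d₁) (ℕₚ.m∸n+n≡m (ℕₚ.<⇒≤ i<l))) A₁.at))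
          go : Tri (m ℕ.< suc j) (m ≡ suc j) (suc j ℕ.< m) → ⊥
          go (tri≈ _ x _) = e≢d₁ (trans (sym e≡) (trans (cong (λ t → iter σ t (α y)) x) d₁≡))
          go (tri> _ _ x) = A₁.before (m ℕ.∸ suc j) (ℕₚ.<-≤-trans (ℕₚ.∸-monoʳ-< (ℕ.s≤s ℕ.z≤n) (ℕₚ.<⇒≤ x)) (ℕₚ.m∸n≤m A₁.len i))
            (trans (cong (iter σ (m ℕ.∸ suc j)) (sym d₁≡)) (trans (sym (iter-+ σ (m ℕ.∸ suc j) (suc j) (α y)))
              (trans (cong (λ t → iter σ t (α y)) (ℕₚ.m∸n+n≡m (ℕₚ.<⇒≤ x))) e≡)))
          go (tri< x _ _) = false≢true (hit-min (φ y) (α y) (σ-vert (α y)) (trans (inside-α Y y) yP) (ℕ.pred m) (subst (ℕ._≤ j) (sym m≡) (ℕₚ.≤-pred x)))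
              (trans (cong P (trans (sym (iter-suc σ (ℕ.pred m) (α y))) (trans (cong (λ t → iter σ t (α y)) m≡) e≡))) eP)
            where
            m≡ : suc (ℕ.pred m) ≡ m
            m≡ = ℕₚ.suc-pred m {{ℕ.>-nonZero (ℕₚ.m<n⇒0<n∸m i<l)}}
        end : C (w τ) ≡ C r
        end = trans (cong C (sym y-end)) (C-edge {y} (cong₂ (λ a b → a ∧ not b) yP (not-arcs
            (𝔹ₚ.¬-not (λ h → H≢ w-H r-X (arc₁-r h)))
            (𝔹ₚ.¬-not (λ h → H≢ w-H uX (arc₂-u h)))
            (𝔹ₚ.¬-not late)
            (𝔹ₚ.¬-not (λ h → u≢r (sym (arc₂-u h)))))))

      opaque
        Q : VSet n
        Q v = eqF (C v) (C z)

        Qz : Q z ≡ true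
        Qz = ≟-refl (C z)

        Qr : Q r ≡ false
        Qr = eqF-false apart

        Q-r : ∀ {v} → C v ≡ C r → Q v ≡ false
        Q-r q = trans (cong (λ c → eqF c (C z)) q) Qr

        Q⊂X : ∀ v → Q v ≡ true → X v ≡ true
        Q⊂X v h = in-X (Split-U (sp v) Yv)
          where
          ends-Y : ∀ {a b} d → P d ≡ true → (a , b) ≡ (vert d , vert (α d)) → Y a ≡ Y b
          ends-Y d Pd eq = trans (cong (Y ∘ proj₁) eq) (trans (trans (P-tail Pd) (sym (P-head Pd))) (sym (cong (Y ∘ proj₂) eq)))
          Y-C : ∀ x → Y (C x) ≡ Y x
          Y-C = cls-inv Y (prim A″) (λ m → let (d , d∈ , eq) = ∈-map⁻ (λ d → (vert d , vert (α d))) m in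
                  ends-Y d (proj₁ (∧-true (edges-in P′ d∈))) eq)
          Yv : Y v ≡ true
          Yv = trans (sym (Y-C v)) (trans (cong Y (eqF-true h)) (trans (Y-C z) (P-head d₁P)))
          in-X : hv v ≡ true ⊎ X v ≡ true → X v ≡ true
          in-X (inj₂ x) = x
          in-X (inj₁ x) = ⊥-elim (false≢true (Q-r (C-H v x)) h)

        -- An edge leaving the component of `z` must have been cut, and each cut edge has `r` or `u`
        -- as an end; these two lie on the other side.
        Q-edge : ∀ {a b} → Q a ≡ true → Q b ≡ false → Y a ≡ true → Y b ≡ true → Adj a b → b ≡ r ⊎ b ≡ u
        Q-edge {a} {b} ha hb Ya Yb (d , p , q) = split (𝔹ₚ.T? (arcs d))
          where
          Pd : P d ≡ true
          Pd = cong₂ _∧_ (trans (cong Y p) Ya) (trans (cong Y q) Yb)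
          by : (arc₁ d ≡ true ⊎ arc₂ d ≡ true) ⊎ (arc₁ (α d) ≡ true ⊎ arc₂ (α d) ≡ true) → b ≡ r ⊎ b ≡ u
          by (inj₁ (inj₁ x)) = ⊥-elim (false≢true (trans (cong Q (trans (sym p) (arc₁-r x))) Qr) ha)
          by (inj₁ (inj₂ x)) = ⊥-elim (false≢true (trans (cong Q (trans (sym p) (arc₂-u x))) (Q-r C-u)) ha)
          by (inj₂ (inj₁ x)) = inj₁ (trans (sym q) (arc₁-r x))
          by (inj₂ (inj₂ x)) = inj₂ (trans (sym q) (arc₂-u x))
          split : Dec (𝔹.T (arcs d)) → b ≡ r ⊎ b ≡ u
          split (yes t) = by (arcs-cases {d} (Equivalence.to 𝔹ₚ.T-≡ t))
          split (no ¬t) = ⊥-elim (false≢true hb (trans (cong (λ c → eqF c (C z))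
            (trans (cong C (sym q)) (trans (sym (C-edge {d} (cong₂ (λ a b → a ∧ not b) Pd (𝔹ₚ.¬-not (λ h → ¬t (Equivalence.from 𝔹ₚ.T-≡ h)))))) (cong C p)))) ha))

        Qu : Q u ≡ false
        Qu = Q-r C-u

        Q-H : ∀ v → hv v ≡ true → Q v ≡ false
        Q-H v h = Q-r (C-H v h)

    irr : ∀ v → adjB v v ≡ false
    irr = Adjacency.adjB-irr G

    module Cut (sg : Segment) (ex : Exception sg) (e : Fin k) (e-r : vert e ≡ vert (α (Exception.y ex)))
        (uX : X (vert (α e)) ≡ true) (uA : big (vert (α e)) ≡ false)
        (u≢z : vert (α e) ≢ vert (α (ψ (Exception.y ex)))) where
      open Exception ex using (r-X; r-A)
      open Chord sg ex e e-r uX uA u≢z using (r; u; z; u≢r; Q; Qz; Qr; Qu; Q-H; Q⊂X; Q-edge; Y-X)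

      X₁ : VSet n
      X₁ = X ∖ Q

      ends Q⁺ : VSet n
      ends = ⟦ r ⟧ ∪ ⟦ u ⟧
      Q⁺ = Q ∪ ends

      ends-out : ∀ {v} → ends v ≡ true → v ≡ r ⊎ v ≡ u
      ends-out {v} h with ∨-true {⟦ r ⟧ v} h
      ... | inj₁ q = inj₁ (≟-true q)
      ... | inj₂ q = inj₂ (≟-true q)

      ends-split : Split ends ⟦ r ⟧ ⟦ u ⟧
      ends-split = split-∪ {X = ⟦ r ⟧} {⟦ u ⟧} (λ v h → eqF-false (λ q → u≢r (trans (sym q) (≟-true h))))

      Q⁺-split : Split Q⁺ Q ends
      Q⁺-split = split-∪ {X = Q} {ends} (λ v h → 𝔹ₚ.¬-not (λ h′ → miss v h (ends-out {v} h′)))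
        where
        miss : ∀ v → Q v ≡ true → v ≡ r ⊎ v ≡ u → ⊥
        miss v h (inj₁ refl) = false≢true Qr h
        miss v h (inj₂ refl) = false≢true Qu h

      Q⁺⊂X : ∀ v → Q⁺ v ≡ true → X v ≡ true
      Q⁺⊂X v h with Split-U (Q⁺-split v) h
      ... | inj₁ q = Q⊂X v q
      ... | inj₂ q with ends-out {v} q
      ...   | inj₁ refl = r-X
      ...   | inj₂ refl = uX

      ∅ : VSet n
      ∅ _ = false

      sp⁺ : Split Q⁺ ∅ Q⁺
      sp⁺ v with Q⁺ v
      ... | true = inʳ
      ... | false = out

      -- The part cut off is considered together with both ends of the chord as a graph with empty
      -- `H`, for which the basic bound is 4.
      module K = Count tf ∅ Q⁺ big Q⁺ sp⁺ (λ v h hb → outerA v (Q⁺⊂X v h) hb)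

      deg∅ : ∀ v → deg ∅ v ≡ 0ℤ
      deg∅ v = sum-zero (λ _ → refl)

      κ⁺ : ∀ v → K.κ v ≡ + 4 + ι (big v)
      κ⁺ v = trans (cong (λ t → + 4 + ι (big v) - (t + t)) (deg∅ v)) (ℤₚ.+-identityʳ _)

      four : + 4 ≤ ρ K.κ Q⁺
      four = subst (_≤ ρ K.κ Q⁺) (cong₂ (λ a b → + 4 + a - + 4 * b + + 0) (sum-zero {n} {λ _ → 0ℤ} (λ _ → refl)) (sum-zero {n} {λ _ → 0ℤ} (λ _ → refl)))
        (K.ρ-bound e (cong₂ _∧_ (trans (cong Q⁺ e-r) (Q⁺-r r refl)) (Q⁺-u u refl)) [] [] []
          (λ v hX hb f hf Pf → let (x , a , b , c) = K.outer-dart v hX hb f hf Pf in x , a , b , c , λ ()))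
        where
        Q⁺-r : ∀ v → v ≡ r → Q⁺ v ≡ true
        Q⁺-r v q = ∨-inʳ (Q v) (cong (λ b → b ∨ ⟦ u ⟧ v) (trans (cong (λ x → ⟦ r ⟧ x) q) (≟-refl r)))
        Q⁺-u : ∀ v → v ≡ u → Q⁺ v ≡ true
        Q⁺-u v q = ∨-inʳ (Q v) (∨-inʳ (⟦ r ⟧ v) (trans (cong (λ x → ⟦ u ⟧ x) q) (≟-refl u)))

      deg-H : ∀ v → Q v ≡ true → deg hv v ≡ 0ℤ
      deg-H v h = sum-zero pt
        where
        pt : ∀ x → ι (hv x ∧ adjB v x) ≡ 0ℤ
        pt x with hv x in hx | adjB v x in a
        ... | false | _ = refl
        ... | true | false = refl
        ... | true | true with Q-edge {v} {x} h (Q-H x hx) (Y-X (Q⊂X v h)) (H⊂Y hx) (Adjacency.adjB⇒Adj G a)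
        ...   | inj₁ refl = ⊥-elim (false≢true (X-not-H r-X) hx)
        ...   | inj₂ refl = ⊥-elim (false≢true (X-not-H uX) hx)

      ρ-Q : ρ κ Q ≡ ρ K.κ Q
      ρ-Q = sum-cong-≗ pt
        where
        pt : ∀ v → on (Q v) (κ v - 1ℤ - deg Q v) ≡ on (Q v) (K.κ v - 1ℤ - deg Q v)
        pt v with Q v in h
        ... | false = refl
        ... | true = cong (λ t → t - 1ℤ - deg Q v) (trans (cong (λ t → + 4 + ι (big v) - (t + t)) (deg-H v h))
                       (sym (cong (λ t → + 4 + ι (big v) - (t + t)) (deg∅ v))))

      ρ-ends : ρ K.κ ends ≡ + 4
      ρ-ends = trans (ρ-split K.κ ends-split) (cong₂ (λ a b → a - (b + b))
          (cong₂ _+_ (trans (ρ-single irr K.κ r) (cong (_- 1ℤ) (trans (κ⁺ r) (cong (λ b → + 4 + ι b) r-A))))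
                     (trans (ρ-single irr K.κ u) (cong (_- 1ℤ) (trans (κ⁺ u) (cong (λ b → + 4 + ι b) uA)))))
          (trans (edges-single u ⟦ r ⟧) (trans (deg-single r u) (cong ι ur))))
        where
        ur : adjB u r ≡ true
        ur = Adjacency.Adj⇒adjB G (α e , refl , trans (cong vert (α-invol e)) e-r)

      boundary : edges X₁ Q ≡ edges ends Q
      boundary = sum-cong-≗ pt
        where
        X₁-in : ∀ {v} → X v ≡ true → Q v ≡ false → X₁ v ≡ true
        X₁-in a b = cong₂ (λ x y → x ∧ not y) a b
        none : ∀ v → X₁ v ≡ true → ends v ≡ false → deg Q v ≡ 0ℤ
        none v h h′ = sum-zero pt
          where
          vX : X v ≡ true
          vX = proj₁ (∧-true h)
          vQ : Q v ≡ false
          vQ = 𝔹ₚ.not-injective (proj₂ (∧-true {X v} h))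
          pt : ∀ x → ι (Q x ∧ adjB v x) ≡ 0ℤ
          pt x with Q x in hx | adjB v x in a
          ... | false | _ = refl
          ... | true | false = refl
          ... | true | true with Q-edge {x} {v} hx vQ (Y-X (Q⊂X x hx)) (Y-X vX) (Adjacency.adjB⇒Adj G (trans (Adjacency.adjB-sym G x v) a))
          ...   | inj₁ q = ⊥-elim (false≢true h′ (cong (_∨ ⟦ u ⟧ v) (trans (cong (λ x → ⟦ r ⟧ x) q) (≟-refl r))))
          ...   | inj₂ q = ⊥-elim (false≢true h′ (∨-inʳ (⟦ r ⟧ v) (trans (cong (λ x → ⟦ u ⟧ x) q) (≟-refl u))))
        pt : ∀ v → on (X₁ v) (deg Q v) ≡ on (ends v) (deg Q v)
        pt v = go (X₁ v) (ends v) refl refl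
          where
          go : ∀ a b → X₁ v ≡ a → ends v ≡ b → on a (deg Q v) ≡ on b (deg Q v)
          go true true _ _ = refl
          go false false _ _ = refl
          go true false a b = none v a b
          go false true a b with ends-out {v} b
          ... | inj₁ q = ⊥-elim (false≢true a (X₁-in (trans (cong X q) r-X) (trans (cong Q q) Qr)))
          ... | inj₂ q = ⊥-elim (false≢true a (X₁-in (trans (cong X q) uX) (trans (cong Q q) Qu)))

      -- Since `Q` has no neighbour in `H` and is attached to the rest only at `r` and `u`, ρ(X) -
      -- ρ(X₁) is the potential of `Q⁺` without `H` minus that of the chord. The former is at least
      -- 4, the latter 3 + 3 - 2 = 4.
      cheaper : ρ κ X₁ ≤ ρ κ X
      cheaper = lin₁ 0 four (trans (cong (_- ρ κ X₁) (trans (ρ-split κ (split-∖ Q⊂X)) (cong₂ (λ a b → a + ρ κ X₁ - (b + b)) ρ-Q boundary)))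
        (trans (ar (ρ K.κ Q) (ρ κ X₁) (edges ends Q))
          (sym (cong (λ t → t - + 4 + + 0) (trans (ρ-split K.κ Q⁺-split) (cong (λ t → ρ K.κ Q + t - (edges ends Q + edges ends Q)) ρ-ends))))))
        where
        ar : ∀ q x b → q + x - (b + b) - x ≡ q + + 4 - (b + b) - + 4 + + 0
        ar = solve-∀

      X₁r : X₁ r ≡ true
      X₁r = cong₂ (λ a b → a ∧ not b) r-X Qr

      X₁z : X₁ z ≡ false
      X₁z = trans (cong (λ b → X z ∧ not b) Qz) (𝔹ₚ.∧-zeroʳ (X z))

      zX : X z ≡ true
      zX = Q⊂X z Qz

    LowPart : Set
    LowPart = ∃ λ X₁ → ∃ (λ v → X₁ v ≡ true) × (∀ v → X₁ v ≡ true → X v ≡ true) ×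
                       (∃ λ v → X v ≡ true × X₁ v ≡ false) × ρ κ X₁ ≤ -1ℤ

    PivotAt : Fin n → Set
    PivotAt r = κ r ≡ + 2 × (deg X r ≤ + 2 ⊎ + 2 ≤ deg (λ v → X v ∧ big v) r)

    below : ∀ {a} → ¬ (-1ℤ ≤ a) → a ≤ -1ℤ
    below h = ℤₚ.<⇒≤ (ℤₚ.≰⇒> h)

    -- The vertex `r` has small lists and at least one neighbour in `H`. With d ≥ 2 such neighbours
    -- its own potential 3 - 2d is at most -1; with exactly one its capacity is 2. If moreover no
    -- chord cuts off a part, `z` is the only possible neighbour of `r` in `X` with small lists, and
    -- one of the two choices of a pivot holds.
    pivotal : (sg : Segment) → Exception sg → ¬ (-1ℤ ≤ ρ κ X) → LowPart ⊎ ∃ λ r → X r ≡ true × PivotAt r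
    pivotal sg ex ρ< = go (deg hv r ≤? 1ℤ)
      where
      open Exception ex
      open Seg sg
      r z : Fin n
      r = vert (α y)
      z = vert (α (ψ y))
      yr : adjB r (vert y) ≡ true
      yr = Adjacency.Adj⇒adjB G (α y , refl , cong vert (α-invol y))
      y-H : hv (vert y) ≡ true
      y-H = trans (cong hv y-end) (in-H τ ℕₚ.≤-refl)
      d≥1 : 1ℤ ≤ deg hv r
      d≥1 = subst (_≤ deg hv r) (cong ι (cong₂ _∧_ y-H yr)) (term≤sum (λ v → ι (hv v ∧ adjB r v)) (λ v → 0≤ι (hv v ∧ adjB r v)) (vert y))
      κr : κ r ≡ + 4 + 0ℤ - (deg hv r + deg hv r)
      κr = cong (λ b → + 4 + ι b - (deg hv r + deg hv r)) r-A
      Chordal : Fin k → Set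
      Chordal e = vert e ≡ r × X (vert (α e)) ≡ true × big (vert (α e)) ≡ false × vert (α e) ≢ z
      chordal? : ∀ e → Dec (Chordal e)
      chordal? e = (vert e Fin.≟ r) ×-dec ((X (vert (α e)) 𝔹.≟ true) ×-dec ((big (vert (α e)) 𝔹.≟ false) ×-dec ¬? (vert (α e) Fin.≟ z)))
      go : Dec (deg hv r ≤ 1ℤ) → LowPart ⊎ ∃ λ r → X r ≡ true × PivotAt r
      go (no d≰) = single (Finₚ.any? (λ v → (X v 𝔹.≟ true) ×-dec (⟦ r ⟧ v 𝔹.≟ false)))
        where
        d≥2 : + 2 ≤ deg hv r
        d≥2 = ℤₚ.i<j⇒suc[i]≤j (ℤₚ.≰⇒> d≰)
        ρr : ρ κ ⟦ r ⟧ ≡ + 3 - (deg hv r + deg hv r)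
        ρr = trans (ρ-single irr κ r) (trans (cong (_- 1ℤ) κr) (ar (deg hv r)))
          where
          ar : ∀ d → + 4 + 0ℤ - (d + d) - 1ℤ ≡ + 3 - (d + d)
          ar = solve-∀
        single : Dec (∃ λ v → X v ≡ true × ⟦ r ⟧ v ≡ false) → LowPart ⊎ ∃ λ r → X r ≡ true × PivotAt r
        single (yes w) = inj₁ (⟦ r ⟧ , (r , ≟-refl r) , (λ v h → trans (cong X (≟-true h)) r-X) , w ,
            lin₂ 0 d≥2 d≥2 (trans (cong (λ t → -1ℤ - t) ρr) (ar (deg hv r))))
          where
          ar : ∀ d → -1ℤ - (+ 3 - (d + d)) ≡ (d - + 2) + (d - + 2) + + 0
          ar = solve-∀
        -- If `X` consists of `r` alone, then d = 2 gives potential -1, against the assumption, and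
        -- d ≥ 3 violates the bound -2.
        single (no ¬w) = ⊥-elim (ρ< (subst (-1ℤ ≤_) (sym (trans ρX ρr)) (small (deg hv r ≤? + 2))))
          where
          ρX : ρ κ X ≡ ρ κ ⟦ r ⟧
          ρX = ρ-cong {κ} {κ} (λ _ → refl) same
            where
            same : ∀ v → X v ≡ ⟦ r ⟧ v
            same v with X v in a | ⟦ r ⟧ v in b
            ... | true | true = refl
            ... | false | false = refl
            ... | true | false = ⊥-elim (¬w (v , a , b))
            ... | false | true = ⊥-elim (false≢true a (trans (cong X (≟-true b)) r-X))
          small : Dec (deg hv r ≤ + 2) → -1ℤ ≤ + 3 - (deg hv r + deg hv r)
          small (yes d≤) = lin₂ 0 d≤ d≤ (ar (deg hv r))
            where
            ar : ∀ d → + 3 - (d + d) - -1ℤ ≡ (+ 2 - d) + (+ 2 - d) + + 0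
            ar = solve-∀
          small (no d≰2) = ⊥-elim (absurd (lin₃ 0 d≥3 d≥3 (subst (- + 2 ≤_) (trans ρX ρr) ρ≥) (ar (deg hv r))))
            where
            d≥3 : + 3 ≤ deg hv r
            d≥3 = ℤₚ.i<j⇒suc[i]≤j (ℤₚ.≰⇒> d≰2)
            absurd : ¬ (1ℤ ≤ 0ℤ)
            absurd (+≤+ ())
            ar : ∀ d → 0ℤ - 1ℤ ≡ (d - + 3) + (d - + 3) + (+ 3 - (d + d) - - + 2) + + 0
            ar = solve-∀
      go (yes d≤) = search (Finₚ.any? chordal?)
        where
        search : Dec (∃ Chordal) → LowPart ⊎ ∃ λ r → X r ≡ true × PivotAt r
        search (yes (e , e-r , uX , uA , u≢z)) =
          inj₁ (C.X₁ , (r , C.X₁r) , (λ v h → proj₁ (∧-true h)) , (z , C.zX , C.X₁z) , ℤₚ.≤-trans C.cheaper (below ρ<))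
          where module C = Cut sg ex e e-r uX uA u≢z
        search (no ¬e) = inj₂ (r , r-X , κ2 , choose (+ 2 ≤? Db))
          where
          κ2 : κ r ≡ + 2
          κ2 = trans κr (cong (λ d → + 4 + 0ℤ - (d + d)) (ℤₚ.≤-antisym d≤ d≥1))
          Db : ℤ
          Db = deg (λ v → X v ∧ big v) r
          deg≤ : deg X r ≤ Db + 1ℤ
          deg≤ = subst (deg X r ≤_) (trans (∑-distrib-+ _ _) (cong (λ t → Db + t) (sum-point z (λ _ → 1ℤ)))) (sum-mono pt)
            where
            pt : ∀ v → ι (X v ∧ adjB r v) ≤ ι ((X v ∧ big v) ∧ adjB r v) + on ⌊ v Fin.≟ z ⌋ 1ℤ
            pt v with X v in a | big v in b | adjB r v in c | v Fin.≟ z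
            ... | false | _ | _ | yes _ = +≤+ ℕ.z≤n
            ... | false | _ | _ | no _ = ℤₚ.≤-refl
            ... | true | true | false | yes _ = +≤+ ℕ.z≤n
            ... | true | false | false | yes _ = +≤+ ℕ.z≤n
            ... | true | true | false | no _ = ℤₚ.≤-refl
            ... | true | false | false | no _ = ℤₚ.≤-refl
            ... | true | true | true | yes _ = +≤+ (ℕ.s≤s ℕ.z≤n)
            ... | true | true | true | no _ = ℤₚ.≤-refl
            ... | true | false | true | yes _ = ℤₚ.≤-refl
            ... | true | false | true | no ne = ⊥-elim (¬e (found (Adjacency.adjB⇒Adj G c)))
              where
              found : Adj r v → ∃ Chordal
              found (d , p , refl) = d , p , a , b , ne
          choose : Dec (+ 2 ≤ Db) → deg X r ≤ + 2 ⊎ + 2 ≤ Db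
          choose (yes h) = inj₂ h
          choose (no h) = inj₁ (ℤₚ.≤-trans deg≤ (lin₁ 0 (ℤₚ.i<j⇒suc[i]≤j (ℤₚ.≰⇒> h)) (ar Db)))
            where
            ar : ∀ b → + 2 - (b + 1ℤ) ≡ (+ 2 - (1ℤ + b)) + + 0
            ar = solve-∀

-- Resting next to `H`, and the application of the bounds to a valid scene.

absurd : ¬ (1ℤ ≤ 0ℤ)
absurd (+≤+ ())

-- The colour chosen in the first step may be kept in the second one provided that it also avoids
-- the three colours of each neighbour in H.
capH : ℤ → ℤ → ℤ
capH d b = if ⌊ d ≤? 1ℤ ⌋ then + 3 + + 2 * b - + 3 * d else -1ℤ

capH-val : ∀ d b → d ≤ 1ℤ → capH d b ≡ + 3 + + 2 * b - + 3 * d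
capH-val d b h with d ≤? 1ℤ
... | yes _ = refl
... | no ¬h = ⊥-elim (¬h h)

capH-nonneg : ∀ d b → 0ℤ ≤ b → d ≤ 1ℤ → 0ℤ ≤ capH d b
capH-nonneg d b b≥0 h = subst (0ℤ ≤_) (sym (capH-val d b h))
  (lin₂ 0 (ℤₚ.*-monoˡ-≤-nonNeg (+ 3) h) (ℤₚ.*-monoˡ-≤-nonNeg (+ 2) b≥0) (ar b d))
  where
  ar : ∀ b d → + 3 + + 2 * b - + 3 * d - 0ℤ ≡ (+ 3 * 1ℤ - + 3 * d) + (+ 2 * b - + 2 * 0ℤ) + + 0
  ar = solve-∀

capH-neg : ∀ d b → 0ℤ ≤ b → -1ℤ ≤ capH d b
capH-neg d b b≥0 = go (d ≤? 1ℤ)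
  where
  go : Dec (d ≤ 1ℤ) → -1ℤ ≤ capH d b
  go (yes h) = ℤₚ.≤-trans -≤+ (capH-nonneg d b b≥0 h)
  go (no ¬h) with d ≤? 1ℤ
  ... | yes h = ⊥-elim (¬h h)
  ... | no _ = ℤₚ.≤-refl

capH-room : ∀ d b → 0ℤ ≤ capH d b → capH d b + + 3 * d ≤ + 3 + + 2 * b
capH-room d b h with d ≤? 1ℤ
... | yes _ = ℤₚ.≤-reflexive (ar b d)
  where
  ar : ∀ b d → + 3 + + 2 * b - + 3 * d + + 3 * d ≡ + 3 + + 2 * b
  ar = solve-∀
capH-room d b () | no _

-- Capacity at least 4 forces d = 0, where both budgets equal 3 + 2b; otherwise the left-hand side
-- is -1.
capS≤capH : ∀ d b → 0ℤ ≤ d → 0ℤ ≤ b → b ≤ 1ℤ → capS (+ 4 + b - (d + d)) b ≤ capH d b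
capS≤capH d b d≥0 b≥0 b≤1 = go (+ 4 ≤? + 4 + b - (d + d)) (d ≤? 0ℤ)
  where
  go : Dec (+ 4 ≤ + 4 + b - (d + d)) → Dec (d ≤ 0ℤ) → capS (+ 4 + b - (d + d)) b ≤ capH d b
  go (no ¬p) _ = subst (_≤ capH d b) (sym (capS-neg _ b ¬p)) (capH-neg d b b≥0)
  go (yes p) (yes d≤0) = subst₂ _≤_ (sym (capS-val _ b p)) (sym (capH-val d b (ℤₚ.≤-trans d≤0 (+≤+ ℕ.z≤n))))
    (lin₁ 0 d≤0 (ar b d))
    where
    ar : ∀ b d → + 3 + + 2 * b - + 3 * d - (+ 4 + b - (d + d) + b - 1ℤ) ≡ (0ℤ - d) + + 0
    ar = solve-∀
  go (yes p) (no ¬d) = ⊥-elim (absurd (lin₃ 0 (ℤₚ.+-mono-≤ d≥1 d≥1) b≤1 p (ar b d)))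
    where
    d≥1 : 1ℤ ≤ d
    d≥1 = ℤₚ.i<j⇒suc[i]≤j (ℤₚ.≰⇒> ¬d)
    ar : ∀ b d → 0ℤ - 1ℤ ≡ (d + d - (1ℤ + 1ℤ)) + (1ℤ - b) + (+ 4 + b - (d + d) - + 4) + + 0
    ar = solve-∀

module _ (G : PlaneGraph) (S : Colouring.Scene G) (T : Colouring.TValidScene G S) where
  open PlaneGraph G
  open Colouring G
  open Scene S
  open TValid T
  open Adjacency G
  open Assemble G S T using (V; big; Big?; dH; κ; trajectory; V-not)
  open Graph adjB adjB-sym using (ρ; deg; 0≤deg)
  open Plane G using (OuterOK)
  open Bounds G triangleFree hv big using (Segment; shrink; h; Ends; NoShare; module Over)

  outer? : ∀ v → Dec (OuterVertex v)
  outer? v = Finₚ.any? (λ d → (outerD d 𝔹.≟ true) ×-dec (vert d Fin.≟ v)) ⊎-dec (outerIso v 𝔹.≟ true)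

  big-yes : ∀ {v} → Big v L₁ L₂ → big v ≡ true
  big-yes {v} b with Big? v
  ... | yes _ = refl
  ... | no ¬b = ⊥-elim (¬b b)

  outerA : ∀ X → OuterOK X big
  outerA X v _ hb = decidable-stable (outer? v) (λ internal → false≢true hb (big-yes (Tb-internal v internal)))

  ends : Ends
  ends m p ip = convert (suc m ℕ.∸ 3) (good (p Fin.zero)) (good (p (Fin.fromℕ m))) (Tb-ends m p ip)
    where
    good : ∀ x → GoodEnd hv L₁ L₂ x → ∀ v → hv v ≡ false → Adj x v → big v ≡ true
    good x g v hf a = big-yes (g v hf a)
    convert : ∀ m {A B A′ B′ : Set} → (A → A′) → (B → B′) → AtLeastEnds m A B → AtLeastEnds m A′ B′
    convert 0 f g e = e
    convert 1 f g (inj₁ a) = inj₁ (f a)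
    convert 1 f g (inj₂ b) = inj₂ (g b)
    convert 2 f g (a , b) = f a , g b

  boundary-walk : h ≤ 1ℤ ⊎ Segment
  boundary-walk = go H-outer
    where
    empty : (∀ v → hv v ≡ false) → h ≤ 1ℤ
    empty none = ℤₚ.≤-trans (ℤₚ.≤-reflexive (sum-zero (λ v → cong ι (none v)))) (+≤+ ℕ.z≤n)
    go : ConsecutiveOnOuter hv → h ≤ 1ℤ ⊎ Segment
    go (inj₁ none) = inj₁ (empty none)
    go (inj₂ (inj₁ (d , zero , o , iff))) = inj₁ (empty (λ v → 𝔹ₚ.¬-not (λ hh → no-step (Equivalence.to (iff v) hh))))
      where
      no-step : ∀ {v} → ¬ (∃ λ i → i ℕ.< 0 × vert (iter φ i d) ≡ v)
      no-step (_ , () , _)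
    go (inj₂ (inj₁ (d , suc τ , o , iff))) = inj₂ (shrink τ d o (λ i l → Equivalence.from (iff _) (i , ℕ.s≤s l , refl))
      (λ v hh → let (i , l , q) = Equivalence.to (iff v) hh in i , ℕₚ.≤-pred l , q))
    go (inj₂ (inj₂ (v , _ , iff))) = inj₁ (ℤₚ.≤-trans (sum-mono pt) (ℤₚ.≤-reflexive (sum-point v (λ _ → 1ℤ))))
      where
      pt : ∀ u → ι (hv u) ≤ on ⌊ u Fin.≟ v ⌋ 1ℤ
      pt u with u Fin.≟ v | hv u in e
      ... | yes _ | b = ι≤1 b
      ... | no _ | false = ℤₚ.≤-refl
      ... | no ne | true = ⊥-elim (ne (Equivalence.to (iff u) e))

  cS : Fin n → ℤ
  cS v = capH (dH v) (ι (big v))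

  tri : ∀ u v w → adjB u v ≡ true → adjB v w ≡ true → adjB u w ≡ true → ⊥
  tri u v w a b c = triangleFree u v w (adjB⇒Adj a) (adjB⇒Adj b) (adjB⇒Adj c)

  open Core adjB adjB-sym adjB-irr tri using (_⊂ᵇ_; Nonempty; Low; low; Inv)
  open Exceptional adjB adjB-sym adjB-irr tri κ big cS (λ v → capS≤capH (dH v) (ι (big v)) (0≤deg hv v) (0≤ι (big v)) (ι≤1 (big v)))
    using (Pivot; exceptional)

  module _ (X : VSet n) (X⊂V : X ⊂ᵇ V) where
    private
      sp : Split (hv ∪ X) hv X
      sp = split-∪ {X = hv} {X} (λ v hh → 𝔹ₚ.¬-not (λ hX → false≢true (V-not (X⊂V v hX)) hh))
      module P = Over X (hv ∪ X) sp (outerA X)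

      exceptional-case : -1ℤ ≤ ρ κ X ⊎ ∃ P.Exception
      exceptional-case = go boundary-walk
        where
        with-segment : ∀ sg → -1ℤ ≤ ρ κ X ⊎ P.Exception sg → -1ℤ ≤ ρ κ X ⊎ ∃ P.Exception
        with-segment sg = Sum.map₂ (λ ex → sg , ex)
        go : h ≤ 1ℤ ⊎ Segment → -1ℤ ≤ ρ κ X ⊎ ∃ P.Exception
        go (inj₁ h≤1) = inj₁ (P.small-H h≤1)
        go (inj₂ sg) = with-segment sg (P.planar-bound ends Tc sg smallH)

    ρ≥-2 : - + 2 ≤ ρ κ X
    ρ≥-2 = go exceptional-case
      where
      go : -1ℤ ≤ ρ κ X ⊎ ∃ P.Exception → - + 2 ≤ ρ κ X
      go (inj₁ ρ≥) = ℤₚ.≤-trans (-≤- ℕ.z≤n) ρ≥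
      go (inj₂ (_ , ex)) = P.Exception.ρ≥ ex

    low-or-pivot : ¬ (-1ℤ ≤ ρ κ X) → ∃ (Low -1ℤ κ X) ⊎ Pivot X
    low-or-pivot ρ< = go exceptional-case
      where
      ar : ∀ d b → 0ℤ - 1ℤ ≡ (d + d - (+ 2 + + 2)) + (1ℤ - b) + (+ 4 + b - (d + d) - + 2) + + 0
      ar = solve-∀
      d≤1 : ∀ r → κ r ≡ + 2 → Dec (dH r ≤ 1ℤ) → dH r ≤ 1ℤ
      d≤1 r κr (yes h) = h
      d≤1 r κr (no ¬h) = ⊥-elim (absurd (lin₃ 0 (ℤₚ.+-mono-≤ d≥2 d≥2) (ι≤1 (big r)) (ℤₚ.≤-reflexive (sym κr)) (ar (dH r) (ι (big r)))))
        where
        d≥2 : + 2 ≤ dH r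
        d≥2 = ℤₚ.i<j⇒suc[i]≤j (ℤₚ.≰⇒> ¬h)
      result : P.LowPart ⊎ (∃ λ r → X r ≡ true × P.PivotAt r) → ∃ (Low -1ℤ κ X) ⊎ Pivot X
      result (inj₁ (X₁ , ne , sub , proper , le)) = inj₁ (X₁ , low ne sub proper le)
      result (inj₂ (r , rX , κr , choice)) = inj₂ (record { v = r ; vX = rX ; κv = κr
        ; cSv = capH-nonneg (dH r) (ι (big r)) (0≤ι (big r)) (d≤1 r κr (dH r ≤? 1ℤ)) ; choice = choice })
      go : -1ℤ ≤ ρ κ X ⊎ ∃ P.Exception → ∃ (Low -1ℤ κ X) ⊎ Pivot X
      go (inj₁ ρ≥) = ⊥-elim (ρ< ρ≥)
      go (inj₂ (sg , ex)) = result (P.pivotal sg ex ρ<)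

  valid-scene-has-trajectory : HasTrajectory S
  valid-scene-has-trajectory = trajectory
    (exceptional (countB V) V ℕₚ.≤-refl inv (λ X _ sub → ρ≥-2 X sub) (λ X _ sub → low-or-pivot X sub))
    (λ v → capH-room (dH v) (ι (big v)))
    where
    inv : Inv κ big V
    inv v _ = lin₂ 0 (0≤deg hv v) (0≤deg hv v) (ar (ι (big v)) (dH v))
      where
      ar : ∀ b d → + 4 + b - (+ 4 + b - (d + d)) ≡ (d - 0ℤ) + (d - 0ℤ) + + 0
      ar = solve-∀

theorem21 : (G : PlaneGraph) (S : Colouring.Scene G) →
    Colouring.TValidScene G S → Colouring.HasTrajectory G S
theorem21 = valid-scene-has-trajectory
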